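{- Let $m,n\ge 2$ be integers, let $G$ be the $m\times n$ rectangular graph, $R=[0,m-1]\times[0,n-1]$, and work over the field $K=\mathbb{Z}/(2)$. Let $\mathcal{T}_b$ (resp. $\mathcal{T}_w$) be the set of tilings of $R$ all of whose tiles are black (resp. white). Then there exist bijections $$\Phi_b:\ker BW_{\mathbb{Z}/(2)}\setminus\{0\}\to\mathcal{T}_b\qquad\text{and}\qquad \Phi_w:\ker \mathit{WB}_{\mathbb{Z}/(2)}\setminus\{0\}\to\mathcal{T}_w .$$
   Context: The $m\times n$ rectangular graph is $G=\{(x,y)\in\mathbb{Z}^2: 0\le x\le m-1,\ 0\le y\le n-1\}$, two points adjacent iff they differ by exactly $1$ in exactly one coordinate; $(x,y)$ is black if $x+y$ is even and white if odd. Over a field $K$, $BW_K$ maps a function $v$ on the black points to the function on white points $w\mapsto\sum_{b\text{ black},\,b\sim w}v(b)$; $\mathit{WB}_K$ is defined analogously from white to black points. Tiles. For positive integers $a,b$, the following closed polygons (given by their vertices in order) are tiles, as are all their images under translations and rotations by integer multiples of $\pi/2$; some sides are designated "dashed": (1) the square with vertices $(0,0),(2,0),(2,2),(0,2)$ (no dashed side); (2) the square with vertices $(0,0),(1,1),(0,2),(-1,1)$ (no dashed side); (3) the hexagon with vertices $(0,0),(2,0),(2,2),(2-a,2+a),(-a,2+a),(-a,a)$ (no dashed side); (4) the octagon with vertices $(0,0),(2,0),(2+a,a),(2+a,a+2),(2+a-b,a+b+2),(a-b,a+b+2),(-b,b+2),(-b,b)$ (no dashed side); (5) the trapezoid with vertices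 $(0,0),(2a+2,0),(a+2,a),(a,a)$, whose side from $(0,0)$ to $(2a+2,0)$ is dashed; (6) the right isosceles triangle with vertices $(0,0),(a,0),(0,a)$, whose two legs (the sides through $(0,0)$) are dashed. A tiling of $R$ is a finite collection of tiles whose union is $R$, whose interiors are pairwise disjoint, and such that every dashed side of every tile is contained in the boundary $\partial R$. A tile all of whose vertices lie in $\mathbb{Z}^2$ is called black (resp. white) if the common color of its vertices is black (resp. white), where for a triangle tile one uses the color of its two vertices at the angles $\pi/4$ (the vertices of the other tiles all have the same color). -}

module Defs where

open import Data.Bool using (Bool; true; false; _∧_; _∨_; _xor_; if_then_else_; not)
open import Data.Nat as ℕ using (ℕ; zero; suc; _%_; _≡ᵇ_)
open import Data.Integer as ℤ using (ℤ; +_; -_; _+_; _-_; _*_; ∣_∣; _≤ᵇ_; 0ℤ; 1ℤ)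
open import Data.Fin using (Fin; toℕ)
open import Data.List using (List; []; _∷_; foldr; map; allFin; length)
open import Data.List.Membership.Propositional using (_∈_)
open import Data.List.Relation.Unary.All using (All)
open import Data.Product using (Σ; ∃; _×_; _,_; proj₁; proj₂)
open import Data.Sum using (_⊎_)
open import Relation.Binary.PropositionalEquality using (_≡_)
open import Relation.Nullary using (Dec; yes; no)

data Colour : Set where
  black white : Colour

opp : Colour → Colour
opp black = white
opp white = black

parityColour : ℕ → Colour
parityColour k = if k % 2 ≡ᵇ 0 then black else white

colourℤ : ℤ → ℤ → Colour
colourℤ x y = parityColour ∣ x + y ∣

_≟ᶜ_ : (c d : Colour) → Dec (c ≡ d)
black ≟ᶜ black = yes _≡_.refl
black ≟ᶜ white = no (λ ())
white ≟ᶜ black = no (λ ())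
white ≟ᶜ white = yes _≡_.refl

-- The m × n rectangular graph G, its points of colour c,
-- and the maps BW (c = black) / WB (c = white) over K = ℤ/(2) ≅ (Bool, xor).

colourFin : ∀ {m n} → Fin m → Fin n → Colour
colourFin x y = parityColour (toℕ x ℕ.+ toℕ y)

Pt : Colour → ℕ → ℕ → Set
Pt c m n = Σ (Fin m × Fin n) (λ p → colourFin (proj₁ p) (proj₂ p) ≡ c)

adjB : ∀ {m n} → Fin m × Fin n → Fin m × Fin n → Bool
adjB (x , y) (x' , y') =
  (∣ + toℕ x - + toℕ x' ∣ ℕ.+ ∣ + toℕ y - + toℕ y' ∣) ≡ᵇ 1

xorSum : {A : Set} → List A → (A → Bool) → Bool
xorSum xs f = foldr (λ a acc → f a xor acc) false xs

Map : (c : Colour) (m n : ℕ) → (Pt c m n → Bool) → Pt (opp c) m n → Bool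
Map c m n v w = xorSum (allFin m) λ x → xorSum (allFin n) λ y → term x y
  where
  term : Fin m → Fin n → Bool
  term x y with colourFin x y ≟ᶜ c
  ... | yes p = if adjB (x , y) (proj₁ w) then v ((x , y) , p) else false
  ... | no _  = false

BW : (m n : ℕ) → (Pt black m n → Bool) → Pt white m n → Bool
BW = Map black
WB : (m n : ℕ) → (Pt white m n → Bool) → Pt black m n → Bool
WB = Map white

InKer : (c : Colour) (m n : ℕ) → (Pt c m n → Bool) → Set
InKer c m n v = ∀ w → Map c m n v w ≡ false

NonZeroV : ∀ {c m n} → (Pt c m n → Bool) → Set
NonZeroV v = ∃ λ p → v p ≡ true

_≈ᵥ_ : ∀ {c m n} → (Pt c m n → Bool) → (Pt c m n → Bool) → Set
v ≈ᵥ w = ∀ p → v p ≡ w p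

-- Tiles.  Parameters a, b are positive integers, encoded as suc k.

data Shape : Set where
  square   : Shape
  diamond  : Shape
  hexagon  : ℕ → Shape
  octagon  : ℕ → ℕ → Shape
  trapezoid : ℕ → Shape
  triangle : ℕ → Shape

Point : Set
Point = ℤ × ℤ

-- vertices of the base tile, in the order given in the paper (counterclockwise)
baseVertices : Shape → List Point
baseVertices square = (+ 0 , + 0) ∷ (+ 2 , + 0) ∷ (+ 2 , + 2) ∷ (+ 0 , + 2) ∷ []
baseVertices diamond = (+ 0 , + 0) ∷ (+ 1 , + 1) ∷ (+ 0 , + 2) ∷ (- + 1 , + 1) ∷ []
baseVertices (hexagon k) =
  let a = + suc k in
  (+ 0 , + 0) ∷ (+ 2 , + 0) ∷ (+ 2 , + 2) ∷ (+ 2 - a , + 2 + a)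
    ∷ (- a , + 2 + a) ∷ (- a , a) ∷ []
baseVertices (octagon k l) =
  let a = + suc k ; b = + suc l in
  (+ 0 , + 0) ∷ (+ 2 , + 0) ∷ (+ 2 + a , a) ∷ (+ 2 + a , a + + 2)
    ∷ (+ 2 + a - b , a + b + + 2) ∷ (a - b , a + b + + 2)
    ∷ (- b , b + + 2) ∷ (- b , b) ∷ []
baseVertices (trapezoid k) =
  let a = + suc k in
  (+ 0 , + 0) ∷ (+ 2 * a + + 2 , + 0) ∷ (a + + 2 , a) ∷ (a , a) ∷ []
baseVertices (triangle k) =
  let a = + suc k in
  (+ 0 , + 0) ∷ (a , + 0) ∷ (+ 0 , a) ∷ []

baseDashed : Shape → List (Point × Point)
baseDashed (trapezoid k) = ((+ 0 , + 0) , (+ 2 * + suc k + + 2 , + 0)) ∷ []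
baseDashed (triangle k) =
  ((+ 0 , + 0) , (+ suc k , + 0)) ∷ ((+ 0 , + 0) , (+ 0 , + suc k)) ∷ []
baseDashed _ = []

-- vertices relevant for the colour of the tile: all vertices, except for
-- the triangle, where only the two vertices at the angles π/4 are used
baseColourVertices : Shape → List Point
baseColourVertices (triangle k) = (+ suc k , + 0) ∷ (+ 0 , + suc k) ∷ []
baseColourVertices s = baseVertices s

-- A tile with all vertices in ℤ²: a base tile rotated about the origin by
-- rot · π/2 and then translated by the integer vector (tx , ty).
-- (Since (0,0) is a vertex of every base tile, all vertices are integral
-- iff the translation vector is integral.)
record Tile : Set where
  constructor mkTile
  field
    shape : Shape
    rot   : Fin 4
    tx ty : ℤ

rot90 : Point → Point
rot90 (x , y) = (- y , x)

rotN : ℕ → Point → Point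
rotN zero p = p
rotN (suc r) p = rot90 (rotN r p)

place : Tile → Point → Point
place t p with rotN (toℕ (Tile.rot t)) p
... | (x , y) = (x + Tile.tx t , y + Tile.ty t)

vertices : Tile → List Point
vertices t = map (place t) (baseVertices (Tile.shape t))

dashedSides : Tile → List (Point × Point)
dashedSides t = map (λ e → place t (proj₁ e) , place t (proj₂ e)) (baseDashed (Tile.shape t))

HasColour : Colour → Tile → Set
HasColour c t = All (λ p → colourℤ (proj₁ p) (proj₂ p) ≡ c)
                    (map (place t) (baseColourVertices (Tile.shape t)))

-- Regions.  The lines x ∈ ℤ, y ∈ ℤ, x ± y ∈ ℤ cut the plane into the
-- triangular cells (i , j , q): the square [i,i+1]×[j,j+1] is cut by its two
-- diagonals into q = 0 (bottom), 1 (right), 2 (top), 3 (left).  Every tile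
-- (integral vertices, sides on such lines) is the closure of the union of the
-- cells it contains, and R is the closure of the union of its cells.

Cell : Set
Cell = ℤ × ℤ × Fin 4

centroid6 : Cell → Point
centroid6 (i , j , q) = off q
  where
  I = + 6 * i
  J = + 6 * j
  off : Fin 4 → Point
  off Fin.zero = (I + + 3 , J + + 1)
  off (Fin.suc Fin.zero) = (I + + 5 , J + + 3)
  off (Fin.suc (Fin.suc Fin.zero)) = (I + + 3 , J + + 5)
  off (Fin.suc (Fin.suc (Fin.suc Fin.zero))) = (I + + 1 , J + + 3)

scale6 : Point → Point
scale6 (x , y) = (+ 6 * x , + 6 * y)

leftOf : Point → Point → Point → Bool
leftOf (ux , uy) (vx , vy) (px , py) =
  1ℤ ≤ᵇ ((vx - ux) * (py - uy) - (vy - uy) * (px - ux))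

edges : List Point → List (Point × Point)
edges [] = []
edges (p ∷ ps) = go p (p ∷ ps)
  where
  go : Point → List Point → List (Point × Point)
  go first [] = []
  go first (x ∷ []) = (x , first) ∷ []
  go first (x ∷ y ∷ xs) = (x , y) ∷ go first (y ∷ xs)

allB : {A : Set} → (A → Bool) → List A → Bool
allB f [] = true
allB f (x ∷ xs) = f x ∧ allB f xs

-- the cell lies in the (convex, counterclockwise) tile
inTile : Tile → Cell → Bool
inTile t c =
  allB (λ e → leftOf (scale6 (proj₁ e)) (scale6 (proj₂ e)) (centroid6 c))
      (edges (vertices t))

inR : ℕ → ℕ → Cell → Bool
inR m n (i , j , _) =
  (0ℤ ≤ᵇ i) ∧ (i + + 2 ≤ᵇ + m) ∧ (0ℤ ≤ᵇ j) ∧ (j + + 2 ≤ᵇ + n)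

count : Cell → List Tile → ℕ
count c [] = 0
count c (t ∷ ts) = (if inTile t c then 1 else 0) ℕ.+ count c ts

PtInR : ℕ → ℕ → Point → Set
PtInR m n (x , y) = (0ℤ ℤ.≤ x) × (x ℤ.≤ + m - + 1) × (0ℤ ℤ.≤ y) × (y ℤ.≤ + n - + 1)

SegInBoundary : ℕ → ℕ → Point × Point → Set
SegInBoundary m n ((px , py) , (qx , qy)) =
  PtInR m n (px , py) × PtInR m n (qx , qy) ×
  ( (px ≡ 0ℤ × qx ≡ 0ℤ) ⊎ (px ≡ + m - + 1 × qx ≡ + m - + 1)
  ⊎ (py ≡ 0ℤ × qy ≡ 0ℤ) ⊎ (py ≡ + n - + 1 × qy ≡ + n - + 1))

-- ts is a tiling of R: the union is R and the interiors are pairwise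
-- disjoint (every cell of R lies in exactly one tile, no other cell lies in
-- any tile), and every dashed side lies in ∂R.
IsTiling : ℕ → ℕ → List Tile → Set
IsTiling m n ts =
  (∀ c → count c ts ≡ (if inR m n c then 1 else 0)) ×
  All (λ t → All (SegInBoundary m n) (dashedSides t)) ts

IsColTiling : Colour → ℕ → ℕ → List Tile → Set
IsColTiling c m n ts = IsTiling m n ts × All (HasColour c) ts

SameTile : Tile → Tile → Set
SameTile t t' = ∀ c → inTile t c ≡ inTile t' c

SameTiling : List Tile → List Tile → Set
SameTiling ts ts' =
  (∀ {t} → t ∈ ts → ∃ λ t' → t' ∈ ts' × SameTile t t') ×
  (∀ {t'} → t' ∈ ts' → ∃ λ t → t ∈ ts × SameTile t t')

-- A bijection  Φ : ker(Map c) \ {0} → {tilings of R by tiles of colour c}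
-- (domain up to pointwise equality of vectors, codomain up to equality of
-- the collections of polygons).
KerTilingBijection : Colour → ℕ → ℕ → Set
KerTilingBijection c m n =
  Σ ((v : Pt c m n → Bool) → InKer c m n v → NonZeroV v → List Tile) λ Φ →
    (∀ v k z → IsColTiling c m n (Φ v k z)) ×
    (∀ v k z w k' z' → v ≈ᵥ w → SameTiling (Φ v k z) (Φ w k' z')) ×
    (∀ v k z w k' z' → SameTiling (Φ v k z) (Φ w k' z') → v ≈ᵥ w) ×
    (∀ ts → IsColTiling c m n ts → ∃ λ v → Σ (InKer c m n v) λ k →
        Σ (NonZeroV v) λ z → SameTiling (Φ v k z) ts)

{-# OPTIONS --safe #-}
-- Extend a kernel vector v to ℤ² by reflection in the lines x = −1, x = m, y = −1, y = n
-- ("walls"), on which it is zero.  In diagonal coordinates i, j on the points of the given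
-- colour, the kernel condition says that the sum over the corners of every unit face is
-- zero, so v (i , j) = F i + F j, where F is invariant under the reflections.  Hence the
-- zeros of v form the blocks I × J, for maximal runs I, J of F with equal values.  The nearest
-- nonzero points around a block are the lattice points on the boundary of an octagon (a
-- hexagon or square if I or J is a singleton), the faces with four nonzero corners are
-- the diamonds, and the octagons symmetric about one or two walls are cut off to
-- trapezoids and triangles; together these polygons tile the rectangle.
--
-- Conversely, every tile of the given colour is such a polygon for some block I × J, and
-- the vector vanishing exactly at the points of these blocks lies in the kernel: if a tile
-- meets a face, then the value at a corner (a , b) of the face is [a ∈ I] + [b ∈ J].
module Submission where

open import Defs
open import Data.Bool using (Bool; true; false; _∧_; _∨_; _xor_; if_then_else_; not; T)
import Data.Bool.Properties as 𝔹
open import Data.Bool.Properties using (T-∧; T-∨)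
open import Data.Nat as ℕ using (ℕ; zero; suc; _≡ᵇ_)
import Data.Nat.Properties as ℕP
open import Data.Integer as ℤ using (ℤ; +_; -[1+_]; -_; _+_; _-_; _*_; ∣_∣; 0ℤ; 1ℤ; _≤_; _<_; _≤ᵇ_)
import Data.Integer.Properties as ℤP
open import Data.Integer.Tactic.RingSolver using (solve-∀)
open import Data.Fin as Fin using (Fin; toℕ)
open import Data.Fin.Patterns using (0F; 1F; 2F; 3F)
import Data.Fin.Properties as FinP
open import Data.List using (List; []; _∷_; _++_; map; concatMap; foldr; tabulate; allFin; cartesianProduct)
open import Data.List.Membership.Propositional using (_∈_; find; lose)
open import Data.List.Membership.Propositional.Properties using (∈-map⁺; ∈-map⁻; ∈-allFin; ∈-cartesianProduct⁺; ∈-concat⁺′)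
open import Data.List.Relation.Unary.All as All using (All; []; _∷_)
import Data.List.Relation.Unary.All.Properties as AllP
open import Data.List.Relation.Unary.AllPairs using (AllPairs; []; _∷_)
open import Data.List.Relation.Unary.Any as Any using (Any; here; there)
open import Data.Product using (Σ; ∃; _×_; _,_; proj₁; proj₂)
open import Data.Sum using (_⊎_; inj₁; inj₂)
open import Data.Empty using (⊥; ⊥-elim)
open import Data.Unit using (⊤; tt)
open import Function using (_∘_; case_of_; _$_; Equivalence)
open import Relation.Nullary using (yes; no; ¬_; Dec; does; _×-dec_)
open import Relation.Binary.PropositionalEquality hiding ([_])

-- Linear integer arithmetic

-- The walls lie one unit outside the rectangle R. An octagon that is symmetric about a wall is
-- therefore not cut along its axis but one unit away from it, along the side of R, and this cut is
-- the dashed side. The obstacle is that a tiling shows only the part of a block inside R, while the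
-- runs of `F` reach beyond the walls. So the values of `F` outside R must be recovered by
-- reflection, and for injectivity a block must be recovered from its visible part. All geometry is
-- turned into integer linear arithmetic. A tile is given by bounds on x, y, x + y and x - y, each
-- of which is linear in the end points of the runs I and J, in m and n, and in an offset `ε` that
-- is 0 for black and 1 for white. Both colours are thus treated at once, and every geometric fact
-- becomes an implication between linear inequalities, which a verified refutation procedure checks
-- during type checking.

infixl 6 _:+_ _:-_
infixl 7 _:*_
infix 5 _:≤_ _:<_ _:≡_
infixr 4 _:∧_

data Expr : Set where
  V : ℕ → Expr
  K : ℤ → Expr
  _:+_ _:-_ : Expr → Expr → Expr
  _:*_ : ℤ → Expr → Expr
  neg : Expr → Expr

data Form : Set where
  _:≤_ _:<_ _:≡_ : Expr → Expr → Form
  _:∧_ : Form → Form → Form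
  ⊤ᶠ ⊥ᶠ : Form

-- Missing entries count as zero, for environments and coefficient lists alike. In the same spirit
-- `add` keeps the longer tail and `dot` stops at the shorter list, so lengths never have to match.
lookup₀ : List ℤ → ℕ → ℤ
lookup₀ [] _ = 0ℤ
lookup₀ (x ∷ ρ) zero = x
lookup₀ (x ∷ ρ) (suc k) = lookup₀ ρ k

⟦_⟧ : Expr → List ℤ → ℤ
⟦ V k ⟧ ρ = lookup₀ ρ k
⟦ K z ⟧ ρ = z
⟦ a :+ b ⟧ ρ = ⟦ a ⟧ ρ + ⟦ b ⟧ ρ
⟦ a :- b ⟧ ρ = ⟦ a ⟧ ρ - ⟦ b ⟧ ρ
⟦ k :* a ⟧ ρ = k * ⟦ a ⟧ ρ
⟦ neg a ⟧ ρ = - ⟦ a ⟧ ρ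

Holds : Form → List ℤ → Set
Holds (a :≤ b) ρ = ⟦ a ⟧ ρ ℤ.≤ ⟦ b ⟧ ρ
Holds (a :< b) ρ = ⟦ a ⟧ ρ ℤ.< ⟦ b ⟧ ρ
Holds (a :≡ b) ρ = ⟦ a ⟧ ρ ≡ ⟦ b ⟧ ρ
Holds (f :∧ g) ρ = Holds f ρ × Holds g ρ
Holds ⊤ᶠ ρ = ⊤
Holds ⊥ᶠ ρ = ⊥

add : List ℤ → List ℤ → List ℤ
add [] b = b
add a [] = a
add (x ∷ a) (y ∷ b) = x + y ∷ add a b

scale : ℤ → List ℤ → List ℤ
scale k = map (k *_)

dot : List ℤ → List ℤ → ℤ
dot (a ∷ as) (x ∷ xs) = a * x + dot as xs
dot _ _ = 0ℤ

dot-add : ∀ a b ρ → dot (add a b) ρ ≡ dot a ρ + dot b ρ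
dot-add [] b ρ = sym (ℤP.+-identityˡ _)
dot-add (x ∷ a) [] ρ = sym (ℤP.+-identityʳ _)
dot-add (x ∷ a) (y ∷ b) [] = refl
dot-add (x ∷ a) (y ∷ b) (r ∷ ρ) rewrite dot-add a b ρ = lem x y r (dot a ρ) (dot b ρ)
  where
  lem : ∀ x y r a b → (x + y) * r + (a + b) ≡ (x * r + a) + (y * r + b)
  lem = solve-∀

dot-scale : ∀ k a ρ → dot (scale k a) ρ ≡ k * dot a ρ
dot-scale k [] ρ = sym (ℤP.*-zeroʳ k)
dot-scale k (x ∷ a) [] = sym (ℤP.*-zeroʳ k)
dot-scale k (x ∷ a) (r ∷ ρ) rewrite dot-scale k a ρ = lem k x r (dot a ρ)
  where
  lem : ∀ k x r a → k * x * r + k * a ≡ k * (x * r + a)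
  lem = solve-∀

unit : ℕ → List ℤ
unit zero = 1ℤ ∷ []
unit (suc k) = 0ℤ ∷ unit k

dot-unit : ∀ k ρ → dot (unit k) ρ ≡ lookup₀ ρ k
dot-unit zero [] = refl
dot-unit (suc k) [] = refl
dot-unit zero (x ∷ ρ) = trans (ℤP.+-identityʳ _) (ℤP.*-identityˡ x)
dot-unit (suc k) (x ∷ ρ) = trans (ℤP.+-identityˡ _) (dot-unit k ρ)

-- Coefficient 0 of a linear form is its constant term.
lin : Expr → List ℤ
lin (V k) = unit (suc k)
lin (K z) = z ∷ []
lin (a :+ b) = add (lin a) (lin b)
lin (a :- b) = add (lin a) (scale (- 1ℤ) (lin b))
lin (k :* a) = scale k (lin a)
lin (neg a) = scale (- 1ℤ) (lin a)

-1*≡ : ∀ {x y} → x ≡ y → - 1ℤ * x ≡ - y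
-1*≡ {x} refl = ℤP.-1*i≡-i x

lin-sound : ∀ e ρ → dot (lin e) (1ℤ ∷ ρ) ≡ ⟦ e ⟧ ρ
lin-sound (V k) ρ = dot-unit (suc k) (1ℤ ∷ ρ)
lin-sound (K z) ρ = trans (ℤP.+-identityʳ _) (ℤP.*-identityʳ z)
lin-sound (a :+ b) ρ =
  trans (dot-add (lin a) (lin b) _) (cong₂ _+_ (lin-sound a ρ) (lin-sound b ρ))
lin-sound (a :- b) ρ =
  trans (dot-add (lin a) (scale (- 1ℤ) (lin b)) _)
    (cong₂ _+_ (lin-sound a ρ)
      (trans (dot-scale (- 1ℤ) (lin b) _) (-1*≡ (lin-sound b ρ))))
lin-sound (k :* a) ρ = trans (dot-scale k (lin a) _) (cong (k *_) (lin-sound a ρ))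
lin-sound (neg b) ρ =
  trans (dot-scale (- 1ℤ) (lin b) _) (-1*≡ (lin-sound b ρ))

data Kind : Set where
  eqn geq : Kind

Row : Set
Row = Kind × List ℤ

Sat : List ℤ → Row → Set
Sat ρ (eqn , a) = dot a (1ℤ ∷ ρ) ≡ 0ℤ
Sat ρ (geq , a) = 0ℤ ℤ.≤ dot a (1ℤ ∷ ρ)

isZero : ℤ → Bool
isZero (+ zero) = true
isZero _ = false

isNeg : ℤ → Bool
isNeg -[1+ _ ] = true
isNeg _ = false

allZero : List ℤ → Bool
allZero [] = true
allZero (x ∷ a) = isZero x ∧ allZero a

bad : Row → Bool
bad (geq , x ∷ a) = isNeg x ∧ allZero a
bad (eqn , x ∷ a) = not (isZero x) ∧ allZero a
bad (_ , []) = false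

dot-allZero : ∀ a ρ → T (allZero a) → dot a ρ ≡ 0ℤ
dot-allZero [] ρ _ = refl
dot-allZero (+ zero ∷ a) [] _ = refl
dot-allZero (+ zero ∷ a) (x ∷ ρ) p = trans (ℤP.+-identityˡ _) (dot-allZero a ρ p)

dot-const : ∀ x a ρ → T (allZero a) → dot (x ∷ a) (1ℤ ∷ ρ) ≡ x
dot-const x a ρ p rewrite dot-allZero a ρ p = trans (ℤP.+-identityʳ _) (ℤP.*-identityʳ x)

bad-sound : ∀ ρ r → T (bad r) → ¬ Sat ρ r
bad-sound ρ (geq , -[1+ k ] ∷ a) b s rewrite dot-const -[1+ k ] a ρ b with s
... | ()
bad-sound ρ (eqn , + suc k ∷ a) b s with trans (sym (dot-const (+ suc k) a ρ b)) s
... | ()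
bad-sound ρ (eqn , -[1+ k ] ∷ a) b s with trans (sym (dot-const -[1+ k ] a ρ b)) s
... | ()

coef : ℕ → Row → ℤ
coef k (_ , a) = lookup₀ a (suc k)

-- p times r plus q times s; an inequality s may only enter with q ≥ 0.
combine : ℕ → Row → ℤ → Row → Row
combine p (κ , a) q (eqn , b) = κ , add (scale (+ p) a) (scale q b)
combine p (eqn , a) (+ q) (geq , b) = geq , add (scale (+ p) a) (scale (+ q) b)
combine p (geq , a) (+ q) (geq , b) = geq , add (scale (+ p) a) (scale (+ q) b)
combine p r -[1+ _ ] (geq , _) = r

scale-nonneg : ∀ p x → 0ℤ ℤ.≤ x → 0ℤ ℤ.≤ + p * x
scale-nonneg p x h = subst (ℤ._≤ + p * x) (ℤP.*-zeroʳ (+ p)) (ℤP.*-monoˡ-≤-nonNeg (+ p) h)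

combine-sound : ∀ ρ p r q s → Sat ρ r → Sat ρ s → Sat ρ (combine p r q s)
combine-sound ρ p (eqn , a) q (eqn , b) hr hs
  rewrite dot-add (scale (+ p) a) (scale q b) (1ℤ ∷ ρ) | dot-scale (+ p) a (1ℤ ∷ ρ) | dot-scale q b (1ℤ ∷ ρ)
        | hr | hs | ℤP.*-zeroʳ (+ p) | ℤP.*-zeroʳ q = refl
combine-sound ρ p (geq , a) q (eqn , b) hr hs
  rewrite dot-add (scale (+ p) a) (scale q b) (1ℤ ∷ ρ) | dot-scale (+ p) a (1ℤ ∷ ρ) | dot-scale q b (1ℤ ∷ ρ)
        | hs | ℤP.*-zeroʳ q = ℤP.+-mono-≤ (scale-nonneg p _ hr) ℤP.≤-refl
combine-sound ρ p (eqn , a) (+ q) (geq , b) hr hs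
  rewrite dot-add (scale (+ p) a) (scale (+ q) b) (1ℤ ∷ ρ) | dot-scale (+ p) a (1ℤ ∷ ρ) | dot-scale (+ q) b (1ℤ ∷ ρ)
        | hr | ℤP.*-zeroʳ (+ p) = ℤP.+-mono-≤ (ℤP.≤-refl {0ℤ}) (scale-nonneg q _ hs)
combine-sound ρ p (geq , a) (+ q) (geq , b) hr hs
  rewrite dot-add (scale (+ p) a) (scale (+ q) b) (1ℤ ∷ ρ) | dot-scale (+ p) a (1ℤ ∷ ρ) | dot-scale (+ q) b (1ℤ ∷ ρ)
        = ℤP.+-mono-≤ (scale-nonneg p _ hr) (scale-nonneg q _ hs)
combine-sound ρ p (eqn , a) -[1+ _ ] (geq , b) hr hs = hr
combine-sound ρ p (geq , a) -[1+ _ ] (geq , b) hr hs = hr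

-- Division of an inequality by the common divisor g of its coefficients,
-- rounding the constant term down.
gcd′ : ℕ → ℕ → ℕ → ℕ
gcd′ zero a b = a
gcd′ (suc f) a zero = a
gcd′ (suc f) a (suc b) = gcd′ f (suc b) (a ℕ.% suc b)

-- Twenty Euclidean steps per coefficient are allowed. If they do not suffice, the result may fail
-- to be a common divisor; `tighten` then notices and leaves the row alone.
content : List ℤ → ℕ
content = foldr (λ x g → gcd′ 20 ∣ x ∣ g) 0

divFloor : ℤ → (g : ℕ) → .{{ℕ.NonZero g}} → ℤ
divFloor (+ x) g = + (x ℕ./ g)
divFloor -[1+ x ] g = -[1+ x ℕ./ g ]

sameCoefs : List ℤ → List ℤ → Bool
sameCoefs [] [] = true
sameCoefs (x ∷ a) (y ∷ b) with x ℤ.≟ y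
... | yes _ = sameCoefs a b
... | no _ = false
sameCoefs _ _ = false

sameCoefs-sound : ∀ a b → T (sameCoefs a b) → a ≡ b
sameCoefs-sound [] [] _ = refl
sameCoefs-sound (x ∷ a) (y ∷ b) t with x ℤ.≟ y
... | yes refl = cong (x ∷_) (sameCoefs-sound a b t)

-- The divided row is only a candidate: it is accepted if multiplying by `g` gives back the
-- coefficients and if the old constant is below `g * y + g`. Soundness thus does not rest on any
-- property of `gcd′` or `divFloor`.
tighten : Row → Row
tighten (geq , x ∷ a) with content a
... | zero = geq , x ∷ a
... | suc zero = geq , x ∷ a
... | g@(suc (suc _)) = candidate (divFloor x g) (map (λ y → divFloor y g) a)
  where
  candidate : ℤ → List ℤ → Row
  candidate y b with sameCoefs (scale (+ g) b) a | x ℤ.<? + g * y + + g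
  ... | true | yes _ = geq , y ∷ b
  ... | _ | _ = geq , x ∷ a
tighten r = r

-- Write d for the value of the divided coefficients. If y + d were negative, then y + d + 1 ≤ 0 by
-- integrality, and x < g y + g would give x + g d < g (y + d + 1) ≤ 0, against the original row.
tighten-sound : ∀ ρ r → Sat ρ r → Sat ρ (tighten r)
tighten-sound ρ (eqn , a) h = h
tighten-sound ρ (geq , []) h = h
tighten-sound ρ (geq , x ∷ a) h with content a
... | zero = h
... | suc zero = h
... | g@(suc (suc g′)) with divFloor x g | map (λ y → divFloor y g) a
... | y | b with sameCoefs (scale (+ g) b) a in e | x ℤ.<? + g * y + + g
... | false | _ = h
... | true | no _ = h
... | true | yes lt with sameCoefs-sound (scale (+ g) b) a (subst T (sym e) tt)
... | refl = ℤP.≮⇒≥ λ neg → ℤP.<-irrefl refl (ℤP.<-≤-trans (ℤP.+-mono-<-≤ lt ℤP.≤-refl) (begin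
    (+ g * y + + g) + dot (scale (+ g) b) ρ ≡⟨ cong (λ z → (+ g * y + + g) + z) (dot-scale (+ g) b ρ) ⟩
    (+ g * y + + g) + + g * dot b ρ ≡⟨ lem (+ g) y (dot b ρ) ⟩
    + g * (1ℤ + (y * 1ℤ + dot b ρ)) ≤⟨ ℤP.*-monoˡ-≤-nonNeg (+ g) (ℤP.i<j⇒suc[i]≤j neg) ⟩
    + g * 0ℤ ≡⟨ ℤP.*-zeroʳ (+ g) ⟩
    0ℤ ≤⟨ h ⟩
    x * 1ℤ + dot (scale (+ g) b) ρ ≡⟨ cong (_+ dot (scale (+ g) b) ρ) (ℤP.*-identityʳ x) ⟩
    x + dot (scale (+ g) b) ρ ∎))
  where
  open ℤP.≤-Reasoning
  lem : ∀ g y d → (g * y + g) + g * d ≡ g * (1ℤ + (y * 1ℤ + d))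
  lem = solve-∀

isEqWith : ℕ → Row → Bool
isEqWith k (eqn , a) = not (isZero (lookup₀ a (suc k)))
isEqWith k (geq , a) = false

findEq : ℕ → List Row → List Row
findEq k [] = []
findEq k (r ∷ rs) = if isEqWith k r then r ∷ [] else findEq k rs

-- Fourier–Motzkin elimination of the variable k: with an equation containing k,
-- substitute; otherwise combine every lower bound of k with every upper bound.
substRow : ℕ → Row → Row → Row
substRow k e r with isZero (coef k r)
... | true = r
... | false with coef k e
...   | + c = tighten (combine c r (- coef k r) e)
...   | -[1+ c ] = tighten (combine (suc c) r (coef k r) e)

zeros lows ups : ℕ → List Row → List Row
zeros k [] = []
zeros k (r ∷ rs) with coef k r
... | + zero = r ∷ zeros k rs
... | _ = zeros k rs
lows k [] = []
lows k (r ∷ rs) with coef k r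
... | + suc _ = r ∷ lows k rs
... | _ = lows k rs
ups k [] = []
ups k (r ∷ rs) with coef k r
... | -[1+ _ ] = r ∷ ups k rs
... | _ = ups k rs

cross : ℕ → Row → Row → Row
cross k r s = tighten (combine ∣ coef k s ∣ r (+ ∣ coef k r ∣) s)

trivial : Row → Bool
trivial (_ , []) = true
trivial (eqn , x ∷ a) = isZero x ∧ allZero a
trivial (geq , x ∷ a) = not (isNeg x) ∧ allZero a

implies : Row → Row → Bool
implies (geq , x ∷ a) (geq , y ∷ b) = sameCoefs a b ∧ (x ℤ.≤ᵇ y)
implies _ _ = false

-- Of two inequalities with equal coefficients the one with the smaller constant implies the other;
-- dropping the weaker one limits the growth of the system during elimination.
insert : Row → List Row → List Row
insert r [] = if trivial r then [] else r ∷ []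
insert r (s ∷ rs) = if implies s r then s ∷ rs else (if implies r s then r ∷ rs else s ∷ insert r rs)

prune : List Row → List Row
prune = foldr insert []

eliminate : ℕ → List Row → List Row
eliminate k rs with findEq k rs
... | e ∷ _ = prune (map (substRow k e) rs)
... | [] = prune (zeros k rs ++ concatMap (λ r → map (cross k r) (ups k rs)) (lows k rs))

module _ (ρ : List ℤ) where
  private
    Sats = All (Sat ρ)

  findEq-sound : ∀ k rs → Sats rs → Sats (findEq k rs)
  findEq-sound k [] h = []
  findEq-sound k (r ∷ rs) (h ∷ hs) with isEqWith k r
  ... | true = h ∷ []
  ... | false = findEq-sound k rs hs

  substRow-sound : ∀ k e r → Sat ρ e → Sat ρ r → Sat ρ (substRow k e r)
  substRow-sound k e r he hr with isZero (coef k r)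
  ... | true = hr
  ... | false with coef k e
  ...   | + c = tighten-sound ρ (combine c r (- coef k r) e) (combine-sound ρ c r (- coef k r) e hr he)
  ...   | -[1+ c ] = tighten-sound ρ (combine (suc c) r (coef k r) e) (combine-sound ρ (suc c) r (coef k r) e hr he)

  zeros-sound : ∀ k rs → Sats rs → Sats (zeros k rs)
  zeros-sound k [] h = []
  zeros-sound k (r ∷ rs) (h ∷ hs) with coef k r
  ... | + zero = h ∷ zeros-sound k rs hs
  ... | + suc _ = zeros-sound k rs hs
  ... | -[1+ _ ] = zeros-sound k rs hs

  lows-sound : ∀ k rs → Sats rs → Sats (lows k rs)
  lows-sound k [] h = []
  lows-sound k (r ∷ rs) (h ∷ hs) with coef k r
  ... | + zero = lows-sound k rs hs
  ... | + suc _ = h ∷ lows-sound k rs hs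
  ... | -[1+ _ ] = lows-sound k rs hs

  ups-sound : ∀ k rs → Sats rs → Sats (ups k rs)
  ups-sound k [] h = []
  ups-sound k (r ∷ rs) (h ∷ hs) with coef k r
  ... | + zero = ups-sound k rs hs
  ... | + suc _ = ups-sound k rs hs
  ... | -[1+ _ ] = h ∷ ups-sound k rs hs

  insert-sound : ∀ r rs → Sat ρ r → Sats rs → Sats (insert r rs)
  insert-sound r [] h [] with trivial r
  ... | true = []
  ... | false = h ∷ []
  insert-sound r (s ∷ rs) h (h′ ∷ hs) with implies s r | implies r s
  ... | true | _ = h′ ∷ hs
  ... | false | true = h ∷ hs
  ... | false | false = h′ ∷ insert-sound r rs h hs

  prune-sound : ∀ rs → Sats rs → Sats (prune rs)
  prune-sound [] [] = []
  prune-sound (r ∷ rs) (h ∷ hs) = insert-sound r (prune rs) h (prune-sound rs hs)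

  crosses-sound : ∀ k ls us → Sats ls → Sats us → Sats (concatMap (λ r → map (cross k r) us) ls)
  crosses-sound k [] us [] hu = []
  crosses-sound k (r ∷ ls) us (h ∷ hl) hu = AllP.++⁺
    (AllP.map⁺ (All.map (λ {s} hs → tighten-sound ρ (combine ∣ coef k s ∣ r (+ ∣ coef k r ∣) s)
      (combine-sound ρ ∣ coef k s ∣ r (+ ∣ coef k r ∣) s h hs)) hu))
    (crosses-sound k ls us hl hu)

  eliminate-sound : ∀ k rs → Sats rs → Sats (eliminate k rs)
  eliminate-sound k rs h with findEq k rs | findEq-sound k rs h
  ... | e ∷ _ | he ∷ _ = prune-sound _ (AllP.map⁺ (All.map (λ {r} → substRow-sound k e r he) h))
  ... | [] | _ = prune-sound _ (AllP.++⁺ (zeros-sound k rs h)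
                   (crosses-sound k (lows k rs) (ups k rs) (lows-sound k rs h) (ups-sound k rs h)))

len : {A : Set} → List A → ℕ
len [] = 0
len (_ ∷ l) = suc (len l)

-- An equation allows substitution, and a variable bounded on one side only makes rows disappear;
-- both come before any product of lower and upper bounds. A variable without occurrences gets a
-- prohibitive cost, so that no elimination is spent on it.
cost : ℕ → List Row → ℕ
cost k rs with findEq k rs | len (lows k rs) | len (ups k rs)
... | _ ∷ _ | _ | _ = 1
... | [] | zero | zero = 1000000
... | [] | l | u = (l ℕ.* u) ℕ.+ 2

cheapest : ℕ → List Row → ℕ × ℕ
cheapest zero rs = 0 , 2000000
cheapest (suc k) rs with cheapest k rs | cost k rs
... | j , c | d = if d ℕ.<ᵇ c then (k , d) else (j , c)

anyBad : List Row → Bool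
anyBad [] = false
anyBad (r ∷ rs) = bad r ∨ anyBad rs

anyBad-sound : ∀ ρ rs → T (anyBad rs) → ¬ All (Sat ρ) rs
anyBad-sound ρ (r ∷ rs) t (h ∷ hs) with Equivalence.to (T-∨ {bad r}) t
... | inj₁ b = bad-sound ρ r b h
... | inj₂ b = anyBad-sound ρ rs b hs

-- `n` is the number of variables, the second argument the number of eliminations still allowed. A
-- contradiction is looked for before each elimination, so the search can stop early.
refute : ℕ → ℕ → List Row → Bool
refute n zero rs = anyBad rs
refute n (suc f) rs = anyBad rs ∨ refute n f (eliminate (proj₁ (cheapest n rs)) rs)

refute-sound : ∀ ρ n f rs → T (refute n f rs) → ¬ All (Sat ρ) rs
refute-sound ρ n zero rs t h = anyBad-sound ρ rs t h
refute-sound ρ n (suc f) rs t h with Equivalence.to (T-∨ {anyBad rs}) t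
... | inj₁ b = anyBad-sound ρ rs b h
... | inj₂ b = refute-sound ρ n f _ b (eliminate-sound ρ (proj₁ (cheapest n rs)) rs h)

rows : Form → List Row
rows (a :≤ b) = (geq , lin (b :- a)) ∷ []
rows (a :< b) = (geq , lin (b :- a :- K 1ℤ)) ∷ []
rows (a :≡ b) = (eqn , lin (b :- a)) ∷ []
rows (f :∧ g) = rows f ++ rows g
rows ⊤ᶠ = []
rows ⊥ᶠ = []

≤-sat : ∀ a b ρ → ⟦ a ⟧ ρ ℤ.≤ ⟦ b ⟧ ρ → Sat ρ (geq , lin (b :- a))
≤-sat a b ρ h = subst (0ℤ ℤ.≤_) (sym (lin-sound (b :- a) ρ)) (ℤP.i≤j⇒0≤j-i h)

<-sat : ∀ a b ρ → ⟦ a ⟧ ρ ℤ.< ⟦ b ⟧ ρ → Sat ρ (geq , lin (b :- a :- K 1ℤ))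
<-sat a b ρ h = subst (0ℤ ℤ.≤_)
  (trans (lem (⟦ a ⟧ ρ) (⟦ b ⟧ ρ)) (sym (lin-sound (b :- a :- K 1ℤ) ρ)))
  (ℤP.i≤j⇒0≤j-i (ℤP.i<j⇒suc[i]≤j h))
  where
  lem : ∀ a b → b - (1ℤ + a) ≡ b - a - 1ℤ
  lem = solve-∀

rows-sound : ∀ f ρ → Holds f ρ → All (Sat ρ) (rows f)
rows-sound (a :≤ b) ρ h = ≤-sat a b ρ h ∷ []
rows-sound (a :< b) ρ h = <-sat a b ρ h ∷ []
rows-sound (a :≡ b) ρ h =
  trans (lin-sound (b :- a) ρ) (trans (cong (λ z → ⟦ b ⟧ ρ - z) h) (ℤP.+-inverseʳ (⟦ b ⟧ ρ))) ∷ []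
rows-sound ⊤ᶠ ρ _ = []
rows-sound (f :∧ g) ρ (hf , hg) = AllP.++⁺ (rows-sound f ρ hf) (rows-sound g ρ hg)

module _ (n : ℕ) where
  private
    ref : List Row → Bool
    ref rs = refute n n (prune (map tighten rs))

    ref-sound : ∀ ρ rs → T (ref rs) → ¬ All (Sat ρ) rs
    ref-sound ρ rs t h = refute-sound ρ n n _ t
      (prune-sound ρ (map tighten rs) (AllP.map⁺ (All.map (λ {r} → tighten-sound ρ r) h)))

  -- The negation of an inequality between integers is again an inequality: a ≤ b fails exactly if a
  -- - b - 1 ≥ 0. The negation of an equation is a disjunction, so equations are proved as two
  -- inequalities.
  entails : List Row → Form → Bool
  entails hs (a :≤ b) = ref ((geq , lin (a :- b :- K 1ℤ)) ∷ hs)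
  entails hs (a :< b) = ref ((geq , lin (a :- b)) ∷ hs)
  entails hs (a :≡ b) = entails hs (a :≤ b) ∧ entails hs (b :≤ a)
  entails hs (f :∧ g) = entails hs f ∧ entails hs g
  entails hs ⊤ᶠ = true
  entails hs ⊥ᶠ = ref hs

  entails-sound : ∀ hs g ρ → T (entails hs g) → All (Sat ρ) hs → Holds g ρ
  entails-sound hs (a :≤ b) ρ t h = ℤP.≮⇒≥ λ lt → ref-sound ρ ((geq , lin (a :- b :- K 1ℤ)) ∷ hs) t (<-sat b a ρ lt ∷ h)
  entails-sound hs (a :< b) ρ t h = ℤP.≰⇒> λ le → ref-sound ρ ((geq , lin (a :- b)) ∷ hs) t (≤-sat b a ρ le ∷ h)
  entails-sound hs (a :≡ b) ρ t h with Equivalence.to (T-∧ {entails hs (a :≤ b)}) t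
  ... | t₁ , t₂ = ℤP.≤-antisym (entails-sound hs (a :≤ b) ρ t₁ h) (entails-sound hs (b :≤ a) ρ t₂ h)
  entails-sound hs (f :∧ g) ρ t h with Equivalence.to (T-∧ {entails hs f}) t
  ... | t₁ , t₂ = entails-sound hs f ρ t₁ h , entails-sound hs g ρ t₂ h
  entails-sound hs ⊤ᶠ ρ t h = tt
  entails-sound hs ⊥ᶠ ρ t h = ref-sound ρ _ t h

-- Formulas are written as functions of expressions, so that a call of `lia` names its variables by
-- a lambda. `applyVars` numbers them, and at given integers `Holds` computes to the ordinary
-- statement about these integers.
Fun : ℕ → Set
Fun zero = Form × Form
Fun (suc n) = Expr → Fun n

applyVars : ∀ n → ℕ → Fun n → Form × Form
applyVars zero k p = p
applyVars (suc n) k f = applyVars n (suc k) (f (V k))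

∀ℤ : ℕ → (List ℤ → Set) → Set
∀ℤ zero P = P []
∀ℤ (suc n) P = (x : ℤ) → ∀ℤ n (λ ρ → P (x ∷ ρ))

introℤ : ∀ n {P : List ℤ → Set} → (∀ ρ → P ρ) → ∀ℤ n P
introℤ zero f = f []
introℤ (suc n) f x = introℤ n (λ ρ → f (x ∷ ρ))

-- Used as  lia n (λ x₁ … xₙ → hypotheses ⊢ conclusion) a₁ … aₙ proofs, where the implicit
-- argument is found by running the decision procedure.
abstract
  lia : ∀ n (f : Fun n) (let (h , g) = applyVars n 0 f) → {_ : T (entails n (rows h) g)} →
        ∀ℤ n (λ ρ → Holds h ρ → Holds g ρ)
  lia n f {t} = introℤ n λ ρ h → entails-sound n (rows (proj₁ (applyVars n 0 f))) (proj₂ (applyVars n 0 f)) ρ t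
                  (rows-sound (proj₁ (applyVars n 0 f)) ρ h)

infix 2 _⊢_
_⊢_ : Form → Form → Form × Form
_⊢_ = _,_

infix 8 #_
#_ : ℕ → Expr
# k = K (+ k)

-- Tiles as systems of linear inequalities

infix 1 _⇔_
_⇔_ : Set → Set → Set
A ⇔ B = (A → B) × (B → A)

≤ᵇ-true : ∀ a b → ((a ≤ᵇ b) ≡ true) ⇔ (a ≤ b)
≤ᵇ-true a b = (λ e → ℤP.≤ᵇ⇒≤ (subst T (sym e) tt)) , λ h → T-true (ℤP.≤⇒≤ᵇ h)
  where
  T-true : ∀ {b} → T b → b ≡ true
  T-true {true} _ = refl

allB-All : {A : Set} (f : A → Bool) (l : List A) → (allB f l ≡ true) ⇔ All (λ a → f a ≡ true) l
allB-All f [] = (λ _ → []) , λ _ → refl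
allB-All f (x ∷ l) with f x in e
... | true = (λ h → e ∷ proj₁ (allB-All f l) h) , λ { (_ ∷ h) → proj₂ (allB-All f l) h }
... | false = (λ ()) , λ { (h ∷ _) → trans (sym e) h }

-- The cell (x , y , q) lies strictly between consecutive lines of each of the
-- four families x, y, x + y, x − y ∈ ℤ; sumFl and difFl are the floors of
-- x + y and x − y on it.
σ τ : Fin 4 → ℤ
σ 0F = + 0
σ 1F = + 1
σ 2F = + 1
σ 3F = + 0
τ 0F = + 0
τ 1F = + 0
τ 2F = + 1
τ 3F = + 1

sumFl difFl : Cell → ℤ
sumFl (x , y , q) = x + y + σ q
difFl (x , y , q) = x - y - τ q

data Dir : Set where
  E NE N NW W SW S SE : Dir

dirX dirY : Dir → ℤ
dirX E = + 1
dirX NE = + 1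
dirX N = + 0
dirX NW = - + 1
dirX W = - + 1
dirX SW = - + 1
dirX S = + 0
dirX SE = + 1
dirY E = + 0
dirY NE = + 1
dirY N = + 1
dirY NW = + 1
dirY W = + 0
dirY SW = - + 1
dirY S = - + 1
dirY SE = - + 1

LeftOfLine : Dir → Point → Cell → Set
LeftOfLine E (ux , uy) (x , y , q) = uy ≤ y
LeftOfLine N (ux , uy) (x , y , q) = x < ux
LeftOfLine W (ux , uy) (x , y , q) = y < uy
LeftOfLine S (ux , uy) (x , y , q) = ux ≤ x
LeftOfLine NE (ux , uy) c = difFl c < ux - uy
LeftOfLine NW (ux , uy) c = sumFl c < ux + uy
LeftOfLine SW (ux , uy) c = ux - uy ≤ difFl c
LeftOfLine SE (ux , uy) c = ux + uy ≤ sumFl c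

-- The quantity whose sign decides the side, after division by the length 6k of the edge.
side : Dir → Point → Cell → ℤ
side d (ux , uy) c =
  dirX d * (proj₂ (centroid6 c) - + 6 * uy) - dirY d * (proj₁ (centroid6 c) - + 6 * ux)

positive-multiple : ∀ k z → (1ℤ ≤ + suc k * z) ⇔ (1ℤ ≤ z)
positive-multiple k z =
  (λ h → ℤP.i<j⇒suc[i]≤j $ ℤP.≰⇒> λ z≤0 → case ℤP.≤-trans h (ℤP.≤-trans (ℤP.*-monoˡ-≤-nonNeg (+ suc k) z≤0)
                                (ℤP.≤-reflexive (ℤP.*-zeroʳ (+ suc k)))) of λ { (ℤ.+≤+ ()) }) ,
  λ h → ℤP.≤-trans (ℤ.+≤+ (ℕ.s≤s ℕ.z≤n)) (ℤP.≤-trans (ℤP.≤-reflexive (sym (ℤP.*-identityʳ (+ suc k))))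
          (ℤP.*-monoˡ-≤-nonNeg (+ suc k) h))

leftOf-side : ∀ d ux uy vx vy k c → 1ℤ ≤ k → vx ≡ ux + dirX d * k → vy ≡ uy + dirY d * k →
  (leftOf (scale6 (ux , uy)) (scale6 (vx , vy)) (centroid6 c) ≡ true) ⇔ (1ℤ ≤ side d (ux , uy) c)
leftOf-side d ux uy vx vy (+ suc k) c (ℤ.+≤+ (ℕ.s≤s _)) refl refl with centroid6 c
... | px , py =
  -- The edge consists of `suc k` steps in direction `d`, so the determinant is `suc k * 6` times
  -- `side`; this product computes to `suc (5 + k * 6)`.
  (λ e → proj₁ (positive-multiple (5 ℕ.+ k ℕ.* 6) _) (subst (1ℤ ≤_) det (proj₁ (≤ᵇ-true _ _) e))) ,
  λ h → proj₂ (≤ᵇ-true _ _) (subst (1ℤ ≤_) (sym det) (proj₂ (positive-multiple (5 ℕ.+ k ℕ.* 6) _) h))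
  where
  poly : ∀ K dx dy ux uy px py →
    (+ 6 * (ux + dx * K) - + 6 * ux) * (py - + 6 * uy) - (+ 6 * (uy + dy * K) - + 6 * uy) * (px - + 6 * ux)
    ≡ (K * + 6) * (dx * (py - + 6 * uy) - dy * (px - + 6 * ux))
  poly = solve-∀
  det = poly (+ suc k) (dirX d) (dirY d) ux uy px py

-- Here `p` is six times a coordinate of the centroid and `f` the floor of that coordinate. Since
-- the centroid lies on no line of the family, `p` stays strictly between two consecutive multiples
-- of six.
nearᵉ : Expr → Expr → Form
nearᵉ p f = (+ 6) :* f :+ # 1 :≤ p :∧ p :≤ (+ 6) :* f :+ # 5

-- Templates like this one serve twice: with variables they are input for `lia`, with `K` they are
-- propositions about given integers. Both unfold to the same type, so proofs pass between them
-- without conversion.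
flᵉ : Expr → Expr → Expr → Expr → Expr → Expr → Form
flᵉ px py x y s d = nearᵉ px x :∧ nearᵉ py y :∧ nearᵉ (px :+ py) s :∧ nearᵉ (px :- py) d

centroid-floors : ∀ (c : Cell) → let (x , y , _) = c ; (px , py) = centroid6 c in
  Holds (flᵉ (K px) (K py) (K x) (K y) (K (sumFl c)) (K (difFl c))) []
centroid-floors (x , y , 0F) = lia 2 (λ x y → ⊤ᶠ ⊢
  let px = (+ 6) :* x :+ # 3 ; py = (+ 6) :* y :+ # 1 in
  flᵉ px py x y (x :+ y :+ # 0) (x :- y :- # 0)) x y tt
centroid-floors (x , y , 1F) = lia 2 (λ x y → ⊤ᶠ ⊢
  let px = (+ 6) :* x :+ # 5 ; py = (+ 6) :* y :+ # 3 in
  flᵉ px py x y (x :+ y :+ # 1) (x :- y :- # 0)) x y tt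
centroid-floors (x , y , 2F) = lia 2 (λ x y → ⊤ᶠ ⊢
  let px = (+ 6) :* x :+ # 3 ; py = (+ 6) :* y :+ # 5 in
  flᵉ px py x y (x :+ y :+ # 1) (x :- y :- # 1)) x y tt
centroid-floors (x , y , 3F) = lia 2 (λ x y → ⊤ᶠ ⊢
  let px = (+ 6) :* x :+ # 1 ; py = (+ 6) :* y :+ # 3 in
  flᵉ px py x y (x :+ y :+ # 0) (x :- y :- # 1)) x y tt

sideᵉ : ℤ → ℤ → Expr → Expr → Expr → Expr → Expr
sideᵉ dx dy px py ux uy = dx :* (py :- (+ 6) :* uy) :- dy :* (px :- (+ 6) :* ux)

-- Up to sign, `side` is the difference between a multiple of six and one of px, py, px + py, px -
-- py. As the latter avoid the multiples of six, its sign is decided by comparing floors.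
leftOf-line : ∀ d u c → (1ℤ ≤ side d u c) ⇔ LeftOfLine d u c
leftOf-line E (ux , uy) c@(x , y , _) =
  (λ h → lia 8 (λ px py x y s d ux uy → flᵉ px py x y s d :∧ # 1 :≤ sideᵉ (+ 1) (+ 0) px py ux uy ⊢ uy :≤ y)
    (proj₁ (centroid6 c)) (proj₂ (centroid6 c)) x y (sumFl c) (difFl c) ux uy (centroid-floors c , h)) ,
  (λ h → lia 8 (λ px py x y s d ux uy → flᵉ px py x y s d :∧ uy :≤ y ⊢ # 1 :≤ sideᵉ (+ 1) (+ 0) px py ux uy)
    (proj₁ (centroid6 c)) (proj₂ (centroid6 c)) x y (sumFl c) (difFl c) ux uy (centroid-floors c , h))
leftOf-line N (ux , uy) c@(x , y , _) =
  (λ h → lia 8 (λ px py x y s d ux uy → flᵉ px py x y s d :∧ # 1 :≤ sideᵉ (+ 0) (+ 1) px py ux uy ⊢ x :< ux)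
    (proj₁ (centroid6 c)) (proj₂ (centroid6 c)) x y (sumFl c) (difFl c) ux uy (centroid-floors c , h)) ,
  (λ h → lia 8 (λ px py x y s d ux uy → flᵉ px py x y s d :∧ x :< ux ⊢ # 1 :≤ sideᵉ (+ 0) (+ 1) px py ux uy)
    (proj₁ (centroid6 c)) (proj₂ (centroid6 c)) x y (sumFl c) (difFl c) ux uy (centroid-floors c , h))
leftOf-line W (ux , uy) c@(x , y , _) =
  (λ h → lia 8 (λ px py x y s d ux uy → flᵉ px py x y s d :∧ # 1 :≤ sideᵉ (- + 1) (+ 0) px py ux uy ⊢ y :< uy)
    (proj₁ (centroid6 c)) (proj₂ (centroid6 c)) x y (sumFl c) (difFl c) ux uy (centroid-floors c , h)) ,
  (λ h → lia 8 (λ px py x y s d ux uy → flᵉ px py x y s d :∧ y :< uy ⊢ # 1 :≤ sideᵉ (- + 1) (+ 0) px py ux uy)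
    (proj₁ (centroid6 c)) (proj₂ (centroid6 c)) x y (sumFl c) (difFl c) ux uy (centroid-floors c , h))
leftOf-line S (ux , uy) c@(x , y , _) =
  (λ h → lia 8 (λ px py x y s d ux uy → flᵉ px py x y s d :∧ # 1 :≤ sideᵉ (+ 0) (- + 1) px py ux uy ⊢ ux :≤ x)
    (proj₁ (centroid6 c)) (proj₂ (centroid6 c)) x y (sumFl c) (difFl c) ux uy (centroid-floors c , h)) ,
  (λ h → lia 8 (λ px py x y s d ux uy → flᵉ px py x y s d :∧ ux :≤ x ⊢ # 1 :≤ sideᵉ (+ 0) (- + 1) px py ux uy)
    (proj₁ (centroid6 c)) (proj₂ (centroid6 c)) x y (sumFl c) (difFl c) ux uy (centroid-floors c , h))
leftOf-line NE (ux , uy) c@(x , y , _) =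
  (λ h → lia 8 (λ px py x y s d ux uy → flᵉ px py x y s d :∧ # 1 :≤ sideᵉ (+ 1) (+ 1) px py ux uy ⊢ d :< ux :- uy)
    (proj₁ (centroid6 c)) (proj₂ (centroid6 c)) x y (sumFl c) (difFl c) ux uy (centroid-floors c , h)) ,
  (λ h → lia 8 (λ px py x y s d ux uy → flᵉ px py x y s d :∧ d :< ux :- uy ⊢ # 1 :≤ sideᵉ (+ 1) (+ 1) px py ux uy)
    (proj₁ (centroid6 c)) (proj₂ (centroid6 c)) x y (sumFl c) (difFl c) ux uy (centroid-floors c , h))
leftOf-line NW (ux , uy) c@(x , y , _) =
  (λ h → lia 8 (λ px py x y s d ux uy → flᵉ px py x y s d :∧ # 1 :≤ sideᵉ (- + 1) (+ 1) px py ux uy ⊢ s :< ux :+ uy)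
    (proj₁ (centroid6 c)) (proj₂ (centroid6 c)) x y (sumFl c) (difFl c) ux uy (centroid-floors c , h)) ,
  (λ h → lia 8 (λ px py x y s d ux uy → flᵉ px py x y s d :∧ s :< ux :+ uy ⊢ # 1 :≤ sideᵉ (- + 1) (+ 1) px py ux uy)
    (proj₁ (centroid6 c)) (proj₂ (centroid6 c)) x y (sumFl c) (difFl c) ux uy (centroid-floors c , h))
leftOf-line SW (ux , uy) c@(x , y , _) =
  (λ h → lia 8 (λ px py x y s d ux uy → flᵉ px py x y s d :∧ # 1 :≤ sideᵉ (- + 1) (- + 1) px py ux uy ⊢ ux :- uy :≤ d)
    (proj₁ (centroid6 c)) (proj₂ (centroid6 c)) x y (sumFl c) (difFl c) ux uy (centroid-floors c , h)) ,
  (λ h → lia 8 (λ px py x y s d ux uy → flᵉ px py x y s d :∧ ux :- uy :≤ d ⊢ # 1 :≤ sideᵉ (- + 1) (- + 1) px py ux uy)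
    (proj₁ (centroid6 c)) (proj₂ (centroid6 c)) x y (sumFl c) (difFl c) ux uy (centroid-floors c , h))
leftOf-line SE (ux , uy) c@(x , y , _) =
  (λ h → lia 8 (λ px py x y s d ux uy → flᵉ px py x y s d :∧ # 1 :≤ sideᵉ (+ 1) (- + 1) px py ux uy ⊢ ux :+ uy :≤ s)
    (proj₁ (centroid6 c)) (proj₂ (centroid6 c)) x y (sumFl c) (difFl c) ux uy (centroid-floors c , h)) ,
  (λ h → lia 8 (λ px py x y s d ux uy → flᵉ px py x y s d :∧ ux :+ uy :≤ s ⊢ # 1 :≤ sideᵉ (+ 1) (- + 1) px py ux uy)
    (proj₁ (centroid6 c)) (proj₂ (centroid6 c)) x y (sumFl c) (difFl c) ux uy (centroid-floors c , h))

inTile-All : ∀ t c → (inTile t c ≡ true) ⇔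
  All (λ e → leftOf (scale6 (proj₁ e)) (scale6 (proj₂ e)) (centroid6 c) ≡ true) (edges (vertices t))
inTile-All t c = allB-All _ (edges (vertices t))

1≤suc : ∀ {k} → 1ℤ ≤ + suc k
1≤suc = ℤ.+≤+ (ℕ.s≤s ℕ.z≤n)

leftOf-edge : ∀ d ux uy vx vy k c → 1ℤ ≤ k → vx ≡ ux + dirX d * k × vy ≡ uy + dirY d * k →
  (leftOf (scale6 (ux , uy)) (scale6 (vx , vy)) (centroid6 c) ≡ true) ⇔ LeftOfLine d (ux , uy) c
leftOf-edge d ux uy vx vy k c k≥1 (ex , ey) =
  (proj₁ (leftOf-line d (ux , uy) c) ∘ proj₁ (leftOf-side d ux uy vx vy k c k≥1 ex ey)) ,
  (proj₂ (leftOf-side d ux uy vx vy k c k≥1 ex ey) ∘ proj₂ (leftOf-line d (ux , uy) c))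

record Oct : Set where
  constructor oct
  field
    xl xu yl yu sl su dl du : ℤ

octᵉ : (xl xu yl yu sl su dl du x y s d : Expr) → Form
octᵉ xl xu yl yu sl su dl du x y s d =
  (xl :≤ x :∧ x :< xu) :∧ (yl :≤ y :∧ y :< yu) :∧ (sl :≤ s :∧ s :< su) :∧ (dl :≤ d :∧ d :< du)

InOct : Oct → Cell → Set
InOct (oct xl xu yl yu sl su dl du) c@(x , y , _) =
  Holds (octᵉ (K xl) (K xu) (K yl) (K yu) (K sl) (K su) (K dl) (K du) (K x) (K y) (K (sumFl c)) (K (difFl c))) []

cellᵉ : (x y s d : Expr) → Form
cellᵉ x y s d = x :+ y :≤ s :∧ s :≤ x :+ y :+ # 1 :∧ x :- y :- # 1 :≤ d :∧ d :≤ x :- y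

cell-floors : ∀ (c : Cell) → let (x , y , _) = c in Holds (cellᵉ (K x) (K y) (K (sumFl c)) (K (difFl c))) []
cell-floors c@(x , y , _) =
  lia 6 (λ px py x y s d → flᵉ px py x y s d ⊢ cellᵉ x y s d)
    (proj₁ (centroid6 c)) (proj₂ (centroid6 c)) x y (sumFl c) (difFl c) (centroid-floors c)

octagonOct : (p q tx ty : ℤ) → Oct
octagonOct p q tx ty = oct
  (tx - q) (tx + + 2 + p) ty (ty + p + q + + 2)
  (tx + ty) (tx + ty + + 2 * p + + 4) (tx - ty - + 2 * q - + 2) (tx - ty + + 2)

-- Some of the bounds of the trapezoid and of the triangle are redundant; they are
-- those of the octagon obtained by reflecting the tile in its dashed sides.
baseOct : Shape → ℤ → ℤ → Oct
baseOct square tx ty = octagonOct (+ 0) (+ 0) tx ty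
baseOct diamond tx ty = oct (tx - + 1) (tx + + 1) ty (ty + + 2) (tx + ty) (tx + ty + + 2) (tx - ty - + 2) (tx - ty)
baseOct (hexagon k) tx ty = octagonOct (+ 0) (+ suc k) tx ty
baseOct (octagon k l) tx ty = octagonOct (+ suc k) (+ suc l) tx ty
baseOct (trapezoid k) tx ty = let a = + suc k in
  oct tx (tx + + 2 * a + + 2) ty (ty + a) (tx + ty - + 2) (tx + ty + + 2 * a + + 2) (tx - ty) (tx - ty + + 2 * a + + 4)
baseOct (triangle k) tx ty = let a = + suc k in
  oct tx (tx + a) ty (ty + a) (tx + ty - a - + 4) (tx + ty + a) (tx - ty - a - + 2) (tx - ty + a + + 2)

-- Each edge contributes the one bound that faces it. A bound without an edge follows from the
-- others and from `cellᵉ`, which ties the floors of x + y and x - y to those of x and y; for the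
-- diamond this also uses integrality.
base-inTile : ∀ sh tx ty c → (inTile (mkTile sh 0F tx ty) c ≡ true) ⇔ InOct (baseOct sh tx ty) c
base-inTile square tx ty c@(x , y , _) =
  (λ h → case proj₁ (inTile-All (mkTile square 0F tx ty) c) h of λ { (h0 ∷ h1 ∷ h2 ∷ h3 ∷ []) →
    lia 6 (λ  tx ty x y s d → cellᵉ x y s d :∧
        (# 0 :+ ty) :≤ y :∧ x :< (# 2 :+ tx) :∧ y :< (# 2 :+ ty) :∧ (# 0 :+ tx) :≤ x
      ⊢ octᵉ (tx :- # 0) (tx :+ # 2 :+ # 0) ty (ty :+ # 0 :+ # 0 :+ # 2) (tx :+ ty) (tx :+ ty :+ (+ 2) :* # 0 :+ # 4) (tx :- ty :- (+ 2) :* # 0 :- # 2) (tx :- ty :+ # 2) x y s d)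
       tx ty x y (sumFl c) (difFl c)
      (cell-floors c , proj₁ e0 h0 , proj₁ e1 h1 , proj₁ e2 h2 , proj₁ e3 h3) }) ,
  (λ h → let (h0 , h1 , h2 , h3) = lia 6 (λ  tx ty x y s d → cellᵉ x y s d :∧
                  octᵉ (tx :- # 0) (tx :+ # 2 :+ # 0) ty (ty :+ # 0 :+ # 0 :+ # 2) (tx :+ ty) (tx :+ ty :+ (+ 2) :* # 0 :+ # 4) (tx :- ty :- (+ 2) :* # 0 :- # 2) (tx :- ty :+ # 2) x y s d
                ⊢ (# 0 :+ ty) :≤ y :∧ x :< (# 2 :+ tx) :∧ y :< (# 2 :+ ty) :∧ (# 0 :+ tx) :≤ x)
                   tx ty x y (sumFl c) (difFl c) (cell-floors c , h)
   in proj₂ (inTile-All (mkTile square 0F tx ty) c) (proj₂ e0 h0 ∷ proj₂ e1 h1 ∷ proj₂ e2 h2 ∷ proj₂ e3 h3 ∷ []))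
  where
  e0 = leftOf-edge E (+ 0 + tx) (+ 0 + ty) (+ 2 + tx) (+ 0 + ty) (+ 2) c
    1≤suc
    (lia 2 (λ  tx ty → ⊤ᶠ ⊢ # 2 :+ tx :≡ # 0 :+ tx :+ (+ 1) :* (# 2) :∧ # 0 :+ ty :≡ # 0 :+ ty :+ (+ 0) :* (# 2))  tx ty tt)
  e1 = leftOf-edge N (+ 2 + tx) (+ 0 + ty) (+ 2 + tx) (+ 2 + ty) (+ 2) c
    1≤suc
    (lia 2 (λ  tx ty → ⊤ᶠ ⊢ # 2 :+ tx :≡ # 2 :+ tx :+ (+ 0) :* (# 2) :∧ # 2 :+ ty :≡ # 0 :+ ty :+ (+ 1) :* (# 2))  tx ty tt)
  e2 = leftOf-edge W (+ 2 + tx) (+ 2 + ty) (+ 0 + tx) (+ 2 + ty) (+ 2) c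
    1≤suc
    (lia 2 (λ  tx ty → ⊤ᶠ ⊢ # 0 :+ tx :≡ # 2 :+ tx :+ (- + 1) :* (# 2) :∧ # 2 :+ ty :≡ # 2 :+ ty :+ (+ 0) :* (# 2))  tx ty tt)
  e3 = leftOf-edge S (+ 0 + tx) (+ 2 + ty) (+ 0 + tx) (+ 0 + ty) (+ 2) c
    1≤suc
    (lia 2 (λ  tx ty → ⊤ᶠ ⊢ # 0 :+ tx :≡ # 0 :+ tx :+ (+ 0) :* (# 2) :∧ # 0 :+ ty :≡ # 2 :+ ty :+ (- + 1) :* (# 2))  tx ty tt)
base-inTile diamond tx ty c@(x , y , _) =
  (λ h → case proj₁ (inTile-All (mkTile diamond 0F tx ty) c) h of λ { (h0 ∷ h1 ∷ h2 ∷ h3 ∷ []) →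
    lia 6 (λ  tx ty x y s d → cellᵉ x y s d :∧
        d :< (# 0 :+ tx) :- (# 0 :+ ty) :∧ s :< (# 1 :+ tx) :+ (# 1 :+ ty) :∧ (# 0 :+ tx) :- (# 2 :+ ty) :≤ d :∧ (neg (# 1) :+ tx) :+ (# 1 :+ ty) :≤ s
      ⊢ octᵉ (tx :- # 1) (tx :+ # 1) ty (ty :+ # 2) (tx :+ ty) (tx :+ ty :+ # 2) (tx :- ty :- # 2) (tx :- ty) x y s d)
       tx ty x y (sumFl c) (difFl c)
      (cell-floors c , proj₁ e0 h0 , proj₁ e1 h1 , proj₁ e2 h2 , proj₁ e3 h3) }) ,
  (λ h → let (h0 , h1 , h2 , h3) = lia 6 (λ  tx ty x y s d → cellᵉ x y s d :∧
                  octᵉ (tx :- # 1) (tx :+ # 1) ty (ty :+ # 2) (tx :+ ty) (tx :+ ty :+ # 2) (tx :- ty :- # 2) (tx :- ty) x y s d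
                ⊢ d :< (# 0 :+ tx) :- (# 0 :+ ty) :∧ s :< (# 1 :+ tx) :+ (# 1 :+ ty) :∧ (# 0 :+ tx) :- (# 2 :+ ty) :≤ d :∧ (neg (# 1) :+ tx) :+ (# 1 :+ ty) :≤ s)
                   tx ty x y (sumFl c) (difFl c) (cell-floors c , h)
   in proj₂ (inTile-All (mkTile diamond 0F tx ty) c) (proj₂ e0 h0 ∷ proj₂ e1 h1 ∷ proj₂ e2 h2 ∷ proj₂ e3 h3 ∷ []))
  where
  e0 = leftOf-edge NE (+ 0 + tx) (+ 0 + ty) (+ 1 + tx) (+ 1 + ty) (+ 1) c
    1≤suc
    (lia 2 (λ  tx ty → ⊤ᶠ ⊢ # 1 :+ tx :≡ # 0 :+ tx :+ (+ 1) :* (# 1) :∧ # 1 :+ ty :≡ # 0 :+ ty :+ (+ 1) :* (# 1))  tx ty tt)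
  e1 = leftOf-edge NW (+ 1 + tx) (+ 1 + ty) (+ 0 + tx) (+ 2 + ty) (+ 1) c
    1≤suc
    (lia 2 (λ  tx ty → ⊤ᶠ ⊢ # 0 :+ tx :≡ # 1 :+ tx :+ (- + 1) :* (# 1) :∧ # 2 :+ ty :≡ # 1 :+ ty :+ (+ 1) :* (# 1))  tx ty tt)
  e2 = leftOf-edge SW (+ 0 + tx) (+ 2 + ty) (- (+ 1) + tx) (+ 1 + ty) (+ 1) c
    1≤suc
    (lia 2 (λ  tx ty → ⊤ᶠ ⊢ neg (# 1) :+ tx :≡ # 0 :+ tx :+ (- + 1) :* (# 1) :∧ # 1 :+ ty :≡ # 2 :+ ty :+ (- + 1) :* (# 1))  tx ty tt)
  e3 = leftOf-edge SE (- (+ 1) + tx) (+ 1 + ty) (+ 0 + tx) (+ 0 + ty) (+ 1) c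
    1≤suc
    (lia 2 (λ  tx ty → ⊤ᶠ ⊢ # 0 :+ tx :≡ neg (# 1) :+ tx :+ (+ 1) :* (# 1) :∧ # 0 :+ ty :≡ # 1 :+ ty :+ (- + 1) :* (# 1))  tx ty tt)
base-inTile (hexagon k) tx ty c@(x , y , _) =
  (λ h → case proj₁ (inTile-All (mkTile (hexagon k) 0F tx ty) c) h of λ { (h0 ∷ h1 ∷ h2 ∷ h3 ∷ h4 ∷ h5 ∷ []) →
    lia 7 (λ a tx ty x y s d → # 1 :≤ a :∧ cellᵉ x y s d :∧
        (# 0 :+ ty) :≤ y :∧ x :< (# 2 :+ tx) :∧ s :< (# 2 :+ tx) :+ (# 2 :+ ty) :∧ y :< (# 2 :+ a :+ ty) :∧ (neg a :+ tx) :≤ x :∧ (neg a :+ tx) :+ (a :+ ty) :≤ s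
      ⊢ octᵉ (tx :- a) (tx :+ # 2 :+ # 0) ty (ty :+ # 0 :+ a :+ # 2) (tx :+ ty) (tx :+ ty :+ (+ 2) :* # 0 :+ # 4) (tx :- ty :- (+ 2) :* a :- # 2) (tx :- ty :+ # 2) x y s d)
      (+ suc k) tx ty x y (sumFl c) (difFl c)
      (1≤suc , cell-floors c , proj₁ e0 h0 , proj₁ e1 h1 , proj₁ e2 h2 , proj₁ e3 h3 , proj₁ e4 h4 , proj₁ e5 h5) }) ,
  (λ h → let (h0 , h1 , h2 , h3 , h4 , h5) = lia 7 (λ a tx ty x y s d → # 1 :≤ a :∧ cellᵉ x y s d :∧
                  octᵉ (tx :- a) (tx :+ # 2 :+ # 0) ty (ty :+ # 0 :+ a :+ # 2) (tx :+ ty) (tx :+ ty :+ (+ 2) :* # 0 :+ # 4) (tx :- ty :- (+ 2) :* a :- # 2) (tx :- ty :+ # 2) x y s d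
                ⊢ (# 0 :+ ty) :≤ y :∧ x :< (# 2 :+ tx) :∧ s :< (# 2 :+ tx) :+ (# 2 :+ ty) :∧ y :< (# 2 :+ a :+ ty) :∧ (neg a :+ tx) :≤ x :∧ (neg a :+ tx) :+ (a :+ ty) :≤ s)
                  (+ suc k) tx ty x y (sumFl c) (difFl c) (1≤suc , cell-floors c , h)
   in proj₂ (inTile-All (mkTile (hexagon k) 0F tx ty) c) (proj₂ e0 h0 ∷ proj₂ e1 h1 ∷ proj₂ e2 h2 ∷ proj₂ e3 h3 ∷ proj₂ e4 h4 ∷ proj₂ e5 h5 ∷ []))
  where
  a = + suc k
  e0 = leftOf-edge E (+ 0 + tx) (+ 0 + ty) (+ 2 + tx) (+ 0 + ty) (+ 2) c
    1≤suc
    (lia 3 (λ a tx ty → ⊤ᶠ ⊢ # 2 :+ tx :≡ # 0 :+ tx :+ (+ 1) :* (# 2) :∧ # 0 :+ ty :≡ # 0 :+ ty :+ (+ 0) :* (# 2)) (+ suc k) tx ty tt)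
  e1 = leftOf-edge N (+ 2 + tx) (+ 0 + ty) (+ 2 + tx) (+ 2 + ty) (+ 2) c
    1≤suc
    (lia 3 (λ a tx ty → ⊤ᶠ ⊢ # 2 :+ tx :≡ # 2 :+ tx :+ (+ 0) :* (# 2) :∧ # 2 :+ ty :≡ # 0 :+ ty :+ (+ 1) :* (# 2)) (+ suc k) tx ty tt)
  e2 = leftOf-edge NW (+ 2 + tx) (+ 2 + ty) (+ 2 - a + tx) (+ 2 + a + ty) (a) c
    1≤suc
    (lia 3 (λ a tx ty → ⊤ᶠ ⊢ # 2 :- a :+ tx :≡ # 2 :+ tx :+ (- + 1) :* (a) :∧ # 2 :+ a :+ ty :≡ # 2 :+ ty :+ (+ 1) :* (a)) (+ suc k) tx ty tt)
  e3 = leftOf-edge W (+ 2 - a + tx) (+ 2 + a + ty) (- a + tx) (+ 2 + a + ty) (+ 2) c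
    1≤suc
    (lia 3 (λ a tx ty → ⊤ᶠ ⊢ neg a :+ tx :≡ # 2 :- a :+ tx :+ (- + 1) :* (# 2) :∧ # 2 :+ a :+ ty :≡ # 2 :+ a :+ ty :+ (+ 0) :* (# 2)) (+ suc k) tx ty tt)
  e4 = leftOf-edge S (- a + tx) (+ 2 + a + ty) (- a + tx) (a + ty) (+ 2) c
    1≤suc
    (lia 3 (λ a tx ty → ⊤ᶠ ⊢ neg a :+ tx :≡ neg a :+ tx :+ (+ 0) :* (# 2) :∧ a :+ ty :≡ # 2 :+ a :+ ty :+ (- + 1) :* (# 2)) (+ suc k) tx ty tt)
  e5 = leftOf-edge SE (- a + tx) (a + ty) (+ 0 + tx) (+ 0 + ty) (a) c
    1≤suc
    (lia 3 (λ a tx ty → ⊤ᶠ ⊢ # 0 :+ tx :≡ neg a :+ tx :+ (+ 1) :* (a) :∧ # 0 :+ ty :≡ a :+ ty :+ (- + 1) :* (a)) (+ suc k) tx ty tt)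
base-inTile (octagon k l) tx ty c@(x , y , _) =
  (λ h → case proj₁ (inTile-All (mkTile (octagon k l) 0F tx ty) c) h of λ { (h0 ∷ h1 ∷ h2 ∷ h3 ∷ h4 ∷ h5 ∷ h6 ∷ h7 ∷ []) →
    lia 8 (λ a b tx ty x y s d → # 1 :≤ a :∧ # 1 :≤ b :∧ cellᵉ x y s d :∧
        (# 0 :+ ty) :≤ y :∧ d :< (# 2 :+ tx) :- (# 0 :+ ty) :∧ x :< (# 2 :+ a :+ tx) :∧ s :< (# 2 :+ a :+ tx) :+ (a :+ # 2 :+ ty) :∧ y :< (a :+ b :+ # 2 :+ ty) :∧ (a :- b :+ tx) :- (a :+ b :+ # 2 :+ ty) :≤ d :∧ (neg b :+ tx) :≤ x :∧ (neg b :+ tx) :+ (b :+ ty) :≤ s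
      ⊢ octᵉ (tx :- b) (tx :+ # 2 :+ a) ty (ty :+ a :+ b :+ # 2) (tx :+ ty) (tx :+ ty :+ (+ 2) :* a :+ # 4) (tx :- ty :- (+ 2) :* b :- # 2) (tx :- ty :+ # 2) x y s d)
      (+ suc k) (+ suc l) tx ty x y (sumFl c) (difFl c)
      (1≤suc , 1≤suc , cell-floors c , proj₁ e0 h0 , proj₁ e1 h1 , proj₁ e2 h2 , proj₁ e3 h3 , proj₁ e4 h4 , proj₁ e5 h5 , proj₁ e6 h6 , proj₁ e7 h7) }) ,
  (λ h → let (h0 , h1 , h2 , h3 , h4 , h5 , h6 , h7) = lia 8 (λ a b tx ty x y s d → # 1 :≤ a :∧ # 1 :≤ b :∧ cellᵉ x y s d :∧
                  octᵉ (tx :- b) (tx :+ # 2 :+ a) ty (ty :+ a :+ b :+ # 2) (tx :+ ty) (tx :+ ty :+ (+ 2) :* a :+ # 4) (tx :- ty :- (+ 2) :* b :- # 2) (tx :- ty :+ # 2) x y s d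
                ⊢ (# 0 :+ ty) :≤ y :∧ d :< (# 2 :+ tx) :- (# 0 :+ ty) :∧ x :< (# 2 :+ a :+ tx) :∧ s :< (# 2 :+ a :+ tx) :+ (a :+ # 2 :+ ty) :∧ y :< (a :+ b :+ # 2 :+ ty) :∧ (a :- b :+ tx) :- (a :+ b :+ # 2 :+ ty) :≤ d :∧ (neg b :+ tx) :≤ x :∧ (neg b :+ tx) :+ (b :+ ty) :≤ s)
                  (+ suc k) (+ suc l) tx ty x y (sumFl c) (difFl c) (1≤suc , 1≤suc , cell-floors c , h)
   in proj₂ (inTile-All (mkTile (octagon k l) 0F tx ty) c) (proj₂ e0 h0 ∷ proj₂ e1 h1 ∷ proj₂ e2 h2 ∷ proj₂ e3 h3 ∷ proj₂ e4 h4 ∷ proj₂ e5 h5 ∷ proj₂ e6 h6 ∷ proj₂ e7 h7 ∷ []))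
  where
  a = + suc k
  b = + suc l
  e0 = leftOf-edge E (+ 0 + tx) (+ 0 + ty) (+ 2 + tx) (+ 0 + ty) (+ 2) c
    1≤suc
    (lia 4 (λ a b tx ty → ⊤ᶠ ⊢ # 2 :+ tx :≡ # 0 :+ tx :+ (+ 1) :* (# 2) :∧ # 0 :+ ty :≡ # 0 :+ ty :+ (+ 0) :* (# 2)) (+ suc k) (+ suc l) tx ty tt)
  e1 = leftOf-edge NE (+ 2 + tx) (+ 0 + ty) (+ 2 + a + tx) (a + ty) (a) c
    1≤suc
    (lia 4 (λ a b tx ty → ⊤ᶠ ⊢ # 2 :+ a :+ tx :≡ # 2 :+ tx :+ (+ 1) :* (a) :∧ a :+ ty :≡ # 0 :+ ty :+ (+ 1) :* (a)) (+ suc k) (+ suc l) tx ty tt)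
  e2 = leftOf-edge N (+ 2 + a + tx) (a + ty) (+ 2 + a + tx) (a + + 2 + ty) (+ 2) c
    1≤suc
    (lia 4 (λ a b tx ty → ⊤ᶠ ⊢ # 2 :+ a :+ tx :≡ # 2 :+ a :+ tx :+ (+ 0) :* (# 2) :∧ a :+ # 2 :+ ty :≡ a :+ ty :+ (+ 1) :* (# 2)) (+ suc k) (+ suc l) tx ty tt)
  e3 = leftOf-edge NW (+ 2 + a + tx) (a + + 2 + ty) (+ 2 + a - b + tx) (a + b + + 2 + ty) (b) c
    1≤suc
    (lia 4 (λ a b tx ty → ⊤ᶠ ⊢ # 2 :+ a :- b :+ tx :≡ # 2 :+ a :+ tx :+ (- + 1) :* (b) :∧ a :+ b :+ # 2 :+ ty :≡ a :+ # 2 :+ ty :+ (+ 1) :* (b)) (+ suc k) (+ suc l) tx ty tt)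
  e4 = leftOf-edge W (+ 2 + a - b + tx) (a + b + + 2 + ty) (a - b + tx) (a + b + + 2 + ty) (+ 2) c
    1≤suc
    (lia 4 (λ a b tx ty → ⊤ᶠ ⊢ a :- b :+ tx :≡ # 2 :+ a :- b :+ tx :+ (- + 1) :* (# 2) :∧ a :+ b :+ # 2 :+ ty :≡ a :+ b :+ # 2 :+ ty :+ (+ 0) :* (# 2)) (+ suc k) (+ suc l) tx ty tt)
  e5 = leftOf-edge SW (a - b + tx) (a + b + + 2 + ty) (- b + tx) (b + + 2 + ty) (a) c
    1≤suc
    (lia 4 (λ a b tx ty → ⊤ᶠ ⊢ neg b :+ tx :≡ a :- b :+ tx :+ (- + 1) :* (a) :∧ b :+ # 2 :+ ty :≡ a :+ b :+ # 2 :+ ty :+ (- + 1) :* (a)) (+ suc k) (+ suc l) tx ty tt)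
  e6 = leftOf-edge S (- b + tx) (b + + 2 + ty) (- b + tx) (b + ty) (+ 2) c
    1≤suc
    (lia 4 (λ a b tx ty → ⊤ᶠ ⊢ neg b :+ tx :≡ neg b :+ tx :+ (+ 0) :* (# 2) :∧ b :+ ty :≡ b :+ # 2 :+ ty :+ (- + 1) :* (# 2)) (+ suc k) (+ suc l) tx ty tt)
  e7 = leftOf-edge SE (- b + tx) (b + ty) (+ 0 + tx) (+ 0 + ty) (b) c
    1≤suc
    (lia 4 (λ a b tx ty → ⊤ᶠ ⊢ # 0 :+ tx :≡ neg b :+ tx :+ (+ 1) :* (b) :∧ # 0 :+ ty :≡ b :+ ty :+ (- + 1) :* (b)) (+ suc k) (+ suc l) tx ty tt)
base-inTile (trapezoid k) tx ty c@(x , y , _) =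
  (λ h → case proj₁ (inTile-All (mkTile (trapezoid k) 0F tx ty) c) h of λ { (h0 ∷ h1 ∷ h2 ∷ h3 ∷ []) →
    lia 7 (λ a tx ty x y s d → # 1 :≤ a :∧ cellᵉ x y s d :∧
        (# 0 :+ ty) :≤ y :∧ s :< ((+ 2) :* a :+ # 2 :+ tx) :+ (# 0 :+ ty) :∧ y :< (a :+ ty) :∧ (a :+ tx) :- (a :+ ty) :≤ d
      ⊢ octᵉ tx (tx :+ (+ 2) :* a :+ # 2) ty (ty :+ a) (tx :+ ty :- # 2) (tx :+ ty :+ (+ 2) :* a :+ # 2) (tx :- ty) (tx :- ty :+ (+ 2) :* a :+ # 4) x y s d)
      (+ suc k) tx ty x y (sumFl c) (difFl c)
      (1≤suc , cell-floors c , proj₁ e0 h0 , proj₁ e1 h1 , proj₁ e2 h2 , proj₁ e3 h3) }) ,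
  (λ h → let (h0 , h1 , h2 , h3) = lia 7 (λ a tx ty x y s d → # 1 :≤ a :∧ cellᵉ x y s d :∧
                  octᵉ tx (tx :+ (+ 2) :* a :+ # 2) ty (ty :+ a) (tx :+ ty :- # 2) (tx :+ ty :+ (+ 2) :* a :+ # 2) (tx :- ty) (tx :- ty :+ (+ 2) :* a :+ # 4) x y s d
                ⊢ (# 0 :+ ty) :≤ y :∧ s :< ((+ 2) :* a :+ # 2 :+ tx) :+ (# 0 :+ ty) :∧ y :< (a :+ ty) :∧ (a :+ tx) :- (a :+ ty) :≤ d)
                  (+ suc k) tx ty x y (sumFl c) (difFl c) (1≤suc , cell-floors c , h)
   in proj₂ (inTile-All (mkTile (trapezoid k) 0F tx ty) c) (proj₂ e0 h0 ∷ proj₂ e1 h1 ∷ proj₂ e2 h2 ∷ proj₂ e3 h3 ∷ []))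
  where
  a = + suc k
  e0 = leftOf-edge E (+ 0 + tx) (+ 0 + ty) (+ 2 * a + + 2 + tx) (+ 0 + ty) (+ 2 * a + + 2) c
    1≤suc
    (lia 3 (λ a tx ty → ⊤ᶠ ⊢ (+ 2) :* a :+ # 2 :+ tx :≡ # 0 :+ tx :+ (+ 1) :* ((+ 2) :* a :+ # 2) :∧ # 0 :+ ty :≡ # 0 :+ ty :+ (+ 0) :* ((+ 2) :* a :+ # 2)) (+ suc k) tx ty tt)
  e1 = leftOf-edge NW (+ 2 * a + + 2 + tx) (+ 0 + ty) (a + + 2 + tx) (a + ty) (a) c
    1≤suc
    (lia 3 (λ a tx ty → ⊤ᶠ ⊢ a :+ # 2 :+ tx :≡ (+ 2) :* a :+ # 2 :+ tx :+ (- + 1) :* (a) :∧ a :+ ty :≡ # 0 :+ ty :+ (+ 1) :* (a)) (+ suc k) tx ty tt)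
  e2 = leftOf-edge W (a + + 2 + tx) (a + ty) (a + tx) (a + ty) (+ 2) c
    1≤suc
    (lia 3 (λ a tx ty → ⊤ᶠ ⊢ a :+ tx :≡ a :+ # 2 :+ tx :+ (- + 1) :* (# 2) :∧ a :+ ty :≡ a :+ ty :+ (+ 0) :* (# 2)) (+ suc k) tx ty tt)
  e3 = leftOf-edge SW (a + tx) (a + ty) (+ 0 + tx) (+ 0 + ty) (a) c
    1≤suc
    (lia 3 (λ a tx ty → ⊤ᶠ ⊢ # 0 :+ tx :≡ a :+ tx :+ (- + 1) :* (a) :∧ # 0 :+ ty :≡ a :+ ty :+ (- + 1) :* (a)) (+ suc k) tx ty tt)
base-inTile (triangle k) tx ty c@(x , y , _) =
  (λ h → case proj₁ (inTile-All (mkTile (triangle k) 0F tx ty) c) h of λ { (h0 ∷ h1 ∷ h2 ∷ []) →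
    lia 7 (λ a tx ty x y s d → # 1 :≤ a :∧ cellᵉ x y s d :∧
        (# 0 :+ ty) :≤ y :∧ s :< (a :+ tx) :+ (# 0 :+ ty) :∧ (# 0 :+ tx) :≤ x
      ⊢ octᵉ tx (tx :+ a) ty (ty :+ a) (tx :+ ty :- a :- # 4) (tx :+ ty :+ a) (tx :- ty :- a :- # 2) (tx :- ty :+ a :+ # 2) x y s d)
      (+ suc k) tx ty x y (sumFl c) (difFl c)
      (1≤suc , cell-floors c , proj₁ e0 h0 , proj₁ e1 h1 , proj₁ e2 h2) }) ,
  (λ h → let (h0 , h1 , h2) = lia 7 (λ a tx ty x y s d → # 1 :≤ a :∧ cellᵉ x y s d :∧
                  octᵉ tx (tx :+ a) ty (ty :+ a) (tx :+ ty :- a :- # 4) (tx :+ ty :+ a) (tx :- ty :- a :- # 2) (tx :- ty :+ a :+ # 2) x y s d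
                ⊢ (# 0 :+ ty) :≤ y :∧ s :< (a :+ tx) :+ (# 0 :+ ty) :∧ (# 0 :+ tx) :≤ x)
                  (+ suc k) tx ty x y (sumFl c) (difFl c) (1≤suc , cell-floors c , h)
   in proj₂ (inTile-All (mkTile (triangle k) 0F tx ty) c) (proj₂ e0 h0 ∷ proj₂ e1 h1 ∷ proj₂ e2 h2 ∷ []))
  where
  a = + suc k
  e0 = leftOf-edge E (+ 0 + tx) (+ 0 + ty) (a + tx) (+ 0 + ty) (a) c
    1≤suc
    (lia 3 (λ a tx ty → ⊤ᶠ ⊢ a :+ tx :≡ # 0 :+ tx :+ (+ 1) :* (a) :∧ # 0 :+ ty :≡ # 0 :+ ty :+ (+ 0) :* (a)) (+ suc k) tx ty tt)
  e1 = leftOf-edge NW (a + tx) (+ 0 + ty) (+ 0 + tx) (a + ty) (a) c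
    1≤suc
    (lia 3 (λ a tx ty → ⊤ᶠ ⊢ # 0 :+ tx :≡ a :+ tx :+ (- + 1) :* (a) :∧ a :+ ty :≡ # 0 :+ ty :+ (+ 1) :* (a)) (+ suc k) tx ty tt)
  e2 = leftOf-edge S (+ 0 + tx) (a + ty) (+ 0 + tx) (+ 0 + ty) (a) c
    1≤suc
    (lia 3 (λ a tx ty → ⊤ᶠ ⊢ # 0 :+ tx :≡ # 0 :+ tx :+ (+ 0) :* (a) :∧ # 0 :+ ty :≡ a :+ ty :+ (- + 1) :* (a)) (+ suc k) tx ty tt)

-- Quarter turns of cells, bounds and tiles

unrotQ : Fin 4 → Fin 4
unrotQ 0F = 3F
unrotQ 1F = 0F
unrotQ 2F = 1F
unrotQ 3F = 2F

unrotCell : Cell → Cell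
unrotCell (x , y , q) = y , - x - + 1 , unrotQ q

centroid-unrot : ∀ c → centroid6 c ≡ rot90 (centroid6 (unrotCell c))
centroid-unrot (x , y , 0F) = cong (_, + 6 * y + + 1) (poly x)
  where
  poly : ∀ x → + 6 * x + + 3 ≡ - (+ 6 * (- x - + 1) + + 3)
  poly = solve-∀
centroid-unrot (x , y , 1F) = cong (_, + 6 * y + + 3) (poly x)
  where
  poly : ∀ x → + 6 * x + + 5 ≡ - (+ 6 * (- x - + 1) + + 1)
  poly = solve-∀
centroid-unrot (x , y , 2F) = cong (_, + 6 * y + + 5) (poly x)
  where
  poly : ∀ x → + 6 * x + + 3 ≡ - (+ 6 * (- x - + 1) + + 3)
  poly = solve-∀
centroid-unrot (x , y , 3F) = cong (_, + 6 * y + + 3) (poly x)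
  where
  poly : ∀ x → + 6 * x + + 1 ≡ - (+ 6 * (- x - + 1) + + 5)
  poly = solve-∀

-- Under (x , y) ↦ (-y , x) the old difference becomes the new sum and the negated old sum the new
-- difference. Negation exchanges lower and upper bounds.
rotOct : Oct → Oct
rotOct (oct xl xu yl yu sl su dl du) = oct (- yu) (- yl) xl xu dl du (- su) (- sl)

unrot-floors : ∀ c → sumFl (unrotCell c) ≡ - difFl c - + 1 × difFl (unrotCell c) ≡ sumFl c
unrot-floors (x , y , 0F) = lia 2 (λ x y → ⊤ᶠ ⊢
  y :+ (neg x :- # 1) :+ # 0 :≡ neg (x :- y :- # 0) :- # 1 :∧ y :- (neg x :- # 1) :- # 1 :≡ x :+ y :+ # 0) x y tt
unrot-floors (x , y , 1F) = lia 2 (λ x y → ⊤ᶠ ⊢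
  y :+ (neg x :- # 1) :+ # 0 :≡ neg (x :- y :- # 0) :- # 1 :∧ y :- (neg x :- # 1) :- # 0 :≡ x :+ y :+ # 1) x y tt
unrot-floors (x , y , 2F) = lia 2 (λ x y → ⊤ᶠ ⊢
  y :+ (neg x :- # 1) :+ # 1 :≡ neg (x :- y :- # 1) :- # 1 :∧ y :- (neg x :- # 1) :- # 0 :≡ x :+ y :+ # 1) x y tt
unrot-floors (x , y , 3F) = lia 2 (λ x y → ⊤ᶠ ⊢
  y :+ (neg x :- # 1) :+ # 1 :≡ neg (x :- y :- # 1) :- # 1 :∧ y :- (neg x :- # 1) :- # 1 :≡ x :+ y :+ # 0) x y tt

rotOct-unrot : ∀ o c → InOct o (unrotCell c) ⇔ InOct (rotOct o) c
rotOct-unrot (oct xl xu yl yu sl su dl du) c@(x , y , _) =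
  (λ h → lia 14 (λ xl xu yl yu sl su dl du x y s d s′ d′ →
     (s′ :≡ neg d :- # 1 :∧ d′ :≡ s) :∧ octᵉ xl xu yl yu sl su dl du y (neg x :- # 1) s′ d′
     ⊢ octᵉ (neg yu) (neg yl) xl xu dl du (neg su) (neg sl) x y s d)
     xl xu yl yu sl su dl du x y (sumFl c) (difFl c) (sumFl c′) (difFl c′) (unrot-floors c , h)) ,
  (λ h → lia 14 (λ xl xu yl yu sl su dl du x y s d s′ d′ →
     (s′ :≡ neg d :- # 1 :∧ d′ :≡ s) :∧ octᵉ (neg yu) (neg yl) xl xu dl du (neg su) (neg sl) x y s d
     ⊢ octᵉ xl xu yl yu sl su dl du y (neg x :- # 1) s′ d′)
     xl xu yl yu sl su dl du x y (sumFl c) (difFl c) (sumFl c′) (difFl c′) (unrot-floors c , h))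
  where
  c′ = unrotCell c

-- `edges` recurses through a local function; on the explicit vertex list of each shape both sides
-- simply compute.
edges-map : (f : Point → Point) (sh : Shape) →
  edges (map f (baseVertices sh)) ≡ map (λ e → f (proj₁ e) , f (proj₂ e)) (edges (baseVertices sh))
edges-map f square = refl
edges-map f diamond = refl
edges-map f (hexagon k) = refl
edges-map f (octagon k l) = refl
edges-map f (trapezoid k) = refl
edges-map f (triangle k) = refl

allB-map-cong : {A B : Set} (f g : A → B) (p q : B → Bool) (l : List A) →
  (∀ a → p (f a) ≡ q (g a)) → allB p (map f l) ≡ allB q (map g l)
allB-map-cong f g p q [] h = refl
allB-map-cong f g p q (a ∷ l) h = cong₂ _∧_ (h a) (allB-map-cong f g p q l h)

-- Rotations preserve the determinants that decide on which side of an edge a point lies. The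
-- translation vector has to be turned back together with the cell, because a tile is rotated before
-- it is translated.
inTile-unrot : ∀ sh (r r′ : Fin 4) tx ty c → toℕ r′ ≡ suc (toℕ r) →
  inTile (mkTile sh r ty (- tx)) (unrotCell c) ≡ inTile (mkTile sh r′ tx ty) c
inTile-unrot sh r r′ tx ty c e
  rewrite edges-map (place (mkTile sh r ty (- tx))) sh | edges-map (place (mkTile sh r′ tx ty)) sh
        | centroid-unrot c | e =
  allB-map-cong _ _ _ _ (edges (baseVertices sh)) λ (u , v) →
    cong (1ℤ ≤ᵇ_) (poly (proj₁ (rotN (toℕ r) u)) (proj₂ (rotN (toℕ r) u)) (proj₁ (rotN (toℕ r) v)) (proj₂ (rotN (toℕ r) v))
      tx ty (proj₁ (centroid6 (unrotCell c))) (proj₂ (centroid6 (unrotCell c))))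
  where
  poly : ∀ ux uy vx vy tx ty px py →
    (+ 6 * (vx + ty) - + 6 * (ux + ty)) * (py - + 6 * (uy + - tx)) - (+ 6 * (vy + - tx) - + 6 * (uy + - tx)) * (px - + 6 * (ux + ty))
    ≡ (+ 6 * (- vy + tx) - + 6 * (- uy + tx)) * (px - + 6 * (ux + ty)) - (+ 6 * (vx + ty) - + 6 * (ux + ty)) * (- py - + 6 * (- uy + tx))
  poly = solve-∀

-- Undoing one turn replaces the translation (tx , ty) by (ty , -tx). The double negation after
-- three turns is left as it is, so that iterating `rotate-oct` fits definitionally.
tileOct : Tile → Oct
tileOct (mkTile sh 0F tx ty) = baseOct sh tx ty
tileOct (mkTile sh 1F tx ty) = rotOct (baseOct sh ty (- tx))
tileOct (mkTile sh 2F tx ty) = rotOct (rotOct (baseOct sh (- tx) (- ty)))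
tileOct (mkTile sh 3F tx ty) = rotOct (rotOct (rotOct (baseOct sh (- ty) (- (- tx)))))

IsOctOf : Tile → Oct → Set
IsOctOf t o = ∀ c → (inTile t c ≡ true) ⇔ InOct o c

rotate-oct : ∀ sh r r′ tx ty o → toℕ r′ ≡ suc (toℕ r) →
  IsOctOf (mkTile sh r ty (- tx)) o → IsOctOf (mkTile sh r′ tx ty) (rotOct o)
rotate-oct sh r r′ tx ty o e h c =
  (proj₁ (rotOct-unrot o c) ∘ proj₁ (h (unrotCell c)) ∘ trans (inTile-unrot sh r r′ tx ty c e)) ,
  (trans (sym (inTile-unrot sh r r′ tx ty c e)) ∘ proj₂ (h (unrotCell c)) ∘ proj₂ (rotOct-unrot o c))

inTile-oct : ∀ t → IsOctOf t (tileOct t)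
inTile-oct (mkTile sh 0F tx ty) = base-inTile sh tx ty
inTile-oct (mkTile sh 1F tx ty) =
  rotate-oct sh 0F 1F tx ty _ refl (base-inTile sh ty (- tx))
inTile-oct (mkTile sh 2F tx ty) =
  rotate-oct sh 1F _ tx ty _ refl (rotate-oct sh 0F _ ty (- tx) _ refl (base-inTile sh (- tx) (- ty)))
inTile-oct (mkTile sh 3F tx ty) =
  rotate-oct sh 2F _ tx ty _ refl
    (rotate-oct sh 1F _ ty (- tx) _ refl
      (rotate-oct sh 0F _ (- tx) (- ty) _ refl (base-inTile sh (- ty) (- (- tx)))))

-- Runs of a Boolean function on ℤ

eps : Colour → ℤ
eps black = + 0
eps white = + 1

eps-bounds : ∀ c → + 0 ≤ eps c × eps c ≤ + 1
eps-bounds black = ℤP.≤-refl , ℤ.+≤+ ℕ.z≤n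
eps-bounds white = ℤ.+≤+ ℕ.z≤n , ℤP.≤-refl

≤∣∣ : ∀ i → i ≤ + ∣ i ∣
≤∣∣ (+ _) = ℤP.≤-refl
≤∣∣ -[1+ _ ] = ℤ.-≤+

halve : ∀ z → ∃ λ k → z ≡ + 2 * k + + 0 ⊎ z ≡ + 2 * k + + 1
halve (+ zero) = + 0 , inj₁ refl
halve (+ suc l) with halve (+ l)
... | k , inj₁ e = k , inj₂ (lia 2 (λ l k → l :≡ (+ 2) :* k :+ # 0 ⊢ # 1 :+ l :≡ (+ 2) :* k :+ # 1) (+ l) k e)
... | k , inj₂ e = k + + 1 , inj₁ (lia 2 (λ l k → l :≡ (+ 2) :* k :+ # 1 ⊢ # 1 :+ l :≡ (+ 2) :* (k :+ # 1) :+ # 0) (+ l) k e)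
halve -[1+ zero ] = - + 1 , inj₂ refl
halve -[1+ suc l ] with halve -[1+ l ]
... | k , inj₁ e = k - + 1 , inj₂ (lia 2 (λ l k → l :≡ (+ 2) :* k :+ # 0 ⊢ K (- + 1) :+ l :≡ (+ 2) :* (k :- # 1) :+ # 1) -[1+ l ] k e)
... | k , inj₂ e = k , inj₁ (lia 2 (λ l k → l :≡ (+ 2) :* k :+ # 1 ⊢ K (- + 1) :+ l :≡ (+ 2) :* k :+ # 0) -[1+ l ] k e)

clash : ∀ {b c : Bool} {A : Set} → b ≡ c → b ≡ not c → A
clash {false} {false} _ ()
clash {true} {true} _ ()

flip-not : ∀ {b c} → b ≡ not c → c ≡ not b
flip-not {c = c} refl = sym (𝔹.not-involutive c)

record Run (F : ℤ → Bool) (β : Bool) (a b : ℤ) : Set where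
  field
    nonempty : a ≤ b
    constant : ∀ k → a ≤ k → k ≤ b → F k ≡ β
    before   : F (a - + 1) ≡ not β
    after    : F (b + + 1) ≡ not β

module _ {F : ℤ → Bool} {β : Bool} where
  open Run

  run-extendʳ : ∀ {a b k} → Run F β a b → a ≤ k + + 1 → k ≤ b → F (k + + 1) ≡ β → k + + 1 ≤ b
  run-extendʳ {a} {b} {k} r a≤k k≤b e with k + + 1 ℤ.≤? b
  ... | yes p = p
  ... | no p = clash (trans (cong F (lia 2 (λ b k → k :≤ b :∧ b :< k :+ # 1 ⊢ b :+ # 1 :≡ k :+ # 1) b k (k≤b , ℤP.≰⇒> p))) e)
                     (after r)

  -- By maximality neither run contains the point just beyond an end of the other. So runs of equal
  -- value with no point between them must end at the same places.
  run-compare : ∀ {a b a′ b′} → Run F β a b → Run F β a′ b′ →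
    (a ≡ a′ × b ≡ b′) ⊎ (b + + 2 ≤ a′ ⊎ b′ + + 2 ≤ a)
  run-compare {a} {b} {a′} {b′} r r′ with b + + 2 ℤ.≤? a′ | b′ + + 2 ℤ.≤? a
  ... | yes p | _ = inj₂ (inj₁ p)
  ... | no _ | yes p = inj₂ (inj₂ p)
  ... | no p | no p′ = inj₁ (ℤP.≤-antisym a≤ a′≤ , ℤP.≤-antisym b≤ b′≤)
    where
    b≤ : b ≤ b′
    b≤ = ℤP.≮⇒≥ λ lt → clash
      (constant r (b′ + + 1) (lia 2 (λ a b′ → a :< b′ :+ # 2 ⊢ a :≤ b′ :+ # 1) a b′ (ℤP.≰⇒> p′))
                             (lia 2 (λ b b′ → b′ :< b ⊢ b′ :+ # 1 :≤ b) b b′ lt)) (after r′)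
    b′≤ : b′ ≤ b
    b′≤ = ℤP.≮⇒≥ λ lt → clash
      (constant r′ (b + + 1) (lia 2 (λ a b′ → a :< b′ :+ # 2 ⊢ a :≤ b′ :+ # 1) a′ b (ℤP.≰⇒> p))
                             (lia 2 (λ b b′ → b′ :< b ⊢ b′ :+ # 1 :≤ b) b′ b lt)) (after r)
    a≤ : a ≤ a′
    a≤ = ℤP.≮⇒≥ λ lt → clash
      (constant r′ (a - + 1) (lia 2 (λ a a′ → a′ :< a ⊢ a′ :≤ a :- # 1) a a′ lt)
                             (lia 2 (λ a b′ → a :< b′ :+ # 2 ⊢ a :- # 1 :≤ b′) a b′ (ℤP.≰⇒> p′))) (before r)
    a′≤ : a′ ≤ a
    a′≤ = ℤP.≮⇒≥ λ lt → clash
      (constant r (a′ - + 1) (lia 2 (λ a a′ → a′ :< a ⊢ a′ :≤ a :- # 1) a′ a lt)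
                             (lia 2 (λ a b′ → a :< b′ :+ # 2 ⊢ a :- # 1 :≤ b′) a′ b (ℤP.≰⇒> p))) (before r′)

  -- The bounds on `k` say that the pair {k , k + 1} meets the run. Different runs of equal value
  -- are separated by a point of the other value, so a pair of neighbours cannot meet both.
  run-touching : ∀ {a b a′ b′} k → Run F β a b → Run F β a′ b′ →
    a - + 1 ≤ k → k ≤ b → a′ - + 1 ≤ k → k ≤ b′ → a ≡ a′ × b ≡ b′
  run-touching {a} {b} {a′} {b′} k r r′ h₁ h₂ h₃ h₄ with run-compare r r′
  ... | inj₁ e = e
  ... | inj₂ (inj₁ p) = ⊥-elim (lia 3 (λ k b a′ → b :+ # 2 :≤ a′ :∧ a′ :- # 1 :≤ k :∧ k :≤ b ⊢ ⊥ᶠ) k b a′ (p , h₃ , h₂))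
  ... | inj₂ (inj₂ p) = ⊥-elim (lia 3 (λ k b a′ → b :+ # 2 :≤ a′ :∧ a′ :- # 1 :≤ k :∧ k :≤ b ⊢ ⊥ᶠ) k b′ a (p , h₁ , h₄))

  run-meets : ∀ {a b} k → Run F β a b → a - + 1 ≤ k → k ≤ b → (a ≤ k × F k ≡ β) ⊎ (k + + 1 ≤ b × a ≡ k + + 1 × F (k + + 1) ≡ β)
  run-meets {a} {b} k r h₁ h₂ with a ℤ.≤? k
  ... | yes p = inj₁ (p , constant r k p h₂)
  ... | no p =
    let (q , e) = lia 3 (λ a b k → a :- # 1 :≤ k :∧ k :< a :∧ a :≤ b ⊢ k :+ # 1 :≤ b :∧ a :≡ k :+ # 1) a b k (h₁ , ℤP.≰⇒> p , nonempty r)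
    in inj₂ (q , e , constant r (k + + 1) (ℤP.≤-reflexive e) q)

-- A periodic function that takes both values takes each of them arbitrarily far out in both
-- directions, so all its runs are finite. The distance to a point with the other value is the fuel
-- for finding the end of a run.
module Search {F : ℤ → Bool} (N : ℤ) (1≤N : + 1 ≤ N) (periodic : ∀ k → F (k + N) ≡ F k) where

  shift-up : ∀ z (l : ℕ) → ∃ λ z′ → F z′ ≡ F z × z + + l ≤ z′
  shift-up z zero = z , refl , ℤP.≤-reflexive (ℤP.+-identityʳ z)
  shift-up z (suc l) with shift-up z l
  ... | z′ , e , h = z′ + N , trans (periodic z′) e ,
    lia 4 (λ z l z′ N → # 1 :≤ N :∧ z :+ l :≤ z′ ⊢ z :+ (# 1 :+ l) :≤ z′ :+ N) z (+ l) z′ N (1≤N , h)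

  shift-down : ∀ z (l : ℕ) → ∃ λ z′ → F z′ ≡ F z × z′ ≤ z - + l
  shift-down z zero = z , refl , ℤP.≤-reflexive (sym (ℤP.+-identityʳ z))
  shift-down z (suc l) with shift-down z l
  ... | z′ , e , h = z′ - N , trans (sym (trans (cong F (lia 2 (λ z N → ⊤ᶠ ⊢ z :≡ z :- N :+ N) z′ N tt)) (periodic (z′ - N)))) e ,
    lia 4 (λ z l z′ N → # 1 :≤ N :∧ z′ :≤ z :- l ⊢ z′ :- N :≤ z :- (# 1 :+ l)) z (+ l) z′ N (1≤N , h)

  module _ (k : ℤ) where
    extend-up : ∀ (d : ℕ) b z → F z ≡ not (F k) → k ≤ z → z ≤ b + + d → k ≤ b → (∀ t → k ≤ t → t ≤ b → F t ≡ F k) →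
      ∃ λ b′ → k ≤ b′ × (∀ t → k ≤ t → t ≤ b′ → F t ≡ F k) × F (b′ + + 1) ≡ not (F k)
    extend-up zero b z Fz k≤z z≤b k≤b con = clash (con z k≤z (subst (z ≤_) (ℤP.+-identityʳ b) z≤b)) Fz
    extend-up (suc d) b z Fz k≤z z≤b k≤b con with F (b + + 1) 𝔹.≟ F k
    ... | no ne = b , k≤b , con , 𝔹.¬-not ne
    ... | yes e = extend-up d (b + + 1) z Fz k≤z
        (lia 3 (λ z b d → z :≤ b :+ (# 1 :+ d) ⊢ z :≤ b :+ # 1 :+ d) z b (+ d) z≤b)
        (lia 2 (λ k b → k :≤ b ⊢ k :≤ b :+ # 1) k b k≤b) con′
      where
      con′ : ∀ t → k ≤ t → t ≤ b + + 1 → F t ≡ F k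
      con′ t k≤t t≤b with t ℤ.≤? b
      ... | yes p = con t k≤t p
      ... | no p = trans (cong F (lia 2 (λ t b → b :< t :∧ t :≤ b :+ # 1 ⊢ t :≡ b :+ # 1) t b (ℤP.≰⇒> p , t≤b))) e

    extend-down : ∀ (d : ℕ) a z → F z ≡ not (F k) → z ≤ k → a - + d ≤ z → a ≤ k → (∀ t → a ≤ t → t ≤ k → F t ≡ F k) →
      ∃ λ a′ → a′ ≤ k × (∀ t → a′ ≤ t → t ≤ k → F t ≡ F k) × F (a′ - + 1) ≡ not (F k)
    extend-down zero a z Fz z≤k a≤z a≤k con = clash (con z (subst (_≤ z) (ℤP.+-identityʳ a) a≤z) z≤k) Fz
    extend-down (suc d) a z Fz z≤k a≤z a≤k con with F (a - + 1) 𝔹.≟ F k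
    ... | no ne = a , a≤k , con , 𝔹.¬-not ne
    ... | yes e = extend-down d (a - + 1) z Fz z≤k
        (lia 3 (λ z a d → a :- (# 1 :+ d) :≤ z ⊢ a :- # 1 :- d :≤ z) z a (+ d) a≤z)
        (lia 2 (λ k a → a :≤ k ⊢ a :- # 1 :≤ k) k a a≤k) con′
      where
      con′ : ∀ t → a - + 1 ≤ t → t ≤ k → F t ≡ F k
      con′ t a≤t t≤k with a ℤ.≤? t
      ... | yes p = con t p t≤k
      ... | no p = trans (cong F (lia 2 (λ t a → t :< a :∧ a :- # 1 :≤ t ⊢ t :≡ a :- # 1) t a (ℤP.≰⇒> p , a≤t))) e

    abstract
      run-through : (∃ λ z → F z ≡ not (F k)) → ∃ λ a → ∃ λ b → a ≤ k × k ≤ b × Run F (F k) a b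
      run-through (z , Fz) with shift-up z ∣ k - z ∣ | shift-down z ∣ z - k ∣
      ... | u , eu , hu | d , ed , hd =
        let k≤u = lia 4 (λ k z u A → k :- z :≤ A :∧ z :+ A :≤ u ⊢ k :≤ u) k z u (+ ∣ k - z ∣) (≤∣∣ (k - z) , hu)
            d≤k = lia 4 (λ k z d A → z :- k :≤ A :∧ d :≤ z :- A ⊢ d :≤ k) k z d (+ ∣ z - k ∣) (≤∣∣ (z - k) , hd)
            (b , k≤b , cb , eb) = extend-up ∣ u - k ∣ k u (trans eu Fz) k≤u
              (lia 3 (λ k u A → u :- k :≤ A ⊢ u :≤ k :+ A) k u (+ ∣ u - k ∣) (≤∣∣ (u - k))) ℤP.≤-refl
              (λ t h h′ → cong F (ℤP.≤-antisym h′ h))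
            (a , a≤k , ca , ea) = extend-down ∣ k - d ∣ k d (trans ed Fz) d≤k
              (lia 3 (λ k d A → k :- d :≤ A ⊢ k :- A :≤ d) k d (+ ∣ k - d ∣) (≤∣∣ (k - d))) ℤP.≤-refl
              (λ t h h′ → cong F (ℤP.≤-antisym h′ h))
        in a , b , a≤k , k≤b , record
          { nonempty = ℤP.≤-trans a≤k k≤b
          ; constant = λ t h h′ → case t ℤ.≤? k of λ
              { (yes p) → ca t h p
              ; (no p) → cb t (ℤP.<⇒≤ (ℤP.≰⇒> p)) h′ }
          ; before = ea
          ; after = eb }

-- Sums over neighbours

xor-swap : ∀ a b c d → (a xor b) xor (c xor d) ≡ (a xor c) xor (b xor d)
xor-swap false false c d = refl
xor-swap false true false d = refl
xor-swap false true true d = refl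
xor-swap true false false d = refl
xor-swap true false true d = 𝔹.not-involutive d
xor-swap true true false d = sym (𝔹.not-involutive d)
xor-swap true true true d = refl

xorSumℕ : ℕ → (ℕ → Bool) → Bool
xorSumℕ zero f = false
xorSumℕ (suc n) f = f 0 xor xorSumℕ n (f ∘ suc)

xorSum-tabulate : ∀ {A : Set} n (e : Fin n → A) (f : A → Bool) (φ : ℕ → Bool) →
  (∀ i → f (e i) ≡ φ (toℕ i)) → xorSum (tabulate e) f ≡ xorSumℕ n φ
xorSum-tabulate zero e f φ h = refl
xorSum-tabulate (suc n) e f φ h = cong₂ _xor_ (h 0F) (xorSum-tabulate n (e ∘ Fin.suc) f (φ ∘ suc) (h ∘ Fin.suc))

xorSumℕ-cong : ∀ n {f g : ℕ → Bool} → (∀ k → f k ≡ g k) → xorSumℕ n f ≡ xorSumℕ n g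
xorSumℕ-cong zero h = refl
xorSumℕ-cong (suc n) h = cong₂ _xor_ (h 0) (xorSumℕ-cong n (h ∘ suc))

xorSumℕ-xor : ∀ n f g → xorSumℕ n (λ k → f k xor g k) ≡ xorSumℕ n f xor xorSumℕ n g
xorSumℕ-xor zero f g = refl
xorSumℕ-xor (suc n) f g = trans (cong ((f 0 xor g 0) xor_) (xorSumℕ-xor n (f ∘ suc) (g ∘ suc)))
  (xor-swap (f 0) (g 0) (xorSumℕ n (f ∘ suc)) (xorSumℕ n (g ∘ suc)))

xorSumℕ-false : ∀ n → xorSumℕ n (λ _ → false) ≡ false
xorSumℕ-false zero = refl
xorSumℕ-false (suc n) = xorSumℕ-false n

xorSumℕ-∧ : ∀ n a f → xorSumℕ n (λ k → a ∧ f k) ≡ a ∧ xorSumℕ n f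
xorSumℕ-∧ n true f = refl
xorSumℕ-∧ n false f = xorSumℕ-false n

-- Functions on `Fin n` are extended by zero to all of ℕ. A neighbour beyond the range then
-- contributes nothing to a sum and needs no separate case.
VanishesFrom : ℕ → (ℕ → Bool) → Set
VanishesFrom n f = ∀ k → n ℕ.≤ k → f k ≡ false

xorSumℕ-delta : ∀ n a f → VanishesFrom n f → xorSumℕ n (λ k → (k ≡ᵇ a) ∧ f k) ≡ f a
xorSumℕ-delta zero a f h = sym (h a ℕ.z≤n)
xorSumℕ-delta (suc n) zero f h = trans (cong (f 0 xor_) (xorSumℕ-false n)) (𝔹.xor-identityʳ (f 0))
xorSumℕ-delta (suc n) (suc a) f h = xorSumℕ-delta n a (f ∘ suc) (λ k n≤k → h (suc k) (ℕ.s≤s n≤k))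

pred-value : (ℕ → Bool) → ℕ → Bool
pred-value f zero = false
pred-value f (suc k) = f k

xorSumℕ-delta-suc : ∀ n a f → VanishesFrom n f → xorSumℕ n (λ k → (suc k ≡ᵇ a) ∧ f k) ≡ pred-value f a
xorSumℕ-delta-suc n zero f h = xorSumℕ-false n
xorSumℕ-delta-suc n (suc a) f h = xorSumℕ-delta n a f h

-- The two alternatives exclude each other, so `xor` can stand for their disjunction, and sums over
-- neighbours split accordingly.
beside : ℕ → ℕ → Bool
beside x a = (x ≡ᵇ suc a) xor (suc x ≡ᵇ a)

xorSumℕ-beside : ∀ n a f → VanishesFrom n f → xorSumℕ n (λ k → beside k a ∧ f k) ≡ f (suc a) xor pred-value f a
xorSumℕ-beside n a f h = trans (xorSumℕ-cong n (λ k → 𝔹.∧-distribʳ-xor (f k) (k ≡ᵇ suc a) (suc k ≡ᵇ a)))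
  (trans (xorSumℕ-xor n (λ k → (k ≡ᵇ suc a) ∧ f k) (λ k → (suc k ≡ᵇ a) ∧ f k))
    (cong₂ _xor_ (xorSumℕ-delta n (suc a) f h) (xorSumℕ-delta-suc n a f h)))

private
  dist : ℕ → ℕ → ℕ
  dist a b = ∣ + a - + b ∣

  dist-suc : ∀ a b → dist (suc a) (suc b) ≡ dist a b
  dist-suc a b = cong ∣_∣ (trans (ℤP.m-n≡m⊖n (suc a) (suc b)) (trans (ℤP.[1+m]⊖[1+n]≡m⊖n a b) (sym (ℤP.m-n≡m⊖n a b))))

  dist-0 : ∀ a b → (dist a b ≡ᵇ 0) ≡ (a ≡ᵇ b)
  dist-0 zero zero = refl
  dist-0 zero (suc b) = refl
  dist-0 (suc a) zero = refl
  dist-0 (suc a) (suc b) = trans (cong (_≡ᵇ 0) (dist-suc a b)) (dist-0 a b)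

  dist-1 : ∀ a b → (dist a b ≡ᵇ 1) ≡ beside a b
  dist-1 zero zero = refl
  dist-1 zero (suc zero) = refl
  dist-1 zero (suc (suc b)) = refl
  dist-1 (suc zero) zero = refl
  dist-1 (suc (suc a)) zero = refl
  dist-1 (suc a) (suc b) = trans (cong (_≡ᵇ 1) (dist-suc a b)) (dist-1 a b)

  sum-1 : ∀ p q → (p ℕ.+ q ≡ᵇ 1) ≡ ((p ≡ᵇ 0) ∧ (q ≡ᵇ 1)) xor ((p ≡ᵇ 1) ∧ (q ≡ᵇ 0))
  sum-1 zero q = sym (𝔹.xor-identityʳ (q ≡ᵇ 1))
  sum-1 (suc zero) zero = refl
  sum-1 (suc zero) (suc q) = refl
  sum-1 (suc (suc p)) q = refl

adjacent : ∀ x y a b → (∣ + x - + a ∣ ℕ.+ ∣ + y - + b ∣ ≡ᵇ 1) ≡ ((x ≡ᵇ a) ∧ beside y b) xor (beside x a ∧ (y ≡ᵇ b))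
adjacent x y a b = trans (sum-1 (dist x a) (dist y b))
  (cong₂ _xor_ (cong₂ _∧_ (dist-0 x a) (dist-1 y b)) (cong₂ _∧_ (dist-1 x a) (dist-0 y b)))

-- By `adjacent`, adjacency is a sum of products of conditions on a single coordinate each. The
-- double sum therefore collapses one variable at a time and leaves the four neighbours.
neighbour-sum : ∀ m n (H : ℕ → ℕ → Bool) a b → (∀ x y → m ℕ.≤ x → H x y ≡ false) → (∀ x y → n ℕ.≤ y → H x y ≡ false) →
  xorSumℕ m (λ x → xorSumℕ n (λ y → (∣ + x - + a ∣ ℕ.+ ∣ + y - + b ∣ ≡ᵇ 1) ∧ H x y)) ≡
  (H a (suc b) xor pred-value (H a) b) xor (H (suc a) b xor pred-value (λ x → H x b) a)
neighbour-sum m n H a b hx hy =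
  trans (xorSumℕ-cong m inner)
    (trans (xorSumℕ-xor m (λ x → (x ≡ᵇ a) ∧ A x) (λ x → beside x a ∧ H x b))
      (cong₂ _xor_ (xorSumℕ-delta m a A (λ x p → cong₂ _xor_ (hx x (suc b) p) (pv x b p)))
                   (xorSumℕ-beside m a (λ x → H x b) (λ x p → hx x b p))))
  where
  A : ℕ → Bool
  A x = H x (suc b) xor pred-value (H x) b
  pv : ∀ x b → m ℕ.≤ x → pred-value (H x) b ≡ false
  pv x zero p = refl
  pv x (suc b) p = hx x b p
  inner : ∀ x → xorSumℕ n (λ y → (∣ + x - + a ∣ ℕ.+ ∣ + y - + b ∣ ≡ᵇ 1) ∧ H x y) ≡ ((x ≡ᵇ a) ∧ A x) xor (beside x a ∧ H x b)
  inner x =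
    trans (xorSumℕ-cong n λ y → trans (cong (_∧ H x y) (adjacent x y a b))
            (trans (𝔹.∧-distribʳ-xor (H x y) ((x ≡ᵇ a) ∧ beside y b) (beside x a ∧ (y ≡ᵇ b)))
              (cong₂ _xor_ (𝔹.∧-assoc (x ≡ᵇ a) (beside y b) (H x y)) (𝔹.∧-assoc (beside x a) (y ≡ᵇ b) (H x y)))))
    (trans (xorSumℕ-xor n (λ y → (x ≡ᵇ a) ∧ (beside y b ∧ H x y)) (λ y → beside x a ∧ ((y ≡ᵇ b) ∧ H x y)))
      (cong₂ _xor_
        (trans (xorSumℕ-∧ n (x ≡ᵇ a) _) (cong ((x ≡ᵇ a) ∧_) (xorSumℕ-beside n b (H x) (hy x))))
        (trans (xorSumℕ-∧ n (beside x a) _) (cong (beside x a ∧_) (xorSumℕ-delta n b (H x) (hy x))))))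

-- The zigzag ℤ → [0 , M] of period 2M, as the position at time |X| of a particle
-- bouncing between 0 and M; a state also records the distance to M.
data State : Set where
  up down : ℕ → ℕ → State

next : State → State
next (up p (suc q)) = up (suc p) q
next (up (suc p) zero) = down p 1
next (up zero zero) = up zero zero
next (down (suc p) q) = down p (suc q)
next (down zero (suc q)) = up 1 q
next (down zero zero) = down zero zero

pos gap : State → ℕ
pos (up p q) = p
pos (down p q) = p
gap (up p q) = q
gap (down p q) = q

-- The possible positions of three consecutive points `a`, `P`, `b` of the zigzag. At a turning
-- point both neighbours agree, so that they cancel in a sum modulo 2; elsewhere they are the true
-- neighbours of `P`, in either order.
Neighbours : ℤ → ℤ → ℤ → ℤ → Set
Neighbours M a P b =
  ((P ≡ + 0 ⊎ P ≡ M) × a ≡ b) ⊎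
  ((+ 0 < P × P < M) × ((a ≡ P - + 1 × b ≡ P + + 1) ⊎ (a ≡ P + + 1 × b ≡ P - + 1)))

module Bounce (M : ℕ) (1≤M : 1 ℕ.≤ M) where

  bounce : ℕ → State
  bounce zero = up 0 M
  bounce (suc k) = next (bounce k)

  next-total : ∀ s → pos s ℕ.+ gap s ≡ M → pos (next s) ℕ.+ gap (next s) ≡ M
  next-total (up p (suc q)) e = trans (sym (ℕP.+-suc p q)) e
  next-total (up (suc p) zero) e = trans (ℕP.+-suc p 0) e
  next-total (up zero zero) e = e
  next-total (down (suc p) q) e = trans (ℕP.+-suc p q) e
  next-total (down zero (suc q)) e = e
  next-total (down zero zero) e = e

  bounce-total : ∀ k → pos (bounce k) ℕ.+ gap (bounce k) ≡ M
  bounce-total zero = refl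
  bounce-total (suc k) = next-total (bounce k) (bounce-total k)

  -- The absolute value makes `fold` even, which is the reflection at 0; the reflection at M is the
  -- turn of the particle.
  fold : ℤ → ℤ
  fold X = + pos (bounce ∣ X ∣)

  private
    pos+1 : ∀ p → + p ≡ + suc p - + 1
    pos+1 p = lia 1 (λ p → ⊤ᶠ ⊢ p :≡ # 1 :+ p :- # 1) (+ p) tt
    suc+1 : ∀ p → + suc p ≡ + p + + 1
    suc+1 p = lia 1 (λ p → ⊤ᶠ ⊢ # 1 :+ p :≡ p :+ # 1) (+ p) tt
    pos<M : ∀ p q → p ℕ.+ suc q ≡ M → + p < + M
    pos<M p q e = ℤ.+<+ (subst (p ℕ.<_) e (ℕP.m<m+n p (ℕ.s≤s ℕ.z≤n)))

  steps : ∀ s → pos s ℕ.+ gap s ≡ M → Neighbours (+ M) (+ pos s) (+ pos (next s)) (+ pos (next (next s)))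
  steps (up zero zero) e with subst (1 ℕ.≤_) (sym e) 1≤M
  ... | ()
  steps (down zero zero) e with subst (1 ℕ.≤_) (sym e) 1≤M
  ... | ()
  steps (up p (suc zero)) e = inj₁ (inj₂ (cong +_ (trans (cong suc (sym (ℕP.+-identityʳ p))) (trans (sym (ℕP.+-suc p 0)) e))) , refl)
  steps (up p (suc (suc q))) e =
    inj₂ ((ℤ.+<+ (ℕ.s≤s ℕ.z≤n) , pos<M (suc p) q (trans (sym (ℕP.+-suc p (suc q))) e)) , inj₁ (pos+1 p , suc+1 (suc p)))
  steps (up (suc zero) zero) e = inj₁ (inj₁ refl , refl)
  steps (up (suc (suc p)) zero) e =
    inj₂ ((ℤ.+<+ (ℕ.s≤s ℕ.z≤n) , pos<M (suc p) 0 (trans (ℕP.+-suc (suc p) 0) e)) , inj₂ (suc+1 (suc p) , pos+1 p))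
  steps (down (suc zero) q) e = inj₁ (inj₁ refl , refl)
  steps (down (suc (suc p)) q) e =
    inj₂ ((ℤ.+<+ (ℕ.s≤s ℕ.z≤n) , pos<M (suc p) q (trans (ℕP.+-suc (suc p) q) e)) , inj₂ (suc+1 (suc p) , pos+1 p))
  steps (down zero (suc zero)) e = inj₁ (inj₂ (cong +_ e) , refl)
  steps (down zero (suc (suc q))) e =
    inj₂ ((ℤ.+<+ (ℕ.s≤s ℕ.z≤n) , pos<M 1 q e) , inj₁ (refl , refl))

  neighbours-sym : ∀ {a P b} → Neighbours (+ M) a P b → Neighbours (+ M) b P a
  neighbours-sym (inj₁ (h , e)) = inj₁ (h , sym e)
  neighbours-sym (inj₂ (h , inj₁ (e , e′))) = inj₂ (h , inj₂ (e′ , e))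
  neighbours-sym (inj₂ (h , inj₂ (e , e′))) = inj₂ (h , inj₁ (e′ , e))

  fold-neighbours : ∀ X → Neighbours (+ M) (fold (X - + 1)) (fold X) (fold (X + + 1))
  fold-neighbours (+ zero) = inj₁ (inj₁ refl , refl)
  fold-neighbours (+ suc k) = subst (λ z → Neighbours (+ M) (+ pos (bounce k)) (fold (+ suc k)) (+ pos (bounce z)))
    (sym (ℕP.+-comm (suc k) 1)) (steps (bounce k) (bounce-total k))
  fold-neighbours -[1+ zero ] = neighbours-sym (steps (bounce 0) refl)
  fold-neighbours -[1+ suc k ] = subst (λ z → Neighbours (+ M) (+ pos (bounce (suc (suc z)))) (fold -[1+ suc k ]) (+ pos (bounce (suc k))))
    (cong suc (sym (ℕP.+-identityʳ k))) (neighbours-sym (steps (bounce (suc k)) (bounce-total (suc k))))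

  fold-neg : ∀ X → fold (- X) ≡ fold X
  fold-neg X = cong (λ k → + pos (bounce k)) (ℤP.∣-i∣≡∣i∣ X)

  bounce-up : ∀ k l → k ℕ.+ l ≡ M → bounce k ≡ up k l
  bounce-up zero l refl = refl
  bounce-up (suc k) l e rewrite bounce-up k (suc l) (trans (ℕP.+-suc k l) e) = refl

  fold-id : ∀ k → k ℕ.≤ M → fold (+ k) ≡ + k
  fold-id k k≤M with ℕP.m≤n⇒∃[o]m+o≡n k≤M
  ... | l , e = cong (+_ ∘ pos) (bounce-up k l e)

-- The rectangle in diagonal coordinates: quads, blocks and pieces

module Board (c : Colour) (m n : ℕ) (2≤m : 2 ℕ.≤ m) (2≤n : 2 ℕ.≤ n) where

  ε : ℤ
  ε = eps c

  εᵉ mᵉ nᵉ : Expr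
  εᵉ = V 0
  mᵉ = V 1
  nᵉ = V 2

  ρ₀ : List ℤ
  ρ₀ = ε ∷ + m ∷ + n ∷ []

  globalsᵉ : Form
  globalsᵉ = # 0 :≤ εᵉ :∧ εᵉ :≤ # 1 :∧ # 2 :≤ mᵉ :∧ # 2 :≤ nᵉ

  globals : ∀ ρ → Holds globalsᵉ (ε ∷ + m ∷ + n ∷ ρ)
  globals ρ = proj₁ (eps-bounds c) , proj₂ (eps-bounds c) , ℤ.+≤+ 2≤m , ℤ.+≤+ 2≤n

  abstract
    -- A version of `lia` with the bounds on ε, m and n as standing hypotheses. These three are the
    -- variables 0, 1 and 2, so the variables of the caller are numbered from 3.
    liaG : ∀ k (f : Fun k) (let (h , g) = applyVars k 3 f) → {_ : T (entails (3 ℕ.+ k) (rows (globalsᵉ :∧ h)) g)} →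
      ∀ℤ k (λ ρ → Holds h (ε ∷ + m ∷ + n ∷ ρ) → Holds g (ε ∷ + m ∷ + n ∷ ρ))
    liaG k f {t} = introℤ k λ ρ h → let hg = applyVars k 3 f in
      entails-sound (3 ℕ.+ k) (rows (globalsᵉ :∧ proj₁ hg)) (proj₂ hg) (ε ∷ + m ∷ + n ∷ ρ) t
        (rows-sound (globalsᵉ :∧ proj₁ hg) (ε ∷ + m ∷ + n ∷ ρ) (globals ρ , h))

  -- The points of colour c are (x , y) = (i + j + ε − 1 , i − j − 1), i, j ∈ ℤ; those of the
  -- opposite colour are the centres of the faces (i , j) spanned by the points (i , j) [west],
  -- (i + 1 , j) [north], (i , j + 1) [south], (i + 1 , j + 1) [east].  A face is cut into four
  -- quads by the axes; the quad is eastern if hx = 1 and northern if hy = 1.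
  record Quad : Set where
    constructor quad
    field
      i j hx hy : ℤ

  bitsᵉ : (hx hy : Expr) → Form
  bitsᵉ hx hy = # 0 :≤ hx :∧ hx :≤ # 1 :∧ # 0 :≤ hy :∧ hy :≤ # 1

  inRᵉ : (i j hx hy : Expr) → Form
  inRᵉ i j hx hy = let x = i :+ j :+ εᵉ :- # 1 :+ hx ; y = i :- j :- # 2 :+ hy in
    # 0 :≤ x :∧ x :≤ mᵉ :- # 2 :∧ # 0 :≤ y :∧ y :≤ nᵉ :- # 2

  -- The first four inequalities say that some corner of the face lies in the block. The others are
  -- the sides parallel to the axes: at each of the four faces that meet the block only in one of
  -- its extreme points, they select the two quads next to that point.
  blkᵉ : (i₀ i₁ j₀ j₁ i j hx hy : Expr) → Form
  blkᵉ i₀ i₁ j₀ j₁ i j hx hy =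
    i₀ :- # 1 :≤ i :∧ i :≤ i₁ :∧ j₀ :- # 1 :≤ j :∧ j :≤ j₁ :∧
    i₀ :+ j₀ :- # 1 :≤ i :+ j :+ hx :∧ i :+ j :+ hx :≤ i₁ :+ j₁ :∧
    i₀ :- j₁ :≤ i :- j :+ hy :∧ i :- j :+ hy :≤ i₁ :- j₀ :+ # 1

  Bits InR : Quad → Set
  Bits (quad i j hx hy) = Holds (bitsᵉ (K hx) (K hy)) ρ₀
  InR (quad i j hx hy) = Holds (inRᵉ (K i) (K j) (K hx) (K hy)) ρ₀

  -- The regions a tile can have: a single face, or the octagon around the block of
  -- points [i₀ , i₁] × [j₀ , j₁], cut off by the walls.
  data Piece : Set where
    dia : (a b : ℤ) → Piece
    blk : (i₀ i₁ j₀ j₁ : ℤ) → Piece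

  infix 4 _∋_
  _∋_ : Piece → Quad → Set
  dia a b ∋ quad i j hx hy = i ≡ a × j ≡ b
  blk i₀ i₁ j₀ j₁ ∋ quad i j hx hy =
    Holds (blkᵉ (K i₀) (K i₁) (K j₀) (K j₁) (K i) (K j) (K hx) (K hy)) ρ₀

  -- The pieces of the vector v (i , j) = F i xor F j.
  FPiece : (ℤ → Bool) → Piece → Set
  FPiece F (dia a b) = F (a + + 1) ≡ F a × F (b + + 1) ≡ F b × F b ≡ not (F a)
  FPiece F (blk i₀ i₁ j₀ j₁) = ∃ λ β → Run F β i₀ i₁ × Run F β j₀ j₁

  bit : ∀ h → + 0 ≤ h → h ≤ + 1 → h ≡ + 0 ⊎ h ≡ + 1
  bit (+ 0) _ _ = inj₁ refl
  bit (+ 1) _ _ = inj₂ refl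
  bit (+ suc (suc _)) _ (ℤ.+≤+ (ℕ.s≤s ()))

  module _ {F : ℤ → Bool} where
    open Run

    private
      -- Runs of different values are disjoint, so each of them takes exactly one of the points k
      -- and k + 1: one run ends where the other begins.
      not-both : ∀ {β β′ a b a′ b′} k → β ≢ β′ → Run F β a b → Run F β′ a′ b′ → a - + 1 ≤ k → k ≤ b → a′ - + 1 ≤ k → k ≤ b′ →
        (k ≡ b × a′ ≡ k + + 1) ⊎ (k ≡ b′ × a ≡ k + + 1)
      not-both {a = a} {b} {a′} {b′} k β≢ r r′ h₁ h₂ h₃ h₄ with run-meets k r h₁ h₂ | run-meets k r′ h₃ h₄
      ... | inj₁ (p , e) | inj₁ (p′ , e′) = ⊥-elim (β≢ (trans (sym e) e′))
      ... | inj₂ (q , p , e) | inj₂ (q′ , p′ , e′) = ⊥-elim (β≢ (trans (sym e) e′))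
      ... | inj₁ (p , e) | inj₂ (q′ , p′ , e′) = inj₁ (ℤP.≤-antisym h₂ (ℤP.≮⇒≥ λ lt → β≢ (trans (sym (constant r (k + + 1)
              (lia 2 (λ a k → a :≤ k ⊢ a :≤ k :+ # 1) a k p) (lia 2 (λ k b → k :< b ⊢ k :+ # 1 :≤ b) k b lt))) e′)) , p′)
      ... | inj₂ (q , p , e) | inj₁ (p′ , e′) = inj₂ (ℤP.≤-antisym h₄ (ℤP.≮⇒≥ λ lt → β≢ (trans (sym e) (constant r′ (k + + 1)
              (lia 2 (λ a k → a :≤ k ⊢ a :≤ k :+ # 1) a′ k p′) (lia 2 (λ k b → k :< b ⊢ k :+ # 1 :≤ b) k b′ lt)))) , p)

      dia-blk : ∀ {a b i₀ i₁ j₀ j₁ i j hx hy} → FPiece F (dia a b) → FPiece F (blk i₀ i₁ j₀ j₁) →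
        dia a b ∋ quad i j hx hy → blk i₀ i₁ j₀ j₁ ∋ quad i j hx hy → ⊥
      dia-blk (ea , eb , ne) (β , rI , rJ) (refl , refl) (h₁ , h₂ , h₃ , h₄ , _) = clash (trans Fb (sym Fa)) ne
        where
        Fa : F _ ≡ β
        Fa with run-meets _ rI h₁ h₂
        ... | inj₁ (_ , e) = e
        ... | inj₂ (_ , _ , e) = trans (sym ea) e
        Fb : F _ ≡ β
        Fb with run-meets _ rJ h₃ h₄
        ... | inj₁ (_ , e) = e
        ... | inj₂ (_ , _ , e) = trans (sym eb) e

    -- For equal values `run-touching` identifies the runs. For different values `not-both`, applied
    -- to both coordinates, shows that the blocks touch the face at opposite corners, and there each
    -- block owns only the half of the face on its own side.
    piece-unique : ∀ P P′ q → FPiece F P → FPiece F P′ → P ∋ q → P′ ∋ q → P ≡ P′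
    piece-unique (dia a b) (dia a′ b′) q _ _ (refl , refl) (refl , refl) = refl
    piece-unique (dia a b) (blk _ _ _ _) q f f′ h h′ = ⊥-elim (dia-blk f f′ h h′)
    piece-unique (blk _ _ _ _) (dia _ _) q f f′ h h′ = ⊥-elim (dia-blk f′ f h′ h)
    piece-unique (blk i₀ i₁ j₀ j₁) (blk i₀′ i₁′ j₀′ j₁′) (quad i j hx hy) (β , rI , rJ) (β′ , rI′ , rJ′)
      h@(h₁ , h₂ , h₃ , h₄ , _) h′@(h₁′ , h₂′ , h₃′ , h₄′ , _) with β 𝔹.≟ β′
    ... | yes refl with run-touching i rI rI′ h₁ h₂ h₁′ h₂′ | run-touching j rJ rJ′ h₃ h₄ h₃′ h₄′
    ...   | refl , refl | refl , refl = refl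
    piece-unique (blk i₀ i₁ j₀ j₁) (blk i₀′ i₁′ j₀′ j₁′) (quad i j hx hy) (β , rI , rJ) (β′ , rI′ , rJ′)
      h@(h₁ , h₂ , h₃ , h₄ , _) h′@(h₁′ , h₂′ , h₃′ , h₄′ , _)
        | no β≢ with not-both i β≢ rI rI′ h₁ h₂ h₁′ h₂′ | not-both j β≢ rJ rJ′ h₃ h₄ h₃′ h₄′
    ...   | inj₁ (e₁ , e₂) | inj₁ (e₃ , e₄) = ⊥-elim (liaG 12 (λ i₀ i₁ j₀ j₁ i₀′ i₁′ j₀′ j₁′ i j hx hy →
              blkᵉ i₀ i₁ j₀ j₁ i j hx hy :∧ blkᵉ i₀′ i₁′ j₀′ j₁′ i j hx hy :∧ i :≡ i₁ :∧ i₀′ :≡ i :+ # 1 :∧ j :≡ j₁ :∧ j₀′ :≡ j :+ # 1 ⊢ ⊥ᶠ)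
              i₀ i₁ j₀ j₁ i₀′ i₁′ j₀′ j₁′ i j hx hy (h , h′ , e₁ , e₂ , e₃ , e₄))
    ...   | inj₁ (e₁ , e₂) | inj₂ (e₃ , e₄) = ⊥-elim (liaG 12 (λ i₀ i₁ j₀ j₁ i₀′ i₁′ j₀′ j₁′ i j hx hy →
              blkᵉ i₀ i₁ j₀ j₁ i j hx hy :∧ blkᵉ i₀′ i₁′ j₀′ j₁′ i j hx hy :∧ i :≡ i₁ :∧ i₀′ :≡ i :+ # 1 :∧ j :≡ j₁′ :∧ j₀ :≡ j :+ # 1 ⊢ ⊥ᶠ)
              i₀ i₁ j₀ j₁ i₀′ i₁′ j₀′ j₁′ i j hx hy (h , h′ , e₁ , e₂ , e₃ , e₄))
    ...   | inj₂ (e₁ , e₂) | inj₁ (e₃ , e₄) = ⊥-elim (liaG 12 (λ i₀ i₁ j₀ j₁ i₀′ i₁′ j₀′ j₁′ i j hx hy →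
              blkᵉ i₀ i₁ j₀ j₁ i j hx hy :∧ blkᵉ i₀′ i₁′ j₀′ j₁′ i j hx hy :∧ i :≡ i₁′ :∧ i₀ :≡ i :+ # 1 :∧ j :≡ j₁ :∧ j₀′ :≡ j :+ # 1 ⊢ ⊥ᶠ)
              i₀ i₁ j₀ j₁ i₀′ i₁′ j₀′ j₁′ i j hx hy (h , h′ , e₁ , e₂ , e₃ , e₄))
    ...   | inj₂ (e₁ , e₂) | inj₂ (e₃ , e₄) = ⊥-elim (liaG 12 (λ i₀ i₁ j₀ j₁ i₀′ i₁′ j₀′ j₁′ i j hx hy →
              blkᵉ i₀ i₁ j₀ j₁ i j hx hy :∧ blkᵉ i₀′ i₁′ j₀′ j₁′ i j hx hy :∧ i :≡ i₁′ :∧ i₀ :≡ i :+ # 1 :∧ j :≡ j₁′ :∧ j₀ :≡ j :+ # 1 ⊢ ⊥ᶠ)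
              i₀ i₁ j₀ j₁ i₀′ i₁′ j₀′ j₁′ i j hx hy (h , h′ , e₁ , e₂ , e₃ , e₄))

  -- The pieces of a reflective function: position at the walls, and covering

  record Reflective (F : ℤ → Bool) : Set where
    field
      left  : ∀ k → F (- ε - k) ≡ F k
      top   : ∀ k → F (k + (+ n + + 1)) ≡ F k
      right : ∀ k → F (+ m + + 1 - ε - k) ≡ F k

  NonConstant : (ℤ → Bool) → Set
  NonConstant F = ∃ λ x → ∃ λ y → F y ≡ not (F x)

  -- Each wall is either not crossed by the octagon, or a symmetry axis of it.
  Bottom Top Left Right : (i₀ i₁ j₀ j₁ : ℤ) → Set
  Bottom i₀ i₁ j₀ j₁ = (+ 0 ≤ i₀ - j₁ - + 2) ⊎ (i₀ ≡ j₀ × i₁ ≡ j₁ × i₀ < i₁)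
  Top i₀ i₁ j₀ j₁ = (i₁ - j₀ ≤ + n - + 1) ⊎ (i₀ ≡ j₀ + + n + + 1 × i₁ ≡ j₁ + + n + + 1 × i₀ < i₁)
  Left i₀ i₁ j₀ j₁ = (+ 0 ≤ i₀ + j₀ + ε - + 2) ⊎ (i₀ + j₁ + ε ≡ + 0 × i₁ + j₀ + ε ≡ + 0 × i₀ < i₁)
  Right i₀ i₁ j₀ j₁ = (i₁ + j₁ + ε ≤ + m - + 1) ⊎ (i₀ + j₁ + ε ≡ + m + + 1 × i₁ + j₀ + ε ≡ + m + + 1 × i₀ < i₁)

  Walled : Piece → Set
  Walled (dia a b) = + 0 ≤ a + b + ε - + 1 × a + b + ε ≤ + m - + 2 × + 0 ≤ a - b - + 2 × a - b - + 1 ≤ + n - + 2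
  Walled (blk i₀ i₁ j₀ j₁) = i₀ ≤ i₁ × j₀ ≤ j₁ × Bottom i₀ i₁ j₀ j₁ × Top i₀ i₁ j₀ j₁ × Left i₀ i₁ j₀ j₁ × Right i₀ i₁ j₀ j₁

  walledDiaᵉ : (a b : Expr) → Form
  walledDiaᵉ a b = # 0 :≤ a :+ b :+ εᵉ :- # 1 :∧ a :+ b :+ εᵉ :≤ mᵉ :- # 2 :∧ # 0 :≤ a :- b :- # 2 :∧ a :- b :- # 1 :≤ nᵉ :- # 2

  1≤n+1 : + 1 ≤ + n + + 1
  1≤n+1 = liaG 0 (⊤ᶠ ⊢ # 1 :≤ nᵉ :+ # 1) tt

  module _ {F : ℤ → Bool} (refl-F : Reflective F) where
    open Run
    open Reflective refl-F

    run-shift : ∀ {β a b} → Run F β a b → Run F β (a + (+ n + + 1)) (b + (+ n + + 1))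
    run-shift {β} {a} {b} r = record
      { nonempty = ℤP.+-monoˡ-≤ (+ n + + 1) (nonempty r)
      ; constant = λ k h h′ → trans
          (trans (cong F (liaG 1 (λ k → ⊤ᶠ ⊢ k :≡ k :- (nᵉ :+ # 1) :+ (nᵉ :+ # 1)) k tt)) (top (k - (+ n + + 1))))
          (constant r _ (liaG 2 (λ a k → a :+ (nᵉ :+ # 1) :≤ k ⊢ a :≤ k :- (nᵉ :+ # 1)) a k h)
                        (liaG 2 (λ b k → k :≤ b :+ (nᵉ :+ # 1) ⊢ k :- (nᵉ :+ # 1) :≤ b) b k h′))
      ; before = trans (trans (cong F (liaG 1 (λ a → ⊤ᶠ ⊢ a :+ (nᵉ :+ # 1) :- # 1 :≡ a :- # 1 :+ (nᵉ :+ # 1)) a tt)) (top (a - + 1))) (before r)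
      ; after = trans (trans (cong F (liaG 1 (λ a → ⊤ᶠ ⊢ a :+ (nᵉ :+ # 1) :+ # 1 :≡ a :+ # 1 :+ (nᵉ :+ # 1)) b tt)) (top (b + + 1))) (after r) }

    run-reflect : ∀ s → (∀ k → F (s - k) ≡ F k) → ∀ {β a b} → Run F β a b → Run F β (s - b) (s - a)
    run-reflect s inv {β} {a} {b} r = record
      { nonempty = ℤP.+-monoʳ-≤ s (ℤP.neg-mono-≤ (nonempty r))
      ; constant = λ k h h′ → trans (sym (inv k))
          (constant r (s - k) (lia 3 (λ s a k → k :≤ s :- a ⊢ a :≤ s :- k) s a k h′) (lia 3 (λ s b k → s :- b :≤ k ⊢ s :- k :≤ b) s b k h))
      ; before = trans (trans (cong F (lia 2 (λ s b → ⊤ᶠ ⊢ s :- b :- # 1 :≡ s :- (b :+ # 1)) s b tt)) (inv (b + + 1))) (after r)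
      ; after = trans (trans (cong F (lia 2 (λ s a → ⊤ᶠ ⊢ s :- a :+ # 1 :≡ s :- (a :- # 1)) s a tt)) (inv (a - + 1))) (before r) }

    -- At each wall the run I is compared with the mirror image of J, which is a run of the same
    -- value; for the bottom wall i = j this image is J itself. If they coincide, the wall is an
    -- axis of the block. Otherwise they are at least two apart, and the octagon stays on one side
    -- of the wall, namely that of R because it contains `q`. The strict inequality holds because
    -- the square around a single point of a wall has no quad in R. A diamond reaching out of R
    -- would have a corner on a wall, where the vector is zero.
    walled : ∀ P q → FPiece F P → Bits q → P ∋ q → InR q → Walled P
    walled (dia a b) (quad i j hx hy) (ea , eb , ne) bs (refl , refl) h =
      liaG 4 (λ a b hx hy → bitsᵉ hx hy :∧ inRᵉ a b hx hy :∧ # 0 :≤ a :+ b :+ εᵉ :- # 1 ⊢ # 0 :≤ a :+ b :+ εᵉ :- # 1) a b hx hy (bs , h , l) ,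
      r , bo , to
      where
      l : + 0 ≤ a + b + ε - + 1
      l = ℤP.≮⇒≥ λ lt → clash (trans (cong F (liaG 4 (λ a b hx hy → bitsᵉ hx hy :∧ inRᵉ a b hx hy :∧ a :+ b :+ εᵉ :- # 1 :< # 0 ⊢
            b :≡ neg εᵉ :- a) a b hx hy (bs , h , lt))) (left a)) ne
      r : a + b + ε ≤ + m - + 2
      r = ℤP.≮⇒≥ λ lt → clash (trans (trans (sym eb) (cong F (liaG 4 (λ a b hx hy → bitsᵉ hx hy :∧ inRᵉ a b hx hy :∧ mᵉ :- # 2 :< a :+ b :+ εᵉ ⊢
            b :+ # 1 :≡ mᵉ :+ # 1 :- εᵉ :- (a :+ # 1)) a b hx hy (bs , h , lt)))) (trans (right (a + + 1)) ea)) ne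
      bo : + 0 ≤ a - b - + 2
      bo = ℤP.≮⇒≥ λ lt → clash (trans (sym eb) (cong F (liaG 4 (λ a b hx hy → bitsᵉ hx hy :∧ inRᵉ a b hx hy :∧ a :- b :- # 2 :< # 0 ⊢
            b :+ # 1 :≡ a) a b hx hy (bs , h , lt)))) ne
      to : a - b - + 1 ≤ + n - + 2
      to = ℤP.≮⇒≥ λ lt → clash (trans (trans (sym (top b)) (cong F (liaG 4 (λ a b hx hy → bitsᵉ hx hy :∧ inRᵉ a b hx hy :∧ nᵉ :- # 2 :< a :- b :- # 1 ⊢
            b :+ (nᵉ :+ # 1) :≡ a :+ # 1) a b hx hy (bs , h , lt)))) ea) ne
    walled (blk i₀ i₁ j₀ j₁) (quad i j hx hy) (β , rI , rJ) bs h hR = nonempty rI , nonempty rJ , bo , to , le , ri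
      where
      hypᵉ : (i₀ i₁ j₀ j₁ i j hx hy : Expr) → Form
      hypᵉ i₀ i₁ j₀ j₁ i j hx hy = bitsᵉ hx hy :∧ blkᵉ i₀ i₁ j₀ j₁ i j hx hy :∧ inRᵉ i j hx hy :∧ i₀ :≤ i₁
      hyp = bs , h , hR , nonempty rI
      bo : Bottom i₀ i₁ j₀ j₁
      bo with run-compare rI rJ
      ... | inj₁ (e , e′) = inj₂ (e , e′ , liaG 8 (λ i₀ i₁ j₀ j₁ i j hx hy → hypᵉ i₀ i₁ j₀ j₁ i j hx hy :∧ i₀ :≡ j₀ :∧ i₁ :≡ j₁ ⊢ i₀ :< i₁)
              i₀ i₁ j₀ j₁ i j hx hy (hyp , e , e′))
      ... | inj₂ (inj₁ p) = ⊥-elim (liaG 8 (λ i₀ i₁ j₀ j₁ i j hx hy → hypᵉ i₀ i₁ j₀ j₁ i j hx hy :∧ i₁ :+ # 2 :≤ j₀ ⊢ ⊥ᶠ)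
              i₀ i₁ j₀ j₁ i j hx hy (hyp , p))
      ... | inj₂ (inj₂ p) = inj₁ (lia 2 (λ i₀ j₁ → j₁ :+ # 2 :≤ i₀ ⊢ # 0 :≤ i₀ :- j₁ :- # 2) i₀ j₁ p)
      to : Top i₀ i₁ j₀ j₁
      to with run-compare rI (run-shift rJ)
      ... | inj₁ (e , e′) = inj₂ (liaG 8 (λ i₀ i₁ j₀ j₁ i j hx hy → hypᵉ i₀ i₁ j₀ j₁ i j hx hy :∧ i₀ :≡ j₀ :+ (nᵉ :+ # 1) :∧ i₁ :≡ j₁ :+ (nᵉ :+ # 1) ⊢
              i₀ :≡ j₀ :+ nᵉ :+ # 1 :∧ i₁ :≡ j₁ :+ nᵉ :+ # 1 :∧ i₀ :< i₁)
              i₀ i₁ j₀ j₁ i j hx hy (hyp , e , e′))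
      ... | inj₂ (inj₁ p) = inj₁ (liaG 2 (λ i₁ j₀ → i₁ :+ # 2 :≤ j₀ :+ (nᵉ :+ # 1) ⊢ i₁ :- j₀ :≤ nᵉ :- # 1) i₁ j₀ p)
      ... | inj₂ (inj₂ p) = ⊥-elim (liaG 8 (λ i₀ i₁ j₀ j₁ i j hx hy → hypᵉ i₀ i₁ j₀ j₁ i j hx hy :∧ j₁ :+ (nᵉ :+ # 1) :+ # 2 :≤ i₀ ⊢ ⊥ᶠ)
              i₀ i₁ j₀ j₁ i j hx hy (hyp , p))
      le : Left i₀ i₁ j₀ j₁
      le with run-compare rI (run-reflect (- ε) left rJ)
      ... | inj₁ (e , e′) = inj₂ (liaG 8 (λ i₀ i₁ j₀ j₁ i j hx hy → hypᵉ i₀ i₁ j₀ j₁ i j hx hy :∧ i₀ :≡ neg εᵉ :- j₁ :∧ i₁ :≡ neg εᵉ :- j₀ ⊢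
              i₀ :+ j₁ :+ εᵉ :≡ # 0 :∧ i₁ :+ j₀ :+ εᵉ :≡ # 0 :∧ i₀ :< i₁)
              i₀ i₁ j₀ j₁ i j hx hy (hyp , e , e′))
      ... | inj₂ (inj₁ p) = ⊥-elim (liaG 8 (λ i₀ i₁ j₀ j₁ i j hx hy → hypᵉ i₀ i₁ j₀ j₁ i j hx hy :∧ i₁ :+ # 2 :≤ neg εᵉ :- j₁ ⊢ ⊥ᶠ)
              i₀ i₁ j₀ j₁ i j hx hy (hyp , p))
      ... | inj₂ (inj₂ p) = inj₁ (liaG 2 (λ i₀ j₀ → neg εᵉ :- j₀ :+ # 2 :≤ i₀ ⊢ # 0 :≤ i₀ :+ j₀ :+ εᵉ :- # 2) i₀ j₀ p)
      ri : Right i₀ i₁ j₀ j₁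
      ri with run-compare rI (run-reflect (+ m + + 1 - ε) right rJ)
      ... | inj₁ (e , e′) = inj₂ (liaG 8 (λ i₀ i₁ j₀ j₁ i j hx hy → hypᵉ i₀ i₁ j₀ j₁ i j hx hy :∧ i₀ :≡ mᵉ :+ # 1 :- εᵉ :- j₁ :∧ i₁ :≡ mᵉ :+ # 1 :- εᵉ :- j₀ ⊢
              i₀ :+ j₁ :+ εᵉ :≡ mᵉ :+ # 1 :∧ i₁ :+ j₀ :+ εᵉ :≡ mᵉ :+ # 1 :∧ i₀ :< i₁)
              i₀ i₁ j₀ j₁ i j hx hy (hyp , e , e′))
      ... | inj₂ (inj₁ p) = inj₁ (liaG 2 (λ i₁ j₁ → i₁ :+ # 2 :≤ mᵉ :+ # 1 :- εᵉ :- j₁ ⊢ i₁ :+ j₁ :+ εᵉ :≤ mᵉ :- # 1) i₁ j₁ p)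
      ... | inj₂ (inj₂ p) = ⊥-elim (liaG 8 (λ i₀ i₁ j₀ j₁ i j hx hy → hypᵉ i₀ i₁ j₀ j₁ i j hx hy :∧ mᵉ :+ # 1 :- εᵉ :- j₀ :+ # 2 :≤ i₀ ⊢ ⊥ᶠ)
              i₀ i₁ j₀ j₁ i j hx hy (hyp , p))

    module _ (nc : NonConstant F) where
      other : ∀ k → ∃ λ z → F z ≡ not (F k)
      other k with F (proj₁ nc) 𝔹.≟ F k
      ... | yes e = proj₁ (proj₂ nc) , trans (proj₂ (proj₂ nc)) (cong not e)
      ... | no ne = proj₁ nc , 𝔹.¬-not ne

      Owned : (i j : ℤ) → Set
      Owned i j = ∃ λ i₀ → ∃ λ i₁ → ∃ λ j₀ → ∃ λ j₁ →
        (i₀ ≤ i × i ≤ i₁ × j₀ ≤ j × j ≤ j₁) × Run F (F i) i₀ i₁ × Run F (F i) j₀ j₁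

      open Search {F} (+ n + + 1) 1≤n+1 top

      abstract
        owner : ∀ i j → F i ≡ F j → Owned i j
        owner i j e =
          let (i₀ , i₁ , h₁ , h₂ , rI) = run-through i (other i)
              (j₀ , j₁ , h₃ , h₄ , rJ) = run-through j (other j)
          in i₀ , i₁ , j₀ , j₁ , (h₁ , h₂ , h₃ , h₄) , rI , subst (λ β → Run F β j₀ j₁) (sym e) rJ

      -- A vanishing corner of the quad owns it; if both are nonzero, then a
      -- vanishing opposite corner of the face does, and otherwise all four are nonzero.
      near-v : ∀ i j hx hy → Bits (quad i j hx hy) → F (i + hy) ≡ F (j + + 1 - hy) →
        ∃ λ P → FPiece F P × P ∋ quad i j hx hy
      near-v i j hx hy bs e with owner (i + hy) (j + + 1 - hy) e
      ... | i₀ , i₁ , j₀ , j₁ , h , rI , rJ = blk i₀ i₁ j₀ j₁ , (_ , rI , rJ) ,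
        lia 8 (λ i₀ i₁ j₀ j₁ i j hx hy → bitsᵉ hx hy :∧ (i₀ :≤ i :+ hy :∧ i :+ hy :≤ i₁ :∧ j₀ :≤ j :+ # 1 :- hy :∧ j :+ # 1 :- hy :≤ j₁)
          ⊢ blkᵉ i₀ i₁ j₀ j₁ i j hx hy) i₀ i₁ j₀ j₁ i j hx hy (bs , h)

      near-h : ∀ i j hx hy → Bits (quad i j hx hy) → F (i + hx) ≡ F (j + hx) →
        ∃ λ P → FPiece F P × P ∋ quad i j hx hy
      near-h i j hx hy bs e with owner (i + hx) (j + hx) e
      ... | i₀ , i₁ , j₀ , j₁ , h , rI , rJ = blk i₀ i₁ j₀ j₁ , (_ , rI , rJ) ,
        lia 8 (λ i₀ i₁ j₀ j₁ i j hx hy → bitsᵉ hx hy :∧ (i₀ :≤ i :+ hx :∧ i :+ hx :≤ i₁ :∧ j₀ :≤ j :+ hx :∧ j :+ hx :≤ j₁)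
          ⊢ blkᵉ i₀ i₁ j₀ j₁ i j hx hy) i₀ i₁ j₀ j₁ i j hx hy (bs , h)

      private
        plus0 : ∀ i → F (i + + 0) ≡ F i
        plus0 i = cong F (ℤP.+-identityʳ i)
        minus0 : ∀ i → F (i + + 1 - + 0) ≡ F (i + + 1)
        minus0 i = cong F (ℤP.+-identityʳ (i + + 1))
        minus1 : ∀ i → F (i + + 1 - + 1) ≡ F i
        minus1 i = cong F (lia 1 (λ i → ⊤ᶠ ⊢ i :+ # 1 :- # 1 :≡ i) i tt)

      -- The two nonzero corners of the quad share their first coordinate, which forces
      -- `F j = F (j + 1)`. The other two corners of the face are then both zero or both nonzero: in
      -- the first case one block contains both of them and covers the quad as well, in the second
      -- the face is a diamond.
      far-h : ∀ i j h → + 0 ≤ h → h ≤ + 1 → F (j + + 1) ≡ F j → F (i + h) ≡ not (F j) → ∃ λ P → FPiece F P × P ∋ quad i j h h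
      far-h i j h h≥0 h≤1 eJ ne with F (i + + 1 - h) 𝔹.≟ F j
      ... | yes e with owner (i + + 1 - h) j e
      ...   | i₀ , i₁ , j₀ , j₁ , hh@(_ , _ , j₀≤j , j≤j₁) , rI , rJ = blk i₀ i₁ j₀ j₁ , (_ , rI , rJ) ,
        lia 7 (λ i₀ i₁ j₀ j₁ i j h → (# 0 :≤ h :∧ h :≤ # 1) :∧ (i₀ :≤ i :+ # 1 :- h :∧ i :+ # 1 :- h :≤ i₁ :∧ j₀ :≤ j :∧ j :≤ j₁) :∧ j :+ # 1 :≤ j₁
          ⊢ blkᵉ i₀ i₁ j₀ j₁ i j h h) i₀ i₁ j₀ j₁ i j h
          ((h≥0 , h≤1) , hh , run-extendʳ rJ (lia 2 (λ a k → a :≤ k ⊢ a :≤ k :+ # 1) j₀ j j₀≤j) j≤j₁ (trans eJ (sym e)))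
      far-h i j h h≥0 h≤1 eJ ne | no ne′ with bit h h≥0 h≤1
      ...   | inj₁ refl = dia i j , (trans (trans (sym (minus0 i)) (𝔹.¬-not ne′)) (sym (trans (sym (plus0 i)) ne)) , eJ , flip-not (trans (sym (plus0 i)) ne)) , refl , refl
      ...   | inj₂ refl = dia i j , (trans ne (sym (trans (sym (minus1 i)) (𝔹.¬-not ne′))) , eJ , flip-not (trans (sym (minus1 i)) (𝔹.¬-not ne′))) , refl , refl

      far-v : ∀ i j h → + 0 ≤ h → h ≤ + 1 → F (i + + 1) ≡ F i → F (j + + 1 - h) ≡ not (F i) → ∃ λ P → FPiece F P × P ∋ quad i j (+ 1 - h) h
      far-v i j h h≥0 h≤1 eI ne with F i 𝔹.≟ F (j + h)
      ... | yes e with owner i (j + h) e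
      ...   | i₀ , i₁ , j₀ , j₁ , hh@(i₀≤i , i≤i₁ , _) , rI , rJ = blk i₀ i₁ j₀ j₁ , (_ , rI , rJ) ,
        lia 7 (λ i₀ i₁ j₀ j₁ i j h → (# 0 :≤ h :∧ h :≤ # 1) :∧ (i₀ :≤ i :∧ i :≤ i₁ :∧ j₀ :≤ j :+ h :∧ j :+ h :≤ j₁) :∧ i :+ # 1 :≤ i₁
          ⊢ blkᵉ i₀ i₁ j₀ j₁ i j (# 1 :- h) h) i₀ i₁ j₀ j₁ i j h
          ((h≥0 , h≤1) , hh , run-extendʳ rI (lia 2 (λ a k → a :≤ k ⊢ a :≤ k :+ # 1) i₀ i i₀≤i) i≤i₁ eI)
      far-v i j h h≥0 h≤1 eI ne | no ne′ with bit h h≥0 h≤1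
      ...   | inj₁ refl = dia i j , (eI , trans (trans (sym (minus0 j)) ne) (sym Fj) , Fj) , refl , refl
        where Fj = trans (sym (plus0 j)) (flip-not (𝔹.¬-not ne′))
      ...   | inj₂ refl = dia i j , (eI , trans (flip-not (𝔹.¬-not ne′)) (sym Fj) , Fj) , refl , refl
        where Fj = trans (sym (minus1 j)) ne

      cover : ∀ q → Bits q → ∃ λ P → FPiece F P × P ∋ q
      cover (quad i j hx hy) bs with F (i + hy) 𝔹.≟ F (j + + 1 - hy) | F (i + hx) 𝔹.≟ F (j + hx)
      ... | yes e | _ = near-v i j hx hy bs e
      ... | no _ | yes e = near-h i j hx hy bs e
      cover (quad i j hx hy) bs@(h₁ , h₂ , h₃ , h₄) | no v | no h with bit hx h₁ h₂ | bit hy h₃ h₄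
      ... | inj₁ refl | inj₁ refl = far-h i j (+ 0) h₁ h₂
            (trans (sym (minus0 j)) (trans (flip-not (𝔹.¬-not v)) (trans (cong not (plus0 i)) (sym (flip-not (trans (sym (plus0 i)) (trans (𝔹.¬-not h) (cong not (plus0 j)))))))))
            (trans (𝔹.¬-not h) (cong not (plus0 j)))
      ... | inj₂ refl | inj₂ refl = far-h i j (+ 1) h₁ h₂
            (trans (flip-not (𝔹.¬-not h)) (sym (trans (sym (minus1 j)) (flip-not (𝔹.¬-not v)))))
            (trans (𝔹.¬-not v) (cong not (minus1 j)))
      ... | inj₂ refl | inj₁ refl = far-v i j (+ 0) h₃ h₄
            (trans (𝔹.¬-not h) (sym (trans (sym (plus0 i)) (trans (𝔹.¬-not v) (cong not (minus0 j))))))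
            (trans (flip-not (𝔹.¬-not v)) (cong not (plus0 i)))
      ... | inj₁ refl | inj₂ refl = far-v i j (+ 1) h₃ h₄
            (trans (𝔹.¬-not v) (sym (trans (sym (plus0 i)) (trans (𝔹.¬-not h) (cong not (trans (plus0 j) (sym (minus1 j))))))))
            (trans (minus1 j) (trans (sym (plus0 j)) (trans (flip-not (𝔹.¬-not h)) (cong not (plus0 i)))))

  -- Cells and quads

  quadᵉ : (x y s d i j hx hy : Expr) → Form
  quadᵉ x y s d i j hx hy =
    x :≡ i :+ j :+ εᵉ :- # 1 :+ hx :∧ y :≡ i :- j :- # 2 :+ hy :∧
    (+ 2) :* i :+ εᵉ :- # 2 :≤ s :∧ s :≤ (+ 2) :* i :+ εᵉ :- # 1 :∧
    (+ 2) :* j :+ εᵉ :≤ d :∧ d :≤ (+ 2) :* j :+ εᵉ :+ # 1 :∧ bitsᵉ hx hy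

  IsQuad : Cell → Quad → Set
  IsQuad c@(x , y , _) (quad i j hx hy) =
    Holds (quadᵉ (K x) (K y) (K (sumFl c)) (K (difFl c)) (K i) (K j) (K hx) (K hy)) ρ₀

  quad-bits : ∀ c q → IsQuad c q → Bits q
  quad-bits c q (_ , _ , _ , _ , _ , _ , b) = b

  -- The parity of x + y - ε tells which diagonal of the unit square joins its two vertices of the
  -- given colour. This diagonal cuts the square into two quads of two cells each.
  quadOf : ∀ c → ∃ λ q → IsQuad c q
  quadOf (x , y , q) with halve (x + y - ε) | q
  ... | k , inj₁ e | 0F = quad (k + + 1) (k - y) (+ 0) (+ 1) , liaG 3 (λ x y k → x :+ y :- εᵉ :≡ (+ 2) :* k :+ # 0 ⊢
        quadᵉ x y (x :+ y :+ # 0) (x :- y :- # 0) (k :+ # 1) (k :- y) (# 0) (# 1)) x y k e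
  ... | k , inj₁ e | 1F = quad (k + + 1) (k - y) (+ 0) (+ 1) , liaG 3 (λ x y k → x :+ y :- εᵉ :≡ (+ 2) :* k :+ # 0 ⊢
        quadᵉ x y (x :+ y :+ # 1) (x :- y :- # 0) (k :+ # 1) (k :- y) (# 0) (# 1)) x y k e
  ... | k , inj₁ e | 2F = quad (k + + 1) (k - y - + 1) (+ 1) (+ 0) , liaG 3 (λ x y k → x :+ y :- εᵉ :≡ (+ 2) :* k :+ # 0 ⊢
        quadᵉ x y (x :+ y :+ # 1) (x :- y :- # 1) (k :+ # 1) (k :- y :- # 1) (# 1) (# 0)) x y k e
  ... | k , inj₁ e | 3F = quad (k + + 1) (k - y - + 1) (+ 1) (+ 0) , liaG 3 (λ x y k → x :+ y :- εᵉ :≡ (+ 2) :* k :+ # 0 ⊢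
        quadᵉ x y (x :+ y :+ # 0) (x :- y :- # 1) (k :+ # 1) (k :- y :- # 1) (# 1) (# 0)) x y k e
  ... | k , inj₂ e | 0F = quad (k + + 1) (k - y) (+ 1) (+ 1) , liaG 3 (λ x y k → x :+ y :- εᵉ :≡ (+ 2) :* k :+ # 1 ⊢
        quadᵉ x y (x :+ y :+ # 0) (x :- y :- # 0) (k :+ # 1) (k :- y) (# 1) (# 1)) x y k e
  ... | k , inj₂ e | 1F = quad (k + + 2) (k - y) (+ 0) (+ 0) , liaG 3 (λ x y k → x :+ y :- εᵉ :≡ (+ 2) :* k :+ # 1 ⊢
        quadᵉ x y (x :+ y :+ # 1) (x :- y :- # 0) (k :+ # 2) (k :- y) (# 0) (# 0)) x y k e
  ... | k , inj₂ e | 2F = quad (k + + 2) (k - y) (+ 0) (+ 0) , liaG 3 (λ x y k → x :+ y :- εᵉ :≡ (+ 2) :* k :+ # 1 ⊢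
        quadᵉ x y (x :+ y :+ # 1) (x :- y :- # 1) (k :+ # 2) (k :- y) (# 0) (# 0)) x y k e
  ... | k , inj₂ e | 3F = quad (k + + 1) (k - y) (+ 1) (+ 1) , liaG 3 (λ x y k → x :+ y :- εᵉ :≡ (+ 2) :* k :+ # 1 ⊢
        quadᵉ x y (x :+ y :+ # 0) (x :- y :- # 1) (k :+ # 1) (k :- y) (# 1) (# 1)) x y k e

  -- Of the two cells of a quad, the one with a side on the horizontal axis of the face is chosen:
  -- the top cell of its unit square for a southern quad, the bottom cell for a northern one.
  cellOf : ∀ q → Bits q → ∃ λ c → IsQuad c q
  cellOf (quad i j hx hy) bs@(_ , _ , h₃ , h₄) with bit hy h₃ h₄
  ... | inj₁ refl = (i + j + ε - + 1 + hx , i - j - + 2 + + 0 , 2F) ,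
    liaG 3 (λ i j hx → bitsᵉ hx (# 0) ⊢ let x = i :+ j :+ εᵉ :- # 1 :+ hx ; y = i :- j :- # 2 :+ # 0 in
      quadᵉ x y (x :+ y :+ # 1) (x :- y :- # 1) i j hx (# 0)) i j hx bs
  ... | inj₂ refl = (i + j + ε - + 1 + hx , i - j - + 2 + + 1 , 0F) ,
    liaG 3 (λ i j hx → bitsᵉ hx (# 1) ⊢ let x = i :+ j :+ εᵉ :- # 1 :+ hx ; y = i :- j :- # 2 :+ # 1 in
      quadᵉ x y (x :+ y :+ # 0) (x :- y :- # 0) i j hx (# 1)) i j hx bs

  ∧-true : ∀ {a b} → a ∧ b ≡ true → a ≡ true × b ≡ true
  ∧-true {true} {true} _ = refl , refl

  true-∧ : ∀ {a b} → a ≡ true → b ≡ true → a ∧ b ≡ true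
  true-∧ refl refl = refl

  inR-InR : ∀ c q → IsQuad c q → (inR m n c ≡ true) ⇔ InR q
  inR-InR c@(x , y , _) (quad i j hx hy) h = to , from
    where
    to : inR m n c ≡ true → InR (quad i j hx hy)
    to e =
      let (e₁ , e′) = ∧-true e ; (e₂ , e″) = ∧-true e′ ; (e₃ , e₄) = ∧-true e″ in
      liaG 8 (λ x y s d i j hx hy → quadᵉ x y s d i j hx hy :∧ # 0 :≤ x :∧ x :+ # 2 :≤ mᵉ :∧ # 0 :≤ y :∧ y :+ # 2 :≤ nᵉ ⊢ inRᵉ i j hx hy)
        x y (sumFl c) (difFl c) i j hx hy
        (h , proj₁ (≤ᵇ-true _ _) e₁ , proj₁ (≤ᵇ-true _ _) e₂ , proj₁ (≤ᵇ-true _ _) e₃ , proj₁ (≤ᵇ-true _ _) e₄)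
    from : InR (quad i j hx hy) → inR m n c ≡ true
    from r =
      let (h₁ , h₂ , h₃ , h₄) = liaG 8 (λ x y s d i j hx hy → quadᵉ x y s d i j hx hy :∧ inRᵉ i j hx hy ⊢
                                  # 0 :≤ x :∧ x :+ # 2 :≤ mᵉ :∧ # 0 :≤ y :∧ y :+ # 2 :≤ nᵉ)
                                  x y (sumFl c) (difFl c) i j hx hy (h , r)
      in true-∧ (proj₂ (≤ᵇ-true _ _) h₁) (true-∧ (proj₂ (≤ᵇ-true _ _) h₂) (true-∧ (proj₂ (≤ᵇ-true _ _) h₃) (proj₂ (≤ᵇ-true _ _) h₄)))

  -- The tile is the part of the piece inside R; for trapezoids and triangles the piece is the whole
  -- octagon and larger than the tile.
  Rep : Tile → Piece → Set
  Rep t P = ∀ c q → IsQuad c q → (inTile t c ≡ true) ⇔ (P ∋ q × InR q)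

  record Octᴱ : Set where
    constructor octᴱ
    field
      xl xu yl yu sl su dl du : Expr

  ⌜_⌝ : Oct → Octᴱ
  ⌜ oct xl xu yl yu sl su dl du ⌝ = octᴱ (K xl) (K xu) (K yl) (K yu) (K sl) (K su) (K dl) (K du)

  -- The bounds of the octagon around a block; at a symmetry axis it is cut off by the wall.
  diagᵉ : Octᴱ → (i₀ i₁ j₀ j₁ : Expr) → Form
  diagᵉ (octᴱ xl xu yl yu sl su dl du) i₀ i₁ j₀ j₁ =
    sl :≡ (+ 2) :* i₀ :+ εᵉ :- # 4 :∧ su :≡ (+ 2) :* i₁ :+ εᵉ :∧ dl :≡ (+ 2) :* j₀ :- # 2 :+ εᵉ :∧ du :≡ (+ 2) :* j₁ :+ # 2 :+ εᵉ

  -- N: the octagon does not cross the wall; S: the wall is a symmetry axis.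
  bottomNᵉ bottomSᵉ topNᵉ topSᵉ leftNᵉ leftSᵉ rightNᵉ rightSᵉ : (i₀ i₁ j₀ j₁ : Expr) → Form
  bottomNᵉ i₀ i₁ j₀ j₁ = # 0 :≤ i₀ :- j₁ :- # 2
  bottomSᵉ i₀ i₁ j₀ j₁ = i₀ :≡ j₀ :∧ i₁ :≡ j₁ :∧ i₀ :< i₁
  topNᵉ i₀ i₁ j₀ j₁ = i₁ :- j₀ :≤ nᵉ :- # 1
  topSᵉ i₀ i₁ j₀ j₁ = i₀ :≡ j₀ :+ nᵉ :+ # 1 :∧ i₁ :≡ j₁ :+ nᵉ :+ # 1 :∧ i₀ :< i₁
  leftNᵉ i₀ i₁ j₀ j₁ = # 0 :≤ i₀ :+ j₀ :+ εᵉ :- # 2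
  leftSᵉ i₀ i₁ j₀ j₁ = i₀ :+ j₁ :+ εᵉ :≡ # 0 :∧ i₁ :+ j₀ :+ εᵉ :≡ # 0 :∧ i₀ :< i₁
  rightNᵉ i₀ i₁ j₀ j₁ = i₁ :+ j₁ :+ εᵉ :≤ mᵉ :- # 1
  rightSᵉ i₀ i₁ j₀ j₁ = i₀ :+ j₁ :+ εᵉ :≡ mᵉ :+ # 1 :∧ i₁ :+ j₀ :+ εᵉ :≡ mᵉ :+ # 1 :∧ i₀ :< i₁

  bNᵉ bSᵉ tNᵉ tSᵉ lNᵉ lSᵉ rNᵉ rSᵉ : Octᴱ → (i₀ i₁ j₀ j₁ : Expr) → Form
  bNᵉ o i₀ i₁ j₀ j₁ = Octᴱ.yl o :≡ i₀ :- j₁ :- # 2 :∧ bottomNᵉ i₀ i₁ j₀ j₁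
  bSᵉ o i₀ i₁ j₀ j₁ = Octᴱ.yl o :≡ # 0 :∧ bottomSᵉ i₀ i₁ j₀ j₁
  tNᵉ o i₀ i₁ j₀ j₁ = Octᴱ.yu o :≡ i₁ :- j₀ :∧ topNᵉ i₀ i₁ j₀ j₁
  tSᵉ o i₀ i₁ j₀ j₁ = Octᴱ.yu o :≡ nᵉ :- # 1 :∧ topSᵉ i₀ i₁ j₀ j₁
  lNᵉ o i₀ i₁ j₀ j₁ = Octᴱ.xl o :≡ i₀ :+ j₀ :+ εᵉ :- # 2 :∧ leftNᵉ i₀ i₁ j₀ j₁
  lSᵉ o i₀ i₁ j₀ j₁ = Octᴱ.xl o :≡ # 0 :∧ leftSᵉ i₀ i₁ j₀ j₁
  rNᵉ o i₀ i₁ j₀ j₁ = Octᴱ.xu o :≡ i₁ :+ j₁ :+ εᵉ :∧ rightNᵉ i₀ i₁ j₀ j₁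
  rSᵉ o i₀ i₁ j₀ j₁ = Octᴱ.xu o :≡ mᵉ :- # 1 :∧ rightSᵉ i₀ i₁ j₀ j₁

  -- The link between the eight bounds of a tile and a block. The slanted bounds are always those of
  -- the octagon; each bound on x or y either belongs to the octagon too or is the side of R that
  -- cuts it off.
  record Trace (o : Oct) (i₀ i₁ j₀ j₁ : ℤ) : Set where
    constructor trace
    field
      sizes  : i₀ ≤ i₁ × j₀ ≤ j₁
      diag   : Holds (diagᵉ ⌜ o ⌝ (K i₀) (K i₁) (K j₀) (K j₁)) ρ₀
      bottom : Holds (bNᵉ ⌜ o ⌝ (K i₀) (K i₁) (K j₀) (K j₁)) ρ₀ ⊎ Holds (bSᵉ ⌜ o ⌝ (K i₀) (K i₁) (K j₀) (K j₁)) ρ₀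
      top    : Holds (tNᵉ ⌜ o ⌝ (K i₀) (K i₁) (K j₀) (K j₁)) ρ₀ ⊎ Holds (tSᵉ ⌜ o ⌝ (K i₀) (K i₁) (K j₀) (K j₁)) ρ₀
      left   : Holds (lNᵉ ⌜ o ⌝ (K i₀) (K i₁) (K j₀) (K j₁)) ρ₀ ⊎ Holds (lSᵉ ⌜ o ⌝ (K i₀) (K i₁) (K j₀) (K j₁)) ρ₀
      right  : Holds (rNᵉ ⌜ o ⌝ (K i₀) (K i₁) (K j₀) (K j₁)) ρ₀ ⊎ Holds (rSᵉ ⌜ o ⌝ (K i₀) (K i₁) (K j₀) (K j₁)) ρ₀

  forget : {A B A′ B′ : Set} → (A × A′) ⊎ (B × B′) → A′ ⊎ B′
  forget (inj₁ (_ , h)) = inj₁ h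
  forget (inj₂ (_ , h)) = inj₂ h

  trace-walled : ∀ {o i₀ i₁ j₀ j₁} → Trace o i₀ i₁ j₀ j₁ → Walled (blk i₀ i₁ j₀ j₁)
  trace-walled (trace (h , h′) _ b t l r) = h , h′ , forget b , forget t , forget l , forget r

  module _ {xl xu yl yu sl su dl du i₀ i₁ j₀ j₁ : ℤ} (tr : Trace (oct xl xu yl yu sl su dl du) i₀ i₁ j₀ j₁)
    (x y s d i j hx hy : ℤ) (hq : Holds (quadᵉ (K x) (K y) (K s) (K d) (K i) (K j) (K hx) (K hy)) ρ₀) where

    private
      goˡ : (xl ≤ x) ⇔ (i₀ + j₀ - + 1 ≤ i + j + hx × + 0 ≤ i + j + ε - + 1 + hx)
      goˡ with Trace.left tr
      ... | inj₁ h = (λ p → liaG 13 (λ xl i₀ i₁ j₀ j₁ x y s d i j hx hy → quadᵉ x y s d i j hx hy :∧ (xl :≡ i₀ :+ j₀ :+ εᵉ :- # 2 :∧ leftNᵉ i₀ i₁ j₀ j₁) :∧ xl :≤ x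
                  ⊢ i₀ :+ j₀ :- # 1 :≤ i :+ j :+ hx :∧ # 0 :≤ i :+ j :+ εᵉ :- # 1 :+ hx) xl i₀ i₁ j₀ j₁ x y s d i j hx hy (hq , h , p)) ,
        λ p → liaG 13 (λ xl i₀ i₁ j₀ j₁ x y s d i j hx hy → quadᵉ x y s d i j hx hy :∧ (xl :≡ i₀ :+ j₀ :+ εᵉ :- # 2 :∧ leftNᵉ i₀ i₁ j₀ j₁) :∧
                  i₀ :+ j₀ :- # 1 :≤ i :+ j :+ hx :∧ # 0 :≤ i :+ j :+ εᵉ :- # 1 :+ hx ⊢ xl :≤ x) xl i₀ i₁ j₀ j₁ x y s d i j hx hy (hq , h , p)
      ... | inj₂ h = (λ p → liaG 13 (λ xl i₀ i₁ j₀ j₁ x y s d i j hx hy → quadᵉ x y s d i j hx hy :∧ (xl :≡ # 0 :∧ leftSᵉ i₀ i₁ j₀ j₁) :∧ xl :≤ x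
                  ⊢ i₀ :+ j₀ :- # 1 :≤ i :+ j :+ hx :∧ # 0 :≤ i :+ j :+ εᵉ :- # 1 :+ hx) xl i₀ i₁ j₀ j₁ x y s d i j hx hy (hq , h , p)) ,
        λ p → liaG 13 (λ xl i₀ i₁ j₀ j₁ x y s d i j hx hy → quadᵉ x y s d i j hx hy :∧ (xl :≡ # 0 :∧ leftSᵉ i₀ i₁ j₀ j₁) :∧
                  i₀ :+ j₀ :- # 1 :≤ i :+ j :+ hx :∧ # 0 :≤ i :+ j :+ εᵉ :- # 1 :+ hx ⊢ xl :≤ x) xl i₀ i₁ j₀ j₁ x y s d i j hx hy (hq , h , p)

      goʳ : (x < xu) ⇔ (i + j + hx ≤ i₁ + j₁ × i + j + ε - + 1 + hx ≤ + m - + 2)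
      goʳ with Trace.right tr
      ... | inj₁ h = (λ p → liaG 13 (λ xu i₀ i₁ j₀ j₁ x y s d i j hx hy → quadᵉ x y s d i j hx hy :∧ (xu :≡ i₁ :+ j₁ :+ εᵉ :∧ rightNᵉ i₀ i₁ j₀ j₁) :∧ x :< xu
                  ⊢ i :+ j :+ hx :≤ i₁ :+ j₁ :∧ i :+ j :+ εᵉ :- # 1 :+ hx :≤ mᵉ :- # 2) xu i₀ i₁ j₀ j₁ x y s d i j hx hy (hq , h , p)) ,
        λ p → liaG 13 (λ xu i₀ i₁ j₀ j₁ x y s d i j hx hy → quadᵉ x y s d i j hx hy :∧ (xu :≡ i₁ :+ j₁ :+ εᵉ :∧ rightNᵉ i₀ i₁ j₀ j₁) :∧
                  i :+ j :+ hx :≤ i₁ :+ j₁ :∧ i :+ j :+ εᵉ :- # 1 :+ hx :≤ mᵉ :- # 2 ⊢ x :< xu) xu i₀ i₁ j₀ j₁ x y s d i j hx hy (hq , h , p)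
      ... | inj₂ h = (λ p → liaG 13 (λ xu i₀ i₁ j₀ j₁ x y s d i j hx hy → quadᵉ x y s d i j hx hy :∧ (xu :≡ mᵉ :- # 1 :∧ rightSᵉ i₀ i₁ j₀ j₁) :∧ x :< xu
                  ⊢ i :+ j :+ hx :≤ i₁ :+ j₁ :∧ i :+ j :+ εᵉ :- # 1 :+ hx :≤ mᵉ :- # 2) xu i₀ i₁ j₀ j₁ x y s d i j hx hy (hq , h , p)) ,
        λ p → liaG 13 (λ xu i₀ i₁ j₀ j₁ x y s d i j hx hy → quadᵉ x y s d i j hx hy :∧ (xu :≡ mᵉ :- # 1 :∧ rightSᵉ i₀ i₁ j₀ j₁) :∧
                  i :+ j :+ hx :≤ i₁ :+ j₁ :∧ i :+ j :+ εᵉ :- # 1 :+ hx :≤ mᵉ :- # 2 ⊢ x :< xu) xu i₀ i₁ j₀ j₁ x y s d i j hx hy (hq , h , p)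

      goᵇ : (yl ≤ y) ⇔ (i₀ - j₁ ≤ i - j + hy × + 0 ≤ i - j - + 2 + hy)
      goᵇ with Trace.bottom tr
      ... | inj₁ h = (λ p → liaG 13 (λ yl i₀ i₁ j₀ j₁ x y s d i j hx hy → quadᵉ x y s d i j hx hy :∧ (yl :≡ i₀ :- j₁ :- # 2 :∧ bottomNᵉ i₀ i₁ j₀ j₁) :∧ yl :≤ y
                  ⊢ i₀ :- j₁ :≤ i :- j :+ hy :∧ # 0 :≤ i :- j :- # 2 :+ hy) yl i₀ i₁ j₀ j₁ x y s d i j hx hy (hq , h , p)) ,
        λ p → liaG 13 (λ yl i₀ i₁ j₀ j₁ x y s d i j hx hy → quadᵉ x y s d i j hx hy :∧ (yl :≡ i₀ :- j₁ :- # 2 :∧ bottomNᵉ i₀ i₁ j₀ j₁) :∧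
                  i₀ :- j₁ :≤ i :- j :+ hy :∧ # 0 :≤ i :- j :- # 2 :+ hy ⊢ yl :≤ y) yl i₀ i₁ j₀ j₁ x y s d i j hx hy (hq , h , p)
      ... | inj₂ h = (λ p → liaG 13 (λ yl i₀ i₁ j₀ j₁ x y s d i j hx hy → quadᵉ x y s d i j hx hy :∧ (yl :≡ # 0 :∧ bottomSᵉ i₀ i₁ j₀ j₁) :∧ yl :≤ y
                  ⊢ i₀ :- j₁ :≤ i :- j :+ hy :∧ # 0 :≤ i :- j :- # 2 :+ hy) yl i₀ i₁ j₀ j₁ x y s d i j hx hy (hq , h , p)) ,
        λ p → liaG 13 (λ yl i₀ i₁ j₀ j₁ x y s d i j hx hy → quadᵉ x y s d i j hx hy :∧ (yl :≡ # 0 :∧ bottomSᵉ i₀ i₁ j₀ j₁) :∧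
                  i₀ :- j₁ :≤ i :- j :+ hy :∧ # 0 :≤ i :- j :- # 2 :+ hy ⊢ yl :≤ y) yl i₀ i₁ j₀ j₁ x y s d i j hx hy (hq , h , p)

      goᵗ : (y < yu) ⇔ (i - j + hy ≤ i₁ - j₀ + + 1 × i - j - + 2 + hy ≤ + n - + 2)
      goᵗ with Trace.top tr
      ... | inj₁ h = (λ p → liaG 13 (λ yu i₀ i₁ j₀ j₁ x y s d i j hx hy → quadᵉ x y s d i j hx hy :∧ (yu :≡ i₁ :- j₀ :∧ topNᵉ i₀ i₁ j₀ j₁) :∧ y :< yu
                  ⊢ i :- j :+ hy :≤ i₁ :- j₀ :+ # 1 :∧ i :- j :- # 2 :+ hy :≤ nᵉ :- # 2) yu i₀ i₁ j₀ j₁ x y s d i j hx hy (hq , h , p)) ,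
        λ p → liaG 13 (λ yu i₀ i₁ j₀ j₁ x y s d i j hx hy → quadᵉ x y s d i j hx hy :∧ (yu :≡ i₁ :- j₀ :∧ topNᵉ i₀ i₁ j₀ j₁) :∧
                  i :- j :+ hy :≤ i₁ :- j₀ :+ # 1 :∧ i :- j :- # 2 :+ hy :≤ nᵉ :- # 2 ⊢ y :< yu) yu i₀ i₁ j₀ j₁ x y s d i j hx hy (hq , h , p)
      ... | inj₂ h = (λ p → liaG 13 (λ yu i₀ i₁ j₀ j₁ x y s d i j hx hy → quadᵉ x y s d i j hx hy :∧ (yu :≡ nᵉ :- # 1 :∧ topSᵉ i₀ i₁ j₀ j₁) :∧ y :< yu
                  ⊢ i :- j :+ hy :≤ i₁ :- j₀ :+ # 1 :∧ i :- j :- # 2 :+ hy :≤ nᵉ :- # 2) yu i₀ i₁ j₀ j₁ x y s d i j hx hy (hq , h , p)) ,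
        λ p → liaG 13 (λ yu i₀ i₁ j₀ j₁ x y s d i j hx hy → quadᵉ x y s d i j hx hy :∧ (yu :≡ nᵉ :- # 1 :∧ topSᵉ i₀ i₁ j₀ j₁) :∧
                  i :- j :+ hy :≤ i₁ :- j₀ :+ # 1 :∧ i :- j :- # 2 :+ hy :≤ nᵉ :- # 2 ⊢ y :< yu) yu i₀ i₁ j₀ j₁ x y s d i j hx hy (hq , h , p)

      goˢ : ((sl ≤ s × s < su) × (dl ≤ d × d < du)) ⇔ (i₀ - + 1 ≤ i × i ≤ i₁ × j₀ - + 1 ≤ j × j ≤ j₁)
      goˢ = (λ p → liaG 16 (λ sl su dl du i₀ i₁ j₀ j₁ x y s d i j hx hy → quadᵉ x y s d i j hx hy :∧ diagᵉ (octᴱ sl sl sl sl sl su dl du) i₀ i₁ j₀ j₁ :∧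
               (sl :≤ s :∧ s :< su) :∧ (dl :≤ d :∧ d :< du) ⊢ i₀ :- # 1 :≤ i :∧ i :≤ i₁ :∧ j₀ :- # 1 :≤ j :∧ j :≤ j₁)
               sl su dl du i₀ i₁ j₀ j₁ x y s d i j hx hy (hq , Trace.diag tr , p)) ,
            (λ p → liaG 16 (λ sl su dl du i₀ i₁ j₀ j₁ x y s d i j hx hy → quadᵉ x y s d i j hx hy :∧ diagᵉ (octᴱ sl sl sl sl sl su dl du) i₀ i₁ j₀ j₁ :∧
               i₀ :- # 1 :≤ i :∧ i :≤ i₁ :∧ j₀ :- # 1 :≤ j :∧ j :≤ j₁ ⊢ (sl :≤ s :∧ s :< su) :∧ (dl :≤ d :∧ d :< du))
               sl su dl du i₀ i₁ j₀ j₁ x y s d i j hx hy (hq , Trace.diag tr , p))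

    -- Each bound on x or y is matched separately with the two conditions facing the same wall, one
    -- from the octagon and one from R. This takes two cases per wall instead of sixteen
    -- combinations.
    trace-quad : Holds (octᵉ (K xl) (K xu) (K yl) (K yu) (K sl) (K su) (K dl) (K du) (K x) (K y) (K s) (K d)) [] ⇔
      (blk i₀ i₁ j₀ j₁ ∋ quad i j hx hy × InR (quad i j hx hy))
    trace-quad =
      (λ { ((a , b) , (e , f) , g) →
        let (p₁ , r₁) = proj₁ goˡ a ; (p₂ , r₂) = proj₁ goʳ b ; (p₃ , r₃) = proj₁ goᵇ e ; (p₄ , r₄) = proj₁ goᵗ f
            (q₁ , q₂ , q₃ , q₄) = proj₁ goˢ g
        in (q₁ , q₂ , q₃ , q₄ , p₁ , p₂ , p₃ , p₄) , (r₁ , r₂ , r₃ , r₄) }) ,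
      (λ { ((q₁ , q₂ , q₃ , q₄ , p₁ , p₂ , p₃ , p₄) , (r₁ , r₂ , r₃ , r₄)) →
        (proj₂ goˡ (p₁ , r₁) , proj₂ goʳ (p₂ , r₂)) , (proj₂ goᵇ (p₃ , r₃) , proj₂ goᵗ (p₄ , r₄)) , proj₂ goˢ (q₁ , q₂ , q₃ , q₄) })

  trace-rep : ∀ t {i₀ i₁ j₀ j₁} → Trace (tileOct t) i₀ i₁ j₀ j₁ → Rep t (blk i₀ i₁ j₀ j₁)
  trace-rep t tr c@(x , y , _) (quad i j hx hy) hq =
    (proj₁ (trace-quad tr x y (sumFl c) (difFl c) i j hx hy hq) ∘ proj₁ (inTile-oct t c)) ,
    (proj₂ (inTile-oct t c) ∘ proj₂ (trace-quad tr x y (sumFl c) (difFl c) i j hx hy hq))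

  -- Colours

  private
    parity+2 : ∀ z → parityColour ∣ z + + 2 ∣ ≡ parityColour ∣ z ∣
    parity+2 (+ a) = cong parityColour (ℕP.+-comm a 2)
    parity+2 -[1+ 0 ] = refl
    parity+2 -[1+ 1 ] = refl
    parity+2 -[1+ suc (suc a) ] = refl

    parity-even : ∀ e k → parityColour ∣ + 2 * k + e ∣ ≡ parityColour ∣ e ∣
    parity-even e (+ zero) = cong (λ z → parityColour ∣ z ∣) (ℤP.+-identityˡ e)
    parity-even e (+ suc k) = trans
      (cong (λ z → parityColour ∣ z ∣) (lia 2 (λ k e → ⊤ᶠ ⊢ (+ 2) :* (# 1 :+ k) :+ e :≡ (+ 2) :* k :+ e :+ # 2) (+ k) e tt))
      (trans (parity+2 (+ 2 * + k + e)) (parity-even e (+ k)))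
    parity-even e -[1+ zero ] = trans (sym (parity+2 (+ 2 * -[1+ 0 ] + e)))
      (cong (λ z → parityColour ∣ z ∣) (lia 1 (λ e → ⊤ᶠ ⊢ K (-[1+ 1 ]) :+ e :+ # 2 :≡ e) e tt))
    parity-even e -[1+ suc k ] = trans (sym (parity+2 (+ 2 * -[1+ suc k ] + e))) (trans
      (cong (λ z → parityColour ∣ z ∣) (lia 2 (λ k e → ⊤ᶠ ⊢ (+ 2) :* (K (- + 1) :+ k) :+ e :+ # 2 :≡ (+ 2) :* k :+ e) -[1+ k ] e tt))
      (parity-even e -[1+ k ]))

    parity-eps : ∀ d → parityColour ∣ eps d ∣ ≡ d
    parity-eps black = refl
    parity-eps white = refl

  half-colour : ∀ x y k → x + y ≡ + 2 * k + ε → colourℤ x y ≡ c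
  half-colour x y k e = trans (cong (λ z → parityColour ∣ z ∣) e) (trans (parity-even ε k) (parity-eps c))

  colour-half : ∀ x y → colourℤ x y ≡ c → ∃ λ k → x + y ≡ + 2 * k + ε
  colour-half x y e with halve (x + y)
  ... | k , inj₁ h = k , trans h (cong (λ d → + 2 * k + eps d) (trans (sym (trans (cong (λ z → parityColour ∣ z ∣) h) (parity-even (+ 0) k))) e))
  ... | k , inj₂ h = k , trans h (cong (λ d → + 2 * k + eps d) (trans (sym (trans (cong (λ z → parityColour ∣ z ∣) h) (parity-even (+ 1) k))) e))

  -- From tiles to pieces

  rotᴱ : Octᴱ → Octᴱ
  rotᴱ (octᴱ xl xu yl yu sl su dl du) = octᴱ (neg yu) (neg yl) xl xu dl du (neg su) (neg sl)

  octagonᴱ : (p q tx ty : Expr) → Octᴱ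
  octagonᴱ p q tx ty = octᴱ
    (tx :- q) (tx :+ # 2 :+ p) ty (ty :+ p :+ q :+ # 2)
    (tx :+ ty) (tx :+ ty :+ (+ 2) :* p :+ # 4) (tx :- ty :- (+ 2) :* q :- # 2) (tx :- ty :+ # 2)

  diamondᴱ : (tx ty : Expr) → Octᴱ
  diamondᴱ tx ty = octᴱ (tx :- # 1) (tx :+ # 1) ty (ty :+ # 2) (tx :+ ty) (tx :+ ty :+ # 2) (tx :- ty :- # 2) (tx :- ty)

  trapezoidᴱ triangleᴱ : (a tx ty : Expr) → Octᴱ
  trapezoidᴱ a tx ty = octᴱ tx (tx :+ (+ 2) :* a :+ # 2) ty (ty :+ a)
    (tx :+ ty :- # 2) (tx :+ ty :+ (+ 2) :* a :+ # 2) (tx :- ty) (tx :- ty :+ (+ 2) :* a :+ # 4)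
  triangleᴱ a tx ty = octᴱ tx (tx :+ a) ty (ty :+ a)
    (tx :+ ty :- a :- # 4) (tx :+ ty :+ a) (tx :- ty :- a :- # 2) (tx :- ty :+ a :+ # 2)

  octOfDiaᵉ : Octᴱ → (a b : Expr) → Form
  octOfDiaᵉ (octᴱ xl xu yl yu sl su dl du) a b =
    xl :≡ a :+ b :+ εᵉ :- # 1 :∧ xu :≡ a :+ b :+ εᵉ :+ # 1 :∧ yl :≡ a :- b :- # 2 :∧ yu :≡ a :- b :∧
    sl :≡ (+ 2) :* a :+ εᵉ :- # 2 :∧ su :≡ (+ 2) :* a :+ εᵉ :∧ dl :≡ (+ 2) :* b :+ εᵉ :∧ du :≡ (+ 2) :* b :+ εᵉ :+ # 2

  octOfBlkᵉ : Octᴱ → (i₀ i₁ j₀ j₁ : Expr) → Form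
  octOfBlkᵉ o i₀ i₁ j₀ j₁ = diagᵉ o i₀ i₁ j₀ j₁ :∧
    Octᴱ.xl o :≡ i₀ :+ j₀ :+ εᵉ :- # 2 :∧ Octᴱ.xu o :≡ i₁ :+ j₁ :+ εᵉ :∧
    Octᴱ.yl o :≡ i₀ :- j₁ :- # 2 :∧ Octᴱ.yu o :≡ i₁ :- j₀

  OctOfDia : Oct → ℤ → ℤ → Set
  OctOfDia o a b = Holds (octOfDiaᵉ ⌜ o ⌝ (K a) (K b)) ρ₀

  OctOfBlk : Oct → (i₀ i₁ j₀ j₁ : ℤ) → Set
  OctOfBlk o i₀ i₁ j₀ j₁ = Holds (octOfBlkᵉ ⌜ o ⌝ (K i₀) (K i₁) (K j₀) (K j₁) :∧ K i₀ :≤ K i₁ :∧ K j₀ :≤ K j₁) ρ₀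

  DiaOct BlkOct : Oct → Set
  DiaOct o = ∃ λ a → ∃ λ b → OctOfDia o a b
  BlkOct o = ∃ λ i₀ → ∃ λ i₁ → ∃ λ j₀ → ∃ λ j₁ → OctOfBlk o i₀ i₁ j₀ j₁

  diamond-oct : ∀ tx ty k → tx + ty ≡ + 2 * k + ε → DiaOct (baseOct diamond tx ty)
  diamond-oct tx ty k e = k + + 1 , k - ty - + 1 , liaG 3 (λ tx ty k → tx :+ ty :≡ (+ 2) :* k :+ εᵉ ⊢ octOfDiaᵉ (diamondᴱ tx ty) (k :+ # 1) (k :- ty :- # 1)) tx ty k e

  -- A quarter turn takes the point (i , j) to (j + 1 , 1 - ε - i). The new west corner, which names
  -- the face, is the image of the north corner (a + 1 , b).
  dia-rot : ∀ o → DiaOct o → DiaOct (rotOct o)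
  dia-rot (oct xl xu yl yu sl su dl du) (a , b , h) = b + + 1 , - a - ε , liaG 10 (λ xl xu yl yu sl su dl du a b → let o = octᴱ xl xu yl yu sl su dl du in
    octOfDiaᵉ o a b ⊢ octOfDiaᵉ (rotᴱ o) (b :+ # 1) (neg a :- εᵉ)) xl xu yl yu sl su dl du a b h

  octagon-oct : ∀ p q tx ty k → + 0 ≤ p → + 0 ≤ q → tx + ty ≡ + 2 * k + ε →
    BlkOct (octagonOct p q tx ty)
  octagon-oct p q tx ty k p≥0 q≥0 e = k + + 2 , k + p + + 2 , k - ty - q , k - ty , liaG 5 (λ p q tx ty k → # 0 :≤ p :∧ # 0 :≤ q :∧ tx :+ ty :≡ (+ 2) :* k :+ εᵉ ⊢
    octOfBlkᵉ (octagonᴱ p q tx ty) (k :+ # 2) (k :+ p :+ # 2) (k :- ty :- q) (k :- ty) :∧ k :+ # 2 :≤ k :+ p :+ # 2 :∧ k :- ty :- q :≤ k :- ty)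
    p q tx ty k (p≥0 , q≥0 , e)

  -- The turn (i , j) ↦ (j + 1 , 1 - ε - i) reverses the first coordinate, so the two ends of I
  -- change places.
  blk-rot : ∀ o → BlkOct o → BlkOct (rotOct o)
  blk-rot (oct xl xu yl yu sl su dl du) (i₀ , i₁ , j₀ , j₁ , h) = j₀ + + 1 , j₁ + + 1 , + 1 - ε - i₁ , + 1 - ε - i₀ , liaG 12 (λ xl xu yl yu sl su dl du i₀ i₁ j₀ j₁ →
    let o = octᴱ xl xu yl yu sl su dl du in
    octOfBlkᵉ o i₀ i₁ j₀ j₁ :∧ i₀ :≤ i₁ :∧ j₀ :≤ j₁ ⊢
    octOfBlkᵉ (rotᴱ o) (j₀ :+ # 1) (j₁ :+ # 1) (# 1 :- εᵉ :- i₁) (# 1 :- εᵉ :- i₀) :∧ j₀ :+ # 1 :≤ j₁ :+ # 1 :∧ # 1 :- εᵉ :- i₁ :≤ # 1 :- εᵉ :- i₀)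
    xl xu yl yu sl su dl du i₀ i₁ j₀ j₁ h

  Inside : Tile → Set
  Inside t = ∀ d → inTile t d ≡ true → inR m n d ≡ true

  Classified : Tile → Set
  Classified t = ∃ λ P → Rep t P × Walled P

  dia-rep : ∀ t a b → OctOfDia (tileOct t) a b → Walled (dia a b) → Rep t (dia a b)
  dia-rep t a b o w d@(x , y , _) (quad i j hx hy) hq with tileOct t | inTile-oct t d
  ... | oct xl xu yl yu sl su dl du | to , from =
    (λ e → let (e₁ , e₂ , r) = liaG 18 (λ xl xu yl yu sl su dl du a b x y s d i j hx hy →
                 octOfDiaᵉ (octᴱ xl xu yl yu sl su dl du) a b :∧ walledDiaᵉ a b :∧ quadᵉ x y s d i j hx hy :∧ octᵉ xl xu yl yu sl su dl du x y s d
                 ⊢ i :≡ a :∧ j :≡ b :∧ inRᵉ i j hx hy) xl xu yl yu sl su dl du a b x y (sumFl d) (difFl d) i j hx hy (o , w , hq , to e)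
           in (e₁ , e₂) , r) ,
    λ { ((e₁ , e₂) , r) → from (liaG 18 (λ xl xu yl yu sl su dl du a b x y s d i j hx hy →
                 octOfDiaᵉ (octᴱ xl xu yl yu sl su dl du) a b :∧ quadᵉ x y s d i j hx hy :∧ i :≡ a :∧ j :≡ b
                 ⊢ octᵉ xl xu yl yu sl su dl du x y s d) xl xu yl yu sl su dl du a b x y (sumFl d) (difFl d) i j hx hy (o , hq , e₁ , e₂)) }

  dia-inOct : ∀ o a b d hx hy → OctOfDia o a b → IsQuad d (quad a b hx hy) → InOct o d
  dia-inOct (oct xl xu yl yu sl su dl du) a b d@(x , y , _) hx hy o hq =
    liaG 16 (λ xl xu yl yu sl su dl du a b x y s d hx hy → octOfDiaᵉ (octᴱ xl xu yl yu sl su dl du) a b :∧ quadᵉ x y s d a b hx hy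
      ⊢ octᵉ xl xu yl yu sl su dl du x y s d) xl xu yl yu sl su dl du a b x y (sumFl d) (difFl d) hx hy (o , hq)

  -- The south-western and the north-eastern quad of a face together have all four of its corners,
  -- so it is enough that these two lie in R.
  classify-dia : ∀ t → DiaOct (tileOct t) → Inside t → Classified t
  classify-dia t (a , b , o) ins = dia a b , dia-rep t a b o w , w
    where
    inside : ∀ hx hy → Bits (quad a b hx hy) → InR (quad a b hx hy)
    inside hx hy bs with cellOf (quad a b hx hy) bs
    ... | d , hq = proj₁ (inR-InR d (quad a b hx hy) hq) (ins d (proj₂ (inTile-oct t d) (dia-inOct (tileOct t) a b d hx hy o hq)))
    w : Walled (dia a b)
    w = liaG 2 (λ a b → inRᵉ a b (# 0) (# 0) :∧ inRᵉ a b (# 1) (# 1) ⊢ walledDiaᵉ a b) a b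
      (inside (+ 0) (+ 0) (liaG 0 (⊤ᶠ ⊢ bitsᵉ (# 0) (# 0)) tt) , inside (+ 1) (+ 1) (liaG 0 (⊤ᶠ ⊢ bitsᵉ (# 1) (# 1)) tt))

  blk-inOct : ∀ o i₀ i₁ j₀ j₁ d i j hx hy → OctOfBlk o i₀ i₁ j₀ j₁ →
    IsQuad d (quad i j hx hy) → blk i₀ i₁ j₀ j₁ ∋ quad i j hx hy → InOct o d
  blk-inOct (oct xl xu yl yu sl su dl du) i₀ i₁ j₀ j₁ d@(x , y , _) i j hx hy (o , _) hq hb =
    liaG 20 (λ xl xu yl yu sl su dl du i₀ i₁ j₀ j₁ x y s d i j hx hy →
      octOfBlkᵉ (octᴱ xl xu yl yu sl su dl du) i₀ i₁ j₀ j₁ :∧ quadᵉ x y s d i j hx hy :∧ blkᵉ i₀ i₁ j₀ j₁ i j hx hy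
      ⊢ octᵉ xl xu yl yu sl su dl du x y s d)
      xl xu yl yu sl su dl du i₀ i₁ j₀ j₁ x y (sumFl d) (difFl d) i j hx hy (o , hq , hb)

  -- A tile of this kind is a whole octagon. One extreme quad in each of the four directions lies in
  -- R, and therefore no wall is crossed.
  classify-blk : ∀ t → BlkOct (tileOct t) → Inside t → Classified t
  classify-blk t (i₀ , i₁ , j₀ , j₁ , o@((dg , ex , eX , ey , eY) , sz)) ins = blk i₀ i₁ j₀ j₁ , trace-rep t tr , trace-walled tr
    where
    inside : ∀ i j hx hy → Bits (quad i j hx hy) → blk i₀ i₁ j₀ j₁ ∋ quad i j hx hy → InR (quad i j hx hy)
    inside i j hx hy bs hb with cellOf (quad i j hx hy) bs
    ... | d , hq = proj₁ (inR-InR d (quad i j hx hy) hq)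
      (ins d (proj₂ (inTile-oct t d) (blk-inOct (tileOct t) i₀ i₁ j₀ j₁ d i j hx hy o hq hb)))
    west = inside (i₀ - + 1) (j₀ - + 1) (+ 1) (+ 0) (liaG 0 (⊤ᶠ ⊢ bitsᵉ (# 1) (# 0)) tt)
      (liaG 4 (λ i₀ i₁ j₀ j₁ → i₀ :≤ i₁ :∧ j₀ :≤ j₁ ⊢ blkᵉ i₀ i₁ j₀ j₁ (i₀ :- # 1) (j₀ :- # 1) (# 1) (# 0)) i₀ i₁ j₀ j₁ sz)
    east = inside i₁ j₁ (+ 0) (+ 0) (liaG 0 (⊤ᶠ ⊢ bitsᵉ (# 0) (# 0)) tt)
      (liaG 4 (λ i₀ i₁ j₀ j₁ → i₀ :≤ i₁ :∧ j₀ :≤ j₁ ⊢ blkᵉ i₀ i₁ j₀ j₁ i₁ j₁ (# 0) (# 0)) i₀ i₁ j₀ j₁ sz)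
    south = inside (i₀ - + 1) j₁ (+ 0) (+ 1) (liaG 0 (⊤ᶠ ⊢ bitsᵉ (# 0) (# 1)) tt)
      (liaG 4 (λ i₀ i₁ j₀ j₁ → i₀ :≤ i₁ :∧ j₀ :≤ j₁ ⊢ blkᵉ i₀ i₁ j₀ j₁ (i₀ :- # 1) j₁ (# 0) (# 1)) i₀ i₁ j₀ j₁ sz)
    north = inside i₁ (j₀ - + 1) (+ 0) (+ 0) (liaG 0 (⊤ᶠ ⊢ bitsᵉ (# 0) (# 0)) tt)
      (liaG 4 (λ i₀ i₁ j₀ j₁ → i₀ :≤ i₁ :∧ j₀ :≤ j₁ ⊢ blkᵉ i₀ i₁ j₀ j₁ i₁ (j₀ :- # 1) (# 0) (# 0)) i₀ i₁ j₀ j₁ sz)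
    tr : Trace (tileOct t) i₀ i₁ j₀ j₁
    tr = trace sz dg
      (inj₁ (ey , liaG 2 (λ i₀ j₁ → inRᵉ (i₀ :- # 1) j₁ (# 0) (# 1) ⊢ # 0 :≤ i₀ :- j₁ :- # 2) i₀ j₁ south))
      (inj₁ (eY , liaG 2 (λ i₁ j₀ → inRᵉ i₁ (j₀ :- # 1) (# 0) (# 0) ⊢ i₁ :- j₀ :≤ nᵉ :- # 1) i₁ j₀ north))
      (inj₁ (ex , liaG 2 (λ i₀ j₀ → inRᵉ (i₀ :- # 1) (j₀ :- # 1) (# 1) (# 0) ⊢ # 0 :≤ i₀ :+ j₀ :+ εᵉ :- # 2) i₀ j₀ west))
      (inj₁ (eX , liaG 2 (λ i₁ j₁ → inRᵉ i₁ j₁ (# 0) (# 0) ⊢ i₁ :+ j₁ :+ εᵉ :≤ mᵉ :- # 1) i₁ j₁ east))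

  classify-diamond : ∀ r tx ty k → tx + ty ≡ + 2 * k + ε → Inside (mkTile diamond r tx ty) → Classified (mkTile diamond r tx ty)
  classify-diamond r@0F tx ty k e = classify-dia (mkTile diamond r tx ty)
    (diamond-oct (tx) (ty) (k) (liaG 3 (λ tx ty k → tx :+ ty :≡ (+ 2) :* k :+ εᵉ ⊢ tx :+ ty :≡ (+ 2) :* (k) :+ εᵉ) tx ty k e))
  classify-diamond r@1F tx ty k e = classify-dia (mkTile diamond r tx ty)
    (dia-rot (baseOct diamond (ty) (- tx)) (diamond-oct (ty) (- tx) (ty - k - ε) (liaG 3 (λ tx ty k → tx :+ ty :≡ (+ 2) :* k :+ εᵉ ⊢ ty :+ neg tx :≡ (+ 2) :* (ty :- k :- εᵉ) :+ εᵉ) tx ty k e)))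
  classify-diamond r@2F tx ty k e = classify-dia (mkTile diamond r tx ty)
    (dia-rot (rotOct (baseOct diamond (- tx) (- ty))) (dia-rot (baseOct diamond (- tx) (- ty)) (diamond-oct (- tx) (- ty) (- k - ε) (liaG 3 (λ tx ty k → tx :+ ty :≡ (+ 2) :* k :+ εᵉ ⊢ neg tx :+ neg ty :≡ (+ 2) :* (neg k :- εᵉ) :+ εᵉ) tx ty k e))))
  classify-diamond r@3F tx ty k e = classify-dia (mkTile diamond r tx ty)
    (dia-rot (rotOct (rotOct (baseOct diamond (- ty) (- (- tx))))) (dia-rot (rotOct (baseOct diamond (- ty) (- (- tx)))) (dia-rot (baseOct diamond (- ty) (- (- tx))) (diamond-oct (- ty) (- (- tx)) (k - ty) (liaG 3 (λ tx ty k → tx :+ ty :≡ (+ 2) :* k :+ εᵉ ⊢ neg ty :+ neg (neg tx) :≡ (+ 2) :* (k :- ty) :+ εᵉ) tx ty k e)))))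

  classify-octagon : ∀ sh p q → + 0 ≤ p → + 0 ≤ q → (∀ tx ty → baseOct sh tx ty ≡ octagonOct p q tx ty) →
    ∀ r tx ty k → tx + ty ≡ + 2 * k + ε → Inside (mkTile sh r tx ty) → Classified (mkTile sh r tx ty)
  classify-octagon sh p q p≥0 q≥0 base r@0F tx ty k e = classify-blk (mkTile sh r tx ty)
    (subst (λ o → BlkOct (o)) (sym (base (tx) (ty)))
      (octagon-oct p q (tx) (ty) (k) p≥0 q≥0 (liaG 3 (λ tx ty k → tx :+ ty :≡ (+ 2) :* k :+ εᵉ ⊢ tx :+ ty :≡ (+ 2) :* (k) :+ εᵉ) tx ty k e)))
  classify-octagon sh p q p≥0 q≥0 base r@1F tx ty k e = classify-blk (mkTile sh r tx ty)
    (subst (λ o → BlkOct (rotOct (o))) (sym (base (ty) (- tx)))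
      (blk-rot (octagonOct p q (ty) (- tx)) (octagon-oct p q (ty) (- tx) (ty - k - ε) p≥0 q≥0 (liaG 3 (λ tx ty k → tx :+ ty :≡ (+ 2) :* k :+ εᵉ ⊢ ty :+ neg tx :≡ (+ 2) :* (ty :- k :- εᵉ) :+ εᵉ) tx ty k e))))
  classify-octagon sh p q p≥0 q≥0 base r@2F tx ty k e = classify-blk (mkTile sh r tx ty)
    (subst (λ o → BlkOct (rotOct (rotOct (o)))) (sym (base (- tx) (- ty)))
      (blk-rot (rotOct (octagonOct p q (- tx) (- ty))) (blk-rot (octagonOct p q (- tx) (- ty)) (octagon-oct p q (- tx) (- ty) (- k - ε) p≥0 q≥0 (liaG 3 (λ tx ty k → tx :+ ty :≡ (+ 2) :* k :+ εᵉ ⊢ neg tx :+ neg ty :≡ (+ 2) :* (neg k :- εᵉ) :+ εᵉ) tx ty k e)))))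
  classify-octagon sh p q p≥0 q≥0 base r@3F tx ty k e = classify-blk (mkTile sh r tx ty)
    (subst (λ o → BlkOct (rotOct (rotOct (rotOct (o))))) (sym (base (- ty) (- (- tx))))
      (blk-rot (rotOct (rotOct (octagonOct p q (- ty) (- (- tx))))) (blk-rot (rotOct (octagonOct p q (- ty) (- (- tx)))) (blk-rot (octagonOct p q (- ty) (- (- tx))) (octagon-oct p q (- ty) (- (- tx)) (k - ty) p≥0 q≥0 (liaG 3 (λ tx ty k → tx :+ ty :≡ (+ 2) :* k :+ εᵉ ⊢ neg ty :+ neg (neg tx) :≡ (+ 2) :* (k :- ty) :+ εᵉ) tx ty k e))))))

  ptᵉ : (x y : Expr) → Form
  ptᵉ x y = # 0 :≤ x :∧ x :≤ mᵉ :- # 1 :∧ # 0 :≤ y :∧ y :≤ nᵉ :- # 1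

  inside-cell : ∀ t → Inside t → ∀ d → InOct (tileOct t) d →
    let (x , y , _) = d in Holds (# 0 :≤ K x :∧ K x :+ # 2 :≤ mᵉ :∧ # 0 :≤ K y :∧ K y :+ # 2 :≤ nᵉ) ρ₀
  inside-cell t ins d h =
    let (e₁ , e′) = ∧-true (ins d (proj₂ (inTile-oct t d) h)) ; (e₂ , e″) = ∧-true e′ ; (e₃ , e₄) = ∧-true e″
    in proj₁ (≤ᵇ-true _ _) e₁ , proj₁ (≤ᵇ-true _ _) e₂ , proj₁ (≤ᵇ-true _ _) e₃ , proj₁ (≤ᵇ-true _ _) e₄

  inOctᵉ : Octᴱ → (x y s d : Expr) → Form
  inOctᵉ (octᴱ xl xu yl yu sl su dl du) x y s d = octᵉ xl xu yl yu sl su dl du x y s d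

  -- The direction of the dashed side excludes two sides of R, and a third one would put the cell
  -- `near`, adjacent to the dashed side, outside R. The cell `far`, at the parallel side of the
  -- trapezoid, keeps the octagon away from the opposite wall, and the end points of the dashed side
  -- keep it away from the other two. The indices of the block are read off from the bounds on x + y
  -- and x - y.
  classify-trapezoid : ∀ k′ r tx ty → let t = mkTile (trapezoid k′) r tx ty in
    HasColour c t → All (SegInBoundary m n) (dashedSides t) → Inside t → Classified t
  classify-trapezoid k′ r@0F tx ty (col ∷ _) ((pt , qt , alt) ∷ []) ins with colour-half ((+ 0) + tx) ((+ 0) + ty) col
  ... | k , ek = go alt
    where
    t = mkTile (trapezoid k′) r tx ty
    a = + suc k′
    near = inside-cell t ins (tx , ty , 0F) (lia 3 (λ a tx ty → # 1 :≤ a ⊢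
        inOctᵉ (trapezoidᴱ a (tx) (ty)) (tx) (ty) (tx :+ (ty) :+ # 0) (tx :- (ty) :- # 0)) a tx ty 1≤suc)
    far = inside-cell t ins (tx + a , ty + a - + 1 , 0F) (lia 3 (λ a tx ty → # 1 :≤ a ⊢
        inOctᵉ (trapezoidᴱ a (tx) (ty)) (tx :+ a) (ty :+ a :- # 1) (tx :+ a :+ (ty :+ a :- # 1) :+ # 0) (tx :+ a :- (ty :+ a :- # 1) :- # 0)) a tx ty 1≤suc)
    go : _ → Classified t
    go (inj₁ (e , e′)) = ⊥-elim (liaG 3 (λ a tx ty → # 1 :≤ a :∧ (# 0) :+ tx :≡ # 0 :∧ ((+ 2) :* a :+ # 2) :+ tx :≡ # 0 ⊢ ⊥ᶠ) a tx ty (1≤suc , e , e′))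
    go (inj₂ (inj₁ (e , e′))) = ⊥-elim (liaG 3 (λ a tx ty → # 1 :≤ a :∧ (# 0) :+ tx :≡ mᵉ :- # 1 :∧ ((+ 2) :* a :+ # 2) :+ tx :≡ mᵉ :- # 1 ⊢ ⊥ᶠ) a tx ty (1≤suc , e , e′))
    go (inj₂ (inj₂ (inj₂ (e , e′)))) = ⊥-elim (liaG 2 (λ tx ty → (# 0 :≤ tx :∧ tx :+ # 2 :≤ mᵉ :∧ # 0 :≤ ty :∧ ty :+ # 2 :≤ nᵉ) :∧ (# 0) :+ ty :≡ nᵉ :- # 1 ⊢ ⊥ᶠ) tx ty (near , e))
    go (inj₂ (inj₂ (inj₁ (e , e′)))) =
      let (sz , dg , bo , to , le , ri) = liaG 4 (λ a k tx ty → let o = trapezoidᴱ a (tx) (ty) in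
            # 1 :≤ a :∧ (# 0) :+ tx :+ ((# 0) :+ ty) :≡ (+ 2) :* k :+ εᵉ :∧ (# 0) :+ ty :≡ # 0 :∧ ptᵉ ((# 0) :+ tx) ((# 0) :+ ty) :∧ ptᵉ (((+ 2) :* a :+ # 2) :+ tx) ((# 0) :+ ty) :∧ (# 0 :≤ tx :+ a :∧ tx :+ a :+ # 2 :≤ mᵉ :∧ # 0 :≤ ty :+ a :- # 1 :∧ ty :+ a :- # 1 :+ # 2 :≤ nᵉ) ⊢
            (k :+ # 1 :≤ k :+ a :+ # 1 :∧ k :+ # 1 :≤ k :+ a :+ # 1) :∧ diagᵉ o (k :+ # 1) (k :+ a :+ # 1) (k :+ # 1) (k :+ a :+ # 1) :∧ bSᵉ o (k :+ # 1) (k :+ a :+ # 1) (k :+ # 1) (k :+ a :+ # 1) :∧ tNᵉ o (k :+ # 1) (k :+ a :+ # 1) (k :+ # 1) (k :+ a :+ # 1) :∧ lNᵉ o (k :+ # 1) (k :+ a :+ # 1) (k :+ # 1) (k :+ a :+ # 1) :∧ rNᵉ o (k :+ # 1) (k :+ a :+ # 1) (k :+ # 1) (k :+ a :+ # 1))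
            a k tx ty (1≤suc , ek , e , pt , qt , far)
          tr = trace sz dg (inj₂ bo) (inj₁ to) (inj₁ le) (inj₁ ri)
      in blk (k + + 1) (k + a + + 1) (k + + 1) (k + a + + 1) , trace-rep t tr , trace-walled tr
  classify-trapezoid k′ r@1F tx ty (col ∷ _) ((pt , qt , alt) ∷ []) ins with colour-half (- (+ 0) + tx) ((+ 0) + ty) col
  ... | k , ek = go alt
    where
    t = mkTile (trapezoid k′) r tx ty
    a = + suc k′
    near = inside-cell t ins (tx - + 1 , ty , 1F) (lia 3 (λ a tx ty → # 1 :≤ a ⊢
        inOctᵉ (rotᴱ (trapezoidᴱ a (ty) (neg tx))) (tx :- # 1) (ty) (tx :- # 1 :+ (ty) :+ # 1) (tx :- # 1 :- (ty) :- # 0)) a tx ty 1≤suc)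
    far = inside-cell t ins (tx - a , ty + a , 1F) (lia 3 (λ a tx ty → # 1 :≤ a ⊢
        inOctᵉ (rotᴱ (trapezoidᴱ a (ty) (neg tx))) (tx :- a) (ty :+ a) (tx :- a :+ (ty :+ a) :+ # 1) (tx :- a :- (ty :+ a) :- # 0)) a tx ty 1≤suc)
    go : _ → Classified t
    go (inj₂ (inj₂ (inj₁ (e , e′)))) = ⊥-elim (liaG 3 (λ a tx ty → # 1 :≤ a :∧ (# 0) :+ ty :≡ # 0 :∧ ((+ 2) :* a :+ # 2) :+ ty :≡ # 0 ⊢ ⊥ᶠ) a tx ty (1≤suc , e , e′))
    go (inj₂ (inj₂ (inj₂ (e , e′)))) = ⊥-elim (liaG 3 (λ a tx ty → # 1 :≤ a :∧ (# 0) :+ ty :≡ nᵉ :- # 1 :∧ ((+ 2) :* a :+ # 2) :+ ty :≡ nᵉ :- # 1 ⊢ ⊥ᶠ) a tx ty (1≤suc , e , e′))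
    go (inj₁ (e , e′)) = ⊥-elim (liaG 2 (λ tx ty → (# 0 :≤ tx :- # 1 :∧ tx :- # 1 :+ # 2 :≤ mᵉ :∧ # 0 :≤ ty :∧ ty :+ # 2 :≤ nᵉ) :∧ neg (# 0) :+ tx :≡ # 0 ⊢ ⊥ᶠ) tx ty (near , e))
    go (inj₂ (inj₁ (e , e′))) =
      let (sz , dg , bo , to , le , ri) = liaG 4 (λ a k tx ty → let o = rotᴱ (trapezoidᴱ a (ty) (neg tx)) in
            # 1 :≤ a :∧ neg (# 0) :+ tx :+ ((# 0) :+ ty) :≡ (+ 2) :* k :+ εᵉ :∧ neg (# 0) :+ tx :≡ mᵉ :- # 1 :∧ ptᵉ (neg (# 0) :+ tx) ((# 0) :+ ty) :∧ ptᵉ (neg (# 0) :+ tx) (((+ 2) :* a :+ # 2) :+ ty) :∧ (# 0 :≤ tx :- a :∧ tx :- a :+ # 2 :≤ mᵉ :∧ # 0 :≤ ty :+ a :∧ ty :+ a :+ # 2 :≤ nᵉ) ⊢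
            (k :+ # 2 :≤ k :+ a :+ # 2 :∧ k :- ty :- a :≤ k :- ty) :∧ diagᵉ o (k :+ # 2) (k :+ a :+ # 2) (k :- ty :- a) (k :- ty) :∧ bNᵉ o (k :+ # 2) (k :+ a :+ # 2) (k :- ty :- a) (k :- ty) :∧ tNᵉ o (k :+ # 2) (k :+ a :+ # 2) (k :- ty :- a) (k :- ty) :∧ lNᵉ o (k :+ # 2) (k :+ a :+ # 2) (k :- ty :- a) (k :- ty) :∧ rSᵉ o (k :+ # 2) (k :+ a :+ # 2) (k :- ty :- a) (k :- ty))
            a k tx ty (1≤suc , ek , e , pt , qt , far)
          tr = trace sz dg (inj₁ bo) (inj₁ to) (inj₁ le) (inj₂ ri)
      in blk (k + + 2) (k + a + + 2) (k - ty - a) (k - ty) , trace-rep t tr , trace-walled tr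
  classify-trapezoid k′ r@2F tx ty (col ∷ _) ((pt , qt , alt) ∷ []) ins with colour-half (- (+ 0) + tx) (- (+ 0) + ty) col
  ... | k , ek = go alt
    where
    t = mkTile (trapezoid k′) r tx ty
    a = + suc k′
    near = inside-cell t ins (tx - + 1 , ty - + 1 , 2F) (lia 3 (λ a tx ty → # 1 :≤ a ⊢
        inOctᵉ (rotᴱ (rotᴱ (trapezoidᴱ a (neg tx) (neg ty)))) (tx :- # 1) (ty :- # 1) (tx :- # 1 :+ (ty :- # 1) :+ # 1) (tx :- # 1 :- (ty :- # 1) :- # 1)) a tx ty 1≤suc)
    far = inside-cell t ins (tx - a - + 1 , ty - a , 2F) (lia 3 (λ a tx ty → # 1 :≤ a ⊢
        inOctᵉ (rotᴱ (rotᴱ (trapezoidᴱ a (neg tx) (neg ty)))) (tx :- a :- # 1) (ty :- a) (tx :- a :- # 1 :+ (ty :- a) :+ # 1) (tx :- a :- # 1 :- (ty :- a) :- # 1)) a tx ty 1≤suc)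
    go : _ → Classified t
    go (inj₁ (e , e′)) = ⊥-elim (liaG 3 (λ a tx ty → # 1 :≤ a :∧ neg (# 0) :+ tx :≡ # 0 :∧ neg ((+ 2) :* a :+ # 2) :+ tx :≡ # 0 ⊢ ⊥ᶠ) a tx ty (1≤suc , e , e′))
    go (inj₂ (inj₁ (e , e′))) = ⊥-elim (liaG 3 (λ a tx ty → # 1 :≤ a :∧ neg (# 0) :+ tx :≡ mᵉ :- # 1 :∧ neg ((+ 2) :* a :+ # 2) :+ tx :≡ mᵉ :- # 1 ⊢ ⊥ᶠ) a tx ty (1≤suc , e , e′))
    go (inj₂ (inj₂ (inj₁ (e , e′)))) = ⊥-elim (liaG 2 (λ tx ty → (# 0 :≤ tx :- # 1 :∧ tx :- # 1 :+ # 2 :≤ mᵉ :∧ # 0 :≤ ty :- # 1 :∧ ty :- # 1 :+ # 2 :≤ nᵉ) :∧ neg (# 0) :+ ty :≡ # 0 ⊢ ⊥ᶠ) tx ty (near , e))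
    go (inj₂ (inj₂ (inj₂ (e , e′)))) =
      let (sz , dg , bo , to , le , ri) = liaG 4 (λ a k tx ty → let o = rotᴱ (rotᴱ (trapezoidᴱ a (neg tx) (neg ty))) in
            # 1 :≤ a :∧ neg (# 0) :+ tx :+ (neg (# 0) :+ ty) :≡ (+ 2) :* k :+ εᵉ :∧ neg (# 0) :+ ty :≡ nᵉ :- # 1 :∧ ptᵉ (neg (# 0) :+ tx) (neg (# 0) :+ ty) :∧ ptᵉ (neg ((+ 2) :* a :+ # 2) :+ tx) (neg (# 0) :+ ty) :∧ (# 0 :≤ tx :- a :- # 1 :∧ tx :- a :- # 1 :+ # 2 :≤ mᵉ :∧ # 0 :≤ ty :- a :∧ ty :- a :+ # 2 :≤ nᵉ) ⊢
            (k :- a :+ # 1 :≤ k :+ # 1 :∧ k :- ty :- a :- # 1 :≤ k :- ty :- # 1) :∧ diagᵉ o (k :- a :+ # 1) (k :+ # 1) (k :- ty :- a :- # 1) (k :- ty :- # 1) :∧ bNᵉ o (k :- a :+ # 1) (k :+ # 1) (k :- ty :- a :- # 1) (k :- ty :- # 1) :∧ tSᵉ o (k :- a :+ # 1) (k :+ # 1) (k :- ty :- a :- # 1) (k :- ty :- # 1) :∧ lNᵉ o (k :- a :+ # 1) (k :+ # 1) (k :- ty :- a :- # 1) (k :- ty :- # 1) :∧ rNᵉ o (k :- a :+ # 1) (k :+ # 1) (k :- ty :- a :- # 1) (k :- ty :- # 1))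
            a k tx ty (1≤suc , ek , e , pt , qt , far)
          tr = trace sz dg (inj₁ bo) (inj₂ to) (inj₁ le) (inj₁ ri)
      in blk (k - a + + 1) (k + + 1) (k - ty - a - + 1) (k - ty - + 1) , trace-rep t tr , trace-walled tr
  classify-trapezoid k′ r@3F tx ty (col ∷ _) ((pt , qt , alt) ∷ []) ins with colour-half (- (- (+ 0)) + tx) (- (+ 0) + ty) col
  ... | k , ek = go alt
    where
    t = mkTile (trapezoid k′) r tx ty
    a = + suc k′
    near = inside-cell t ins (tx , ty - + 1 , 3F) (lia 3 (λ a tx ty → # 1 :≤ a ⊢
        inOctᵉ (rotᴱ (rotᴱ (rotᴱ (trapezoidᴱ a (neg ty) (neg (neg tx)))))) (tx) (ty :- # 1) (tx :+ (ty :- # 1) :+ # 0) (tx :- (ty :- # 1) :- # 1)) a tx ty 1≤suc)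
    far = inside-cell t ins (tx + a - + 1 , ty - a - + 1 , 3F) (lia 3 (λ a tx ty → # 1 :≤ a ⊢
        inOctᵉ (rotᴱ (rotᴱ (rotᴱ (trapezoidᴱ a (neg ty) (neg (neg tx)))))) (tx :+ a :- # 1) (ty :- a :- # 1) (tx :+ a :- # 1 :+ (ty :- a :- # 1) :+ # 0) (tx :+ a :- # 1 :- (ty :- a :- # 1) :- # 1)) a tx ty 1≤suc)
    go : _ → Classified t
    go (inj₂ (inj₂ (inj₁ (e , e′)))) = ⊥-elim (liaG 3 (λ a tx ty → # 1 :≤ a :∧ neg (# 0) :+ ty :≡ # 0 :∧ neg ((+ 2) :* a :+ # 2) :+ ty :≡ # 0 ⊢ ⊥ᶠ) a tx ty (1≤suc , e , e′))
    go (inj₂ (inj₂ (inj₂ (e , e′)))) = ⊥-elim (liaG 3 (λ a tx ty → # 1 :≤ a :∧ neg (# 0) :+ ty :≡ nᵉ :- # 1 :∧ neg ((+ 2) :* a :+ # 2) :+ ty :≡ nᵉ :- # 1 ⊢ ⊥ᶠ) a tx ty (1≤suc , e , e′))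
    go (inj₂ (inj₁ (e , e′))) = ⊥-elim (liaG 2 (λ tx ty → (# 0 :≤ tx :∧ tx :+ # 2 :≤ mᵉ :∧ # 0 :≤ ty :- # 1 :∧ ty :- # 1 :+ # 2 :≤ nᵉ) :∧ neg (neg (# 0)) :+ tx :≡ mᵉ :- # 1 ⊢ ⊥ᶠ) tx ty (near , e))
    go (inj₁ (e , e′)) =
      let (sz , dg , bo , to , le , ri) = liaG 4 (λ a k tx ty → let o = rotᴱ (rotᴱ (rotᴱ (trapezoidᴱ a (neg ty) (neg (neg tx))))) in
            # 1 :≤ a :∧ neg (neg (# 0)) :+ tx :+ (neg (# 0) :+ ty) :≡ (+ 2) :* k :+ εᵉ :∧ neg (neg (# 0)) :+ tx :≡ # 0 :∧ ptᵉ (neg (neg (# 0)) :+ tx) (neg (# 0) :+ ty) :∧ ptᵉ (neg (neg (# 0)) :+ tx) (neg ((+ 2) :* a :+ # 2) :+ ty) :∧ (# 0 :≤ tx :+ a :- # 1 :∧ tx :+ a :- # 1 :+ # 2 :≤ mᵉ :∧ # 0 :≤ ty :- a :- # 1 :∧ ty :- a :- # 1 :+ # 2 :≤ nᵉ) ⊢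
            (k :- a :≤ k :∧ k :- ty :≤ k :- ty :+ a) :∧ diagᵉ o (k :- a) (k) (k :- ty) (k :- ty :+ a) :∧ bNᵉ o (k :- a) (k) (k :- ty) (k :- ty :+ a) :∧ tNᵉ o (k :- a) (k) (k :- ty) (k :- ty :+ a) :∧ lSᵉ o (k :- a) (k) (k :- ty) (k :- ty :+ a) :∧ rNᵉ o (k :- a) (k) (k :- ty) (k :- ty :+ a))
            a k tx ty (1≤suc , ek , e , pt , qt , far)
          tr = trace sz dg (inj₁ bo) (inj₁ to) (inj₂ le) (inj₁ ri)
      in blk (k - a) (k) (k - ty) (k - ty + a) , trace-rep t tr , trace-walled tr

  -- Each leg is confined to one side of R by its direction and by the cell `near` at the right
  -- angle. So the right angle sits in a corner of R, and the octagon is symmetric about both walls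
  -- next to that corner.
  classify-triangle : ∀ k′ r tx ty → let t = mkTile (triangle k′) r tx ty in
    HasColour c t → All (SegInBoundary m n) (dashedSides t) → Inside t → Classified t
  classify-triangle k′ r@0F tx ty (col ∷ _) ((pt₁ , qt₁ , alt₁) ∷ (pt₂ , qt₂ , alt₂) ∷ []) ins with colour-half ((+ suc k′) + tx) ((+ 0) + ty) col
  ... | k , ek =
      let (sz , dg , bo , to , le , ri) = liaG 4 (λ a k tx ty → let o = triangleᴱ a (tx) (ty) in
            # 1 :≤ a :∧ a :+ tx :+ ((# 0) :+ ty) :≡ (+ 2) :* k :+ εᵉ :∧ (# 0) :+ tx :≡ # 0 :∧ (# 0) :+ ty :≡ # 0 :∧ ptᵉ (a :+ tx) ((# 0) :+ ty) :∧ ptᵉ ((# 0) :+ tx) (a :+ ty) ⊢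
            (neg εᵉ :- k :≤ k :∧ neg εᵉ :- k :≤ k) :∧ diagᵉ o (neg εᵉ :- k) (k) (neg εᵉ :- k) (k) :∧ bSᵉ o (neg εᵉ :- k) (k) (neg εᵉ :- k) (k) :∧ tNᵉ o (neg εᵉ :- k) (k) (neg εᵉ :- k) (k) :∧ lSᵉ o (neg εᵉ :- k) (k) (neg εᵉ :- k) (k) :∧ rNᵉ o (neg εᵉ :- k) (k) (neg εᵉ :- k) (k))
            a k tx ty (1≤suc , ek , eqX alt₂ , eqY alt₁ , qt₁ , qt₂)
          tr = trace sz dg (inj₂ bo) (inj₁ to) (inj₂ le) (inj₁ ri)
      in blk (- ε - k) (k) (- ε - k) (k) , trace-rep t tr , trace-walled tr
    where
    t = mkTile (triangle k′) r tx ty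
    a = + suc k′
    near = inside-cell t ins (tx , ty , 0F) (lia 3 (λ a tx ty → # 1 :≤ a ⊢
        inOctᵉ (triangleᴱ a (tx) (ty)) (tx) (ty) (tx :+ (ty) :+ # 0) (tx :- (ty) :- # 0)) a tx ty 1≤suc)
    eqX : _ → (+ 0) + tx ≡ + 0
    eqX (inj₁ (e , e′)) = e
    eqX (inj₂ (inj₁ (e , e′))) = ⊥-elim (liaG 2 (λ tx ty → (# 0 :≤ tx :∧ tx :+ # 2 :≤ mᵉ :∧ # 0 :≤ ty :∧ ty :+ # 2 :≤ nᵉ) :∧ (# 0) :+ tx :≡ mᵉ :- # 1 ⊢ ⊥ᶠ) tx ty (near , e))
    eqX (inj₂ (inj₂ (inj₁ (e , e′)))) = ⊥-elim (liaG 3 (λ a tx ty → # 1 :≤ a :∧ (# 0) :+ ty :≡ # 0 :∧ a :+ ty :≡ # 0 ⊢ ⊥ᶠ) a tx ty (1≤suc , e , e′))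
    eqX (inj₂ (inj₂ (inj₂ (e , e′)))) = ⊥-elim (liaG 3 (λ a tx ty → # 1 :≤ a :∧ (# 0) :+ ty :≡ nᵉ :- # 1 :∧ a :+ ty :≡ nᵉ :- # 1 ⊢ ⊥ᶠ) a tx ty (1≤suc , e , e′))
    eqY : _ → (+ 0) + ty ≡ + 0
    eqY (inj₁ (e , e′)) = ⊥-elim (liaG 3 (λ a tx ty → # 1 :≤ a :∧ (# 0) :+ tx :≡ # 0 :∧ a :+ tx :≡ # 0 ⊢ ⊥ᶠ) a tx ty (1≤suc , e , e′))
    eqY (inj₂ (inj₁ (e , e′))) = ⊥-elim (liaG 3 (λ a tx ty → # 1 :≤ a :∧ (# 0) :+ tx :≡ mᵉ :- # 1 :∧ a :+ tx :≡ mᵉ :- # 1 ⊢ ⊥ᶠ) a tx ty (1≤suc , e , e′))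
    eqY (inj₂ (inj₂ (inj₁ (e , e′)))) = e
    eqY (inj₂ (inj₂ (inj₂ (e , e′)))) = ⊥-elim (liaG 2 (λ tx ty → (# 0 :≤ tx :∧ tx :+ # 2 :≤ mᵉ :∧ # 0 :≤ ty :∧ ty :+ # 2 :≤ nᵉ) :∧ (# 0) :+ ty :≡ nᵉ :- # 1 ⊢ ⊥ᶠ) tx ty (near , e))
  classify-triangle k′ r@1F tx ty (col ∷ _) ((pt₁ , qt₁ , alt₁) ∷ (pt₂ , qt₂ , alt₂) ∷ []) ins with colour-half (- (+ 0) + tx) ((+ suc k′) + ty) col
  ... | k , ek =
      let (sz , dg , bo , to , le , ri) = liaG 4 (λ a k tx ty → let o = rotᴱ (triangleᴱ a (ty) (neg tx)) in
            # 1 :≤ a :∧ neg (# 0) :+ tx :+ (a :+ ty) :≡ (+ 2) :* k :+ εᵉ :∧ neg (# 0) :+ tx :≡ mᵉ :- # 1 :∧ (# 0) :+ ty :≡ # 0 :∧ ptᵉ (neg (# 0) :+ tx) (a :+ ty) :∧ ptᵉ (neg a :+ tx) ((# 0) :+ ty) ⊢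
            (k :- a :+ # 1 :≤ k :+ # 1 :∧ k :- a :- ty :+ # 1 :≤ k :- ty :+ # 1) :∧ diagᵉ o (k :- a :+ # 1) (k :+ # 1) (k :- a :- ty :+ # 1) (k :- ty :+ # 1) :∧ bSᵉ o (k :- a :+ # 1) (k :+ # 1) (k :- a :- ty :+ # 1) (k :- ty :+ # 1) :∧ tNᵉ o (k :- a :+ # 1) (k :+ # 1) (k :- a :- ty :+ # 1) (k :- ty :+ # 1) :∧ lNᵉ o (k :- a :+ # 1) (k :+ # 1) (k :- a :- ty :+ # 1) (k :- ty :+ # 1) :∧ rSᵉ o (k :- a :+ # 1) (k :+ # 1) (k :- a :- ty :+ # 1) (k :- ty :+ # 1))
            a k tx ty (1≤suc , ek , eqX alt₁ , eqY alt₂ , qt₁ , qt₂)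
          tr = trace sz dg (inj₂ bo) (inj₁ to) (inj₁ le) (inj₂ ri)
      in blk (k - a + + 1) (k + + 1) (k - a - ty + + 1) (k - ty + + 1) , trace-rep t tr , trace-walled tr
    where
    t = mkTile (triangle k′) r tx ty
    a = + suc k′
    near = inside-cell t ins (tx - + 1 , ty , 1F) (lia 3 (λ a tx ty → # 1 :≤ a ⊢
        inOctᵉ (rotᴱ (triangleᴱ a (ty) (neg tx))) (tx :- # 1) (ty) (tx :- # 1 :+ (ty) :+ # 1) (tx :- # 1 :- (ty) :- # 0)) a tx ty 1≤suc)
    eqX : _ → - (+ 0) + tx ≡ + m - + 1
    eqX (inj₁ (e , e′)) = ⊥-elim (liaG 2 (λ tx ty → (# 0 :≤ tx :- # 1 :∧ tx :- # 1 :+ # 2 :≤ mᵉ :∧ # 0 :≤ ty :∧ ty :+ # 2 :≤ nᵉ) :∧ neg (# 0) :+ tx :≡ # 0 ⊢ ⊥ᶠ) tx ty (near , e))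
    eqX (inj₂ (inj₁ (e , e′))) = e
    eqX (inj₂ (inj₂ (inj₁ (e , e′)))) = ⊥-elim (liaG 3 (λ a tx ty → # 1 :≤ a :∧ (# 0) :+ ty :≡ # 0 :∧ a :+ ty :≡ # 0 ⊢ ⊥ᶠ) a tx ty (1≤suc , e , e′))
    eqX (inj₂ (inj₂ (inj₂ (e , e′)))) = ⊥-elim (liaG 3 (λ a tx ty → # 1 :≤ a :∧ (# 0) :+ ty :≡ nᵉ :- # 1 :∧ a :+ ty :≡ nᵉ :- # 1 ⊢ ⊥ᶠ) a tx ty (1≤suc , e , e′))
    eqY : _ → (+ 0) + ty ≡ + 0
    eqY (inj₁ (e , e′)) = ⊥-elim (liaG 3 (λ a tx ty → # 1 :≤ a :∧ neg (# 0) :+ tx :≡ # 0 :∧ neg a :+ tx :≡ # 0 ⊢ ⊥ᶠ) a tx ty (1≤suc , e , e′))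
    eqY (inj₂ (inj₁ (e , e′))) = ⊥-elim (liaG 3 (λ a tx ty → # 1 :≤ a :∧ neg (# 0) :+ tx :≡ mᵉ :- # 1 :∧ neg a :+ tx :≡ mᵉ :- # 1 ⊢ ⊥ᶠ) a tx ty (1≤suc , e , e′))
    eqY (inj₂ (inj₂ (inj₁ (e , e′)))) = e
    eqY (inj₂ (inj₂ (inj₂ (e , e′)))) = ⊥-elim (liaG 2 (λ tx ty → (# 0 :≤ tx :- # 1 :∧ tx :- # 1 :+ # 2 :≤ mᵉ :∧ # 0 :≤ ty :∧ ty :+ # 2 :≤ nᵉ) :∧ (# 0) :+ ty :≡ nᵉ :- # 1 ⊢ ⊥ᶠ) tx ty (near , e))
  classify-triangle k′ r@2F tx ty (col ∷ _) ((pt₁ , qt₁ , alt₁) ∷ (pt₂ , qt₂ , alt₂) ∷ []) ins with colour-half (- (+ suc k′) + tx) (- (+ 0) + ty) col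
  ... | k , ek =
      let (sz , dg , bo , to , le , ri) = liaG 4 (λ a k tx ty → let o = rotᴱ (rotᴱ (triangleᴱ a (neg tx) (neg ty))) in
            # 1 :≤ a :∧ neg a :+ tx :+ (neg (# 0) :+ ty) :≡ (+ 2) :* k :+ εᵉ :∧ neg (# 0) :+ tx :≡ mᵉ :- # 1 :∧ neg (# 0) :+ ty :≡ nᵉ :- # 1 :∧ ptᵉ (neg a :+ tx) (neg (# 0) :+ ty) :∧ ptᵉ (neg (# 0) :+ tx) (neg a :+ ty) ⊢
            (k :+ # 2 :≤ k :+ a :+ # 2 :∧ k :- ty :≤ k :+ a :- ty) :∧ diagᵉ o (k :+ # 2) (k :+ a :+ # 2) (k :- ty) (k :+ a :- ty) :∧ bNᵉ o (k :+ # 2) (k :+ a :+ # 2) (k :- ty) (k :+ a :- ty) :∧ tSᵉ o (k :+ # 2) (k :+ a :+ # 2) (k :- ty) (k :+ a :- ty) :∧ lNᵉ o (k :+ # 2) (k :+ a :+ # 2) (k :- ty) (k :+ a :- ty) :∧ rSᵉ o (k :+ # 2) (k :+ a :+ # 2) (k :- ty) (k :+ a :- ty))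
            a k tx ty (1≤suc , ek , eqX alt₂ , eqY alt₁ , qt₁ , qt₂)
          tr = trace sz dg (inj₁ bo) (inj₂ to) (inj₁ le) (inj₂ ri)
      in blk (k + + 2) (k + a + + 2) (k - ty) (k + a - ty) , trace-rep t tr , trace-walled tr
    where
    t = mkTile (triangle k′) r tx ty
    a = + suc k′
    near = inside-cell t ins (tx - + 1 , ty - + 1 , 2F) (lia 3 (λ a tx ty → # 1 :≤ a ⊢
        inOctᵉ (rotᴱ (rotᴱ (triangleᴱ a (neg tx) (neg ty)))) (tx :- # 1) (ty :- # 1) (tx :- # 1 :+ (ty :- # 1) :+ # 1) (tx :- # 1 :- (ty :- # 1) :- # 1)) a tx ty 1≤suc)
    eqX : _ → - (+ 0) + tx ≡ + m - + 1
    eqX (inj₁ (e , e′)) = ⊥-elim (liaG 2 (λ tx ty → (# 0 :≤ tx :- # 1 :∧ tx :- # 1 :+ # 2 :≤ mᵉ :∧ # 0 :≤ ty :- # 1 :∧ ty :- # 1 :+ # 2 :≤ nᵉ) :∧ neg (# 0) :+ tx :≡ # 0 ⊢ ⊥ᶠ) tx ty (near , e))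
    eqX (inj₂ (inj₁ (e , e′))) = e
    eqX (inj₂ (inj₂ (inj₁ (e , e′)))) = ⊥-elim (liaG 3 (λ a tx ty → # 1 :≤ a :∧ neg (# 0) :+ ty :≡ # 0 :∧ neg a :+ ty :≡ # 0 ⊢ ⊥ᶠ) a tx ty (1≤suc , e , e′))
    eqX (inj₂ (inj₂ (inj₂ (e , e′)))) = ⊥-elim (liaG 3 (λ a tx ty → # 1 :≤ a :∧ neg (# 0) :+ ty :≡ nᵉ :- # 1 :∧ neg a :+ ty :≡ nᵉ :- # 1 ⊢ ⊥ᶠ) a tx ty (1≤suc , e , e′))
    eqY : _ → - (+ 0) + ty ≡ + n - + 1
    eqY (inj₁ (e , e′)) = ⊥-elim (liaG 3 (λ a tx ty → # 1 :≤ a :∧ neg (# 0) :+ tx :≡ # 0 :∧ neg a :+ tx :≡ # 0 ⊢ ⊥ᶠ) a tx ty (1≤suc , e , e′))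
    eqY (inj₂ (inj₁ (e , e′))) = ⊥-elim (liaG 3 (λ a tx ty → # 1 :≤ a :∧ neg (# 0) :+ tx :≡ mᵉ :- # 1 :∧ neg a :+ tx :≡ mᵉ :- # 1 ⊢ ⊥ᶠ) a tx ty (1≤suc , e , e′))
    eqY (inj₂ (inj₂ (inj₁ (e , e′)))) = ⊥-elim (liaG 2 (λ tx ty → (# 0 :≤ tx :- # 1 :∧ tx :- # 1 :+ # 2 :≤ mᵉ :∧ # 0 :≤ ty :- # 1 :∧ ty :- # 1 :+ # 2 :≤ nᵉ) :∧ neg (# 0) :+ ty :≡ # 0 ⊢ ⊥ᶠ) tx ty (near , e))
    eqY (inj₂ (inj₂ (inj₂ (e , e′)))) = e
  classify-triangle k′ r@3F tx ty (col ∷ _) ((pt₁ , qt₁ , alt₁) ∷ (pt₂ , qt₂ , alt₂) ∷ []) ins with colour-half (- (- (+ 0)) + tx) (- (+ suc k′) + ty) col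
  ... | k , ek =
      let (sz , dg , bo , to , le , ri) = liaG 4 (λ a k tx ty → let o = rotᴱ (rotᴱ (rotᴱ (triangleᴱ a (neg ty) (neg (neg tx))))) in
            # 1 :≤ a :∧ neg (neg (# 0)) :+ tx :+ (neg a :+ ty) :≡ (+ 2) :* k :+ εᵉ :∧ neg (neg (# 0)) :+ tx :≡ # 0 :∧ neg (# 0) :+ ty :≡ nᵉ :- # 1 :∧ ptᵉ (neg (neg (# 0)) :+ tx) (neg a :+ ty) :∧ ptᵉ (neg (neg a) :+ tx) (neg (# 0) :+ ty) ⊢
            (k :+ # 1 :≤ k :+ a :+ # 1 :∧ k :- ty :- # 1 :≤ k :+ a :- ty :- # 1) :∧ diagᵉ o (k :+ # 1) (k :+ a :+ # 1) (k :- ty :- # 1) (k :+ a :- ty :- # 1) :∧ bNᵉ o (k :+ # 1) (k :+ a :+ # 1) (k :- ty :- # 1) (k :+ a :- ty :- # 1) :∧ tSᵉ o (k :+ # 1) (k :+ a :+ # 1) (k :- ty :- # 1) (k :+ a :- ty :- # 1) :∧ lSᵉ o (k :+ # 1) (k :+ a :+ # 1) (k :- ty :- # 1) (k :+ a :- ty :- # 1) :∧ rNᵉ o (k :+ # 1) (k :+ a :+ # 1) (k :- ty :- # 1) (k :+ a :- ty :- # 1))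
            a k tx ty (1≤suc , ek , eqX alt₁ , eqY alt₂ , qt₁ , qt₂)
          tr = trace sz dg (inj₁ bo) (inj₂ to) (inj₂ le) (inj₁ ri)
      in blk (k + + 1) (k + a + + 1) (k - ty - + 1) (k + a - ty - + 1) , trace-rep t tr , trace-walled tr
    where
    t = mkTile (triangle k′) r tx ty
    a = + suc k′
    near = inside-cell t ins (tx , ty - + 1 , 3F) (lia 3 (λ a tx ty → # 1 :≤ a ⊢
        inOctᵉ (rotᴱ (rotᴱ (rotᴱ (triangleᴱ a (neg ty) (neg (neg tx)))))) (tx) (ty :- # 1) (tx :+ (ty :- # 1) :+ # 0) (tx :- (ty :- # 1) :- # 1)) a tx ty 1≤suc)
    eqX : _ → - (- (+ 0)) + tx ≡ + 0
    eqX (inj₁ (e , e′)) = e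
    eqX (inj₂ (inj₁ (e , e′))) = ⊥-elim (liaG 2 (λ tx ty → (# 0 :≤ tx :∧ tx :+ # 2 :≤ mᵉ :∧ # 0 :≤ ty :- # 1 :∧ ty :- # 1 :+ # 2 :≤ nᵉ) :∧ neg (neg (# 0)) :+ tx :≡ mᵉ :- # 1 ⊢ ⊥ᶠ) tx ty (near , e))
    eqX (inj₂ (inj₂ (inj₁ (e , e′)))) = ⊥-elim (liaG 3 (λ a tx ty → # 1 :≤ a :∧ neg (# 0) :+ ty :≡ # 0 :∧ neg a :+ ty :≡ # 0 ⊢ ⊥ᶠ) a tx ty (1≤suc , e , e′))
    eqX (inj₂ (inj₂ (inj₂ (e , e′)))) = ⊥-elim (liaG 3 (λ a tx ty → # 1 :≤ a :∧ neg (# 0) :+ ty :≡ nᵉ :- # 1 :∧ neg a :+ ty :≡ nᵉ :- # 1 ⊢ ⊥ᶠ) a tx ty (1≤suc , e , e′))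
    eqY : _ → - (+ 0) + ty ≡ + n - + 1
    eqY (inj₁ (e , e′)) = ⊥-elim (liaG 3 (λ a tx ty → # 1 :≤ a :∧ neg (neg (# 0)) :+ tx :≡ # 0 :∧ neg (neg a) :+ tx :≡ # 0 ⊢ ⊥ᶠ) a tx ty (1≤suc , e , e′))
    eqY (inj₂ (inj₁ (e , e′))) = ⊥-elim (liaG 3 (λ a tx ty → # 1 :≤ a :∧ neg (neg (# 0)) :+ tx :≡ mᵉ :- # 1 :∧ neg (neg a) :+ tx :≡ mᵉ :- # 1 ⊢ ⊥ᶠ) a tx ty (1≤suc , e , e′))
    eqY (inj₂ (inj₂ (inj₁ (e , e′)))) = ⊥-elim (liaG 2 (λ tx ty → (# 0 :≤ tx :∧ tx :+ # 2 :≤ mᵉ :∧ # 0 :≤ ty :- # 1 :∧ ty :- # 1 :+ # 2 :≤ nᵉ) :∧ neg (# 0) :+ ty :≡ # 0 ⊢ ⊥ᶠ) tx ty (near , e))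
    eqY (inj₂ (inj₂ (inj₂ (e , e′)))) = e

  place-origin : ∀ sh r tx ty → place (mkTile sh r tx ty) (+ 0 , + 0) ≡ (+ 0 + tx , + 0 + ty)
  place-origin sh 0F tx ty = refl
  place-origin sh 1F tx ty = refl
  place-origin sh 2F tx ty = refl
  place-origin sh 3F tx ty = refl

  origin-half : ∀ sh r tx ty → (let (x , y) = place (mkTile sh r tx ty) (+ 0 , + 0) in colourℤ x y ≡ c) → ∃ λ k → tx + ty ≡ + 2 * k + ε
  origin-half sh r tx ty e =
    let (k , ek) = colour-half (+ 0 + tx) (+ 0 + ty) (subst (λ p → colourℤ (proj₁ p) (proj₂ p) ≡ c) (place-origin sh r tx ty) e)
    in k , liaG 3 (λ tx ty k → # 0 :+ tx :+ (# 0 :+ ty) :≡ (+ 2) :* k :+ εᵉ ⊢ tx :+ ty :≡ (+ 2) :* k :+ εᵉ) tx ty k ek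

  0≤+ : ∀ {k} → + 0 ≤ + k
  0≤+ = ℤ.+≤+ ℕ.z≤n

  classify : ∀ t → HasColour c t → All (SegInBoundary m n) (dashedSides t) → Inside t → Classified t
  classify (mkTile diamond r tx ty) (col ∷ _) _ =
    let (k , e) = origin-half diamond r tx ty col in classify-diamond r tx ty k e
  classify (mkTile square r tx ty) (col ∷ _) _ =
    let (k , e) = origin-half square r tx ty col in classify-octagon square (+ 0) (+ 0) 0≤+ 0≤+ (λ _ _ → refl) r tx ty k e
  classify (mkTile (hexagon l) r tx ty) (col ∷ _) _ =
    let (k , e) = origin-half (hexagon l) r tx ty col in classify-octagon (hexagon l) (+ 0) (+ suc l) 0≤+ 0≤+ (λ _ _ → refl) r tx ty k e
  classify (mkTile (octagon l l′) r tx ty) (col ∷ _) _ =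
    let (k , e) = origin-half (octagon l l′) r tx ty col in classify-octagon (octagon l l′) (+ suc l) (+ suc l′) 0≤+ 0≤+ (λ _ _ → refl) r tx ty k e
  classify (mkTile (trapezoid l) r tx ty) = classify-trapezoid l r tx ty
  classify (mkTile (triangle l) r tx ty) = classify-triangle l r tx ty

  -- From pieces to tiles

  -- The coordinate sum of a vertex changes by an even number under rotations.
  Sum≡ : ℤ → Point → Set
  Sum≡ s (x , y) = ∃ λ k → x + y ≡ + 2 * k + s

  rot90-sum : ∀ s p → Sum≡ s p → Sum≡ s (rot90 p)
  rot90-sum s (x , y) (k , e) = x - k - s , lia 4 (λ x y k s → x :+ y :≡ (+ 2) :* k :+ s ⊢ neg y :+ x :≡ (+ 2) :* (x :- k :- s) :+ s) x y k s e

  rotN-sum : ∀ s r p → Sum≡ s p → Sum≡ s (rotN r p)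
  rotN-sum s zero p h = h
  rotN-sum s (suc r) p h = rot90-sum s (rotN r p) (rotN-sum s r p h)

  place-colour : ∀ sh r tx ty s k → s + tx + ty ≡ + 2 * k + ε → ∀ p → Sum≡ s p →
    colourℤ (proj₁ (place (mkTile sh r tx ty) p)) (proj₂ (place (mkTile sh r tx ty) p)) ≡ c
  place-colour sh r tx ty s k e p h =
    let (x , y) = rotN (toℕ r) p
        (l , e′) = rotN-sum s (toℕ r) p h
    in half-colour (x + tx) (y + ty) (k + l) (liaG 7 (λ x y tx ty s k l → s :+ tx :+ ty :≡ (+ 2) :* k :+ εᵉ :∧ x :+ y :≡ (+ 2) :* l :+ s ⊢
         x :+ tx :+ (y :+ ty) :≡ (+ 2) :* (k :+ l) :+ εᵉ) x y tx ty s k l (e , e′))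

  -- The common value modulo 2 of x + y at the vertices that decide the colour of the base tile.
  shapeSum : Shape → ℤ
  shapeSum (triangle k) = + suc k
  shapeSum _ = + 0

  shape-sums : ∀ sh → All (Sum≡ (shapeSum sh)) (baseColourVertices sh)
  shape-sums square =
    (+ 0 , refl) ∷
    (+ 1 , refl) ∷
    (+ 2 , refl) ∷
    (+ 1 , refl) ∷ []
  shape-sums diamond =
    (+ 0 , refl) ∷
    (+ 1 , refl) ∷
    (+ 1 , refl) ∷
    (+ 0 , refl) ∷ []
  shape-sums (hexagon k) =
    (+ 0 , lia 1 (λ a → ⊤ᶠ ⊢ # 0 :+ (# 0) :≡ (+ 2) :* (# 0) :+ # 0) (+ suc k) tt) ∷
    (+ 1 , lia 1 (λ a → ⊤ᶠ ⊢ # 2 :+ (# 0) :≡ (+ 2) :* (# 1) :+ # 0) (+ suc k) tt) ∷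
    (+ 2 , lia 1 (λ a → ⊤ᶠ ⊢ # 2 :+ (# 2) :≡ (+ 2) :* (# 2) :+ # 0) (+ suc k) tt) ∷
    (+ 2 , lia 1 (λ a → ⊤ᶠ ⊢ # 2 :- a :+ (# 2 :+ a) :≡ (+ 2) :* (# 2) :+ # 0) (+ suc k) tt) ∷
    (+ 1 , lia 1 (λ a → ⊤ᶠ ⊢ neg a :+ (# 2 :+ a) :≡ (+ 2) :* (# 1) :+ # 0) (+ suc k) tt) ∷
    (+ 0 , lia 1 (λ a → ⊤ᶠ ⊢ neg a :+ (a) :≡ (+ 2) :* (# 0) :+ # 0) (+ suc k) tt) ∷ []
  shape-sums (octagon k l) =
    (+ 0 , lia 2 (λ a b → ⊤ᶠ ⊢ # 0 :+ (# 0) :≡ (+ 2) :* (# 0) :+ # 0) (+ suc k) (+ suc l) tt) ∷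
    (+ 1 , lia 2 (λ a b → ⊤ᶠ ⊢ # 2 :+ (# 0) :≡ (+ 2) :* (# 1) :+ # 0) (+ suc k) (+ suc l) tt) ∷
    (+ 1 + + suc k , lia 2 (λ a b → ⊤ᶠ ⊢ # 2 :+ a :+ (a) :≡ (+ 2) :* (# 1 :+ a) :+ # 0) (+ suc k) (+ suc l) tt) ∷
    (+ 2 + + suc k , lia 2 (λ a b → ⊤ᶠ ⊢ # 2 :+ a :+ (a :+ # 2) :≡ (+ 2) :* (# 2 :+ a) :+ # 0) (+ suc k) (+ suc l) tt) ∷
    (+ 2 + + suc k , lia 2 (λ a b → ⊤ᶠ ⊢ # 2 :+ a :- b :+ (a :+ b :+ # 2) :≡ (+ 2) :* (# 2 :+ a) :+ # 0) (+ suc k) (+ suc l) tt) ∷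
    (+ 1 + + suc k , lia 2 (λ a b → ⊤ᶠ ⊢ a :- b :+ (a :+ b :+ # 2) :≡ (+ 2) :* (# 1 :+ a) :+ # 0) (+ suc k) (+ suc l) tt) ∷
    (+ 1 , lia 2 (λ a b → ⊤ᶠ ⊢ neg b :+ (b :+ # 2) :≡ (+ 2) :* (# 1) :+ # 0) (+ suc k) (+ suc l) tt) ∷
    (+ 0 , lia 2 (λ a b → ⊤ᶠ ⊢ neg b :+ (b) :≡ (+ 2) :* (# 0) :+ # 0) (+ suc k) (+ suc l) tt) ∷ []
  shape-sums (trapezoid k) =
    (+ 0 , lia 1 (λ a → ⊤ᶠ ⊢ # 0 :+ (# 0) :≡ (+ 2) :* (# 0) :+ # 0) (+ suc k) tt) ∷
    (+ 1 + + suc k , lia 1 (λ a → ⊤ᶠ ⊢ (+ 2) :* a :+ # 2 :+ (# 0) :≡ (+ 2) :* (# 1 :+ a) :+ # 0) (+ suc k) tt) ∷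
    (+ 1 + + suc k , lia 1 (λ a → ⊤ᶠ ⊢ a :+ # 2 :+ (a) :≡ (+ 2) :* (# 1 :+ a) :+ # 0) (+ suc k) tt) ∷
    (+ 0 + + suc k , lia 1 (λ a → ⊤ᶠ ⊢ a :+ (a) :≡ (+ 2) :* (# 0 :+ a) :+ # 0) (+ suc k) tt) ∷ []
  shape-sums (triangle k) =
    (+ 0 , lia 1 (λ a → ⊤ᶠ ⊢ a :+ (# 0) :≡ (+ 2) :* (# 0) :+ a) (+ suc k) tt) ∷
    (+ 0 , lia 1 (λ a → ⊤ᶠ ⊢ # 0 :+ (a) :≡ (+ 2) :* (# 0) :+ a) (+ suc k) tt) ∷ []

  tile-colour : ∀ sh r tx ty k → shapeSum sh + tx + ty ≡ + 2 * k + ε → HasColour c (mkTile sh r tx ty)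
  tile-colour sh r tx ty k e = AllP.map⁺ (All.map (λ {p} → place-colour sh r tx ty (shapeSum sh) k e p) (shape-sums sh))

  Realized : Piece → Set
  Realized P = ∃ λ t → Rep t P × HasColour c t × All (SegInBoundary m n) (dashedSides t)

  natural : ∀ {i j} → i ≤ j → ∃ λ (k : ℕ) → j ≡ i + + k
  natural {i} {j} h = ∣ j - i ∣ ,
    lia 3 (λ i j d → d :≡ j :- i ⊢ j :≡ i :+ d) i j (+ ∣ j - i ∣) (ℤP.0≤i⇒+∣i∣≡i (ℤP.i≤j⇒0≤j-i h))

  positive : ∀ {i j} → i < j → ∃ λ (k : ℕ) → j ≡ i + + suc k
  positive {i} {j} h with natural (ℤP.i<j⇒suc[i]≤j h)
  ... | k , e = k , lia 3 (λ i j k → j :≡ # 1 :+ i :+ k ⊢ j :≡ i :+ (# 1 :+ k)) i j (+ k) e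

  realize-dia : ∀ a b → Walled (dia a b) → Realized (dia a b)
  realize-dia a b w = mkTile diamond 0F tx ty ,
    dia-rep (mkTile diamond 0F tx ty) a b (liaG 2 (λ a b → ⊤ᶠ ⊢ octOfDiaᵉ (diamondᴱ (a :+ b :+ εᵉ) (a :- b :- # 2)) a b) a b tt) w ,
    tile-colour diamond 0F tx ty (a - + 1) (liaG 2 (λ a b → ⊤ᶠ ⊢ # 0 :+ (a :+ b :+ εᵉ) :+ (a :- b :- # 2) :≡ (+ 2) :* (a :- # 1) :+ εᵉ) a b tt) ,
    []
    where
    tx = a + b + ε
    ty = a - b - + 2

  Unwalled : Piece → Set
  Unwalled (dia a b) = ⊤
  Unwalled (blk i₀ i₁ j₀ j₁) = i₀ ≤ i₁ × j₀ ≤ j₁ ×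
    + 0 ≤ i₀ - j₁ - + 2 × i₁ - j₀ ≤ + n - + 1 × + 0 ≤ i₀ + j₀ + ε - + 2 × i₁ + j₁ + ε ≤ + m - + 1

  realize-square : ∀ i₀ j₀ → Unwalled (blk i₀ (i₀ + + 0) j₀ (j₀ + + 0)) → Realized (blk i₀ (i₀ + + 0) j₀ (j₀ + + 0))
  realize-square i₀ j₀ (s₁ , s₂ , b , t , l , r) =
    let (dg , bo , to , le , ri , ek) = liaG 2 (λ i₀ j₀ → let o = octagonᴱ (# 0) (# 0) ((i₀ :+ (j₀ :+ # 0) :+ εᵉ :- # 2)) ((i₀ :- (j₀ :+ # 0) :- # 2)) in
          bottomNᵉ i₀ (i₀ :+ # 0) j₀ (j₀ :+ # 0) :∧ topNᵉ i₀ (i₀ :+ # 0) j₀ (j₀ :+ # 0) :∧ leftNᵉ i₀ (i₀ :+ # 0) j₀ (j₀ :+ # 0) :∧ rightNᵉ i₀ (i₀ :+ # 0) j₀ (j₀ :+ # 0) ⊢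
          diagᵉ o i₀ (i₀ :+ # 0) j₀ (j₀ :+ # 0) :∧ bNᵉ o i₀ (i₀ :+ # 0) j₀ (j₀ :+ # 0) :∧ tNᵉ o i₀ (i₀ :+ # 0) j₀ (j₀ :+ # 0) :∧ lNᵉ o i₀ (i₀ :+ # 0) j₀ (j₀ :+ # 0) :∧ rNᵉ o i₀ (i₀ :+ # 0) j₀ (j₀ :+ # 0) :∧
          # 0 :+ (i₀ :+ (j₀ :+ # 0) :+ εᵉ :- # 2) :+ (i₀ :- (j₀ :+ # 0) :- # 2) :≡ (+ 2) :* (i₀ :- # 2) :+ εᵉ) i₀ j₀ (b , t , l , r)
    in tile , trace-rep tile (trace (s₁ , s₂) dg (inj₁ bo) (inj₁ to) (inj₁ le) (inj₁ ri)) ,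
       tile-colour square 0F tx ty (i₀ - + 2) ek , []
    where
    tx = i₀ + (j₀ + + 0) + ε - + 2
    ty = i₀ - (j₀ + + 0) - + 2
    tile = mkTile square 0F tx ty

  realize-hexagon0 : ∀ k′ i₀ j₀ → Unwalled (blk i₀ (i₀ + + 0) j₀ (j₀ + (+ suc k′))) → Realized (blk i₀ (i₀ + + 0) j₀ (j₀ + (+ suc k′)))
  realize-hexagon0 k′ i₀ j₀ (s₁ , s₂ , b , t , l , r) =
    let (dg , bo , to , le , ri , ek) = liaG 3 (λ a i₀ j₀ → let o = octagonᴱ (# 0) (a) ((i₀ :+ (j₀ :+ a) :+ εᵉ :- # 2)) ((i₀ :- (j₀ :+ a) :- # 2)) in
          # 1 :≤ a :∧ bottomNᵉ i₀ (i₀ :+ # 0) j₀ (j₀ :+ a) :∧ topNᵉ i₀ (i₀ :+ # 0) j₀ (j₀ :+ a) :∧ leftNᵉ i₀ (i₀ :+ # 0) j₀ (j₀ :+ a) :∧ rightNᵉ i₀ (i₀ :+ # 0) j₀ (j₀ :+ a) ⊢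
          diagᵉ o i₀ (i₀ :+ # 0) j₀ (j₀ :+ a) :∧ bNᵉ o i₀ (i₀ :+ # 0) j₀ (j₀ :+ a) :∧ tNᵉ o i₀ (i₀ :+ # 0) j₀ (j₀ :+ a) :∧ lNᵉ o i₀ (i₀ :+ # 0) j₀ (j₀ :+ a) :∧ rNᵉ o i₀ (i₀ :+ # 0) j₀ (j₀ :+ a) :∧
          # 0 :+ (i₀ :+ (j₀ :+ a) :+ εᵉ :- # 2) :+ (i₀ :- (j₀ :+ a) :- # 2) :≡ (+ 2) :* (i₀ :- # 2) :+ εᵉ) (+ suc k′) i₀ j₀ (1≤suc , b , t , l , r)
    in tile , trace-rep tile (trace (s₁ , s₂) dg (inj₁ bo) (inj₁ to) (inj₁ le) (inj₁ ri)) ,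
       tile-colour (hexagon k′) 0F tx ty (i₀ - + 2) ek , []
    where
    tx = i₀ + (j₀ + (+ suc k′)) + ε - + 2
    ty = i₀ - (j₀ + (+ suc k′)) - + 2
    tile = mkTile (hexagon k′) 0F tx ty

  -- The base hexagon belongs to a block that extends in the direction of j; a block extending in
  -- the direction of i gives its image under a quarter turn.
  realize-hexagon1 : ∀ k′ i₀ j₀ → Unwalled (blk i₀ (i₀ + (+ suc k′)) j₀ (j₀ + + 0)) → Realized (blk i₀ (i₀ + (+ suc k′)) j₀ (j₀ + + 0))
  realize-hexagon1 k′ i₀ j₀ (s₁ , s₂ , b , t , l , r) =
    let (dg , bo , to , le , ri , ek) = liaG 3 (λ a i₀ j₀ → let o = rotᴱ (octagonᴱ (# 0) (a) (((i₀ :+ a) :- (j₀ :+ # 0) :- # 2)) (neg ((i₀ :+ a) :+ (j₀ :+ # 0) :+ εᵉ))) in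
          # 1 :≤ a :∧ bottomNᵉ i₀ (i₀ :+ a) j₀ (j₀ :+ # 0) :∧ topNᵉ i₀ (i₀ :+ a) j₀ (j₀ :+ # 0) :∧ leftNᵉ i₀ (i₀ :+ a) j₀ (j₀ :+ # 0) :∧ rightNᵉ i₀ (i₀ :+ a) j₀ (j₀ :+ # 0) ⊢
          diagᵉ o i₀ (i₀ :+ a) j₀ (j₀ :+ # 0) :∧ bNᵉ o i₀ (i₀ :+ a) j₀ (j₀ :+ # 0) :∧ tNᵉ o i₀ (i₀ :+ a) j₀ (j₀ :+ # 0) :∧ lNᵉ o i₀ (i₀ :+ a) j₀ (j₀ :+ # 0) :∧ rNᵉ o i₀ (i₀ :+ a) j₀ (j₀ :+ # 0) :∧
          # 0 :+ ((i₀ :+ a) :+ (j₀ :+ # 0) :+ εᵉ) :+ ((i₀ :+ a) :- (j₀ :+ # 0) :- # 2) :≡ (+ 2) :* ((i₀ :+ a) :- # 1) :+ εᵉ) (+ suc k′) i₀ j₀ (1≤suc , b , t , l , r)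
    in tile , trace-rep tile (trace (s₁ , s₂) dg (inj₁ bo) (inj₁ to) (inj₁ le) (inj₁ ri)) ,
       tile-colour (hexagon k′) 1F tx ty ((i₀ + (+ suc k′)) - + 1) ek , []
    where
    tx = (i₀ + (+ suc k′)) + (j₀ + + 0) + ε
    ty = (i₀ + (+ suc k′)) - (j₀ + + 0) - + 2
    tile = mkTile (hexagon k′) 1F tx ty

  realize-octagon : ∀ k′ l′ i₀ j₀ → Unwalled (blk i₀ (i₀ + (+ suc k′)) j₀ (j₀ + (+ suc l′))) → Realized (blk i₀ (i₀ + (+ suc k′)) j₀ (j₀ + (+ suc l′)))
  realize-octagon k′ l′ i₀ j₀ (s₁ , s₂ , b , t , l , r) =
    let (dg , bo , to , le , ri , ek) = liaG 4 (λ a b i₀ j₀ → let o = octagonᴱ (a) (b) ((i₀ :+ (j₀ :+ b) :+ εᵉ :- # 2)) ((i₀ :- (j₀ :+ b) :- # 2)) in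
          # 1 :≤ a :∧ # 1 :≤ b :∧ bottomNᵉ i₀ (i₀ :+ a) j₀ (j₀ :+ b) :∧ topNᵉ i₀ (i₀ :+ a) j₀ (j₀ :+ b) :∧ leftNᵉ i₀ (i₀ :+ a) j₀ (j₀ :+ b) :∧ rightNᵉ i₀ (i₀ :+ a) j₀ (j₀ :+ b) ⊢
          diagᵉ o i₀ (i₀ :+ a) j₀ (j₀ :+ b) :∧ bNᵉ o i₀ (i₀ :+ a) j₀ (j₀ :+ b) :∧ tNᵉ o i₀ (i₀ :+ a) j₀ (j₀ :+ b) :∧ lNᵉ o i₀ (i₀ :+ a) j₀ (j₀ :+ b) :∧ rNᵉ o i₀ (i₀ :+ a) j₀ (j₀ :+ b) :∧
          # 0 :+ (i₀ :+ (j₀ :+ b) :+ εᵉ :- # 2) :+ (i₀ :- (j₀ :+ b) :- # 2) :≡ (+ 2) :* (i₀ :- # 2) :+ εᵉ) (+ suc k′) (+ suc l′) i₀ j₀ (1≤suc , 1≤suc , b , t , l , r)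
    in tile , trace-rep tile (trace (s₁ , s₂) dg (inj₁ bo) (inj₁ to) (inj₁ le) (inj₁ ri)) ,
       tile-colour (octagon k′ l′) 0F tx ty (i₀ - + 2) ek , []
    where
    tx = i₀ + (j₀ + (+ suc l′)) + ε - + 2
    ty = i₀ - (j₀ + (+ suc l′)) - + 2
    tile = mkTile (octagon k′ l′) 0F tx ty

  realize-interior : ∀ i₀ j₀ (p q : ℕ) → Unwalled (blk i₀ (i₀ + + p) j₀ (j₀ + + q)) → Realized (blk i₀ (i₀ + + p) j₀ (j₀ + + q))
  realize-interior i₀ j₀ zero zero = realize-square i₀ j₀
  realize-interior i₀ j₀ zero (suc q) = realize-hexagon0 q i₀ j₀
  realize-interior i₀ j₀ (suc p) zero = realize-hexagon1 p i₀ j₀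
  realize-interior i₀ j₀ (suc p) (suc q) = realize-octagon p q i₀ j₀

  -- The index is the number of quarter turns: the axis is the bottom wall for 0, then the right,
  -- the top and the left one. The parameter of the tile is i₁ - i₀, and the position is found by
  -- equating the bounds of the turned base tile with those of the octagon.
  realize-trapezoid0 : ∀ k′ i₀ j₀ j₁ → j₀ ≤ j₁ → Holds (bottomSᵉ (K i₀) (K (i₀ + + suc k′)) (K j₀) (K j₁) :∧ topNᵉ (K i₀) (K (i₀ + + suc k′)) (K j₀) (K j₁) :∧ leftNᵉ (K i₀) (K (i₀ + + suc k′)) (K j₀) (K j₁) :∧ rightNᵉ (K i₀) (K (i₀ + + suc k′)) (K j₀) (K j₁)) ρ₀ →
    Realized (blk i₀ (i₀ + + suc k′) j₀ j₁)
  realize-trapezoid0 k′ i₀ j₀ j₁ s₂ h =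
    let (s₁ , dg , bo , to , le , ri , ek , p0 , q0 , e0 , f0) = liaG 4 (λ a i₀ j₀ j₁ → let o = trapezoidᴱ a ((i₀ :+ j₀ :+ εᵉ :- # 2)) ((# 0)) in
          # 1 :≤ a :∧ bottomSᵉ i₀ (i₀ :+ a) j₀ j₁ :∧ topNᵉ i₀ (i₀ :+ a) j₀ j₁ :∧ leftNᵉ i₀ (i₀ :+ a) j₀ j₁ :∧ rightNᵉ i₀ (i₀ :+ a) j₀ j₁ ⊢
          i₀ :≤ i₀ :+ a :∧ diagᵉ o i₀ (i₀ :+ a) j₀ j₁ :∧ bSᵉ o i₀ (i₀ :+ a) j₀ j₁ :∧ tNᵉ o i₀ (i₀ :+ a) j₀ j₁ :∧ lNᵉ o i₀ (i₀ :+ a) j₀ j₁ :∧ rNᵉ o i₀ (i₀ :+ a) j₀ j₁ :∧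
          # 0 :+ (i₀ :+ j₀ :+ εᵉ :- # 2) :+ (# 0) :≡ (+ 2) :* (i₀ :- # 1) :+ εᵉ :∧
          ptᵉ ((# 0) :+ (i₀ :+ j₀ :+ εᵉ :- # 2)) ((# 0) :+ (# 0)) :∧ ptᵉ (((+ 2) :* a :+ # 2) :+ (i₀ :+ j₀ :+ εᵉ :- # 2)) ((# 0) :+ (# 0)) :∧ (# 0) :+ (# 0) :≡ # 0 :∧ (# 0) :+ (# 0) :≡ # 0) (+ suc k′) i₀ j₀ j₁ (1≤suc , h)
    in tile , trace-rep tile (trace (s₁ , s₂) dg (inj₂ bo) (inj₁ to) (inj₁ le) (inj₁ ri)) ,
       tile-colour (trapezoid k′) 0F tx ty (i₀ - + 1) ek , (p0 , q0 , inj₂ (inj₂ (inj₁ (e0 , f0)))) ∷ []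
    where
    tx = i₀ + j₀ + ε - + 2
    ty = + 0
    tile = mkTile (trapezoid k′) 0F tx ty

  realize-trapezoid1 : ∀ k′ i₀ j₀ j₁ → j₀ ≤ j₁ → Holds (bottomNᵉ (K i₀) (K (i₀ + + suc k′)) (K j₀) (K j₁) :∧ topNᵉ (K i₀) (K (i₀ + + suc k′)) (K j₀) (K j₁) :∧ leftNᵉ (K i₀) (K (i₀ + + suc k′)) (K j₀) (K j₁) :∧ rightSᵉ (K i₀) (K (i₀ + + suc k′)) (K j₀) (K j₁)) ρ₀ →
    Realized (blk i₀ (i₀ + + suc k′) j₀ j₁)
  realize-trapezoid1 k′ i₀ j₀ j₁ s₂ h =
    let (s₁ , dg , bo , to , le , ri , ek , p0 , q0 , e0 , f0) = liaG 4 (λ a i₀ j₀ j₁ → let o = rotᴱ (trapezoidᴱ a ((i₀ :- j₁ :- # 2)) (neg (mᵉ :- # 1))) in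
          # 1 :≤ a :∧ bottomNᵉ i₀ (i₀ :+ a) j₀ j₁ :∧ topNᵉ i₀ (i₀ :+ a) j₀ j₁ :∧ leftNᵉ i₀ (i₀ :+ a) j₀ j₁ :∧ rightSᵉ i₀ (i₀ :+ a) j₀ j₁ ⊢
          i₀ :≤ i₀ :+ a :∧ diagᵉ o i₀ (i₀ :+ a) j₀ j₁ :∧ bNᵉ o i₀ (i₀ :+ a) j₀ j₁ :∧ tNᵉ o i₀ (i₀ :+ a) j₀ j₁ :∧ lNᵉ o i₀ (i₀ :+ a) j₀ j₁ :∧ rSᵉ o i₀ (i₀ :+ a) j₀ j₁ :∧
          # 0 :+ (mᵉ :- # 1) :+ (i₀ :- j₁ :- # 2) :≡ (+ 2) :* (i₀ :- # 2) :+ εᵉ :∧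
          ptᵉ (neg (# 0) :+ (mᵉ :- # 1)) ((# 0) :+ (i₀ :- j₁ :- # 2)) :∧ ptᵉ (neg (# 0) :+ (mᵉ :- # 1)) (((+ 2) :* a :+ # 2) :+ (i₀ :- j₁ :- # 2)) :∧ neg (# 0) :+ (mᵉ :- # 1) :≡ mᵉ :- # 1 :∧ neg (# 0) :+ (mᵉ :- # 1) :≡ mᵉ :- # 1) (+ suc k′) i₀ j₀ j₁ (1≤suc , h)
    in tile , trace-rep tile (trace (s₁ , s₂) dg (inj₁ bo) (inj₁ to) (inj₁ le) (inj₂ ri)) ,
       tile-colour (trapezoid k′) 1F tx ty (i₀ - + 2) ek , (p0 , q0 , inj₂ (inj₁ (e0 , f0))) ∷ []
    where
    tx = + m - + 1
    ty = i₀ - j₁ - + 2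
    tile = mkTile (trapezoid k′) 1F tx ty

  realize-trapezoid2 : ∀ k′ i₀ j₀ j₁ → j₀ ≤ j₁ → Holds (bottomNᵉ (K i₀) (K (i₀ + + suc k′)) (K j₀) (K j₁) :∧ topSᵉ (K i₀) (K (i₀ + + suc k′)) (K j₀) (K j₁) :∧ leftNᵉ (K i₀) (K (i₀ + + suc k′)) (K j₀) (K j₁) :∧ rightNᵉ (K i₀) (K (i₀ + + suc k′)) (K j₀) (K j₁)) ρ₀ →
    Realized (blk i₀ (i₀ + + suc k′) j₀ j₁)
  realize-trapezoid2 k′ i₀ j₀ j₁ s₂ h =
    let (s₁ , dg , bo , to , le , ri , ek , p0 , q0 , e0 , f0) = liaG 4 (λ a i₀ j₀ j₁ → let o = rotᴱ (rotᴱ (trapezoidᴱ a (neg ((i₀ :+ a) :+ j₁ :+ εᵉ)) (neg (nᵉ :- # 1)))) in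
          # 1 :≤ a :∧ bottomNᵉ i₀ (i₀ :+ a) j₀ j₁ :∧ topSᵉ i₀ (i₀ :+ a) j₀ j₁ :∧ leftNᵉ i₀ (i₀ :+ a) j₀ j₁ :∧ rightNᵉ i₀ (i₀ :+ a) j₀ j₁ ⊢
          i₀ :≤ i₀ :+ a :∧ diagᵉ o i₀ (i₀ :+ a) j₀ j₁ :∧ bNᵉ o i₀ (i₀ :+ a) j₀ j₁ :∧ tSᵉ o i₀ (i₀ :+ a) j₀ j₁ :∧ lNᵉ o i₀ (i₀ :+ a) j₀ j₁ :∧ rNᵉ o i₀ (i₀ :+ a) j₀ j₁ :∧
          # 0 :+ ((i₀ :+ a) :+ j₁ :+ εᵉ) :+ (nᵉ :- # 1) :≡ (+ 2) :* ((i₀ :+ a) :- # 1) :+ εᵉ :∧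
          ptᵉ (neg (# 0) :+ ((i₀ :+ a) :+ j₁ :+ εᵉ)) (neg (# 0) :+ (nᵉ :- # 1)) :∧ ptᵉ (neg ((+ 2) :* a :+ # 2) :+ ((i₀ :+ a) :+ j₁ :+ εᵉ)) (neg (# 0) :+ (nᵉ :- # 1)) :∧ neg (# 0) :+ (nᵉ :- # 1) :≡ nᵉ :- # 1 :∧ neg (# 0) :+ (nᵉ :- # 1) :≡ nᵉ :- # 1) (+ suc k′) i₀ j₀ j₁ (1≤suc , h)
    in tile , trace-rep tile (trace (s₁ , s₂) dg (inj₁ bo) (inj₂ to) (inj₁ le) (inj₁ ri)) ,
       tile-colour (trapezoid k′) 2F tx ty ((i₀ + (+ suc k′)) - + 1) ek , (p0 , q0 , inj₂ (inj₂ (inj₂ (e0 , f0)))) ∷ []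
    where
    tx = (i₀ + (+ suc k′)) + j₁ + ε
    ty = + n - + 1
    tile = mkTile (trapezoid k′) 2F tx ty

  realize-trapezoid3 : ∀ k′ i₀ j₀ j₁ → j₀ ≤ j₁ → Holds (bottomNᵉ (K i₀) (K (i₀ + + suc k′)) (K j₀) (K j₁) :∧ topNᵉ (K i₀) (K (i₀ + + suc k′)) (K j₀) (K j₁) :∧ leftSᵉ (K i₀) (K (i₀ + + suc k′)) (K j₀) (K j₁) :∧ rightNᵉ (K i₀) (K (i₀ + + suc k′)) (K j₀) (K j₁)) ρ₀ →
    Realized (blk i₀ (i₀ + + suc k′) j₀ j₁)
  realize-trapezoid3 k′ i₀ j₀ j₁ s₂ h =
    let (s₁ , dg , bo , to , le , ri , ek , p0 , q0 , e0 , f0) = liaG 4 (λ a i₀ j₀ j₁ → let o = rotᴱ (rotᴱ (rotᴱ (trapezoidᴱ a (neg ((i₀ :+ a) :- j₀)) (neg (neg (# 0)))))) in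
          # 1 :≤ a :∧ bottomNᵉ i₀ (i₀ :+ a) j₀ j₁ :∧ topNᵉ i₀ (i₀ :+ a) j₀ j₁ :∧ leftSᵉ i₀ (i₀ :+ a) j₀ j₁ :∧ rightNᵉ i₀ (i₀ :+ a) j₀ j₁ ⊢
          i₀ :≤ i₀ :+ a :∧ diagᵉ o i₀ (i₀ :+ a) j₀ j₁ :∧ bNᵉ o i₀ (i₀ :+ a) j₀ j₁ :∧ tNᵉ o i₀ (i₀ :+ a) j₀ j₁ :∧ lSᵉ o i₀ (i₀ :+ a) j₀ j₁ :∧ rNᵉ o i₀ (i₀ :+ a) j₀ j₁ :∧
          # 0 :+ (# 0) :+ ((i₀ :+ a) :- j₀) :≡ (+ 2) :* ((i₀ :+ a)) :+ εᵉ :∧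
          ptᵉ (neg (neg (# 0)) :+ (# 0)) (neg (# 0) :+ ((i₀ :+ a) :- j₀)) :∧ ptᵉ (neg (neg (# 0)) :+ (# 0)) (neg ((+ 2) :* a :+ # 2) :+ ((i₀ :+ a) :- j₀)) :∧ neg (neg (# 0)) :+ (# 0) :≡ # 0 :∧ neg (neg (# 0)) :+ (# 0) :≡ # 0) (+ suc k′) i₀ j₀ j₁ (1≤suc , h)
    in tile , trace-rep tile (trace (s₁ , s₂) dg (inj₁ bo) (inj₁ to) (inj₂ le) (inj₁ ri)) ,
       tile-colour (trapezoid k′) 3F tx ty ((i₀ + (+ suc k′))) ek , (p0 , q0 , inj₁ (e0 , f0)) ∷ []
    where
    tx = + 0
    ty = (i₀ + (+ suc k′)) - j₀
    tile = mkTile (trapezoid k′) 3F tx ty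

  -- The quarter turns carry the right angle through the corners of R in the order south-west,
  -- south-east, north-east, north-west.
  realize-triangle0 : ∀ k′ i₀ j₀ j₁ → j₀ ≤ j₁ → Holds (bottomSᵉ (K i₀) (K (i₀ + + suc k′)) (K j₀) (K j₁) :∧ topNᵉ (K i₀) (K (i₀ + + suc k′)) (K j₀) (K j₁) :∧ leftSᵉ (K i₀) (K (i₀ + + suc k′)) (K j₀) (K j₁) :∧ rightNᵉ (K i₀) (K (i₀ + + suc k′)) (K j₀) (K j₁)) ρ₀ →
    Realized (blk i₀ (i₀ + + suc k′) j₀ j₁)
  realize-triangle0 k′ i₀ j₀ j₁ s₂ h =
    let (s₁ , dg , bo , to , le , ri , ek , p0 , q0 , e0 , f0 , p1 , q1 , e1 , f1) = liaG 4 (λ a i₀ j₀ j₁ → let o = triangleᴱ a ((# 0)) ((# 0)) in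
          # 1 :≤ a :∧ bottomSᵉ i₀ (i₀ :+ a) j₀ j₁ :∧ topNᵉ i₀ (i₀ :+ a) j₀ j₁ :∧ leftSᵉ i₀ (i₀ :+ a) j₀ j₁ :∧ rightNᵉ i₀ (i₀ :+ a) j₀ j₁ ⊢
          i₀ :≤ i₀ :+ a :∧ diagᵉ o i₀ (i₀ :+ a) j₀ j₁ :∧ bSᵉ o i₀ (i₀ :+ a) j₀ j₁ :∧ tNᵉ o i₀ (i₀ :+ a) j₀ j₁ :∧ lSᵉ o i₀ (i₀ :+ a) j₀ j₁ :∧ rNᵉ o i₀ (i₀ :+ a) j₀ j₁ :∧
          a :+ (# 0) :+ (# 0) :≡ (+ 2) :* ((i₀ :+ a)) :+ εᵉ :∧
          ptᵉ ((# 0) :+ (# 0)) ((# 0) :+ (# 0)) :∧ ptᵉ (a :+ (# 0)) ((# 0) :+ (# 0)) :∧ (# 0) :+ (# 0) :≡ # 0 :∧ (# 0) :+ (# 0) :≡ # 0 :∧ ptᵉ ((# 0) :+ (# 0)) ((# 0) :+ (# 0)) :∧ ptᵉ ((# 0) :+ (# 0)) (a :+ (# 0)) :∧ (# 0) :+ (# 0) :≡ # 0 :∧ (# 0) :+ (# 0) :≡ # 0) (+ suc k′) i₀ j₀ j₁ (1≤suc , h)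
    in tile , trace-rep tile (trace (s₁ , s₂) dg (inj₂ bo) (inj₁ to) (inj₂ le) (inj₁ ri)) ,
       tile-colour (triangle k′) 0F tx ty ((i₀ + (+ suc k′))) ek , (p0 , q0 , inj₂ (inj₂ (inj₁ (e0 , f0)))) ∷ (p1 , q1 , inj₁ (e1 , f1)) ∷ []
    where
    tx = + 0
    ty = + 0
    tile = mkTile (triangle k′) 0F tx ty

  realize-triangle1 : ∀ k′ i₀ j₀ j₁ → j₀ ≤ j₁ → Holds (bottomSᵉ (K i₀) (K (i₀ + + suc k′)) (K j₀) (K j₁) :∧ topNᵉ (K i₀) (K (i₀ + + suc k′)) (K j₀) (K j₁) :∧ leftNᵉ (K i₀) (K (i₀ + + suc k′)) (K j₀) (K j₁) :∧ rightSᵉ (K i₀) (K (i₀ + + suc k′)) (K j₀) (K j₁)) ρ₀ →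
    Realized (blk i₀ (i₀ + + suc k′) j₀ j₁)
  realize-triangle1 k′ i₀ j₀ j₁ s₂ h =
    let (s₁ , dg , bo , to , le , ri , ek , p0 , q0 , e0 , f0 , p1 , q1 , e1 , f1) = liaG 4 (λ a i₀ j₀ j₁ → let o = rotᴱ (triangleᴱ a ((# 0)) (neg (mᵉ :- # 1))) in
          # 1 :≤ a :∧ bottomSᵉ i₀ (i₀ :+ a) j₀ j₁ :∧ topNᵉ i₀ (i₀ :+ a) j₀ j₁ :∧ leftNᵉ i₀ (i₀ :+ a) j₀ j₁ :∧ rightSᵉ i₀ (i₀ :+ a) j₀ j₁ ⊢
          i₀ :≤ i₀ :+ a :∧ diagᵉ o i₀ (i₀ :+ a) j₀ j₁ :∧ bSᵉ o i₀ (i₀ :+ a) j₀ j₁ :∧ tNᵉ o i₀ (i₀ :+ a) j₀ j₁ :∧ lNᵉ o i₀ (i₀ :+ a) j₀ j₁ :∧ rSᵉ o i₀ (i₀ :+ a) j₀ j₁ :∧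
          a :+ (mᵉ :- # 1) :+ (# 0) :≡ (+ 2) :* ((i₀ :+ a) :- # 1) :+ εᵉ :∧
          ptᵉ (neg (# 0) :+ (mᵉ :- # 1)) ((# 0) :+ (# 0)) :∧ ptᵉ (neg (# 0) :+ (mᵉ :- # 1)) (a :+ (# 0)) :∧ neg (# 0) :+ (mᵉ :- # 1) :≡ mᵉ :- # 1 :∧ neg (# 0) :+ (mᵉ :- # 1) :≡ mᵉ :- # 1 :∧ ptᵉ (neg (# 0) :+ (mᵉ :- # 1)) ((# 0) :+ (# 0)) :∧ ptᵉ (neg a :+ (mᵉ :- # 1)) ((# 0) :+ (# 0)) :∧ (# 0) :+ (# 0) :≡ # 0 :∧ (# 0) :+ (# 0) :≡ # 0) (+ suc k′) i₀ j₀ j₁ (1≤suc , h)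
    in tile , trace-rep tile (trace (s₁ , s₂) dg (inj₂ bo) (inj₁ to) (inj₁ le) (inj₂ ri)) ,
       tile-colour (triangle k′) 1F tx ty ((i₀ + (+ suc k′)) - + 1) ek , (p0 , q0 , inj₂ (inj₁ (e0 , f0))) ∷ (p1 , q1 , inj₂ (inj₂ (inj₁ (e1 , f1)))) ∷ []
    where
    tx = + m - + 1
    ty = + 0
    tile = mkTile (triangle k′) 1F tx ty

  realize-triangle2 : ∀ k′ i₀ j₀ j₁ → j₀ ≤ j₁ → Holds (bottomNᵉ (K i₀) (K (i₀ + + suc k′)) (K j₀) (K j₁) :∧ topSᵉ (K i₀) (K (i₀ + + suc k′)) (K j₀) (K j₁) :∧ leftNᵉ (K i₀) (K (i₀ + + suc k′)) (K j₀) (K j₁) :∧ rightSᵉ (K i₀) (K (i₀ + + suc k′)) (K j₀) (K j₁)) ρ₀ →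
    Realized (blk i₀ (i₀ + + suc k′) j₀ j₁)
  realize-triangle2 k′ i₀ j₀ j₁ s₂ h =
    let (s₁ , dg , bo , to , le , ri , ek , p0 , q0 , e0 , f0 , p1 , q1 , e1 , f1) = liaG 4 (λ a i₀ j₀ j₁ → let o = rotᴱ (rotᴱ (triangleᴱ a (neg (mᵉ :- # 1)) (neg (nᵉ :- # 1)))) in
          # 1 :≤ a :∧ bottomNᵉ i₀ (i₀ :+ a) j₀ j₁ :∧ topSᵉ i₀ (i₀ :+ a) j₀ j₁ :∧ leftNᵉ i₀ (i₀ :+ a) j₀ j₁ :∧ rightSᵉ i₀ (i₀ :+ a) j₀ j₁ ⊢
          i₀ :≤ i₀ :+ a :∧ diagᵉ o i₀ (i₀ :+ a) j₀ j₁ :∧ bNᵉ o i₀ (i₀ :+ a) j₀ j₁ :∧ tSᵉ o i₀ (i₀ :+ a) j₀ j₁ :∧ lNᵉ o i₀ (i₀ :+ a) j₀ j₁ :∧ rSᵉ o i₀ (i₀ :+ a) j₀ j₁ :∧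
          a :+ (mᵉ :- # 1) :+ (nᵉ :- # 1) :≡ (+ 2) :* ((i₀ :+ a) :- # 2) :+ εᵉ :∧
          ptᵉ (neg (# 0) :+ (mᵉ :- # 1)) (neg (# 0) :+ (nᵉ :- # 1)) :∧ ptᵉ (neg a :+ (mᵉ :- # 1)) (neg (# 0) :+ (nᵉ :- # 1)) :∧ neg (# 0) :+ (nᵉ :- # 1) :≡ nᵉ :- # 1 :∧ neg (# 0) :+ (nᵉ :- # 1) :≡ nᵉ :- # 1 :∧ ptᵉ (neg (# 0) :+ (mᵉ :- # 1)) (neg (# 0) :+ (nᵉ :- # 1)) :∧ ptᵉ (neg (# 0) :+ (mᵉ :- # 1)) (neg a :+ (nᵉ :- # 1)) :∧ neg (# 0) :+ (mᵉ :- # 1) :≡ mᵉ :- # 1 :∧ neg (# 0) :+ (mᵉ :- # 1) :≡ mᵉ :- # 1) (+ suc k′) i₀ j₀ j₁ (1≤suc , h)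
    in tile , trace-rep tile (trace (s₁ , s₂) dg (inj₁ bo) (inj₂ to) (inj₁ le) (inj₂ ri)) ,
       tile-colour (triangle k′) 2F tx ty ((i₀ + (+ suc k′)) - + 2) ek , (p0 , q0 , inj₂ (inj₂ (inj₂ (e0 , f0)))) ∷ (p1 , q1 , inj₂ (inj₁ (e1 , f1))) ∷ []
    where
    tx = + m - + 1
    ty = + n - + 1
    tile = mkTile (triangle k′) 2F tx ty

  realize-triangle3 : ∀ k′ i₀ j₀ j₁ → j₀ ≤ j₁ → Holds (bottomNᵉ (K i₀) (K (i₀ + + suc k′)) (K j₀) (K j₁) :∧ topSᵉ (K i₀) (K (i₀ + + suc k′)) (K j₀) (K j₁) :∧ leftSᵉ (K i₀) (K (i₀ + + suc k′)) (K j₀) (K j₁) :∧ rightNᵉ (K i₀) (K (i₀ + + suc k′)) (K j₀) (K j₁)) ρ₀ →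
    Realized (blk i₀ (i₀ + + suc k′) j₀ j₁)
  realize-triangle3 k′ i₀ j₀ j₁ s₂ h =
    let (s₁ , dg , bo , to , le , ri , ek , p0 , q0 , e0 , f0 , p1 , q1 , e1 , f1) = liaG 4 (λ a i₀ j₀ j₁ → let o = rotᴱ (rotᴱ (rotᴱ (triangleᴱ a (neg (nᵉ :- # 1)) (neg (neg (# 0)))))) in
          # 1 :≤ a :∧ bottomNᵉ i₀ (i₀ :+ a) j₀ j₁ :∧ topSᵉ i₀ (i₀ :+ a) j₀ j₁ :∧ leftSᵉ i₀ (i₀ :+ a) j₀ j₁ :∧ rightNᵉ i₀ (i₀ :+ a) j₀ j₁ ⊢
          i₀ :≤ i₀ :+ a :∧ diagᵉ o i₀ (i₀ :+ a) j₀ j₁ :∧ bNᵉ o i₀ (i₀ :+ a) j₀ j₁ :∧ tSᵉ o i₀ (i₀ :+ a) j₀ j₁ :∧ lSᵉ o i₀ (i₀ :+ a) j₀ j₁ :∧ rNᵉ o i₀ (i₀ :+ a) j₀ j₁ :∧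
          a :+ (# 0) :+ (nᵉ :- # 1) :≡ (+ 2) :* ((i₀ :+ a) :- # 1) :+ εᵉ :∧
          ptᵉ (neg (neg (# 0)) :+ (# 0)) (neg (# 0) :+ (nᵉ :- # 1)) :∧ ptᵉ (neg (neg (# 0)) :+ (# 0)) (neg a :+ (nᵉ :- # 1)) :∧ neg (neg (# 0)) :+ (# 0) :≡ # 0 :∧ neg (neg (# 0)) :+ (# 0) :≡ # 0 :∧ ptᵉ (neg (neg (# 0)) :+ (# 0)) (neg (# 0) :+ (nᵉ :- # 1)) :∧ ptᵉ (neg (neg a) :+ (# 0)) (neg (# 0) :+ (nᵉ :- # 1)) :∧ neg (# 0) :+ (nᵉ :- # 1) :≡ nᵉ :- # 1 :∧ neg (# 0) :+ (nᵉ :- # 1) :≡ nᵉ :- # 1) (+ suc k′) i₀ j₀ j₁ (1≤suc , h)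
    in tile , trace-rep tile (trace (s₁ , s₂) dg (inj₁ bo) (inj₂ to) (inj₂ le) (inj₁ ri)) ,
       tile-colour (triangle k′) 3F tx ty ((i₀ + (+ suc k′)) - + 1) ek , (p0 , q0 , inj₁ (e0 , f0)) ∷ (p1 , q1 , inj₂ (inj₂ (inj₂ (e1 , f1)))) ∷ []
    where
    tx = + 0
    ty = + n - + 1
    tile = mkTile (triangle k′) 3F tx ty

  -- The shape is decided by the walls that are axes of the block: none for squares, hexagons and
  -- octagons, one for trapezoids, two adjacent ones for triangles. Two parallel walls cannot both
  -- be axes, since they prescribe different distances between the runs.
  realize : ∀ P → Walled P → Realized P
  realize (dia a b) w = realize-dia a b w
  realize (blk i₀ i₁ j₀ j₁) (s₁ , s₂ , inj₁ b , inj₁ t , inj₁ l , inj₁ r) with natural s₁ | natural s₂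
  ... | p , refl | q , refl = realize-interior i₀ j₀ p q (s₁ , s₂ , b , t , l , r)
  realize (blk i₀ i₁ j₀ j₁) (s₁ , s₂ , inj₂ b@(_ , _ , lt) , inj₁ t , inj₁ l , inj₁ r) with positive lt
  ... | k , refl = realize-trapezoid0 k i₀ j₀ j₁ s₂ (b , t , l , r)
  realize (blk i₀ i₁ j₀ j₁) (s₁ , s₂ , inj₁ b , inj₁ t , inj₁ l , inj₂ r@(_ , _ , lt)) with positive lt
  ... | k , refl = realize-trapezoid1 k i₀ j₀ j₁ s₂ (b , t , l , r)
  realize (blk i₀ i₁ j₀ j₁) (s₁ , s₂ , inj₁ b , inj₂ t@(_ , _ , lt) , inj₁ l , inj₁ r) with positive lt
  ... | k , refl = realize-trapezoid2 k i₀ j₀ j₁ s₂ (b , t , l , r)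
  realize (blk i₀ i₁ j₀ j₁) (s₁ , s₂ , inj₁ b , inj₁ t , inj₂ l@(_ , _ , lt) , inj₁ r) with positive lt
  ... | k , refl = realize-trapezoid3 k i₀ j₀ j₁ s₂ (b , t , l , r)
  realize (blk i₀ i₁ j₀ j₁) (s₁ , s₂ , inj₂ b@(_ , _ , lt) , inj₁ t , inj₂ l , inj₁ r) with positive lt
  ... | k , refl = realize-triangle0 k i₀ j₀ j₁ s₂ (b , t , l , r)
  realize (blk i₀ i₁ j₀ j₁) (s₁ , s₂ , inj₂ b@(_ , _ , lt) , inj₁ t , inj₁ l , inj₂ r) with positive lt
  ... | k , refl = realize-triangle1 k i₀ j₀ j₁ s₂ (b , t , l , r)
  realize (blk i₀ i₁ j₀ j₁) (s₁ , s₂ , inj₁ b , inj₂ t@(_ , _ , lt) , inj₁ l , inj₂ r) with positive lt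
  ... | k , refl = realize-triangle2 k i₀ j₀ j₁ s₂ (b , t , l , r)
  realize (blk i₀ i₁ j₀ j₁) (s₁ , s₂ , inj₁ b , inj₂ t@(_ , _ , lt) , inj₂ l , inj₁ r) with positive lt
  ... | k , refl = realize-triangle3 k i₀ j₀ j₁ s₂ (b , t , l , r)
  realize (blk i₀ i₁ j₀ j₁) (s₁ , s₂ , inj₂ b , inj₂ t , _) =
    ⊥-elim (liaG 4 (λ i₀ i₁ j₀ j₁ → bottomSᵉ i₀ i₁ j₀ j₁ :∧ topSᵉ i₀ i₁ j₀ j₁ ⊢ ⊥ᶠ) i₀ i₁ j₀ j₁ (b , t))
  realize (blk i₀ i₁ j₀ j₁) (s₁ , s₂ , _ , _ , inj₂ l , inj₂ r) =
    ⊥-elim (liaG 4 (λ i₀ i₁ j₀ j₁ → leftSᵉ i₀ i₁ j₀ j₁ :∧ rightSᵉ i₀ i₁ j₀ j₁ ⊢ ⊥ᶠ) i₀ i₁ j₀ j₁ (l , r))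

  -- Kernel vectors

  Vector : Set
  Vector = Pt c m n → Bool

  colour-irr : ∀ {d d′ : Colour} (e e′ : d ≡ d′) → e ≡ e′
  colour-irr refl refl = refl

  onFin : Vector → Fin m → Fin n → Bool
  onFin v x y with colourFin x y ≟ᶜ c
  ... | yes e = v ((x , y) , e)
  ... | no _ = false

  onFin-value : ∀ v x y (e : colourFin x y ≡ c) → onFin v x y ≡ v ((x , y) , e)
  onFin-value v x y e with colourFin x y ≟ᶜ c
  ... | yes e′ = cong (λ e → v ((x , y) , e)) (colour-irr e′ e)
  ... | no ne = ⊥-elim (ne e)

  onFin-zero : ∀ v x y → colourFin x y ≢ c → onFin v x y ≡ false
  onFin-zero v x y ne with colourFin x y ≟ᶜ c
  ... | yes e = ⊥-elim (ne e)
  ... | no _ = refl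

  onℕ : Vector → ℕ → ℕ → Bool
  onℕ v x y with x ℕ.<? m | y ℕ.<? n
  ... | yes p | yes q = onFin v (Fin.fromℕ< p) (Fin.fromℕ< q)
  ... | _ | _ = false

  onℤ : Vector → ℤ → ℤ → Bool
  onℤ v (+ x) (+ y) = onℕ v x y
  onℤ v _ _ = false

  onℕ-Fin : ∀ v x y → onℕ v (toℕ x) (toℕ y) ≡ onFin v x y
  onℕ-Fin v x y with toℕ x ℕ.<? m | toℕ y ℕ.<? n
  ... | yes p | yes q = cong₂ (onFin v) (FinP.fromℕ<-toℕ x p) (FinP.fromℕ<-toℕ y q)
  ... | yes p | no nq = ⊥-elim (nq (FinP.toℕ<n y))
  ... | no np | _ = ⊥-elim (np (FinP.toℕ<n x))

  onℕ-outˣ : ∀ v x y → m ℕ.≤ x → onℕ v x y ≡ false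
  onℕ-outˣ v x y h with x ℕ.<? m | y ℕ.<? n
  ... | yes p | _ = ⊥-elim (ℕP.<⇒≱ p h)
  ... | no _ | _ = refl

  onℕ-outʸ : ∀ v x y → n ℕ.≤ y → onℕ v x y ≡ false
  onℕ-outʸ v x y h with x ℕ.<? m | y ℕ.<? n
  ... | yes _ | yes q = ⊥-elim (ℕP.<⇒≱ q h)
  ... | yes _ | no _ = refl
  ... | no _ | _ = refl

  onℤ-outˣ : ∀ v y → onℤ v (+ m) y ≡ false
  onℤ-outˣ v (+ y) = onℕ-outˣ v m y ℕP.≤-refl
  onℤ-outˣ v -[1+ y ] = refl

  onℤ-outʸ : ∀ v x → onℤ v x (+ n) ≡ false
  onℤ-outʸ v (+ x) = onℕ-outʸ v x n ℕP.≤-refl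
  onℤ-outʸ v -[1+ x ] = refl

  onℤ-below : ∀ v x → onℤ v x -[1+ 0 ] ≡ false
  onℤ-below v (+ x) = refl
  onℤ-below v -[1+ x ] = refl

  -- The summand of Map is local to its definition; unification against foldr recovers it.
  map-outer : ∀ v (w : Pt (opp c) m n) → Σ (Fin m → Bool → Bool) λ k → Map c m n v w ≡ foldr k false (allFin m)
  map-outer v w = _ , refl

  map-inner : ∀ v (w : Pt (opp c) m n) → Σ (Fin m → Fin n → Bool → Bool) λ l →
    ∀ x acc → proj₁ (map-outer v w) x acc ≡ foldr (l x) false (allFin n) xor acc
  map-inner v w = _ , λ x acc → refl

  module _ (v : Vector) (x′ : Fin m) (y′ : Fin n) (e′ : colourFin x′ y′ ≡ opp c) where
    summand : Fin m → Fin n → Bool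
    summand x y = (∣ + toℕ x - + toℕ x′ ∣ ℕ.+ ∣ + toℕ y - + toℕ y′ ∣ ℕ.≡ᵇ 1) ∧ onFin v x y

    map-inner-summand : ∀ x y acc → proj₁ (map-inner v ((x′ , y′) , e′)) x y acc ≡ summand x y xor acc
    map-inner-summand x y acc with colourFin x y ≟ᶜ c
    ... | yes e = cong (_xor acc) (if-∧ (adjB (x , y) (x′ , y′)) (v ((x , y) , e)))
      where
      if-∧ : ∀ a b → (if a then b else false) ≡ a ∧ b
      if-∧ true b = refl
      if-∧ false b = refl
    ... | no _ = cong (_xor acc) (sym (𝔹.∧-zeroʳ (adjB (x , y) (x′ , y′))))

  foldr-xorSum : {A : Set} (l : List A) (k : A → Bool → Bool) (g : A → Bool) →
    (∀ a acc → k a acc ≡ g a xor acc) → foldr k false l ≡ xorSum l g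
  foldr-xorSum [] k g h = refl
  foldr-xorSum (a ∷ l) k g h = trans (h a (foldr k false l)) (cong (g a xor_) (foldr-xorSum l k g h))

  map-summands : ∀ v x′ y′ e′ → Map c m n v ((x′ , y′) , e′) ≡ xorSum (allFin m) (λ x → xorSum (allFin n) (summand v x′ y′ e′ x))
  map-summands v x′ y′ e′ = trans (proj₂ (map-outer v w)) (foldr-xorSum (allFin m) (proj₁ (map-outer v w)) (λ x → xorSum (allFin n) (summand v x′ y′ e′ x)) λ x acc →
    trans (proj₂ (map-inner v w) x acc)
      (cong (_xor acc) (foldr-xorSum (allFin n) (proj₁ (map-inner v w) x) (summand v x′ y′ e′ x) (map-inner-summand v x′ y′ e′ x))))
    where w = (x′ , y′) , e′

  private
    pred-value-ℤ : ∀ (f : ℤ → Bool) → f -[1+ 0 ] ≡ false → ∀ a → pred-value (λ k → f (+ k)) a ≡ f (+ a - + 1)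
    pred-value-ℤ f e zero = sym e
    pred-value-ℤ f e (suc a) = refl

  neighbourSum : (ℤ → ℤ → Bool) → ℤ → ℤ → Bool
  neighbourSum f x y = (f x (y + + 1) xor f x (y - + 1)) xor (f (x + + 1) y xor f (x - + 1) y)

  map-neighbours : ∀ v w → Map c m n v w ≡ neighbourSum (onℤ v) (+ toℕ (proj₁ (proj₁ w))) (+ toℕ (proj₂ (proj₁ w)))
  map-neighbours v ((x′ , y′) , e′) =
    trans (map-summands v x′ y′ e′)
    (trans (xorSum-tabulate m (λ x → x) _ (λ x → xorSumℕ n (λ y → (∣ + x - + a ∣ ℕ.+ ∣ + y - + b ∣ ℕ.≡ᵇ 1) ∧ onℕ v x y))
        (λ x → xorSum-tabulate n (λ y → y) _ _
          (λ y → cong ((∣ + toℕ x - + a ∣ ℕ.+ ∣ + toℕ y - + b ∣ ℕ.≡ᵇ 1) ∧_) (sym (onℕ-Fin v x y)))))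
    (trans (neighbour-sum m n (onℕ v) a b (onℕ-outˣ v) (onℕ-outʸ v))
    (cong₂ _xor_
      (cong₂ _xor_ (cong (onℤ v (+ a)) (cong +_ (ℕP.+-comm 1 b))) (pred-value-ℤ (onℤ v (+ a)) refl b))
      (cong₂ _xor_ (cong (λ z → onℤ v z (+ b)) (cong +_ (ℕP.+-comm 1 a))) (pred-value-ℤ (λ z → onℤ v z (+ b)) refl a)))))
    where
    a = toℕ x′
    b = toℕ y′

  data InRange : ℤ → ℤ → Set where
    inRange : (x : Fin m) (y : Fin n) → InRange (+ toℕ x) (+ toℕ y)

  range : ∀ x y → + 0 ≤ x → x < + m → + 0 ≤ y → y < + n → InRange x y
  range (+ x) (+ y) _ (ℤ.+<+ p) _ (ℤ.+<+ q) =
    subst₂ (λ a b → InRange (+ a) (+ b)) (FinP.toℕ-fromℕ< p) (FinP.toℕ-fromℕ< q) (inRange (Fin.fromℕ< p) (Fin.fromℕ< q))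

  onℤ-zero : ∀ v x y → (∀ k → x + y ≢ + 2 * k + ε) → onℤ v x y ≡ false
  onℤ-zero v -[1+ x ] y h = refl
  onℤ-zero v (+ x) -[1+ y ] h = refl
  onℤ-zero v (+ x) (+ y) h with x ℕ.<? m | y ℕ.<? n
  ... | yes p | yes q = onFin-zero v (Fin.fromℕ< p) (Fin.fromℕ< q) λ e →
          let (k , ek) = colour-half (+ x) (+ y) (trans (sym (cong₂ (λ a b → parityColour (a ℕ.+ b)) (FinP.toℕ-fromℕ< p) (FinP.toℕ-fromℕ< q))) e)
          in h k ek
  ... | yes _ | no _ = refl
  ... | no _ | _ = refl

  -- `tighten` leaves equations alone, so parity has to be offered to `lia` as a pair of
  -- inequalities with coefficients 2; rounding their constants makes them contradictory.
  parity-clash : ∀ {x y : ℤ} k l → x ≡ + 2 * k + y → x ≡ + 2 * l + y + + 1 → ⊥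
  parity-clash {x} {y} k l e e′ = lia 2 (λ k l → (+ 2) :* k :≤ (+ 2) :* l :+ # 1 :∧ (+ 2) :* l :+ # 1 :≤ (+ 2) :* k ⊢ ⊥ᶠ) k l
    (lia 4 (λ x y k l → x :≡ (+ 2) :* k :+ y :∧ x :≡ (+ 2) :* l :+ y :+ # 1 ⊢
      (+ 2) :* k :≤ (+ 2) :* l :+ # 1 :∧ (+ 2) :* l :+ # 1 :≤ (+ 2) :* k) x y k l (e , e′))

  not-c⇒opp : ∀ {d} (e : Colour) → d ≢ e → d ≡ opp e
  not-c⇒opp {black} black ne = ⊥-elim (ne refl)
  not-c⇒opp {white} black ne = refl
  not-c⇒opp {black} white ne = refl
  not-c⇒opp {white} white ne = ⊥-elim (ne refl)

  -- At points of the opposite colour this is the kernel condition. At points of colour `c` all four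
  -- neighbours have the other colour, where the extension by zero vanishes. So the condition holds
  -- at all points of R, and the reflection below need not keep track of colours.
  kernel-sum : ∀ v → InKer c m n v → ∀ {x y} → InRange x y → neighbourSum (onℤ v) x y ≡ false
  kernel-sum v ker (inRange x y) with colourFin x y ≟ᶜ c
  ... | no ne = trans (sym (map-neighbours v ((x , y) , not-c⇒opp c ne))) (ker ((x , y) , not-c⇒opp c ne))
  ... | yes e with colour-half (+ toℕ x) (+ toℕ y) e
  ...   | k , ek = cong₂ _xor_ (cong₂ _xor_ z₃ z₄) (cong₂ _xor_ z₁ z₂)
    where
    X = + toℕ x
    Y = + toℕ y
    z₃ : onℤ v X (Y + + 1) ≡ false
    z₃ = onℤ-zero v X (Y + + 1) λ l el → parity-clash l k el
      (liaG 3 (λ X Y k → X :+ Y :≡ (+ 2) :* k :+ εᵉ ⊢ X :+ (Y :+ # 1) :≡ (+ 2) :* k :+ εᵉ :+ # 1) X Y k ek)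
    z₄ : onℤ v X (Y - + 1) ≡ false
    z₄ = onℤ-zero v X (Y - + 1) λ l el → parity-clash l (k - + 1) el
      (liaG 3 (λ X Y k → X :+ Y :≡ (+ 2) :* k :+ εᵉ ⊢ X :+ (Y :- # 1) :≡ (+ 2) :* (k :- # 1) :+ εᵉ :+ # 1) X Y k ek)
    z₁ : onℤ v (X + + 1) Y ≡ false
    z₁ = onℤ-zero v (X + + 1) Y λ l el → parity-clash l k el
      (liaG 3 (λ X Y k → X :+ Y :≡ (+ 2) :* k :+ εᵉ ⊢ X :+ # 1 :+ Y :≡ (+ 2) :* k :+ εᵉ :+ # 1) X Y k ek)
    z₂ : onℤ v (X - + 1) Y ≡ false
    z₂ = onℤ-zero v (X - + 1) Y λ l el → parity-clash l (k - + 1) el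
      (liaG 3 (λ X Y k → X :+ Y :≡ (+ 2) :* k :+ εᵉ ⊢ X :- # 1 :+ Y :≡ (+ 2) :* (k :- # 1) :+ εᵉ :+ # 1) X Y k ek)

  -- Reflecting a kernel vector in the walls and splitting it

  module FoldX = Bounce (suc m) (ℕ.s≤s ℕ.z≤n)
  module FoldY = Bounce (suc n) (ℕ.s≤s ℕ.z≤n)

  -- Extension of v to ℤ² by reflection in the walls, in the coordinates
  -- X = x + 1 and Y = y + 1.
  extended : Vector → ℤ → ℤ → Bool
  extended v X Y = onℤ v (FoldX.fold X - + 1) (FoldY.fold Y - + 1)

  onℤ-wallˣ : ∀ v P y → P ≡ + 0 ⊎ P ≡ + suc m → onℤ v (P - + 1) y ≡ false
  onℤ-wallˣ v P y (inj₁ refl) = refl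
  onℤ-wallˣ v P y (inj₂ refl) = onℤ-outˣ v y

  onℤ-wallʸ : ∀ v x P → P ≡ + 0 ⊎ P ≡ + suc n → onℤ v x (P - + 1) ≡ false
  onℤ-wallʸ v x P (inj₁ refl) = onℤ-below v x
  onℤ-wallʸ v x P (inj₂ refl) = onℤ-outʸ v x

  module _ (v : Vector) (ker : InKer c m n v) where
    private
      f : ℤ → ℤ → Bool
      f P Q = onℤ v (P - + 1) (Q - + 1)

      interior : ∀ P Q → + 0 < P × P < + suc m → + 0 < Q × Q < + suc n →
        (f P (Q + + 1) xor f P (Q - + 1)) xor (f (P + + 1) Q xor f (P - + 1) Q) ≡ false
      interior P Q (h₁ , h₂) (h₃ , h₄) =
        trans (cong₂ _xor_ (cong₂ _xor_ (cong (onℤ v (P - + 1)) (sh Q)) refl)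
                           (cong₂ _xor_ (cong (λ z → onℤ v z (Q - + 1)) (sh P)) refl))
          (kernel-sum v ker (range (P - + 1) (Q - + 1)
            (lia 1 (λ P → # 0 :< P ⊢ # 0 :≤ P :- # 1) P h₁) (lia 2 (λ P m → P :< # 1 :+ m ⊢ P :- # 1 :< m) P (+ m) h₂)
            (lia 1 (λ P → # 0 :< P ⊢ # 0 :≤ P :- # 1) Q h₃) (lia 2 (λ P m → P :< # 1 :+ m ⊢ P :- # 1 :< m) Q (+ n) h₄)))
        where
        sh : ∀ P → P + + 1 - + 1 ≡ P - + 1 + + 1
        sh P = lia 1 (λ P → ⊤ᶠ ⊢ P :+ # 1 :- # 1 :≡ P :- # 1 :+ # 1) P tt

      -- At a point of a wall, the neighbours along the wall have value zero, and those across it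
      -- are mirror images of each other and cancel. Elsewhere the folded neighbours are the true
      -- ones up to order, and the kernel condition applies.
      folded-sum : ∀ {a P b a′ Q b′} → Neighbours (+ suc m) a P b → Neighbours (+ suc n) a′ Q b′ →
        (f P b′ xor f P a′) xor (f b Q xor f a Q) ≡ false
      folded-sum {a} {P} {a′ = a′} {Q} {b′} (inj₁ (w , refl)) _ =
        cong₂ _xor_ (cong₂ _xor_ (onℤ-wallˣ v P (b′ - + 1) w) (onℤ-wallˣ v P (a′ - + 1) w)) (𝔹.xor-same (f a Q))
      folded-sum {a} {P} {b} {a′} {Q} (inj₂ _) (inj₁ (w , refl)) =
        cong₂ _xor_ (𝔹.xor-same (f P a′)) (cong₂ _xor_ (onℤ-wallʸ v (b - + 1) Q w) (onℤ-wallʸ v (a - + 1) Q w))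
      folded-sum {P = P} {Q = Q} (inj₂ (h , inj₁ (refl , refl))) (inj₂ (h′ , inj₁ (refl , refl))) = interior P Q h h′
      folded-sum {P = P} {Q = Q} (inj₂ (h , inj₁ (refl , refl))) (inj₂ (h′ , inj₂ (refl , refl))) =
        trans (cong (_xor (f (P + + 1) Q xor f (P - + 1) Q)) (𝔹.xor-comm (f P (Q - + 1)) (f P (Q + + 1)))) (interior P Q h h′)
      folded-sum {P = P} {Q = Q} (inj₂ (h , inj₂ (refl , refl))) (inj₂ (h′ , inj₁ (refl , refl))) =
        trans (cong ((f P (Q + + 1) xor f P (Q - + 1)) xor_) (𝔹.xor-comm (f (P - + 1) Q) (f (P + + 1) Q))) (interior P Q h h′)
      folded-sum {P = P} {Q = Q} (inj₂ (h , inj₂ (refl , refl))) (inj₂ (h′ , inj₂ (refl , refl))) =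
        trans (cong₂ _xor_ (𝔹.xor-comm (f P (Q - + 1)) (f P (Q + + 1))) (𝔹.xor-comm (f (P - + 1) Q) (f (P + + 1) Q))) (interior P Q h h′)

    extended-sum : ∀ X Y → neighbourSum (extended v) X Y ≡ false
    extended-sum X Y = folded-sum (FoldX.fold-neighbours X) (FoldY.fold-neighbours Y)

  -- The extension along the line j = 0. This line meets the bottom wall at (0 , 0), so `F` vanishes
  -- at 0 and the splitting into F i and F j needs no correction by a constant.
  profile : Vector → ℤ → Bool
  profile v i = extended v (i + ε) i

  ℤ-constant : (h : ℤ → Bool) → (∀ k → h (k + + 1) ≡ h k) → ∀ k → h k ≡ h (+ 0)
  ℤ-constant h step (+ zero) = refl
  ℤ-constant h step (+ suc k) = trans (trans (cong (h ∘ +_) (ℕP.+-comm 1 k)) (step (+ k))) (ℤ-constant h step (+ k))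
  ℤ-constant h step -[1+ zero ] = sym (step -[1+ 0 ])
  ℤ-constant h step -[1+ suc k ] = trans (sym (step -[1+ suc k ])) (ℤ-constant h step -[1+ k ])

  onℤ-cong : ∀ {v w} → v ≈ᵥ w → ∀ x y → onℤ v x y ≡ onℤ w x y
  onℤ-cong {v} {w} h -[1+ x ] y = refl
  onℤ-cong {v} {w} h (+ x) -[1+ y ] = refl
  onℤ-cong {v} {w} h (+ x) (+ y) with x ℕ.<? m | y ℕ.<? n
  ... | yes _ | no _ = refl
  ... | no _ | _ = refl
  ... | yes p | yes q with colourFin (Fin.fromℕ< p) (Fin.fromℕ< q) ≟ᶜ c
  ...   | yes e = h _
  ...   | no _ = refl

  profile-cong : ∀ {v w} → v ≈ᵥ w → ∀ i → profile v i ≡ profile w i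
  profile-cong h i = onℤ-cong h (FoldX.fold (i + ε) - + 1) (FoldY.fold i - + 1)

  extended-inside : ∀ v x y → InRange x y → extended v (x + + 1) (y + + 1) ≡ onℤ v x y
  extended-inside v _ _ (inRange x y) = cong₂ (onℤ v)
    (trans (cong (_- + 1) (FoldX.fold-id (toℕ x ℕ.+ 1) (subst (ℕ._≤ suc m) (ℕP.+-comm 1 (toℕ x)) (ℕP.<⇒≤ (ℕ.s≤s (FinP.toℕ<n x))))))
      (lia 1 (λ x → ⊤ᶠ ⊢ x :+ # 1 :- # 1 :≡ x) (+ toℕ x) tt))
    (trans (cong (_- + 1) (FoldY.fold-id (toℕ y ℕ.+ 1) (subst (ℕ._≤ suc n) (ℕP.+-comm 1 (toℕ y)) (ℕP.<⇒≤ (ℕ.s≤s (FinP.toℕ<n y))))))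
      (lia 1 (λ x → ⊤ᶠ ⊢ x :+ # 1 :- # 1 :≡ x) (+ toℕ y) tt))

  xor-false : ∀ a b → a xor b ≡ false → a ≡ b
  xor-false false false _ = refl
  xor-false true true _ = refl

  onR : (i j : ℤ) → Set
  onR i j = + 0 ≤ i + j + ε - + 1 × i + j + ε - + 1 < + m × + 0 ≤ i - j - + 1 × i - j - + 1 < + n

  module _ (v : Vector) (ker : InKer c m n v) where
    private
      U : ℤ → ℤ → Bool
      U i j = extended v (i + j + ε) (i - j)

      -- The sum over the corners of a face, arranged so that the increment of `U` in i is seen to
      -- be independent of j. Two uses of `ℤ-constant` then separate the variables.
      U-face : ∀ i j → U (i + + 1) (j + + 1) xor U i (j + + 1) ≡ U (i + + 1) j xor U i j
      U-face i j = arrange (U (i + + 1) j) (U i (j + + 1)) (U (i + + 1) (j + + 1)) (U i j)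
        (trans (cong₂ _xor_
          (cong₂ _xor_ (cong₂ (extended v) (e₁ i j) (e₂ i j)) (cong₂ (extended v) (e₃ i j) (e₄ i j)))
          (cong₂ _xor_ (cong₂ (extended v) (e₅ i j) (e₆ i j)) (cong (λ X → extended v X (i - j)) (e₇ i j))))
          (extended-sum v ker (i + j + ε + + 1) (i - j)))
        where
        arrange : ∀ a b c d → (a xor b) xor (c xor d) ≡ false → c xor b ≡ a xor d
        arrange false false c d e = trans (𝔹.xor-identityʳ c) (xor-false c d e)
        arrange false true false true e = refl
        arrange false true true false e = refl
        arrange true false false true e = refl
        arrange true false true false e = refl
        arrange true true false false e = refl
        arrange true true true true e = refl
        e₁ = λ i j → liaG 2 (λ i j → ⊤ᶠ ⊢ i :+ # 1 :+ j :+ εᵉ :≡ i :+ j :+ εᵉ :+ # 1) i j tt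
        e₂ = λ i j → lia 2 (λ i j → ⊤ᶠ ⊢ i :+ # 1 :- j :≡ i :- j :+ # 1) i j tt
        e₃ = λ i j → liaG 2 (λ i j → ⊤ᶠ ⊢ i :+ (j :+ # 1) :+ εᵉ :≡ i :+ j :+ εᵉ :+ # 1) i j tt
        e₄ = λ i j → lia 2 (λ i j → ⊤ᶠ ⊢ i :- (j :+ # 1) :≡ i :- j :- # 1) i j tt
        e₅ = λ i j → liaG 2 (λ i j → ⊤ᶠ ⊢ i :+ # 1 :+ (j :+ # 1) :+ εᵉ :≡ i :+ j :+ εᵉ :+ # 1 :+ # 1) i j tt
        e₆ = λ i j → lia 2 (λ i j → ⊤ᶠ ⊢ i :+ # 1 :- (j :+ # 1) :≡ i :- j) i j tt
        e₇ = λ i j → liaG 2 (λ i j → ⊤ᶠ ⊢ i :+ j :+ εᵉ :≡ i :+ j :+ εᵉ :+ # 1 :- # 1) i j tt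

      xor-cancelʳ : ∀ a b c d → a xor b ≡ c xor d → a xor c ≡ b xor d
      xor-cancelʳ a b c d e = xor-false (a xor c) (b xor d) (trans (xor-swap a c b d) (trans (cong (_xor (c xor d)) e) (𝔹.xor-same (c xor d))))

      U-column : ∀ i j → U (i + + 1) j xor U i j ≡ U (i + + 1) (+ 0) xor U i (+ 0)
      U-column i = ℤ-constant (λ j → U (i + + 1) j xor U i j) (U-face i)

      U-split : ∀ i j → U i j xor U i (+ 0) ≡ U (+ 0) j xor U (+ 0) (+ 0)
      U-split i j = ℤ-constant (λ i → U i j xor U i (+ 0))
        (λ i → xor-cancelʳ (U (i + + 1) j) (U i j) (U (i + + 1) (+ 0)) (U i (+ 0)) (U-column i j)) i

      F = profile v

      -- The points (0 , j) and (j , 0) are mirror images in the bottom wall, so evenness of the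
      -- extension in Y turns `U 0 j` into `F j`.
      U-values : ∀ i j → U i j ≡ F i xor F j
      U-values i j = trans (move (U i j) (U i (+ 0)) (U (+ 0) j) (U (+ 0) (+ 0)) (onℤ-below v (FoldX.fold (+ 0 + + 0 + ε) - + 1)) (U-split i j))
        (cong₂ _xor_ (cong₂ (extended v) (liaG 1 (λ i → ⊤ᶠ ⊢ i :+ # 0 :+ εᵉ :≡ i :+ εᵉ) i tt) (ℤP.+-identityʳ i))
                     (cong₂ (λ X Y → onℤ v (X - + 1) (Y - + 1))
                       (cong FoldX.fold (liaG 1 (λ j → ⊤ᶠ ⊢ # 0 :+ j :+ εᵉ :≡ j :+ εᵉ) j tt))
                       (trans (cong FoldY.fold (ℤP.+-identityˡ (- j))) (FoldY.fold-neg j))))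
        where
        move : ∀ a b c d → d ≡ false → a xor b ≡ c xor d → a ≡ b xor c
        move a false c .false refl e = trans (sym (𝔹.xor-identityʳ a)) (trans e (𝔹.xor-identityʳ c))
        move false true true .false refl e = refl
        move true true false .false refl e = refl
        move true true true .false refl ()
        move false true false .false refl ()

      wall-eq : ∀ i j → U i j ≡ false → F i ≡ F j
      wall-eq i j e = xor-false (F i) (F j) (trans (sym (U-values i j)) e)

    profile-values : ∀ i j → onR i j → onℤ v (i + j + ε - + 1) (i - j - + 1) ≡ F i xor F j
    profile-values i j (h₁ , h₂ , h₃ , h₄) =
      trans (sym (extended-inside v (i + j + ε - + 1) (i - j - + 1) (range (i + j + ε - + 1) (i - j - + 1) h₁ h₂ h₃ h₄)))
        (trans (cong₂ (extended v) (liaG 2 (λ i j → ⊤ᶠ ⊢ i :+ j :+ εᵉ :- # 1 :+ # 1 :≡ i :+ j :+ εᵉ) i j tt)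
                                   (lia 2 (λ i j → ⊤ᶠ ⊢ i :- j :- # 1 :+ # 1 :≡ i :- j) i j tt))
          (U-values i j))

    -- Each equation says that the extension vanishes at a point of a wall: (-ε - k , k) lies on the
    -- left one, (k + n + 1 , k) on the top one and (m + 1 - ε - k , k) on the right one.
    profile-reflective : Reflective (profile v)
    profile-reflective = record { left = left ; top = top ; right = right }
      where
      left : ∀ k → F (- ε - k) ≡ F k
      left k = wall-eq (- ε - k) k (trans
        (cong (λ X → extended v X (- ε - k - k)) (liaG 1 (λ k → ⊤ᶠ ⊢ neg εᵉ :- k :+ k :+ εᵉ :≡ # 0) k tt))
        (onℤ-wallˣ v (+ 0) (FoldY.fold (- ε - k - k) - + 1) (inj₁ refl)))
      top : ∀ k → F (k + (+ n + + 1)) ≡ F k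
      top k = wall-eq (k + (+ n + + 1)) k (trans
        (cong (extended v (k + (+ n + + 1) + k + ε)) (liaG 1 (λ k → ⊤ᶠ ⊢ k :+ (nᵉ :+ # 1) :- k :≡ # 1 :+ nᵉ) k tt))
        (onℤ-wallʸ v (FoldX.fold (k + (+ n + + 1) + k + ε) - + 1) (FoldY.fold (+ suc n)) (inj₂ (FoldY.fold-id (suc n) ℕP.≤-refl))))
      right : ∀ k → F (+ m + + 1 - ε - k) ≡ F k
      right k = wall-eq (+ m + + 1 - ε - k) k (trans
        (cong (λ X → extended v X (+ m + + 1 - ε - k - k)) (liaG 1 (λ k → ⊤ᶠ ⊢ mᵉ :+ # 1 :- εᵉ :- k :+ k :+ εᵉ :≡ # 1 :+ mᵉ) k tt))
        (onℤ-wallˣ v (FoldX.fold (+ suc m)) (FoldY.fold (+ m + + 1 - ε - k - k) - + 1) (inj₂ (FoldX.fold-id (suc m) ℕP.≤-refl))))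

  coords : ∀ (p : Pt c m n) → let ((x , y) , _) = p in
    ∃ λ i → ∃ λ j → (+ toℕ x ≡ i + j + ε - + 1 × + toℕ y ≡ i - j - + 1) × onR i j
  coords ((x , y) , e) with colour-half (+ toℕ x) (+ toℕ y) e
  ... | k , ek = k + + 1 , + toℕ x - ε - k ,
    liaG 3 (λ x y k → (x :+ y :≡ (+ 2) :* k :+ εᵉ) :∧ (# 0 :≤ x :∧ x :< mᵉ :∧ # 0 :≤ y :∧ y :< nᵉ) ⊢
      let i = k :+ # 1 ; j = x :- εᵉ :- k in
      (x :≡ i :+ j :+ εᵉ :- # 1 :∧ y :≡ i :- j :- # 1) :∧
      (# 0 :≤ i :+ j :+ εᵉ :- # 1 :∧ i :+ j :+ εᵉ :- # 1 :< mᵉ :∧ # 0 :≤ i :- j :- # 1 :∧ i :- j :- # 1 :< nᵉ))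
      (+ toℕ x) (+ toℕ y) k (ek , 0≤+ , ℤ.+<+ (FinP.toℕ<n x) , 0≤+ , ℤ.+<+ (FinP.toℕ<n y))

  onℤ-point : ∀ v (p : Pt c m n) → let ((x , y) , _) = p in onℤ v (+ toℕ x) (+ toℕ y) ≡ v p
  onℤ-point v ((x , y) , e) = trans (onℕ-Fin v x y) (onFin-value v x y e)

  vector-values : ∀ v → InKer c m n v → ∀ p i j → (let ((x , y) , _) = p in + toℕ x ≡ i + j + ε - + 1 × + toℕ y ≡ i - j - + 1) → onR i j →
    v p ≡ profile v i xor profile v j
  vector-values v ker p i j (ex , ey) h = trans (sym (onℤ-point v p)) (trans (cong₂ (onℤ v) ex ey) (profile-values v ker i j h))

  profile-nonconstant : ∀ v → InKer c m n v → NonZeroV v → NonConstant (profile v)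
  profile-nonconstant v ker (p , vp) =
    let (i , j , e , h) = coords p in
    i , j , differ (profile v i) (profile v j) (trans (sym (vector-values v ker p i j e h)) vp)
    where
    differ : ∀ a b → a xor b ≡ true → b ≡ not a
    differ false true _ = refl
    differ true false _ = refl

  -- From tilings to kernel vectors

  containsᵉ : (i₀ i₁ j₀ j₁ a b : Expr) → Form
  containsᵉ i₀ i₁ j₀ j₁ a b = (i₀ :≤ a :∧ a :≤ i₁) :∧ (j₀ :≤ b :∧ b :≤ j₁)

  onRᵉ faceᵉ : (i j : Expr) → Form
  onRᵉ i j = # 0 :≤ i :+ j :+ εᵉ :- # 1 :∧ i :+ j :+ εᵉ :- # 1 :< mᵉ :∧ # 0 :≤ i :- j :- # 1 :∧ i :- j :- # 1 :< nᵉ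
  faceᵉ i j = # 0 :≤ i :+ j :+ εᵉ :∧ i :+ j :+ εᵉ :< mᵉ :∧ # 0 :≤ i :- j :- # 1 :∧ i :- j :- # 1 :< nᵉ

  Contains : Piece → ℤ → ℤ → Set
  Contains (dia _ _) a b = ⊥
  Contains (blk i₀ i₁ j₀ j₁) a b = (i₀ ≤ a × a ≤ i₁) × (j₀ ≤ b × b ≤ j₁)

  contains? : ∀ a b P → Dec (Contains P a b)
  contains? a b (dia _ _) = no λ ()
  contains? a b (blk i₀ i₁ j₀ j₁) = (i₀ ℤ.≤? a ×-dec a ℤ.≤? i₁) ×-dec (j₀ ℤ.≤? b ×-dec b ℤ.≤? j₁)

  -- Eight quads surround a point, two in each of the four faces that have it as west, east, north
  -- or south corner. A block covers all eight around each of its points.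
  around-W : ∀ P a b hy → + 0 ≤ hy → hy ≤ + 1 → Contains P a b → P ∋ quad a b (+ 0) hy
  around-W (blk i₀ i₁ j₀ j₁) a b hy h h′ p = lia 7 (λ i₀ i₁ j₀ j₁ a b hy → (# 0 :≤ hy :∧ hy :≤ # 1) :∧ containsᵉ i₀ i₁ j₀ j₁ a b ⊢
    blkᵉ i₀ i₁ j₀ j₁ a b (# 0) hy) i₀ i₁ j₀ j₁ a b hy ((h , h′) , p)

  around-E : ∀ P a b hy → + 0 ≤ hy → hy ≤ + 1 → Contains P a b → P ∋ quad (a - + 1) (b - + 1) (+ 1) hy
  around-E (blk i₀ i₁ j₀ j₁) a b hy h h′ p = lia 7 (λ i₀ i₁ j₀ j₁ a b hy → (# 0 :≤ hy :∧ hy :≤ # 1) :∧ containsᵉ i₀ i₁ j₀ j₁ a b ⊢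
    blkᵉ i₀ i₁ j₀ j₁ (a :- # 1) (b :- # 1) (# 1) hy) i₀ i₁ j₀ j₁ a b hy ((h , h′) , p)

  around-N : ∀ P a b hx → + 0 ≤ hx → hx ≤ + 1 → Contains P a b → P ∋ quad (a - + 1) b hx (+ 1)
  around-N (blk i₀ i₁ j₀ j₁) a b hx h h′ p = lia 7 (λ i₀ i₁ j₀ j₁ a b hx → (# 0 :≤ hx :∧ hx :≤ # 1) :∧ containsᵉ i₀ i₁ j₀ j₁ a b ⊢
    blkᵉ i₀ i₁ j₀ j₁ (a :- # 1) b hx (# 1)) i₀ i₁ j₀ j₁ a b hx ((h , h′) , p)

  around-S : ∀ P a b hx → + 0 ≤ hx → hx ≤ + 1 → Contains P a b → P ∋ quad a (b - + 1) hx (+ 0)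
  around-S (blk i₀ i₁ j₀ j₁) a b hx h h′ p = lia 7 (λ i₀ i₁ j₀ j₁ a b hx → (# 0 :≤ hx :∧ hx :≤ # 1) :∧ containsᵉ i₀ i₁ j₀ j₁ a b ⊢
    blkᵉ i₀ i₁ j₀ j₁ a (b :- # 1) hx (# 0)) i₀ i₁ j₀ j₁ a b hx ((h , h′) , p)

  0≤0 : + 0 ≤ + 0
  0≤0 = ℤP.≤-refl
  0≤1 : + 0 ≤ + 1
  0≤1 = ℤ.+≤+ ℕ.z≤n
  1≤1 : + 1 ≤ + 1
  1≤1 = ℤP.≤-refl

  -- The positions relative to a block at which it forces the value of the vector: zero inside,
  -- nonzero on the four slanted sides of the octagon, where one coordinate lies just beyond an end
  -- of its run.
  data Place : Set where
    inside iLo iHi jLo jHi : Place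

  placeᵉ : Place → (i₀ i₁ j₀ j₁ a b : Expr) → Form
  placeᵉ inside i₀ i₁ j₀ j₁ a b = (i₀ :≤ a :∧ a :≤ i₁) :∧ (j₀ :≤ b :∧ b :≤ j₁)
  placeᵉ iLo i₀ i₁ j₀ j₁ a b = a :≡ i₀ :- # 1 :∧ (j₀ :≤ b :∧ b :≤ j₁)
  placeᵉ iHi i₀ i₁ j₀ j₁ a b = a :≡ i₁ :+ # 1 :∧ (j₀ :≤ b :∧ b :≤ j₁)
  placeᵉ jLo i₀ i₁ j₀ j₁ a b = b :≡ j₀ :- # 1 :∧ (i₀ :≤ a :∧ a :≤ i₁)
  placeᵉ jHi i₀ i₁ j₀ j₁ a b = b :≡ j₁ :+ # 1 :∧ (i₀ :≤ a :∧ a :≤ i₁)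

  At : Place → (i₀ i₁ j₀ j₁ a b : ℤ) → Set
  At k i₀ i₁ j₀ j₁ a b = Holds (placeᵉ k (K i₀) (K i₁) (K j₀) (K j₁) (K a) (K b)) ρ₀

  -- Such a quad shows that (a , b) is not a zero of the tiling, provided that it is no point of
  -- `P`: a block containing (a , b) would cover the quad too and so overlap with `P`.
  Witness : Piece → ℤ → ℤ → Set
  Witness P a b = ∃ λ q → Bits q × InR q × P ∋ q × (∀ P′ → Contains P′ a b → P′ ∋ q)

  -- By default a fixed quad of the block next to the point is taken. It can stick out of R only at
  -- a wall that is an axis of the block, and then another quad around the same point, on the inner
  -- side, serves instead.
  witness : ∀ k i₀ i₁ j₀ j₁ a b → Walled (blk i₀ i₁ j₀ j₁) → k ≢ inside → At k i₀ i₁ j₀ j₁ a b → onR a b → Witness (blk i₀ i₁ j₀ j₁) a b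
  witness inside i₀ i₁ j₀ j₁ a b w ne = ⊥-elim (ne refl)
  witness iLo i₀ i₁ j₀ j₁ a b (s₁ , s₂ , bo , to , le , ri) ne p r with a + b + ε - + 1 ℤ.≤? + m - + 2 | a - b - + 1 ℤ.≤? + n - + 2
  ... | yes x | yes y =
        let (h₁ , h₂ , h₃) = liaG 6 (λ i₀ i₁ j₀ j₁ a b → placeᵉ iLo i₀ i₁ j₀ j₁ a b :∧ onRᵉ a b :∧ (i₀ :≤ i₁ :∧ j₀ :≤ j₁) :∧ a :+ b :+ εᵉ :- # 1 :≤ mᵉ :- # 2 :∧ a :- b :- # 1 :≤ nᵉ :- # 2 ⊢ bitsᵉ (# 0) (# 1) :∧ inRᵉ (a) (b) (# 0) (# 1) :∧ blkᵉ i₀ i₁ j₀ j₁ (a) (b) (# 0) (# 1))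
              i₀ i₁ j₀ j₁ a b (p , r , (s₁ , s₂) , x , y)
        in quad (a) (b) (+ 0) (+ 1) , h₁ , h₂ , h₃ , λ P′ → around-W P′ a b (+ 1) 0≤1 1≤1
  ... | no x | _ with ri | to
  ...   | inj₁ w | _ = ⊥-elim (liaG 6 (λ i₀ i₁ j₀ j₁ a b → placeᵉ iLo i₀ i₁ j₀ j₁ a b :∧ onRᵉ a b :∧ (i₀ :≤ i₁ :∧ j₀ :≤ j₁) :∧ mᵉ :- # 2 :< a :+ b :+ εᵉ :- # 1 :∧ rightNᵉ i₀ i₁ j₀ j₁ ⊢ ⊥ᶠ) i₀ i₁ j₀ j₁ a b (p , r , (s₁ , s₂) , ℤP.≰⇒> x , w))
  ...   | inj₂ w | inj₁ w′ =
        let (h₁ , h₂ , h₃) = liaG 6 (λ i₀ i₁ j₀ j₁ a b → placeᵉ iLo i₀ i₁ j₀ j₁ a b :∧ onRᵉ a b :∧ (i₀ :≤ i₁ :∧ j₀ :≤ j₁) :∧ mᵉ :- # 2 :< a :+ b :+ εᵉ :- # 1 :∧ rightSᵉ i₀ i₁ j₀ j₁ :∧ topNᵉ i₀ i₁ j₀ j₁ ⊢ bitsᵉ (# 0) (# 0) :∧ inRᵉ (a) (b :- # 1) (# 0) (# 0) :∧ blkᵉ i₀ i₁ j₀ j₁ (a) (b :- # 1) (# 0) (# 0))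
              i₀ i₁ j₀ j₁ a b (p , r , (s₁ , s₂) , ℤP.≰⇒> x , w , w′)
        in quad (a) (b - + 1) (+ 0) (+ 0) , h₁ , h₂ , h₃ , λ P′ → around-S P′ a b (+ 0) 0≤0 0≤1
  ...   | inj₂ w | inj₂ w′ =
        let (h₁ , h₂ , h₃) = liaG 6 (λ i₀ i₁ j₀ j₁ a b → placeᵉ iLo i₀ i₁ j₀ j₁ a b :∧ onRᵉ a b :∧ (i₀ :≤ i₁ :∧ j₀ :≤ j₁) :∧ mᵉ :- # 2 :< a :+ b :+ εᵉ :- # 1 :∧ rightSᵉ i₀ i₁ j₀ j₁ :∧ topSᵉ i₀ i₁ j₀ j₁ ⊢ bitsᵉ (# 0) (# 0) :∧ inRᵉ (a) (b :- # 1) (# 0) (# 0) :∧ blkᵉ i₀ i₁ j₀ j₁ (a) (b :- # 1) (# 0) (# 0))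
              i₀ i₁ j₀ j₁ a b (p , r , (s₁ , s₂) , ℤP.≰⇒> x , w , w′)
        in quad (a) (b - + 1) (+ 0) (+ 0) , h₁ , h₂ , h₃ , λ P′ → around-S P′ a b (+ 0) 0≤0 0≤1
  witness iLo i₀ i₁ j₀ j₁ a b (s₁ , s₂ , bo , to , le , ri) ne p r | yes x | no y with to
  ...   | inj₁ w = ⊥-elim (liaG 6 (λ i₀ i₁ j₀ j₁ a b → placeᵉ iLo i₀ i₁ j₀ j₁ a b :∧ onRᵉ a b :∧ (i₀ :≤ i₁ :∧ j₀ :≤ j₁) :∧ nᵉ :- # 2 :< a :- b :- # 1 :∧ topNᵉ i₀ i₁ j₀ j₁ ⊢ ⊥ᶠ) i₀ i₁ j₀ j₁ a b (p , r , (s₁ , s₂) , ℤP.≰⇒> y , w))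
  ...   | inj₂ w =
        let (h₁ , h₂ , h₃) = liaG 6 (λ i₀ i₁ j₀ j₁ a b → placeᵉ iLo i₀ i₁ j₀ j₁ a b :∧ onRᵉ a b :∧ (i₀ :≤ i₁ :∧ j₀ :≤ j₁) :∧ a :+ b :+ εᵉ :- # 1 :≤ mᵉ :- # 2 :∧ nᵉ :- # 2 :< a :- b :- # 1 :∧ topSᵉ i₀ i₁ j₀ j₁ ⊢ bitsᵉ (# 0) (# 0) :∧ inRᵉ (a) (b) (# 0) (# 0) :∧ blkᵉ i₀ i₁ j₀ j₁ (a) (b) (# 0) (# 0))
              i₀ i₁ j₀ j₁ a b (p , r , (s₁ , s₂) , x , ℤP.≰⇒> y , w)
        in quad (a) (b) (+ 0) (+ 0) , h₁ , h₂ , h₃ , λ P′ → around-W P′ a b (+ 0) 0≤0 0≤1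
  witness iHi i₀ i₁ j₀ j₁ a b (s₁ , s₂ , bo , to , le , ri) ne p r with + 1 ℤ.≤? a + b + ε - + 1 | + 1 ℤ.≤? a - b - + 1
  ... | yes x | yes y =
        let (h₁ , h₂ , h₃) = liaG 6 (λ i₀ i₁ j₀ j₁ a b → placeᵉ iHi i₀ i₁ j₀ j₁ a b :∧ onRᵉ a b :∧ (i₀ :≤ i₁ :∧ j₀ :≤ j₁) :∧ # 1 :≤ a :+ b :+ εᵉ :- # 1 :∧ # 1 :≤ a :- b :- # 1 ⊢ bitsᵉ (# 1) (# 0) :∧ inRᵉ (a :- # 1) (b :- # 1) (# 1) (# 0) :∧ blkᵉ i₀ i₁ j₀ j₁ (a :- # 1) (b :- # 1) (# 1) (# 0))
              i₀ i₁ j₀ j₁ a b (p , r , (s₁ , s₂) , x , y)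
        in quad (a - + 1) (b - + 1) (+ 1) (+ 0) , h₁ , h₂ , h₃ , λ P′ → around-E P′ a b (+ 0) 0≤0 0≤1
  ... | no x | _ with le | bo
  ...   | inj₁ w | _ = ⊥-elim (liaG 6 (λ i₀ i₁ j₀ j₁ a b → placeᵉ iHi i₀ i₁ j₀ j₁ a b :∧ onRᵉ a b :∧ (i₀ :≤ i₁ :∧ j₀ :≤ j₁) :∧ a :+ b :+ εᵉ :- # 1 :< # 1 :∧ leftNᵉ i₀ i₁ j₀ j₁ ⊢ ⊥ᶠ) i₀ i₁ j₀ j₁ a b (p , r , (s₁ , s₂) , ℤP.≰⇒> x , w))
  ...   | inj₂ w | inj₁ w′ =
        let (h₁ , h₂ , h₃) = liaG 6 (λ i₀ i₁ j₀ j₁ a b → placeᵉ iHi i₀ i₁ j₀ j₁ a b :∧ onRᵉ a b :∧ (i₀ :≤ i₁ :∧ j₀ :≤ j₁) :∧ a :+ b :+ εᵉ :- # 1 :< # 1 :∧ leftSᵉ i₀ i₁ j₀ j₁ :∧ bottomNᵉ i₀ i₁ j₀ j₁ ⊢ bitsᵉ (# 1) (# 1) :∧ inRᵉ (a :- # 1) (b) (# 1) (# 1) :∧ blkᵉ i₀ i₁ j₀ j₁ (a :- # 1) (b) (# 1) (# 1))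
              i₀ i₁ j₀ j₁ a b (p , r , (s₁ , s₂) , ℤP.≰⇒> x , w , w′)
        in quad (a - + 1) (b) (+ 1) (+ 1) , h₁ , h₂ , h₃ , λ P′ → around-N P′ a b (+ 1) 0≤1 1≤1
  ...   | inj₂ w | inj₂ w′ =
        let (h₁ , h₂ , h₃) = liaG 6 (λ i₀ i₁ j₀ j₁ a b → placeᵉ iHi i₀ i₁ j₀ j₁ a b :∧ onRᵉ a b :∧ (i₀ :≤ i₁ :∧ j₀ :≤ j₁) :∧ a :+ b :+ εᵉ :- # 1 :< # 1 :∧ leftSᵉ i₀ i₁ j₀ j₁ :∧ bottomSᵉ i₀ i₁ j₀ j₁ ⊢ bitsᵉ (# 1) (# 1) :∧ inRᵉ (a :- # 1) (b) (# 1) (# 1) :∧ blkᵉ i₀ i₁ j₀ j₁ (a :- # 1) (b) (# 1) (# 1))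
              i₀ i₁ j₀ j₁ a b (p , r , (s₁ , s₂) , ℤP.≰⇒> x , w , w′)
        in quad (a - + 1) (b) (+ 1) (+ 1) , h₁ , h₂ , h₃ , λ P′ → around-N P′ a b (+ 1) 0≤1 1≤1
  witness iHi i₀ i₁ j₀ j₁ a b (s₁ , s₂ , bo , to , le , ri) ne p r | yes x | no y with bo
  ...   | inj₁ w = ⊥-elim (liaG 6 (λ i₀ i₁ j₀ j₁ a b → placeᵉ iHi i₀ i₁ j₀ j₁ a b :∧ onRᵉ a b :∧ (i₀ :≤ i₁ :∧ j₀ :≤ j₁) :∧ a :- b :- # 1 :< # 1 :∧ bottomNᵉ i₀ i₁ j₀ j₁ ⊢ ⊥ᶠ) i₀ i₁ j₀ j₁ a b (p , r , (s₁ , s₂) , ℤP.≰⇒> y , w))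
  ...   | inj₂ w =
        let (h₁ , h₂ , h₃) = liaG 6 (λ i₀ i₁ j₀ j₁ a b → placeᵉ iHi i₀ i₁ j₀ j₁ a b :∧ onRᵉ a b :∧ (i₀ :≤ i₁ :∧ j₀ :≤ j₁) :∧ # 1 :≤ a :+ b :+ εᵉ :- # 1 :∧ a :- b :- # 1 :< # 1 :∧ bottomSᵉ i₀ i₁ j₀ j₁ ⊢ bitsᵉ (# 1) (# 1) :∧ inRᵉ (a :- # 1) (b :- # 1) (# 1) (# 1) :∧ blkᵉ i₀ i₁ j₀ j₁ (a :- # 1) (b :- # 1) (# 1) (# 1))
              i₀ i₁ j₀ j₁ a b (p , r , (s₁ , s₂) , x , ℤP.≰⇒> y , w)
        in quad (a - + 1) (b - + 1) (+ 1) (+ 1) , h₁ , h₂ , h₃ , λ P′ → around-E P′ a b (+ 1) 0≤1 1≤1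
  witness jLo i₀ i₁ j₀ j₁ a b (s₁ , s₂ , bo , to , le , ri) ne p r with a + b + ε - + 1 ℤ.≤? + m - + 2 | + 1 ℤ.≤? a - b - + 1
  ... | yes x | yes y =
        let (h₁ , h₂ , h₃) = liaG 6 (λ i₀ i₁ j₀ j₁ a b → placeᵉ jLo i₀ i₁ j₀ j₁ a b :∧ onRᵉ a b :∧ (i₀ :≤ i₁ :∧ j₀ :≤ j₁) :∧ a :+ b :+ εᵉ :- # 1 :≤ mᵉ :- # 2 :∧ # 1 :≤ a :- b :- # 1 ⊢ bitsᵉ (# 0) (# 0) :∧ inRᵉ (a) (b) (# 0) (# 0) :∧ blkᵉ i₀ i₁ j₀ j₁ (a) (b) (# 0) (# 0))
              i₀ i₁ j₀ j₁ a b (p , r , (s₁ , s₂) , x , y)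
        in quad (a) (b) (+ 0) (+ 0) , h₁ , h₂ , h₃ , λ P′ → around-W P′ a b (+ 0) 0≤0 0≤1
  ... | no x | _ with ri | bo
  ...   | inj₁ w | _ = ⊥-elim (liaG 6 (λ i₀ i₁ j₀ j₁ a b → placeᵉ jLo i₀ i₁ j₀ j₁ a b :∧ onRᵉ a b :∧ (i₀ :≤ i₁ :∧ j₀ :≤ j₁) :∧ mᵉ :- # 2 :< a :+ b :+ εᵉ :- # 1 :∧ rightNᵉ i₀ i₁ j₀ j₁ ⊢ ⊥ᶠ) i₀ i₁ j₀ j₁ a b (p , r , (s₁ , s₂) , ℤP.≰⇒> x , w))
  ...   | inj₂ w | inj₁ w′ =
        let (h₁ , h₂ , h₃) = liaG 6 (λ i₀ i₁ j₀ j₁ a b → placeᵉ jLo i₀ i₁ j₀ j₁ a b :∧ onRᵉ a b :∧ (i₀ :≤ i₁ :∧ j₀ :≤ j₁) :∧ mᵉ :- # 2 :< a :+ b :+ εᵉ :- # 1 :∧ rightSᵉ i₀ i₁ j₀ j₁ :∧ bottomNᵉ i₀ i₁ j₀ j₁ ⊢ bitsᵉ (# 0) (# 1) :∧ inRᵉ (a :- # 1) (b) (# 0) (# 1) :∧ blkᵉ i₀ i₁ j₀ j₁ (a :- # 1) (b) (# 0) (# 1))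
              i₀ i₁ j₀ j₁ a b (p , r , (s₁ , s₂) , ℤP.≰⇒> x , w , w′)
        in quad (a - + 1) (b) (+ 0) (+ 1) , h₁ , h₂ , h₃ , λ P′ → around-N P′ a b (+ 0) 0≤0 0≤1
  ...   | inj₂ w | inj₂ w′ =
        let (h₁ , h₂ , h₃) = liaG 6 (λ i₀ i₁ j₀ j₁ a b → placeᵉ jLo i₀ i₁ j₀ j₁ a b :∧ onRᵉ a b :∧ (i₀ :≤ i₁ :∧ j₀ :≤ j₁) :∧ mᵉ :- # 2 :< a :+ b :+ εᵉ :- # 1 :∧ rightSᵉ i₀ i₁ j₀ j₁ :∧ bottomSᵉ i₀ i₁ j₀ j₁ ⊢ bitsᵉ (# 0) (# 1) :∧ inRᵉ (a :- # 1) (b) (# 0) (# 1) :∧ blkᵉ i₀ i₁ j₀ j₁ (a :- # 1) (b) (# 0) (# 1))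
              i₀ i₁ j₀ j₁ a b (p , r , (s₁ , s₂) , ℤP.≰⇒> x , w , w′)
        in quad (a - + 1) (b) (+ 0) (+ 1) , h₁ , h₂ , h₃ , λ P′ → around-N P′ a b (+ 0) 0≤0 0≤1
  witness jLo i₀ i₁ j₀ j₁ a b (s₁ , s₂ , bo , to , le , ri) ne p r | yes x | no y with bo
  ...   | inj₁ w = ⊥-elim (liaG 6 (λ i₀ i₁ j₀ j₁ a b → placeᵉ jLo i₀ i₁ j₀ j₁ a b :∧ onRᵉ a b :∧ (i₀ :≤ i₁ :∧ j₀ :≤ j₁) :∧ a :- b :- # 1 :< # 1 :∧ bottomNᵉ i₀ i₁ j₀ j₁ ⊢ ⊥ᶠ) i₀ i₁ j₀ j₁ a b (p , r , (s₁ , s₂) , ℤP.≰⇒> y , w))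
  ...   | inj₂ w =
        let (h₁ , h₂ , h₃) = liaG 6 (λ i₀ i₁ j₀ j₁ a b → placeᵉ jLo i₀ i₁ j₀ j₁ a b :∧ onRᵉ a b :∧ (i₀ :≤ i₁ :∧ j₀ :≤ j₁) :∧ a :+ b :+ εᵉ :- # 1 :≤ mᵉ :- # 2 :∧ a :- b :- # 1 :< # 1 :∧ bottomSᵉ i₀ i₁ j₀ j₁ ⊢ bitsᵉ (# 0) (# 1) :∧ inRᵉ (a) (b) (# 0) (# 1) :∧ blkᵉ i₀ i₁ j₀ j₁ (a) (b) (# 0) (# 1))
              i₀ i₁ j₀ j₁ a b (p , r , (s₁ , s₂) , x , ℤP.≰⇒> y , w)
        in quad (a) (b) (+ 0) (+ 1) , h₁ , h₂ , h₃ , λ P′ → around-W P′ a b (+ 1) 0≤1 1≤1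
  witness jHi i₀ i₁ j₀ j₁ a b (s₁ , s₂ , bo , to , le , ri) ne p r with + 1 ℤ.≤? a + b + ε - + 1 | a - b - + 1 ℤ.≤? + n - + 2
  ... | yes x | yes y =
        let (h₁ , h₂ , h₃) = liaG 6 (λ i₀ i₁ j₀ j₁ a b → placeᵉ jHi i₀ i₁ j₀ j₁ a b :∧ onRᵉ a b :∧ (i₀ :≤ i₁ :∧ j₀ :≤ j₁) :∧ # 1 :≤ a :+ b :+ εᵉ :- # 1 :∧ a :- b :- # 1 :≤ nᵉ :- # 2 ⊢ bitsᵉ (# 1) (# 1) :∧ inRᵉ (a :- # 1) (b :- # 1) (# 1) (# 1) :∧ blkᵉ i₀ i₁ j₀ j₁ (a :- # 1) (b :- # 1) (# 1) (# 1))
              i₀ i₁ j₀ j₁ a b (p , r , (s₁ , s₂) , x , y)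
        in quad (a - + 1) (b - + 1) (+ 1) (+ 1) , h₁ , h₂ , h₃ , λ P′ → around-E P′ a b (+ 1) 0≤1 1≤1
  ... | no x | _ with le | to
  ...   | inj₁ w | _ = ⊥-elim (liaG 6 (λ i₀ i₁ j₀ j₁ a b → placeᵉ jHi i₀ i₁ j₀ j₁ a b :∧ onRᵉ a b :∧ (i₀ :≤ i₁ :∧ j₀ :≤ j₁) :∧ a :+ b :+ εᵉ :- # 1 :< # 1 :∧ leftNᵉ i₀ i₁ j₀ j₁ ⊢ ⊥ᶠ) i₀ i₁ j₀ j₁ a b (p , r , (s₁ , s₂) , ℤP.≰⇒> x , w))
  ...   | inj₂ w | inj₁ w′ =
        let (h₁ , h₂ , h₃) = liaG 6 (λ i₀ i₁ j₀ j₁ a b → placeᵉ jHi i₀ i₁ j₀ j₁ a b :∧ onRᵉ a b :∧ (i₀ :≤ i₁ :∧ j₀ :≤ j₁) :∧ a :+ b :+ εᵉ :- # 1 :< # 1 :∧ leftSᵉ i₀ i₁ j₀ j₁ :∧ topNᵉ i₀ i₁ j₀ j₁ ⊢ bitsᵉ (# 1) (# 0) :∧ inRᵉ (a) (b :- # 1) (# 1) (# 0) :∧ blkᵉ i₀ i₁ j₀ j₁ (a) (b :- # 1) (# 1) (# 0))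
              i₀ i₁ j₀ j₁ a b (p , r , (s₁ , s₂) , ℤP.≰⇒> x , w , w′)
        in quad (a) (b - + 1) (+ 1) (+ 0) , h₁ , h₂ , h₃ , λ P′ → around-S P′ a b (+ 1) 0≤1 1≤1
  ...   | inj₂ w | inj₂ w′ =
        let (h₁ , h₂ , h₃) = liaG 6 (λ i₀ i₁ j₀ j₁ a b → placeᵉ jHi i₀ i₁ j₀ j₁ a b :∧ onRᵉ a b :∧ (i₀ :≤ i₁ :∧ j₀ :≤ j₁) :∧ a :+ b :+ εᵉ :- # 1 :< # 1 :∧ leftSᵉ i₀ i₁ j₀ j₁ :∧ topSᵉ i₀ i₁ j₀ j₁ ⊢ bitsᵉ (# 1) (# 0) :∧ inRᵉ (a) (b :- # 1) (# 1) (# 0) :∧ blkᵉ i₀ i₁ j₀ j₁ (a) (b :- # 1) (# 1) (# 0))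
              i₀ i₁ j₀ j₁ a b (p , r , (s₁ , s₂) , ℤP.≰⇒> x , w , w′)
        in quad (a) (b - + 1) (+ 1) (+ 0) , h₁ , h₂ , h₃ , λ P′ → around-S P′ a b (+ 1) 0≤1 1≤1
  witness jHi i₀ i₁ j₀ j₁ a b (s₁ , s₂ , bo , to , le , ri) ne p r | yes x | no y with to
  ...   | inj₁ w = ⊥-elim (liaG 6 (λ i₀ i₁ j₀ j₁ a b → placeᵉ jHi i₀ i₁ j₀ j₁ a b :∧ onRᵉ a b :∧ (i₀ :≤ i₁ :∧ j₀ :≤ j₁) :∧ nᵉ :- # 2 :< a :- b :- # 1 :∧ topNᵉ i₀ i₁ j₀ j₁ ⊢ ⊥ᶠ) i₀ i₁ j₀ j₁ a b (p , r , (s₁ , s₂) , ℤP.≰⇒> y , w))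
  ...   | inj₂ w =
        let (h₁ , h₂ , h₃) = liaG 6 (λ i₀ i₁ j₀ j₁ a b → placeᵉ jHi i₀ i₁ j₀ j₁ a b :∧ onRᵉ a b :∧ (i₀ :≤ i₁ :∧ j₀ :≤ j₁) :∧ # 1 :≤ a :+ b :+ εᵉ :- # 1 :∧ nᵉ :- # 2 :< a :- b :- # 1 :∧ topSᵉ i₀ i₁ j₀ j₁ ⊢ bitsᵉ (# 1) (# 0) :∧ inRᵉ (a :- # 1) (b :- # 1) (# 1) (# 0) :∧ blkᵉ i₀ i₁ j₀ j₁ (a :- # 1) (b :- # 1) (# 1) (# 0))
              i₀ i₁ j₀ j₁ a b (p , r , (s₁ , s₂) , x , ℤP.≰⇒> y , w)
        in quad (a - + 1) (b - + 1) (+ 1) (+ 0) , h₁ , h₂ , h₃ , λ P′ → around-E P′ a b (+ 0) 0≤0 0≤1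

  onℤ-outside : ∀ v x y → (+ 0 ≤ x → x < + m → + 0 ≤ y → y < + n → ⊥) → onℤ v x y ≡ false
  onℤ-outside v -[1+ x ] y h = refl
  onℤ-outside v (+ x) -[1+ y ] h = refl
  onℤ-outside v (+ x) (+ y) h with x ℕ.<? m | y ℕ.<? n
  ... | yes p | yes q = ⊥-elim (h 0≤+ (ℤ.+<+ p) 0≤+ (ℤ.+<+ q))
  ... | yes _ | no _ = refl
  ... | no _ | _ = refl

  fins : ∀ {x y} → InRange x y → ∃ λ (a : Fin m) → ∃ λ (b : Fin n) → x ≡ + toℕ a × y ≡ + toℕ b
  fins (inRange a b) = a , b , refl , refl

  either : {A B C : Set} → (A → C) → (B → C) → A ⊎ B → C
  either f g (inj₁ a) = f a
  either f g (inj₂ b) = g b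

  onR? : ∀ a b → Dec (onR a b)
  onR? a b = (+ 0 ℤ.≤? a + b + ε - + 1) ×-dec (a + b + ε - + 1 ℤ.<? + m) ×-dec (+ 0 ℤ.≤? a - b - + 1) ×-dec (a - b - + 1 ℤ.<? + n)

  corner : ∀ i₀ i₁ j₀ j₁ i j hx hy → i₀ ≤ i₁ → j₀ ≤ j₁ → blk i₀ i₁ j₀ j₁ ∋ quad i j hx hy → let P = blk i₀ i₁ j₀ j₁ in
    (Contains P i j ⊎ Contains P (i + + 1) (j + + 1)) ⊎ (Contains P (i + + 1) j ⊎ Contains P i (j + + 1))
  corner i₀ i₁ j₀ j₁ i j hx hy s₁ s₂ h with i₀ ℤ.≤? i | j₀ ℤ.≤? j
  ... | yes p | yes p′ = inj₁ (inj₁ (lia 8 (λ i₀ i₁ j₀ j₁ i j hx hy → blkᵉ i₀ i₁ j₀ j₁ i j hx hy :∧ (i₀ :≤ i₁ :∧ j₀ :≤ j₁) :∧ i₀ :≤ i :∧ j₀ :≤ j ⊢ containsᵉ i₀ i₁ j₀ j₁ (i) (j)) i₀ i₁ j₀ j₁ i j hx hy (h , (s₁ , s₂) , p , p′)))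
  ... | no p | no p′ = inj₁ (inj₂ (lia 8 (λ i₀ i₁ j₀ j₁ i j hx hy → blkᵉ i₀ i₁ j₀ j₁ i j hx hy :∧ (i₀ :≤ i₁ :∧ j₀ :≤ j₁) :∧ i :< i₀ :∧ j :< j₀ ⊢ containsᵉ i₀ i₁ j₀ j₁ (i :+ # 1) (j :+ # 1)) i₀ i₁ j₀ j₁ i j hx hy (h , (s₁ , s₂) , ℤP.≰⇒> p , ℤP.≰⇒> p′)))
  ... | no p | yes p′ = inj₂ (inj₁ (lia 8 (λ i₀ i₁ j₀ j₁ i j hx hy → blkᵉ i₀ i₁ j₀ j₁ i j hx hy :∧ (i₀ :≤ i₁ :∧ j₀ :≤ j₁) :∧ i :< i₀ :∧ j₀ :≤ j ⊢ containsᵉ i₀ i₁ j₀ j₁ (i :+ # 1) (j)) i₀ i₁ j₀ j₁ i j hx hy (h , (s₁ , s₂) , ℤP.≰⇒> p , p′)))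
  ... | yes p | no p′ = inj₂ (inj₂ (lia 8 (λ i₀ i₁ j₀ j₁ i j hx hy → blkᵉ i₀ i₁ j₀ j₁ i j hx hy :∧ (i₀ :≤ i₁ :∧ j₀ :≤ j₁) :∧ i₀ :≤ i :∧ j :< j₀ ⊢ containsᵉ i₀ i₁ j₀ j₁ (i) (j :+ # 1)) i₀ i₁ j₀ j₁ i j hx hy (h , (s₁ , s₂) , p , ℤP.≰⇒> p′)))

  xor-square : ∀ a b c d → ((a xor b) xor (c xor d)) xor ((a xor d) xor (c xor b)) ≡ false
  xor-square a b c d = trans (cong₂ _xor_ (xor-swap a b c d) (trans (xor-swap a d c b) (cong ((a xor c) xor_) (𝔹.xor-comm d b))))
    (𝔹.xor-same ((a xor c) xor (b xor d)))

  -- From a tiling of the quads of R by pieces, to a kernel vector: v vanishes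
  -- exactly at the points of the blocks.
  module FromTiling (Ps : List Piece)
    (walls : ∀ {P} → P ∈ Ps → Walled P)
    (covers : ∀ q → Bits q → InR q → ∃ λ P → P ∈ Ps × P ∋ q)
    (disjoint : ∀ q → Bits q → InR q → ∀ {P P′} → P ∈ Ps → P′ ∈ Ps → P ∋ q → P′ ∋ q → P ≡ P′) where

    Zero : ℤ → ℤ → Set
    Zero a b = Any (λ P → Contains P a b) Ps

    zero? : ∀ a b → Dec (Zero a b)
    zero? a b = Any.any? (contains? a b) Ps

    vector : Vector
    vector p = let (i , j , _) = coords p in not (does (zero? i j))

    val : ℤ → ℤ → Bool
    val a b = onℤ vector (a + b + ε - + 1) (a - b - + 1)

    val-onR : ∀ a b → onR a b → val a b ≡ not (does (zero? a b))
    val-onR a b (h₁ , h₂ , h₃ , h₄) with fins (range (a + b + ε - + 1) (a - b - + 1) h₁ h₂ h₃ h₄)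
    ... | x , y , ex , ey =
      trans (cong₂ (onℤ vector) ex ey) (trans (onℤ-point vector p) (cong₂ (λ i j → not (does (zero? i j))) (proj₁ same) (proj₂ same)))
      where
      colour : colourFin x y ≡ c
      colour = half-colour (+ toℕ x) (+ toℕ y) (a - + 1) (liaG 4 (λ a b x y → a :+ b :+ εᵉ :- # 1 :≡ x :∧ a :- b :- # 1 :≡ y ⊢
        x :+ y :≡ (+ 2) :* (a :- # 1) :+ εᵉ) a b (+ toℕ x) (+ toℕ y) (ex , ey))
      p : Pt c m n
      p = (x , y) , colour
      same : proj₁ (coords p) ≡ a × proj₁ (proj₂ (coords p)) ≡ b
      same = liaG 6 (λ a b x y i j → a :+ b :+ εᵉ :- # 1 :≡ x :∧ a :- b :- # 1 :≡ y :∧ x :≡ i :+ j :+ εᵉ :- # 1 :∧ y :≡ i :- j :- # 1 ⊢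
        i :≡ a :∧ j :≡ b) a b (+ toℕ x) (+ toℕ y) (proj₁ (coords p)) (proj₁ (proj₂ (coords p)))
        (ex , ey , proj₁ (proj₁ (proj₂ (proj₂ (coords p)))) , proj₂ (proj₁ (proj₂ (proj₂ (coords p)))))

    val-off : ∀ a b → ¬ onR a b → val a b ≡ false
    val-off a b h = onℤ-outside vector (a + b + ε - + 1) (a - b - + 1) λ h₁ h₂ h₃ h₄ → h (h₁ , h₂ , h₃ , h₄)

    val-zero : ∀ a b → (onR a b → Zero a b) → val a b ≡ false
    val-zero a b z with onR? a b
    ... | no h = val-off a b h
    ... | yes h = trans (val-onR a b h) (lem (zero? a b))
      where
      lem : (d : Dec (Zero a b)) → not (does d) ≡ false
      lem (yes _) = refl
      lem (no nz) = ⊥-elim (nz (z h))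

    val-one : ∀ a b → onR a b → ¬ Zero a b → val a b ≡ true
    val-one a b h nz = trans (val-onR a b h) (lem (zero? a b))
      where
      lem : (d : Dec (Zero a b)) → not (does d) ≡ true
      lem (yes z) = ⊥-elim (nz z)
      lem (no _) = refl

    no-overlap : ∀ {P a b} → P ∈ Ps → Witness P a b → ¬ Contains P a b → ¬ Zero a b
    no-overlap P∈ (q , bs , r , h , adj) out z with find z
    ... | P′ , P′∈ , p with disjoint q bs r P∈ P′∈ h (adj P′ p)
    ...   | refl = out p

    place-out : ∀ k i₀ i₁ j₀ j₁ a b → k ≢ inside → At k i₀ i₁ j₀ j₁ a b → ¬ Contains (blk i₀ i₁ j₀ j₁) a b
    place-out inside i₀ i₁ j₀ j₁ a b ne _ _ = ne refl
    place-out iLo i₀ i₁ j₀ j₁ a b ne p h = lia 6 (λ i₀ i₁ j₀ j₁ a b → placeᵉ iLo i₀ i₁ j₀ j₁ a b :∧ containsᵉ i₀ i₁ j₀ j₁ a b ⊢ ⊥ᶠ) i₀ i₁ j₀ j₁ a b (p , h)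
    place-out iHi i₀ i₁ j₀ j₁ a b ne p h = lia 6 (λ i₀ i₁ j₀ j₁ a b → placeᵉ iHi i₀ i₁ j₀ j₁ a b :∧ containsᵉ i₀ i₁ j₀ j₁ a b ⊢ ⊥ᶠ) i₀ i₁ j₀ j₁ a b (p , h)
    place-out jLo i₀ i₁ j₀ j₁ a b ne p h = lia 6 (λ i₀ i₁ j₀ j₁ a b → placeᵉ jLo i₀ i₁ j₀ j₁ a b :∧ containsᵉ i₀ i₁ j₀ j₁ a b ⊢ ⊥ᶠ) i₀ i₁ j₀ j₁ a b (p , h)
    place-out jHi i₀ i₁ j₀ j₁ a b ne p h = lia 6 (λ i₀ i₁ j₀ j₁ a b → placeᵉ jHi i₀ i₁ j₀ j₁ a b :∧ containsᵉ i₀ i₁ j₀ j₁ a b ⊢ ⊥ᶠ) i₀ i₁ j₀ j₁ a b (p , h)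

    side-nonzero : ∀ k i₀ i₁ j₀ j₁ a b → blk i₀ i₁ j₀ j₁ ∈ Ps → k ≢ inside → At k i₀ i₁ j₀ j₁ a b → onR a b → ¬ Zero a b
    side-nonzero k i₀ i₁ j₀ j₁ a b P∈ ne p r =
      no-overlap P∈ (witness k i₀ i₁ j₀ j₁ a b (walls P∈) ne p r) (place-out k i₀ i₁ j₀ j₁ a b ne p)

    side-one : ∀ k i₀ i₁ j₀ j₁ a b → blk i₀ i₁ j₀ j₁ ∈ Ps → k ≢ inside → At k i₀ i₁ j₀ j₁ a b → onR a b → val a b ≡ true
    side-one k i₀ i₁ j₀ j₁ a b P∈ ne p r = val-one a b r (side-nonzero k i₀ i₁ j₀ j₁ a b P∈ ne p r)

    inside-zero : ∀ i₀ i₁ j₀ j₁ a b → blk i₀ i₁ j₀ j₁ ∈ Ps → At inside i₀ i₁ j₀ j₁ a b → val a b ≡ false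
    inside-zero i₀ i₁ j₀ j₁ a b P∈ p = val-zero a b λ _ → lose P∈ p

    dia-nonzero : ∀ {a b} → dia a b ∈ Ps → ∀ i j q → Bits q → InR q → dia a b ∋ q → (∀ P′ → Contains P′ i j → P′ ∋ q) → ¬ Zero i j
    dia-nonzero P∈ i j q bs r h adj = no-overlap P∈ (q , bs , r , h , adj) λ ()

    module _ (a b : ℤ) (P∈ : dia a b ∈ Ps) where
      private
        dia-inR : ∀ hx hy → Bits (quad a b hx hy) → InR (quad a b hx hy)
        dia-inR hx hy bs = liaG 4 (λ a b hx hy → bitsᵉ hx hy :∧ walledDiaᵉ a b ⊢ inRᵉ a b hx hy) a b hx hy (bs , walls P∈)
        b₀₀ : Bits (quad a b (+ 0) (+ 0))
        b₀₀ = 0≤0 , 0≤1 , 0≤0 , 0≤1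
        b₁₁ : Bits (quad a b (+ 1) (+ 1))
        b₁₁ = 0≤1 , 1≤1 , 0≤1 , 1≤1
        -1+1 : ∀ i → i + + 1 - + 1 ≡ i
        -1+1 i = lia 1 (λ i → ⊤ᶠ ⊢ i :+ # 1 :- # 1 :≡ i) i tt

      dia-W : val a b ≡ true
      dia-W = val-one a b (liaG 2 (λ a b → walledDiaᵉ a b ⊢ onRᵉ a b) a b (walls P∈))
        (dia-nonzero P∈ a b (quad a b (+ 0) (+ 0)) b₀₀ (dia-inR _ _ b₀₀) (refl , refl) λ P′ → around-W P′ a b (+ 0) 0≤0 0≤1)
      dia-E : val (a + + 1) (b + + 1) ≡ true
      dia-E = val-one (a + + 1) (b + + 1) (liaG 2 (λ a b → walledDiaᵉ a b ⊢ onRᵉ (a :+ # 1) (b :+ # 1)) a b (walls P∈))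
        (dia-nonzero P∈ (a + + 1) (b + + 1) (quad a b (+ 1) (+ 1)) b₁₁ (dia-inR _ _ b₁₁) (refl , refl) λ P′ h →
          subst₂ (λ i j → P′ ∋ quad i j (+ 1) (+ 1)) (-1+1 a) (-1+1 b) (around-E P′ (a + + 1) (b + + 1) (+ 1) 0≤1 1≤1 h))
      dia-N : val (a + + 1) b ≡ true
      dia-N = val-one (a + + 1) b (liaG 2 (λ a b → walledDiaᵉ a b ⊢ onRᵉ (a :+ # 1) b) a b (walls P∈))
        (dia-nonzero P∈ (a + + 1) b (quad a b (+ 1) (+ 1)) b₁₁ (dia-inR _ _ b₁₁) (refl , refl) λ P′ h →
          subst (λ i → P′ ∋ quad i b (+ 1) (+ 1)) (-1+1 a) (around-N P′ (a + + 1) b (+ 1) 0≤1 1≤1 h))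
      dia-S : val a (b + + 1) ≡ true
      dia-S = val-one a (b + + 1) (liaG 2 (λ a b → walledDiaᵉ a b ⊢ onRᵉ a (b :+ # 1)) a b (walls P∈))
        (dia-nonzero P∈ a (b + + 1) (quad a b (+ 0) (+ 0)) b₀₀ (dia-inR _ _ b₀₀) (refl , refl) λ P′ h →
          subst (λ j → P′ ∋ quad a j (+ 0) (+ 0)) (-1+1 b) (around-S P′ a (b + + 1) (+ 0) 0≤0 0≤1 h))

    Face : ℤ → ℤ → Set
    Face i j = + 0 ≤ i + j + ε × i + j + ε < + m × + 0 ≤ i - j - + 1 × i - j - + 1 < + n

    faceSum : ℤ → ℤ → Bool
    faceSum i j = (val (i + + 1) j xor val i (j + + 1)) xor (val (i + + 1) (j + + 1) xor val i j)

    -- The centre of the face is a point of R. As m and n are at least 2, at least one quad around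
    -- it lies in R: an eastern or northern one where there is room, otherwise a western or southern
    -- one.
    quad-in-face : ∀ i j → Face i j → ∃ λ hx → ∃ λ hy → Bits (quad i j hx hy) × InR (quad i j hx hy)
    quad-in-face i j f with i + j + ε ℤ.≤? + m - + 2 | i - j - + 1 ℤ.≤? + n - + 2
    ... | yes p | yes p′ = + 1 , + 1 , liaG 2 (λ i j → faceᵉ i j :∧ i :+ j :+ εᵉ :≤ mᵉ :- # 2 :∧ i :- j :- # 1 :≤ nᵉ :- # 2 ⊢ bitsᵉ (# 1) (# 1) :∧ inRᵉ i j (# 1) (# 1)) i j (f , p , p′)
    ... | yes p | no p′ = + 1 , + 0 , liaG 2 (λ i j → faceᵉ i j :∧ i :+ j :+ εᵉ :≤ mᵉ :- # 2 :∧ nᵉ :- # 2 :< i :- j :- # 1 ⊢ bitsᵉ (# 1) (# 0) :∧ inRᵉ i j (# 1) (# 0)) i j (f , p , ℤP.≰⇒> p′)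
    ... | no p | yes p′ = + 0 , + 1 , liaG 2 (λ i j → faceᵉ i j :∧ mᵉ :- # 2 :< i :+ j :+ εᵉ :∧ i :- j :- # 1 :≤ nᵉ :- # 2 ⊢ bitsᵉ (# 0) (# 1) :∧ inRᵉ i j (# 0) (# 1)) i j (f , ℤP.≰⇒> p , p′)
    ... | no p | no p′ = + 0 , + 0 , liaG 2 (λ i j → faceᵉ i j :∧ mᵉ :- # 2 :< i :+ j :+ εᵉ :∧ nᵉ :- # 2 :< i :- j :- # 1 ⊢ bitsᵉ (# 0) (# 0) :∧ inRᵉ i j (# 0) (# 0)) i j (f , ℤP.≰⇒> p , ℤP.≰⇒> p′)

    -- For a block P ∋ q, the value of v at each corner (a , b) of the face of q is
    -- [a ∈ I] xor [b ∈ J]; these four values add up to zero.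
    module _ (i j hx hy : ℤ) (f : Face i j) (bs : Bits (quad i j hx hy)) (qR : InR (quad i j hx hy))
      (i₀ i₁ j₀ j₁ : ℤ) (P∈ : blk i₀ i₁ j₀ j₁ ∈ Ps) (h : blk i₀ i₁ j₀ j₁ ∋ quad i j hx hy) where
      private
        w = walls P∈
        s₁ : i₀ ≤ i₁
        s₁ = proj₁ w
        s₂ : j₀ ≤ j₁
        s₂ = proj₁ (proj₂ w)
        bo : Bottom i₀ i₁ j₀ j₁
        bo = proj₁ (proj₂ (proj₂ w))
        to : Top i₀ i₁ j₀ j₁
        to = proj₁ (proj₂ (proj₂ (proj₂ w)))
        le : Left i₀ i₁ j₀ j₁
        le = proj₁ (proj₂ (proj₂ (proj₂ (proj₂ w))))
        ri : Right i₀ i₁ j₀ j₁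
        ri = proj₂ (proj₂ (proj₂ (proj₂ (proj₂ w))))

        Side : Place → ℤ → ℤ → Set
        Side k a b = At k i₀ i₁ j₀ j₁ a b × onR a b

        below : ∀ {a₀ a₁ a} → a ≤ a₁ → ¬ (a₀ ≤ a × a ≤ a₁) → a < a₀
        below le ne = ℤP.≰⇒> λ ge → ne (ge , le)

        above : ∀ {a₀ a₁ a} → a₀ - + 1 ≤ a → ¬ (a₀ ≤ a + + 1 × a + + 1 ≤ a₁) → a₁ < a + + 1
        above {a₀} {a = a} ge ne = ℤP.≰⇒> λ le → ne (lia 2 (λ a₀ a → a₀ :- # 1 :≤ a ⊢ a₀ :≤ a :+ # 1) a₀ a ge , le)

        -- If both memberships hold, the point lies in `P`; if exactly one holds, it lies on a
        -- slanted side of `P` and is nonzero. If neither holds, the corner is opposite to the one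
        -- in `P`, and must be a zero of another block or lie outside R.
        value : ∀ k l a b → k ≢ inside → l ≢ inside → (d : Dec (i₀ ≤ a × a ≤ i₁)) (e : Dec (j₀ ≤ b × b ≤ j₁)) →
          (¬ (i₀ ≤ a × a ≤ i₁) → j₀ ≤ b × b ≤ j₁ → Side k a b) → (i₀ ≤ a × a ≤ i₁ → ¬ (j₀ ≤ b × b ≤ j₁) → Side l a b) →
          (¬ (i₀ ≤ a × a ≤ i₁) → ¬ (j₀ ≤ b × b ≤ j₁) → onR a b → Zero a b) → val a b ≡ does d xor does e
        value k l a b _ _ (yes p) (yes q) f g z = inside-zero i₀ i₁ j₀ j₁ a b P∈ (p , q)
        value k l a b k≢ _ (no p) (yes q) f g z = let (at , on) = f p q in side-one k i₀ i₁ j₀ j₁ a b P∈ k≢ at on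
        value k l a b _ l≢ (yes p) (no q) f g z = let (at , on) = g p q in side-one l i₀ i₁ j₀ j₁ a b P∈ l≢ at on
        value k l a b _ _ (no p) (no q) f g z = val-zero a b (z p q)

        i-in : ∀ a → Dec (i₀ ≤ a × a ≤ i₁)
        i-in a = i₀ ℤ.≤? a ×-dec a ℤ.≤? i₁
        j-in : ∀ b → Dec (j₀ ≤ b × b ≤ j₁)
        j-in b = j₀ ℤ.≤? b ×-dec b ℤ.≤? j₁

        h₁ : i₀ - + 1 ≤ i
        h₁ = proj₁ h
        h₂ : i ≤ i₁
        h₂ = proj₁ (proj₂ h)
        h₃ : j₀ - + 1 ≤ j
        h₃ = proj₁ (proj₂ (proj₂ h))
        h₄ : j ≤ j₁
        h₄ = proj₁ (proj₂ (proj₂ (proj₂ h)))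

        touchᵉ : (i₀ i₁ j₀ j₁ i j : Expr) → Form
        touchᵉ i₀ i₁ j₀ j₁ i j = faceᵉ i j :∧ i₀ :- # 1 :≤ i :∧ i :≤ i₁ :∧ j₀ :- # 1 :≤ j :∧ j :≤ j₁
        touch : Holds (touchᵉ (K i₀) (K i₁) (K j₀) (K j₁) (K i) (K j)) ρ₀
        touch = f , h₁ , h₂ , h₃ , h₄

        -- A quad q′ of the face outside P lies in a piece that can only contain the corner opposite to P.
        opposite : ∀ q′ {da db oa ob sa sb ta tb} → Bits q′ → InR q′ → ¬ (blk i₀ i₁ j₀ j₁ ∋ q′) →
          (∀ a b → dia a b ∋ q′ → dia a b ∋ quad i j hx hy) → (∀ D → Contains D oa ob → D ∋ quad i j hx hy) →
          ¬ Zero sa sb → ¬ Zero ta tb →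
          (∀ a₀ a₁ b₀ b₁ → let D = blk a₀ a₁ b₀ b₁ in a₀ ≤ a₁ → b₀ ≤ b₁ → D ∋ q′ → (Contains D da db ⊎ Contains D oa ob) ⊎ (Contains D sa sb ⊎ Contains D ta tb)) →
          Zero da db
        opposite q′ bs′ r′ out same near ns nt split with covers q′ bs′ r′
        ... | dia a b , D∈ , d = case disjoint (quad i j hx hy) bs qR P∈ D∈ h (same a b d) of λ ()
        ... | blk a₀ a₁ b₀ b₁ , D∈ , d with split a₀ a₁ b₀ b₁ (proj₁ (walls D∈)) (proj₁ (proj₂ (walls D∈))) d
        ...   | inj₁ (inj₁ z) = lose D∈ z
        ...   | inj₂ (inj₁ z) = ⊥-elim (ns (lose D∈ z))
        ...   | inj₂ (inj₂ z) = ⊥-elim (nt (lose D∈ z))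
        ...   | inj₁ (inj₂ z) with disjoint (quad i j hx hy) bs qR P∈ D∈ h (near (blk a₀ a₁ b₀ b₁) z)
        ...     | refl = ⊥-elim (out d)

        -- A corner of the face can leave R only onto the wall in its direction. If the block does
        -- not cross that wall, the corner stays in R. If the wall is an axis, a point on it has its
        -- first coordinate in I exactly when its second is in J, which the two hypotheses exclude.
        sideI-W : ¬ (i₀ ≤ i × i ≤ i₁) → (j₀ ≤ j × j ≤ j₁) → Side iLo (i) (j)
        sideI-W p q = either
          (λ w → liaG 6 (λ i₀ i₁ j₀ j₁ i j → touchᵉ i₀ i₁ j₀ j₁ i j :∧ i :< i₀ :∧ (j₀ :≤ j :∧ j :≤ j₁) :∧ leftNᵉ i₀ i₁ j₀ j₁ ⊢ placeᵉ iLo i₀ i₁ j₀ j₁ (i) (j) :∧ onRᵉ (i) (j)) i₀ i₁ j₀ j₁ i j (touch , below h₂ p , q , w))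
          (λ w → liaG 6 (λ i₀ i₁ j₀ j₁ i j → touchᵉ i₀ i₁ j₀ j₁ i j :∧ i :< i₀ :∧ (j₀ :≤ j :∧ j :≤ j₁) :∧ leftSᵉ i₀ i₁ j₀ j₁ ⊢ placeᵉ iLo i₀ i₁ j₀ j₁ (i) (j) :∧ onRᵉ (i) (j)) i₀ i₁ j₀ j₁ i j (touch , below h₂ p , q , w))
          le
        sideJ-W : (i₀ ≤ i × i ≤ i₁) → ¬ (j₀ ≤ j × j ≤ j₁) → Side jLo (i) (j)
        sideJ-W p q = either
          (λ w → liaG 6 (λ i₀ i₁ j₀ j₁ i j → touchᵉ i₀ i₁ j₀ j₁ i j :∧ j :< j₀ :∧ (i₀ :≤ i :∧ i :≤ i₁) :∧ leftNᵉ i₀ i₁ j₀ j₁ ⊢ placeᵉ jLo i₀ i₁ j₀ j₁ (i) (j) :∧ onRᵉ (i) (j)) i₀ i₁ j₀ j₁ i j (touch , below h₄ q , p , w))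
          (λ w → liaG 6 (λ i₀ i₁ j₀ j₁ i j → touchᵉ i₀ i₁ j₀ j₁ i j :∧ j :< j₀ :∧ (i₀ :≤ i :∧ i :≤ i₁) :∧ leftSᵉ i₀ i₁ j₀ j₁ ⊢ placeᵉ jLo i₀ i₁ j₀ j₁ (i) (j) :∧ onRᵉ (i) (j)) i₀ i₁ j₀ j₁ i j (touch , below h₄ q , p , w))
          le
        sideI-E : ¬ (i₀ ≤ i + + 1 × i + + 1 ≤ i₁) → (j₀ ≤ j + + 1 × j + + 1 ≤ j₁) → Side iHi (i + + 1) (j + + 1)
        sideI-E p q = either
          (λ w → liaG 6 (λ i₀ i₁ j₀ j₁ i j → touchᵉ i₀ i₁ j₀ j₁ i j :∧ i₁ :< i :+ # 1 :∧ (j₀ :≤ j :+ # 1 :∧ j :+ # 1 :≤ j₁) :∧ rightNᵉ i₀ i₁ j₀ j₁ ⊢ placeᵉ iHi i₀ i₁ j₀ j₁ (i :+ # 1) (j :+ # 1) :∧ onRᵉ (i :+ # 1) (j :+ # 1)) i₀ i₁ j₀ j₁ i j (touch , above h₁ p , q , w))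
          (λ w → liaG 6 (λ i₀ i₁ j₀ j₁ i j → touchᵉ i₀ i₁ j₀ j₁ i j :∧ i₁ :< i :+ # 1 :∧ (j₀ :≤ j :+ # 1 :∧ j :+ # 1 :≤ j₁) :∧ rightSᵉ i₀ i₁ j₀ j₁ ⊢ placeᵉ iHi i₀ i₁ j₀ j₁ (i :+ # 1) (j :+ # 1) :∧ onRᵉ (i :+ # 1) (j :+ # 1)) i₀ i₁ j₀ j₁ i j (touch , above h₁ p , q , w))
          ri
        sideJ-E : (i₀ ≤ i + + 1 × i + + 1 ≤ i₁) → ¬ (j₀ ≤ j + + 1 × j + + 1 ≤ j₁) → Side jHi (i + + 1) (j + + 1)
        sideJ-E p q = either
          (λ w → liaG 6 (λ i₀ i₁ j₀ j₁ i j → touchᵉ i₀ i₁ j₀ j₁ i j :∧ j₁ :< j :+ # 1 :∧ (i₀ :≤ i :+ # 1 :∧ i :+ # 1 :≤ i₁) :∧ rightNᵉ i₀ i₁ j₀ j₁ ⊢ placeᵉ jHi i₀ i₁ j₀ j₁ (i :+ # 1) (j :+ # 1) :∧ onRᵉ (i :+ # 1) (j :+ # 1)) i₀ i₁ j₀ j₁ i j (touch , above h₃ q , p , w))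
          (λ w → liaG 6 (λ i₀ i₁ j₀ j₁ i j → touchᵉ i₀ i₁ j₀ j₁ i j :∧ j₁ :< j :+ # 1 :∧ (i₀ :≤ i :+ # 1 :∧ i :+ # 1 :≤ i₁) :∧ rightSᵉ i₀ i₁ j₀ j₁ ⊢ placeᵉ jHi i₀ i₁ j₀ j₁ (i :+ # 1) (j :+ # 1) :∧ onRᵉ (i :+ # 1) (j :+ # 1)) i₀ i₁ j₀ j₁ i j (touch , above h₃ q , p , w))
          ri
        sideI-N : ¬ (i₀ ≤ i + + 1 × i + + 1 ≤ i₁) → (j₀ ≤ j × j ≤ j₁) → Side iHi (i + + 1) (j)
        sideI-N p q = either
          (λ w → liaG 6 (λ i₀ i₁ j₀ j₁ i j → touchᵉ i₀ i₁ j₀ j₁ i j :∧ i₁ :< i :+ # 1 :∧ (j₀ :≤ j :∧ j :≤ j₁) :∧ topNᵉ i₀ i₁ j₀ j₁ ⊢ placeᵉ iHi i₀ i₁ j₀ j₁ (i :+ # 1) (j) :∧ onRᵉ (i :+ # 1) (j)) i₀ i₁ j₀ j₁ i j (touch , above h₁ p , q , w))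
          (λ w → liaG 6 (λ i₀ i₁ j₀ j₁ i j → touchᵉ i₀ i₁ j₀ j₁ i j :∧ i₁ :< i :+ # 1 :∧ (j₀ :≤ j :∧ j :≤ j₁) :∧ topSᵉ i₀ i₁ j₀ j₁ ⊢ placeᵉ iHi i₀ i₁ j₀ j₁ (i :+ # 1) (j) :∧ onRᵉ (i :+ # 1) (j)) i₀ i₁ j₀ j₁ i j (touch , above h₁ p , q , w))
          to
        sideJ-N : (i₀ ≤ i + + 1 × i + + 1 ≤ i₁) → ¬ (j₀ ≤ j × j ≤ j₁) → Side jLo (i + + 1) (j)
        sideJ-N p q = either
          (λ w → liaG 6 (λ i₀ i₁ j₀ j₁ i j → touchᵉ i₀ i₁ j₀ j₁ i j :∧ j :< j₀ :∧ (i₀ :≤ i :+ # 1 :∧ i :+ # 1 :≤ i₁) :∧ topNᵉ i₀ i₁ j₀ j₁ ⊢ placeᵉ jLo i₀ i₁ j₀ j₁ (i :+ # 1) (j) :∧ onRᵉ (i :+ # 1) (j)) i₀ i₁ j₀ j₁ i j (touch , below h₄ q , p , w))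
          (λ w → liaG 6 (λ i₀ i₁ j₀ j₁ i j → touchᵉ i₀ i₁ j₀ j₁ i j :∧ j :< j₀ :∧ (i₀ :≤ i :+ # 1 :∧ i :+ # 1 :≤ i₁) :∧ topSᵉ i₀ i₁ j₀ j₁ ⊢ placeᵉ jLo i₀ i₁ j₀ j₁ (i :+ # 1) (j) :∧ onRᵉ (i :+ # 1) (j)) i₀ i₁ j₀ j₁ i j (touch , below h₄ q , p , w))
          to
        sideI-S : ¬ (i₀ ≤ i × i ≤ i₁) → (j₀ ≤ j + + 1 × j + + 1 ≤ j₁) → Side iLo (i) (j + + 1)
        sideI-S p q = either
          (λ w → liaG 6 (λ i₀ i₁ j₀ j₁ i j → touchᵉ i₀ i₁ j₀ j₁ i j :∧ i :< i₀ :∧ (j₀ :≤ j :+ # 1 :∧ j :+ # 1 :≤ j₁) :∧ bottomNᵉ i₀ i₁ j₀ j₁ ⊢ placeᵉ iLo i₀ i₁ j₀ j₁ (i) (j :+ # 1) :∧ onRᵉ (i) (j :+ # 1)) i₀ i₁ j₀ j₁ i j (touch , below h₂ p , q , w))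
          (λ w → liaG 6 (λ i₀ i₁ j₀ j₁ i j → touchᵉ i₀ i₁ j₀ j₁ i j :∧ i :< i₀ :∧ (j₀ :≤ j :+ # 1 :∧ j :+ # 1 :≤ j₁) :∧ bottomSᵉ i₀ i₁ j₀ j₁ ⊢ placeᵉ iLo i₀ i₁ j₀ j₁ (i) (j :+ # 1) :∧ onRᵉ (i) (j :+ # 1)) i₀ i₁ j₀ j₁ i j (touch , below h₂ p , q , w))
          bo
        sideJ-S : (i₀ ≤ i × i ≤ i₁) → ¬ (j₀ ≤ j + + 1 × j + + 1 ≤ j₁) → Side jHi (i) (j + + 1)
        sideJ-S p q = either
          (λ w → liaG 6 (λ i₀ i₁ j₀ j₁ i j → touchᵉ i₀ i₁ j₀ j₁ i j :∧ j₁ :< j :+ # 1 :∧ (i₀ :≤ i :∧ i :≤ i₁) :∧ bottomNᵉ i₀ i₁ j₀ j₁ ⊢ placeᵉ jHi i₀ i₁ j₀ j₁ (i) (j :+ # 1) :∧ onRᵉ (i) (j :+ # 1)) i₀ i₁ j₀ j₁ i j (touch , above h₃ q , p , w))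
          (λ w → liaG 6 (λ i₀ i₁ j₀ j₁ i j → touchᵉ i₀ i₁ j₀ j₁ i j :∧ j₁ :< j :+ # 1 :∧ (i₀ :≤ i :∧ i :≤ i₁) :∧ bottomSᵉ i₀ i₁ j₀ j₁ ⊢ placeᵉ jHi i₀ i₁ j₀ j₁ (i) (j :+ # 1) :∧ onRᵉ (i) (j :+ # 1)) i₀ i₁ j₀ j₁ i j (touch , above h₃ q , p , w))
          bo
        -- In this case `P` meets the face only in its east corner and owns just the eastern quads.
        -- So the mirror image of `q` in the vertical axis of the face is outside `P`, and the piece
        -- covering it must contain the west corner, the north and south corners being nonzero by
        -- `side-nonzero`.
        diag-W : ¬ (i₀ ≤ i × i ≤ i₁) → ¬ (j₀ ≤ j × j ≤ j₁) → onR (i) (j) → Zero (i) (j)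
        diag-W p q on =
          let (bs′ , r′) = liaG 8 (λ i₀ i₁ j₀ j₁ i j hx hy → ((blkᵉ i₀ i₁ j₀ j₁ i j hx hy :∧ bitsᵉ hx hy) :∧ i :< i₀ :∧ j :< j₀) :∧ inRᵉ i j hx hy :∧ onRᵉ (i) (j) ⊢ bitsᵉ (# 1 :- hx) (hy) :∧ inRᵉ i j (# 1 :- hx) (hy)) i₀ i₁ j₀ j₁ i j hx hy (((h , bs) , below h₂ p , below h₄ q) , qR , on)
          in opposite (quad i j (+ 1 - hx) (hy)) bs′ r′
            (λ d → liaG 8 (λ i₀ i₁ j₀ j₁ i j hx hy → ((blkᵉ i₀ i₁ j₀ j₁ i j hx hy :∧ bitsᵉ hx hy) :∧ i :< i₀ :∧ j :< j₀) :∧ blkᵉ i₀ i₁ j₀ j₁ i j (# 1 :- hx) (hy) ⊢ ⊥ᶠ) i₀ i₁ j₀ j₁ i j hx hy (((h , bs) , below h₂ p , below h₄ q) , d)) (λ _ _ d → d)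
            (λ { (blk a₀ a₁ b₀ b₁) z → liaG 12 (λ i₀ i₁ j₀ j₁ i j hx hy a₀ a₁ b₀ b₁ → ((blkᵉ i₀ i₁ j₀ j₁ i j hx hy :∧ bitsᵉ hx hy) :∧ i :< i₀ :∧ j :< j₀) :∧ containsᵉ a₀ a₁ b₀ b₁ (i :+ # 1) (j :+ # 1) ⊢ blkᵉ a₀ a₁ b₀ b₁ i j hx hy) i₀ i₁ j₀ j₁ i j hx hy a₀ a₁ b₀ b₁ (((h , bs) , below h₂ p , below h₄ q) , z) })
            (let (at , on) = sideJ-N (liaG 6 (λ i₀ i₁ j₀ j₁ i j → touchᵉ i₀ i₁ j₀ j₁ i j :∧ i :< i₀ :∧ i₀ :≤ i₁ ⊢ i₀ :≤ i :+ # 1 :∧ i :+ # 1 :≤ i₁) i₀ i₁ j₀ j₁ i j (touch , below h₂ p , s₁)) q in side-nonzero jLo i₀ i₁ j₀ j₁ (i + + 1) (j) P∈ (λ ()) at on)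
            (let (at , on) = sideI-S p (liaG 6 (λ i₀ i₁ j₀ j₁ i j → touchᵉ i₀ i₁ j₀ j₁ i j :∧ j :< j₀ :∧ j₀ :≤ j₁ ⊢ j₀ :≤ j :+ # 1 :∧ j :+ # 1 :≤ j₁) i₀ i₁ j₀ j₁ i j (touch , below h₄ q , s₂)) in side-nonzero iLo i₀ i₁ j₀ j₁ (i) (j + + 1) P∈ (λ ()) at on)
            λ a₀ a₁ b₀ b₁ s s′ d → case corner a₀ a₁ b₀ b₁ i j (+ 1 - hx) (hy) s s′ d of λ { (inj₁ (inj₁ z)) → inj₁ (inj₁ z) ; (inj₁ (inj₂ z)) → inj₁ (inj₂ z) ; (inj₂ (inj₁ z)) → inj₂ (inj₁ z) ; (inj₂ (inj₂ z)) → inj₂ (inj₂ z) }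
        diag-E : ¬ (i₀ ≤ i + + 1 × i + + 1 ≤ i₁) → ¬ (j₀ ≤ j + + 1 × j + + 1 ≤ j₁) → onR (i + + 1) (j + + 1) → Zero (i + + 1) (j + + 1)
        diag-E p q on =
          let (bs′ , r′) = liaG 8 (λ i₀ i₁ j₀ j₁ i j hx hy → ((blkᵉ i₀ i₁ j₀ j₁ i j hx hy :∧ bitsᵉ hx hy) :∧ i₁ :< i :+ # 1 :∧ j₁ :< j :+ # 1) :∧ inRᵉ i j hx hy :∧ onRᵉ (i :+ # 1) (j :+ # 1) ⊢ bitsᵉ (# 1 :- hx) (hy) :∧ inRᵉ i j (# 1 :- hx) (hy)) i₀ i₁ j₀ j₁ i j hx hy (((h , bs) , above h₁ p , above h₃ q) , qR , on)
          in opposite (quad i j (+ 1 - hx) (hy)) bs′ r′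
            (λ d → liaG 8 (λ i₀ i₁ j₀ j₁ i j hx hy → ((blkᵉ i₀ i₁ j₀ j₁ i j hx hy :∧ bitsᵉ hx hy) :∧ i₁ :< i :+ # 1 :∧ j₁ :< j :+ # 1) :∧ blkᵉ i₀ i₁ j₀ j₁ i j (# 1 :- hx) (hy) ⊢ ⊥ᶠ) i₀ i₁ j₀ j₁ i j hx hy (((h , bs) , above h₁ p , above h₃ q) , d)) (λ _ _ d → d)
            (λ { (blk a₀ a₁ b₀ b₁) z → liaG 12 (λ i₀ i₁ j₀ j₁ i j hx hy a₀ a₁ b₀ b₁ → ((blkᵉ i₀ i₁ j₀ j₁ i j hx hy :∧ bitsᵉ hx hy) :∧ i₁ :< i :+ # 1 :∧ j₁ :< j :+ # 1) :∧ containsᵉ a₀ a₁ b₀ b₁ (i) (j) ⊢ blkᵉ a₀ a₁ b₀ b₁ i j hx hy) i₀ i₁ j₀ j₁ i j hx hy a₀ a₁ b₀ b₁ (((h , bs) , above h₁ p , above h₃ q) , z) })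
            (let (at , on) = sideI-N p (liaG 6 (λ i₀ i₁ j₀ j₁ i j → touchᵉ i₀ i₁ j₀ j₁ i j :∧ j₁ :< j :+ # 1 :∧ j₀ :≤ j₁ ⊢ j₀ :≤ j :∧ j :≤ j₁) i₀ i₁ j₀ j₁ i j (touch , above h₃ q , s₂)) in side-nonzero iHi i₀ i₁ j₀ j₁ (i + + 1) (j) P∈ (λ ()) at on)
            (let (at , on) = sideJ-S (liaG 6 (λ i₀ i₁ j₀ j₁ i j → touchᵉ i₀ i₁ j₀ j₁ i j :∧ i₁ :< i :+ # 1 :∧ i₀ :≤ i₁ ⊢ i₀ :≤ i :∧ i :≤ i₁) i₀ i₁ j₀ j₁ i j (touch , above h₁ p , s₁)) q in side-nonzero jHi i₀ i₁ j₀ j₁ (i) (j + + 1) P∈ (λ ()) at on)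
            λ a₀ a₁ b₀ b₁ s s′ d → case corner a₀ a₁ b₀ b₁ i j (+ 1 - hx) (hy) s s′ d of λ { (inj₁ (inj₁ z)) → inj₁ (inj₂ z) ; (inj₁ (inj₂ z)) → inj₁ (inj₁ z) ; (inj₂ (inj₁ z)) → inj₂ (inj₁ z) ; (inj₂ (inj₂ z)) → inj₂ (inj₂ z) }
        diag-N : ¬ (i₀ ≤ i + + 1 × i + + 1 ≤ i₁) → ¬ (j₀ ≤ j × j ≤ j₁) → onR (i + + 1) (j) → Zero (i + + 1) (j)
        diag-N p q on =
          let (bs′ , r′) = liaG 8 (λ i₀ i₁ j₀ j₁ i j hx hy → ((blkᵉ i₀ i₁ j₀ j₁ i j hx hy :∧ bitsᵉ hx hy) :∧ i₁ :< i :+ # 1 :∧ j :< j₀) :∧ inRᵉ i j hx hy :∧ onRᵉ (i :+ # 1) (j) ⊢ bitsᵉ (hx) (# 1 :- hy) :∧ inRᵉ i j (hx) (# 1 :- hy)) i₀ i₁ j₀ j₁ i j hx hy (((h , bs) , above h₁ p , below h₄ q) , qR , on)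
          in opposite (quad i j (hx) (+ 1 - hy)) bs′ r′
            (λ d → liaG 8 (λ i₀ i₁ j₀ j₁ i j hx hy → ((blkᵉ i₀ i₁ j₀ j₁ i j hx hy :∧ bitsᵉ hx hy) :∧ i₁ :< i :+ # 1 :∧ j :< j₀) :∧ blkᵉ i₀ i₁ j₀ j₁ i j (hx) (# 1 :- hy) ⊢ ⊥ᶠ) i₀ i₁ j₀ j₁ i j hx hy (((h , bs) , above h₁ p , below h₄ q) , d)) (λ _ _ d → d)
            (λ { (blk a₀ a₁ b₀ b₁) z → liaG 12 (λ i₀ i₁ j₀ j₁ i j hx hy a₀ a₁ b₀ b₁ → ((blkᵉ i₀ i₁ j₀ j₁ i j hx hy :∧ bitsᵉ hx hy) :∧ i₁ :< i :+ # 1 :∧ j :< j₀) :∧ containsᵉ a₀ a₁ b₀ b₁ (i) (j :+ # 1) ⊢ blkᵉ a₀ a₁ b₀ b₁ i j hx hy) i₀ i₁ j₀ j₁ i j hx hy a₀ a₁ b₀ b₁ (((h , bs) , above h₁ p , below h₄ q) , z) })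
            (let (at , on) = sideJ-W (liaG 6 (λ i₀ i₁ j₀ j₁ i j → touchᵉ i₀ i₁ j₀ j₁ i j :∧ i₁ :< i :+ # 1 :∧ i₀ :≤ i₁ ⊢ i₀ :≤ i :∧ i :≤ i₁) i₀ i₁ j₀ j₁ i j (touch , above h₁ p , s₁)) q in side-nonzero jLo i₀ i₁ j₀ j₁ (i) (j) P∈ (λ ()) at on)
            (let (at , on) = sideI-E p (liaG 6 (λ i₀ i₁ j₀ j₁ i j → touchᵉ i₀ i₁ j₀ j₁ i j :∧ j :< j₀ :∧ j₀ :≤ j₁ ⊢ j₀ :≤ j :+ # 1 :∧ j :+ # 1 :≤ j₁) i₀ i₁ j₀ j₁ i j (touch , below h₄ q , s₂)) in side-nonzero iHi i₀ i₁ j₀ j₁ (i + + 1) (j + + 1) P∈ (λ ()) at on)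
            λ a₀ a₁ b₀ b₁ s s′ d → case corner a₀ a₁ b₀ b₁ i j (hx) (+ 1 - hy) s s′ d of λ { (inj₁ (inj₁ z)) → inj₂ (inj₁ z) ; (inj₁ (inj₂ z)) → inj₂ (inj₂ z) ; (inj₂ (inj₁ z)) → inj₁ (inj₁ z) ; (inj₂ (inj₂ z)) → inj₁ (inj₂ z) }
        diag-S : ¬ (i₀ ≤ i × i ≤ i₁) → ¬ (j₀ ≤ j + + 1 × j + + 1 ≤ j₁) → onR (i) (j + + 1) → Zero (i) (j + + 1)
        diag-S p q on =
          let (bs′ , r′) = liaG 8 (λ i₀ i₁ j₀ j₁ i j hx hy → ((blkᵉ i₀ i₁ j₀ j₁ i j hx hy :∧ bitsᵉ hx hy) :∧ i :< i₀ :∧ j₁ :< j :+ # 1) :∧ inRᵉ i j hx hy :∧ onRᵉ (i) (j :+ # 1) ⊢ bitsᵉ (hx) (# 1 :- hy) :∧ inRᵉ i j (hx) (# 1 :- hy)) i₀ i₁ j₀ j₁ i j hx hy (((h , bs) , below h₂ p , above h₃ q) , qR , on)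
          in opposite (quad i j (hx) (+ 1 - hy)) bs′ r′
            (λ d → liaG 8 (λ i₀ i₁ j₀ j₁ i j hx hy → ((blkᵉ i₀ i₁ j₀ j₁ i j hx hy :∧ bitsᵉ hx hy) :∧ i :< i₀ :∧ j₁ :< j :+ # 1) :∧ blkᵉ i₀ i₁ j₀ j₁ i j (hx) (# 1 :- hy) ⊢ ⊥ᶠ) i₀ i₁ j₀ j₁ i j hx hy (((h , bs) , below h₂ p , above h₃ q) , d)) (λ _ _ d → d)
            (λ { (blk a₀ a₁ b₀ b₁) z → liaG 12 (λ i₀ i₁ j₀ j₁ i j hx hy a₀ a₁ b₀ b₁ → ((blkᵉ i₀ i₁ j₀ j₁ i j hx hy :∧ bitsᵉ hx hy) :∧ i :< i₀ :∧ j₁ :< j :+ # 1) :∧ containsᵉ a₀ a₁ b₀ b₁ (i :+ # 1) (j) ⊢ blkᵉ a₀ a₁ b₀ b₁ i j hx hy) i₀ i₁ j₀ j₁ i j hx hy a₀ a₁ b₀ b₁ (((h , bs) , below h₂ p , above h₃ q) , z) })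
            (let (at , on) = sideI-W p (liaG 6 (λ i₀ i₁ j₀ j₁ i j → touchᵉ i₀ i₁ j₀ j₁ i j :∧ j₁ :< j :+ # 1 :∧ j₀ :≤ j₁ ⊢ j₀ :≤ j :∧ j :≤ j₁) i₀ i₁ j₀ j₁ i j (touch , above h₃ q , s₂)) in side-nonzero iLo i₀ i₁ j₀ j₁ (i) (j) P∈ (λ ()) at on)
            (let (at , on) = sideJ-E (liaG 6 (λ i₀ i₁ j₀ j₁ i j → touchᵉ i₀ i₁ j₀ j₁ i j :∧ i :< i₀ :∧ i₀ :≤ i₁ ⊢ i₀ :≤ i :+ # 1 :∧ i :+ # 1 :≤ i₁) i₀ i₁ j₀ j₁ i j (touch , below h₂ p , s₁)) q in side-nonzero jHi i₀ i₁ j₀ j₁ (i + + 1) (j + + 1) P∈ (λ ()) at on)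
            λ a₀ a₁ b₀ b₁ s s′ d → case corner a₀ a₁ b₀ b₁ i j (hx) (+ 1 - hy) s s′ d of λ { (inj₁ (inj₁ z)) → inj₂ (inj₁ z) ; (inj₁ (inj₂ z)) → inj₂ (inj₂ z) ; (inj₂ (inj₁ z)) → inj₁ (inj₂ z) ; (inj₂ (inj₂ z)) → inj₁ (inj₁ z) }

      face-sum-blk : faceSum i j ≡ false
      face-sum-blk = trans (cong₂ _xor_ (cong₂ _xor_ vN vS) (cong₂ _xor_ vE vW))
        (xor-square (does (i-in (i + + 1))) (does (j-in j)) (does (i-in i)) (does (j-in (j + + 1))))
        where
        vW = value iLo jLo (i) (j) (λ ()) (λ ()) (i-in (i)) (j-in (j)) sideI-W sideJ-W diag-W
        vE = value iHi jHi (i + + 1) (j + + 1) (λ ()) (λ ()) (i-in (i + + 1)) (j-in (j + + 1)) sideI-E sideJ-E diag-E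
        vN = value iHi jLo (i + + 1) (j) (λ ()) (λ ()) (i-in (i + + 1)) (j-in (j)) sideI-N sideJ-N diag-N
        vS = value iLo jHi (i) (j + + 1) (λ ()) (λ ()) (i-in (i)) (j-in (j + + 1)) sideI-S sideJ-S diag-S

    face-sum : ∀ i j → Face i j → faceSum i j ≡ false
    face-sum i j f with quad-in-face i j f
    ... | hx , hy , bs , r with covers (quad i j hx hy) bs r
    ...   | dia _ _ , P∈ , (refl , refl) =
      cong₂ _xor_ (cong₂ _xor_ (dia-N i j P∈) (dia-S i j P∈)) (cong₂ _xor_ (dia-E i j P∈) (dia-W i j P∈))
    ...   | blk i₀ i₁ j₀ j₁ , P∈ , h = face-sum-blk i j hx hy f bs r i₀ i₁ j₀ j₁ P∈ h

    opp-half : ∀ x y → colourℤ x y ≡ opp c → ∃ λ k → x + y ≡ + 2 * k + ε - + 1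
    opp-half x y e with halve (x + y - ε)
    ... | k , inj₂ h = k + + 1 , liaG 3 (λ x y k → x :+ y :- εᵉ :≡ (+ 2) :* k :+ # 1 ⊢ x :+ y :≡ (+ 2) :* (k :+ # 1) :+ εᵉ :- # 1) x y k h
    ... | k , inj₁ h = ⊥-elim (opp-≢ c (trans (sym (half-colour x y k
            (liaG 3 (λ x y k → x :+ y :- εᵉ :≡ (+ 2) :* k :+ # 0 ⊢ x :+ y :≡ (+ 2) :* k :+ εᵉ) x y k h))) e))
      where
      opp-≢ : ∀ d → d ≢ opp d
      opp-≢ black ()
      opp-≢ white ()

    vector-ker : InKer c m n vector
    vector-ker w@((x , y) , e) with opp-half (+ toℕ x) (+ toℕ y) e
    ... | k , ek =
      let (x₁ , y₁ , x₂ , y₂ , x₃ , y₃ , x₄ , y₄ , face) = liaG 3 (λ X Y k → (X :+ Y :≡ (+ 2) :* k :+ εᵉ :- # 1) :∧ (# 0 :≤ X :∧ X :< mᵉ :∧ # 0 :≤ Y :∧ Y :< nᵉ) ⊢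
            let i = k ; j = X :- εᵉ :- k in
            X :≡ i :+ # 1 :+ j :+ εᵉ :- # 1 :∧ Y :+ # 1 :≡ i :+ # 1 :- j :- # 1 :∧
            X :≡ i :+ (j :+ # 1) :+ εᵉ :- # 1 :∧ Y :- # 1 :≡ i :- (j :+ # 1) :- # 1 :∧
            X :+ # 1 :≡ i :+ # 1 :+ (j :+ # 1) :+ εᵉ :- # 1 :∧ Y :≡ i :+ # 1 :- (j :+ # 1) :- # 1 :∧
            X :- # 1 :≡ i :+ j :+ εᵉ :- # 1 :∧ Y :≡ i :- j :- # 1 :∧ faceᵉ i j)
            X Y k (ek , 0≤+ , ℤ.+<+ (FinP.toℕ<n x) , 0≤+ , ℤ.+<+ (FinP.toℕ<n y))
      in trans (map-neighbours vector w) (trans (cong₂ _xor_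
           (cong₂ _xor_ (cong₂ (onℤ vector) x₁ y₁) (cong₂ (onℤ vector) x₂ y₂))
           (cong₂ _xor_ (cong₂ (onℤ vector) x₃ y₃) (cong₂ (onℤ vector) x₄ y₄)))
           (face-sum k (X - ε - k) face))
      where
      X = + toℕ x
      Y = + toℕ y

  -- Carrying the values of the profile across the walls

  hullᵉ : (i₀ i₁ j₀ j₁ a b : Expr) → Form
  hullᵉ i₀ i₁ j₀ j₁ a b = (i₀ :+ j₀ :- # 1 :≤ a :+ b :∧ a :+ b :≤ i₁ :+ j₁ :+ # 1) :∧ (i₀ :- j₁ :- # 1 :≤ a :- b :∧ a :- b :≤ i₁ :- j₀ :+ # 1)

  Hull : (i₀ i₁ j₀ j₁ a b : ℤ) → Set
  Hull i₀ i₁ j₀ j₁ a b = Holds (hullᵉ (K i₀) (K i₁) (K j₀) (K j₁) (K a) (K b)) ρ₀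

  hull : ∀ k i₀ i₁ j₀ j₁ a b → i₀ ≤ i₁ → j₀ ≤ j₁ → At k i₀ i₁ j₀ j₁ a b → Hull i₀ i₁ j₀ j₁ a b
  hull inside i₀ i₁ j₀ j₁ a b s₁ s₂ p = lia 6 (λ i₀ i₁ j₀ j₁ a b → (i₀ :≤ i₁ :∧ j₀ :≤ j₁) :∧ placeᵉ inside i₀ i₁ j₀ j₁ a b ⊢ hullᵉ i₀ i₁ j₀ j₁ a b) i₀ i₁ j₀ j₁ a b ((s₁ , s₂) , p)
  hull iLo i₀ i₁ j₀ j₁ a b s₁ s₂ p = lia 6 (λ i₀ i₁ j₀ j₁ a b → (i₀ :≤ i₁ :∧ j₀ :≤ j₁) :∧ placeᵉ iLo i₀ i₁ j₀ j₁ a b ⊢ hullᵉ i₀ i₁ j₀ j₁ a b) i₀ i₁ j₀ j₁ a b ((s₁ , s₂) , p)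
  hull iHi i₀ i₁ j₀ j₁ a b s₁ s₂ p = lia 6 (λ i₀ i₁ j₀ j₁ a b → (i₀ :≤ i₁ :∧ j₀ :≤ j₁) :∧ placeᵉ iHi i₀ i₁ j₀ j₁ a b ⊢ hullᵉ i₀ i₁ j₀ j₁ a b) i₀ i₁ j₀ j₁ a b ((s₁ , s₂) , p)
  hull jLo i₀ i₁ j₀ j₁ a b s₁ s₂ p = lia 6 (λ i₀ i₁ j₀ j₁ a b → (i₀ :≤ i₁ :∧ j₀ :≤ j₁) :∧ placeᵉ jLo i₀ i₁ j₀ j₁ a b ⊢ hullᵉ i₀ i₁ j₀ j₁ a b) i₀ i₁ j₀ j₁ a b ((s₁ , s₂) , p)
  hull jHi i₀ i₁ j₀ j₁ a b s₁ s₂ p = lia 6 (λ i₀ i₁ j₀ j₁ a b → (i₀ :≤ i₁ :∧ j₀ :≤ j₁) :∧ placeᵉ jHi i₀ i₁ j₀ j₁ a b ⊢ hullᵉ i₀ i₁ j₀ j₁ a b) i₀ i₁ j₀ j₁ a b ((s₁ , s₂) , p)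

  -- The action of the reflections on positions. In the bottom and top walls i and j change roles
  -- with their order kept; in the left and right walls the order is reversed as well, so low and
  -- high ends are exchanged.
  swapʰ swapᵛ : Place → Place
  swapʰ inside = inside
  swapʰ iLo = jLo
  swapʰ iHi = jHi
  swapʰ jLo = iLo
  swapʰ jHi = iHi
  swapᵛ inside = inside
  swapᵛ iLo = jHi
  swapᵛ iHi = jLo
  swapᵛ jLo = iHi
  swapᵛ jHi = iLo

  mirror-bottom : ∀ k i₀ i₁ j₀ j₁ a b → Holds (bottomSᵉ (K i₀) (K i₁) (K j₀) (K j₁)) ρ₀ → At k i₀ i₁ j₀ j₁ a b → At (swapʰ k) i₀ i₁ j₀ j₁ (b) (a)
  mirror-bottom inside i₀ i₁ j₀ j₁ a b w p = liaG 6 (λ i₀ i₁ j₀ j₁ a b → bottomSᵉ i₀ i₁ j₀ j₁ :∧ placeᵉ inside i₀ i₁ j₀ j₁ a b ⊢ placeᵉ inside i₀ i₁ j₀ j₁ (b) (a)) i₀ i₁ j₀ j₁ a b (w , p)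
  mirror-bottom iLo i₀ i₁ j₀ j₁ a b w p = liaG 6 (λ i₀ i₁ j₀ j₁ a b → bottomSᵉ i₀ i₁ j₀ j₁ :∧ placeᵉ iLo i₀ i₁ j₀ j₁ a b ⊢ placeᵉ jLo i₀ i₁ j₀ j₁ (b) (a)) i₀ i₁ j₀ j₁ a b (w , p)
  mirror-bottom iHi i₀ i₁ j₀ j₁ a b w p = liaG 6 (λ i₀ i₁ j₀ j₁ a b → bottomSᵉ i₀ i₁ j₀ j₁ :∧ placeᵉ iHi i₀ i₁ j₀ j₁ a b ⊢ placeᵉ jHi i₀ i₁ j₀ j₁ (b) (a)) i₀ i₁ j₀ j₁ a b (w , p)
  mirror-bottom jLo i₀ i₁ j₀ j₁ a b w p = liaG 6 (λ i₀ i₁ j₀ j₁ a b → bottomSᵉ i₀ i₁ j₀ j₁ :∧ placeᵉ jLo i₀ i₁ j₀ j₁ a b ⊢ placeᵉ iLo i₀ i₁ j₀ j₁ (b) (a)) i₀ i₁ j₀ j₁ a b (w , p)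
  mirror-bottom jHi i₀ i₁ j₀ j₁ a b w p = liaG 6 (λ i₀ i₁ j₀ j₁ a b → bottomSᵉ i₀ i₁ j₀ j₁ :∧ placeᵉ jHi i₀ i₁ j₀ j₁ a b ⊢ placeᵉ iHi i₀ i₁ j₀ j₁ (b) (a)) i₀ i₁ j₀ j₁ a b (w , p)

  -- At a point of an axis, a is in I exactly when b is in J, which rules out the four outer
  -- positions.
  axis-bottom : ∀ k i₀ i₁ j₀ j₁ a b → Holds (bottomSᵉ (K i₀) (K i₁) (K j₀) (K j₁)) ρ₀ → At k i₀ i₁ j₀ j₁ a b → a ≡ b → k ≡ inside
  axis-bottom inside i₀ i₁ j₀ j₁ a b w p e = refl
  axis-bottom iLo i₀ i₁ j₀ j₁ a b w p e = ⊥-elim (liaG 6 (λ i₀ i₁ j₀ j₁ a b → bottomSᵉ i₀ i₁ j₀ j₁ :∧ placeᵉ iLo i₀ i₁ j₀ j₁ a b :∧ a :≡ b ⊢ ⊥ᶠ) i₀ i₁ j₀ j₁ a b (w , p , e))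
  axis-bottom iHi i₀ i₁ j₀ j₁ a b w p e = ⊥-elim (liaG 6 (λ i₀ i₁ j₀ j₁ a b → bottomSᵉ i₀ i₁ j₀ j₁ :∧ placeᵉ iHi i₀ i₁ j₀ j₁ a b :∧ a :≡ b ⊢ ⊥ᶠ) i₀ i₁ j₀ j₁ a b (w , p , e))
  axis-bottom jLo i₀ i₁ j₀ j₁ a b w p e = ⊥-elim (liaG 6 (λ i₀ i₁ j₀ j₁ a b → bottomSᵉ i₀ i₁ j₀ j₁ :∧ placeᵉ jLo i₀ i₁ j₀ j₁ a b :∧ a :≡ b ⊢ ⊥ᶠ) i₀ i₁ j₀ j₁ a b (w , p , e))
  axis-bottom jHi i₀ i₁ j₀ j₁ a b w p e = ⊥-elim (liaG 6 (λ i₀ i₁ j₀ j₁ a b → bottomSᵉ i₀ i₁ j₀ j₁ :∧ placeᵉ jHi i₀ i₁ j₀ j₁ a b :∧ a :≡ b ⊢ ⊥ᶠ) i₀ i₁ j₀ j₁ a b (w , p , e))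

  mirror-top : ∀ k i₀ i₁ j₀ j₁ a b → Holds (topSᵉ (K i₀) (K i₁) (K j₀) (K j₁)) ρ₀ → At k i₀ i₁ j₀ j₁ a b → At (swapʰ k) i₀ i₁ j₀ j₁ (b + (+ n + + 1)) (a - (+ n + + 1))
  mirror-top inside i₀ i₁ j₀ j₁ a b w p = liaG 6 (λ i₀ i₁ j₀ j₁ a b → topSᵉ i₀ i₁ j₀ j₁ :∧ placeᵉ inside i₀ i₁ j₀ j₁ a b ⊢ placeᵉ inside i₀ i₁ j₀ j₁ (b :+ (nᵉ :+ # 1)) (a :- (nᵉ :+ # 1))) i₀ i₁ j₀ j₁ a b (w , p)
  mirror-top iLo i₀ i₁ j₀ j₁ a b w p = liaG 6 (λ i₀ i₁ j₀ j₁ a b → topSᵉ i₀ i₁ j₀ j₁ :∧ placeᵉ iLo i₀ i₁ j₀ j₁ a b ⊢ placeᵉ jLo i₀ i₁ j₀ j₁ (b :+ (nᵉ :+ # 1)) (a :- (nᵉ :+ # 1))) i₀ i₁ j₀ j₁ a b (w , p)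
  mirror-top iHi i₀ i₁ j₀ j₁ a b w p = liaG 6 (λ i₀ i₁ j₀ j₁ a b → topSᵉ i₀ i₁ j₀ j₁ :∧ placeᵉ iHi i₀ i₁ j₀ j₁ a b ⊢ placeᵉ jHi i₀ i₁ j₀ j₁ (b :+ (nᵉ :+ # 1)) (a :- (nᵉ :+ # 1))) i₀ i₁ j₀ j₁ a b (w , p)
  mirror-top jLo i₀ i₁ j₀ j₁ a b w p = liaG 6 (λ i₀ i₁ j₀ j₁ a b → topSᵉ i₀ i₁ j₀ j₁ :∧ placeᵉ jLo i₀ i₁ j₀ j₁ a b ⊢ placeᵉ iLo i₀ i₁ j₀ j₁ (b :+ (nᵉ :+ # 1)) (a :- (nᵉ :+ # 1))) i₀ i₁ j₀ j₁ a b (w , p)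
  mirror-top jHi i₀ i₁ j₀ j₁ a b w p = liaG 6 (λ i₀ i₁ j₀ j₁ a b → topSᵉ i₀ i₁ j₀ j₁ :∧ placeᵉ jHi i₀ i₁ j₀ j₁ a b ⊢ placeᵉ iHi i₀ i₁ j₀ j₁ (b :+ (nᵉ :+ # 1)) (a :- (nᵉ :+ # 1))) i₀ i₁ j₀ j₁ a b (w , p)

  axis-top : ∀ k i₀ i₁ j₀ j₁ a b → Holds (topSᵉ (K i₀) (K i₁) (K j₀) (K j₁)) ρ₀ → At k i₀ i₁ j₀ j₁ a b → a ≡ b + (+ n + + 1) → k ≡ inside
  axis-top inside i₀ i₁ j₀ j₁ a b w p e = refl
  axis-top iLo i₀ i₁ j₀ j₁ a b w p e = ⊥-elim (liaG 6 (λ i₀ i₁ j₀ j₁ a b → topSᵉ i₀ i₁ j₀ j₁ :∧ placeᵉ iLo i₀ i₁ j₀ j₁ a b :∧ a :≡ b :+ (nᵉ :+ # 1) ⊢ ⊥ᶠ) i₀ i₁ j₀ j₁ a b (w , p , e))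
  axis-top iHi i₀ i₁ j₀ j₁ a b w p e = ⊥-elim (liaG 6 (λ i₀ i₁ j₀ j₁ a b → topSᵉ i₀ i₁ j₀ j₁ :∧ placeᵉ iHi i₀ i₁ j₀ j₁ a b :∧ a :≡ b :+ (nᵉ :+ # 1) ⊢ ⊥ᶠ) i₀ i₁ j₀ j₁ a b (w , p , e))
  axis-top jLo i₀ i₁ j₀ j₁ a b w p e = ⊥-elim (liaG 6 (λ i₀ i₁ j₀ j₁ a b → topSᵉ i₀ i₁ j₀ j₁ :∧ placeᵉ jLo i₀ i₁ j₀ j₁ a b :∧ a :≡ b :+ (nᵉ :+ # 1) ⊢ ⊥ᶠ) i₀ i₁ j₀ j₁ a b (w , p , e))
  axis-top jHi i₀ i₁ j₀ j₁ a b w p e = ⊥-elim (liaG 6 (λ i₀ i₁ j₀ j₁ a b → topSᵉ i₀ i₁ j₀ j₁ :∧ placeᵉ jHi i₀ i₁ j₀ j₁ a b :∧ a :≡ b :+ (nᵉ :+ # 1) ⊢ ⊥ᶠ) i₀ i₁ j₀ j₁ a b (w , p , e))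

  mirror-left : ∀ k i₀ i₁ j₀ j₁ a b → Holds (leftSᵉ (K i₀) (K i₁) (K j₀) (K j₁)) ρ₀ → At k i₀ i₁ j₀ j₁ a b → At (swapᵛ k) i₀ i₁ j₀ j₁ (- ε - b) (- ε - a)
  mirror-left inside i₀ i₁ j₀ j₁ a b w p = liaG 6 (λ i₀ i₁ j₀ j₁ a b → leftSᵉ i₀ i₁ j₀ j₁ :∧ placeᵉ inside i₀ i₁ j₀ j₁ a b ⊢ placeᵉ inside i₀ i₁ j₀ j₁ (neg εᵉ :- b) (neg εᵉ :- a)) i₀ i₁ j₀ j₁ a b (w , p)
  mirror-left iLo i₀ i₁ j₀ j₁ a b w p = liaG 6 (λ i₀ i₁ j₀ j₁ a b → leftSᵉ i₀ i₁ j₀ j₁ :∧ placeᵉ iLo i₀ i₁ j₀ j₁ a b ⊢ placeᵉ jHi i₀ i₁ j₀ j₁ (neg εᵉ :- b) (neg εᵉ :- a)) i₀ i₁ j₀ j₁ a b (w , p)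
  mirror-left iHi i₀ i₁ j₀ j₁ a b w p = liaG 6 (λ i₀ i₁ j₀ j₁ a b → leftSᵉ i₀ i₁ j₀ j₁ :∧ placeᵉ iHi i₀ i₁ j₀ j₁ a b ⊢ placeᵉ jLo i₀ i₁ j₀ j₁ (neg εᵉ :- b) (neg εᵉ :- a)) i₀ i₁ j₀ j₁ a b (w , p)
  mirror-left jLo i₀ i₁ j₀ j₁ a b w p = liaG 6 (λ i₀ i₁ j₀ j₁ a b → leftSᵉ i₀ i₁ j₀ j₁ :∧ placeᵉ jLo i₀ i₁ j₀ j₁ a b ⊢ placeᵉ iHi i₀ i₁ j₀ j₁ (neg εᵉ :- b) (neg εᵉ :- a)) i₀ i₁ j₀ j₁ a b (w , p)
  mirror-left jHi i₀ i₁ j₀ j₁ a b w p = liaG 6 (λ i₀ i₁ j₀ j₁ a b → leftSᵉ i₀ i₁ j₀ j₁ :∧ placeᵉ jHi i₀ i₁ j₀ j₁ a b ⊢ placeᵉ iLo i₀ i₁ j₀ j₁ (neg εᵉ :- b) (neg εᵉ :- a)) i₀ i₁ j₀ j₁ a b (w , p)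

  axis-left : ∀ k i₀ i₁ j₀ j₁ a b → Holds (leftSᵉ (K i₀) (K i₁) (K j₀) (K j₁)) ρ₀ → At k i₀ i₁ j₀ j₁ a b → a ≡ - ε - b → k ≡ inside
  axis-left inside i₀ i₁ j₀ j₁ a b w p e = refl
  axis-left iLo i₀ i₁ j₀ j₁ a b w p e = ⊥-elim (liaG 6 (λ i₀ i₁ j₀ j₁ a b → leftSᵉ i₀ i₁ j₀ j₁ :∧ placeᵉ iLo i₀ i₁ j₀ j₁ a b :∧ a :≡ neg εᵉ :- b ⊢ ⊥ᶠ) i₀ i₁ j₀ j₁ a b (w , p , e))
  axis-left iHi i₀ i₁ j₀ j₁ a b w p e = ⊥-elim (liaG 6 (λ i₀ i₁ j₀ j₁ a b → leftSᵉ i₀ i₁ j₀ j₁ :∧ placeᵉ iHi i₀ i₁ j₀ j₁ a b :∧ a :≡ neg εᵉ :- b ⊢ ⊥ᶠ) i₀ i₁ j₀ j₁ a b (w , p , e))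
  axis-left jLo i₀ i₁ j₀ j₁ a b w p e = ⊥-elim (liaG 6 (λ i₀ i₁ j₀ j₁ a b → leftSᵉ i₀ i₁ j₀ j₁ :∧ placeᵉ jLo i₀ i₁ j₀ j₁ a b :∧ a :≡ neg εᵉ :- b ⊢ ⊥ᶠ) i₀ i₁ j₀ j₁ a b (w , p , e))
  axis-left jHi i₀ i₁ j₀ j₁ a b w p e = ⊥-elim (liaG 6 (λ i₀ i₁ j₀ j₁ a b → leftSᵉ i₀ i₁ j₀ j₁ :∧ placeᵉ jHi i₀ i₁ j₀ j₁ a b :∧ a :≡ neg εᵉ :- b ⊢ ⊥ᶠ) i₀ i₁ j₀ j₁ a b (w , p , e))

  mirror-right : ∀ k i₀ i₁ j₀ j₁ a b → Holds (rightSᵉ (K i₀) (K i₁) (K j₀) (K j₁)) ρ₀ → At k i₀ i₁ j₀ j₁ a b → At (swapᵛ k) i₀ i₁ j₀ j₁ (+ m + + 1 - ε - b) (+ m + + 1 - ε - a)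
  mirror-right inside i₀ i₁ j₀ j₁ a b w p = liaG 6 (λ i₀ i₁ j₀ j₁ a b → rightSᵉ i₀ i₁ j₀ j₁ :∧ placeᵉ inside i₀ i₁ j₀ j₁ a b ⊢ placeᵉ inside i₀ i₁ j₀ j₁ (mᵉ :+ # 1 :- εᵉ :- b) (mᵉ :+ # 1 :- εᵉ :- a)) i₀ i₁ j₀ j₁ a b (w , p)
  mirror-right iLo i₀ i₁ j₀ j₁ a b w p = liaG 6 (λ i₀ i₁ j₀ j₁ a b → rightSᵉ i₀ i₁ j₀ j₁ :∧ placeᵉ iLo i₀ i₁ j₀ j₁ a b ⊢ placeᵉ jHi i₀ i₁ j₀ j₁ (mᵉ :+ # 1 :- εᵉ :- b) (mᵉ :+ # 1 :- εᵉ :- a)) i₀ i₁ j₀ j₁ a b (w , p)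
  mirror-right iHi i₀ i₁ j₀ j₁ a b w p = liaG 6 (λ i₀ i₁ j₀ j₁ a b → rightSᵉ i₀ i₁ j₀ j₁ :∧ placeᵉ iHi i₀ i₁ j₀ j₁ a b ⊢ placeᵉ jLo i₀ i₁ j₀ j₁ (mᵉ :+ # 1 :- εᵉ :- b) (mᵉ :+ # 1 :- εᵉ :- a)) i₀ i₁ j₀ j₁ a b (w , p)
  mirror-right jLo i₀ i₁ j₀ j₁ a b w p = liaG 6 (λ i₀ i₁ j₀ j₁ a b → rightSᵉ i₀ i₁ j₀ j₁ :∧ placeᵉ jLo i₀ i₁ j₀ j₁ a b ⊢ placeᵉ iHi i₀ i₁ j₀ j₁ (mᵉ :+ # 1 :- εᵉ :- b) (mᵉ :+ # 1 :- εᵉ :- a)) i₀ i₁ j₀ j₁ a b (w , p)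
  mirror-right jHi i₀ i₁ j₀ j₁ a b w p = liaG 6 (λ i₀ i₁ j₀ j₁ a b → rightSᵉ i₀ i₁ j₀ j₁ :∧ placeᵉ jHi i₀ i₁ j₀ j₁ a b ⊢ placeᵉ iLo i₀ i₁ j₀ j₁ (mᵉ :+ # 1 :- εᵉ :- b) (mᵉ :+ # 1 :- εᵉ :- a)) i₀ i₁ j₀ j₁ a b (w , p)

  axis-right : ∀ k i₀ i₁ j₀ j₁ a b → Holds (rightSᵉ (K i₀) (K i₁) (K j₀) (K j₁)) ρ₀ → At k i₀ i₁ j₀ j₁ a b → a ≡ + m + + 1 - ε - b → k ≡ inside
  axis-right inside i₀ i₁ j₀ j₁ a b w p e = refl
  axis-right iLo i₀ i₁ j₀ j₁ a b w p e = ⊥-elim (liaG 6 (λ i₀ i₁ j₀ j₁ a b → rightSᵉ i₀ i₁ j₀ j₁ :∧ placeᵉ iLo i₀ i₁ j₀ j₁ a b :∧ a :≡ mᵉ :+ # 1 :- εᵉ :- b ⊢ ⊥ᶠ) i₀ i₁ j₀ j₁ a b (w , p , e))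
  axis-right iHi i₀ i₁ j₀ j₁ a b w p e = ⊥-elim (liaG 6 (λ i₀ i₁ j₀ j₁ a b → rightSᵉ i₀ i₁ j₀ j₁ :∧ placeᵉ iHi i₀ i₁ j₀ j₁ a b :∧ a :≡ mᵉ :+ # 1 :- εᵉ :- b ⊢ ⊥ᶠ) i₀ i₁ j₀ j₁ a b (w , p , e))
  axis-right jLo i₀ i₁ j₀ j₁ a b w p e = ⊥-elim (liaG 6 (λ i₀ i₁ j₀ j₁ a b → rightSᵉ i₀ i₁ j₀ j₁ :∧ placeᵉ jLo i₀ i₁ j₀ j₁ a b :∧ a :≡ mᵉ :+ # 1 :- εᵉ :- b ⊢ ⊥ᶠ) i₀ i₁ j₀ j₁ a b (w , p , e))
  axis-right jHi i₀ i₁ j₀ j₁ a b w p e = ⊥-elim (liaG 6 (λ i₀ i₁ j₀ j₁ a b → rightSᵉ i₀ i₁ j₀ j₁ :∧ placeᵉ jHi i₀ i₁ j₀ j₁ a b :∧ a :≡ mᵉ :+ # 1 :- εᵉ :- b ⊢ ⊥ᶠ) i₀ i₁ j₀ j₁ a b (w , p , e))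

  module _ (F : ℤ → Bool) where
    Value : Place → ℤ → ℤ → Set
    Value inside a b = F a ≡ F b
    Value iLo a b = F a ≡ not (F b)
    Value iHi a b = F a ≡ not (F b)
    Value jLo a b = F a ≡ not (F b)
    Value jHi a b = F a ≡ not (F b)

    private

      back : ∀ {x y x′ y′ : Bool} → x′ ≡ y → y′ ≡ x → x′ ≡ not y′ → x ≡ not y
      back refl refl e = flip-not e

    value-h : ∀ k a b a′ b′ → F a′ ≡ F b → F b′ ≡ F a → Value (swapʰ k) a′ b′ → Value k a b
    value-h inside a b a′ b′ e e′ h = trans (sym e′) (trans (sym h) e)
    value-h iLo a b a′ b′ e e′ h = back e e′ h
    value-h iHi a b a′ b′ e e′ h = back e e′ h
    value-h jLo a b a′ b′ e e′ h = back e e′ h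
    value-h jHi a b a′ b′ e e′ h = back e e′ h

    value-v : ∀ k a b a′ b′ → F a′ ≡ F b → F b′ ≡ F a → Value (swapᵛ k) a′ b′ → Value k a b
    value-v inside a b a′ b′ e e′ h = trans (sym e′) (trans (sym h) e)
    value-v iLo a b a′ b′ e e′ h = back e e′ h
    value-v iHi a b a′ b′ e e′ h = back e e′ h
    value-v jLo a b a′ b′ e e′ h = back e e′ h
    value-v jHi a b a′ b′ e e′ h = back e e′ h

    value-axis : ∀ k a b → k ≡ inside → F a ≡ F b → Value k a b
    value-axis inside a b refl e = e

    -- `base` gives the values at points of R only, but a block with an axis reaches beyond the
    -- wall. On the axis both coordinates have the same `F` by invariance; beyond it the mirror
    -- image has the mirrored position, and its value is carried back. One reflection in each
    -- direction suffices, because of two parallel walls at most one is an axis.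
    module Unfold (reflective : Reflective F) (i₀ i₁ j₀ j₁ : ℤ) (w : Walled (blk i₀ i₁ j₀ j₁))
      (base : ∀ k a b → onR a b → At k i₀ i₁ j₀ j₁ a b → Value k a b) where
      open Reflective reflective

      private
        s₁ : i₀ ≤ i₁
        s₁ = proj₁ w
        s₂ : j₀ ≤ j₁
        s₂ = proj₁ (proj₂ w)
        bo : Bottom i₀ i₁ j₀ j₁
        bo = proj₁ (proj₂ (proj₂ w))
        to : Top i₀ i₁ j₀ j₁
        to = proj₁ (proj₂ (proj₂ (proj₂ w)))
        le : Left i₀ i₁ j₀ j₁
        le = proj₁ (proj₂ (proj₂ (proj₂ (proj₂ w))))
        ri : Right i₀ i₁ j₀ j₁
        ri = proj₂ (proj₂ (proj₂ (proj₂ (proj₂ w))))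

      top⁻ : ∀ k → F (k - (+ n + + 1)) ≡ F k
      top⁻ k = trans (sym (top (k - (+ n + + 1)))) (cong F (liaG 1 (λ k → ⊤ᶠ ⊢ k :- (nᵉ :+ # 1) :+ (nᵉ :+ # 1) :≡ k) k tt))

      valuesʸ : ∀ k a b → + 0 ≤ a + b + ε - + 1 → a + b + ε - + 1 < + m → At k i₀ i₁ j₀ j₁ a b → Value k a b
      valuesʸ k a b x₀ x₁ p with + 0 ℤ.≤? a - b - + 1 | a - b - + 1 ℤ.<? + n
      ... | yes y₀ | yes y₁ = base k a b (x₀ , x₁ , y₀ , y₁) p
      ... | no y | _ = either (λ w → ⊥-elim (liaG 6 (λ i₀ i₁ j₀ j₁ a b → hullᵉ i₀ i₁ j₀ j₁ a b :∧ a :- b :- # 1 :< # 0 :∧ bottomNᵉ i₀ i₁ j₀ j₁ ⊢ ⊥ᶠ)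
                          i₀ i₁ j₀ j₁ a b (hull k i₀ i₁ j₀ j₁ a b s₁ s₂ p , ℤP.≰⇒> y , w))) go bo
        where
        go : Holds (bottomSᵉ (K i₀) (K i₁) (K j₀) (K j₁)) ρ₀ → Value k a b
        go w with a ℤ.≟ b
        ... | yes e = value-axis k a b (axis-bottom k i₀ i₁ j₀ j₁ a b w p e) (cong F e)
        ... | no ne = value-h k a b b a refl refl (base (swapʰ k) b a (either
                (λ t → liaG 6 (λ i₀ i₁ j₀ j₁ a b → hullᵉ i₀ i₁ j₀ j₁ a b :∧ a :< b :∧ bottomSᵉ i₀ i₁ j₀ j₁ :∧ topNᵉ i₀ i₁ j₀ j₁ :∧ # 0 :≤ a :+ b :+ εᵉ :- # 1 :∧ a :+ b :+ εᵉ :- # 1 :< mᵉ ⊢ onRᵉ b a)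
                  i₀ i₁ j₀ j₁ a b (hull k i₀ i₁ j₀ j₁ a b s₁ s₂ p , lt , w , t , x₀ , x₁))
                (λ t → liaG 6 (λ i₀ i₁ j₀ j₁ a b → bottomSᵉ i₀ i₁ j₀ j₁ :∧ topSᵉ i₀ i₁ j₀ j₁ ⊢ onRᵉ b a) i₀ i₁ j₀ j₁ a b (w , t)) to)
                (mirror-bottom k i₀ i₁ j₀ j₁ a b w p))
          where
          lt : a < b
          lt = ℤP.≤∧≢⇒< (lia 2 (λ a b → a :- b :- # 1 :< # 0 ⊢ a :≤ b) a b (ℤP.≰⇒> y)) ne
      valuesʸ k a b x₀ x₁ p | yes _ | no y =
          either (λ w → ⊥-elim (liaG 6 (λ i₀ i₁ j₀ j₁ a b → hullᵉ i₀ i₁ j₀ j₁ a b :∧ nᵉ :≤ a :- b :- # 1 :∧ topNᵉ i₀ i₁ j₀ j₁ ⊢ ⊥ᶠ)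
                          i₀ i₁ j₀ j₁ a b (hull k i₀ i₁ j₀ j₁ a b s₁ s₂ p , ℤP.≮⇒≥ y , w))) go to
        where
        go : Holds (topSᵉ (K i₀) (K i₁) (K j₀) (K j₁)) ρ₀ → Value k a b
        go w with a ℤ.≟ b + (+ n + + 1)
        ... | yes e = value-axis k a b (axis-top k i₀ i₁ j₀ j₁ a b w p e) (trans (cong F e) (top b))
        ... | no ne = value-h k a b (b + (+ n + + 1)) (a - (+ n + + 1)) (top b) (top⁻ a) (base (swapʰ k) (b + (+ n + + 1)) (a - (+ n + + 1)) (either
                (λ t → liaG 6 (λ i₀ i₁ j₀ j₁ a b → hullᵉ i₀ i₁ j₀ j₁ a b :∧ b :+ (nᵉ :+ # 1) :< a :∧ topSᵉ i₀ i₁ j₀ j₁ :∧ bottomNᵉ i₀ i₁ j₀ j₁ :∧ # 0 :≤ a :+ b :+ εᵉ :- # 1 :∧ a :+ b :+ εᵉ :- # 1 :< mᵉ ⊢ onRᵉ (b :+ (nᵉ :+ # 1)) (a :- (nᵉ :+ # 1)))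
                  i₀ i₁ j₀ j₁ a b (hull k i₀ i₁ j₀ j₁ a b s₁ s₂ p , lt , w , t , x₀ , x₁))
                (λ t → liaG 6 (λ i₀ i₁ j₀ j₁ a b → topSᵉ i₀ i₁ j₀ j₁ :∧ bottomSᵉ i₀ i₁ j₀ j₁ ⊢ onRᵉ (b :+ (nᵉ :+ # 1)) (a :- (nᵉ :+ # 1))) i₀ i₁ j₀ j₁ a b (w , t)) bo)
                (mirror-top k i₀ i₁ j₀ j₁ a b w p))
          where
          lt : b + (+ n + + 1) < a
          lt = ℤP.≤∧≢⇒< (liaG 2 (λ a b → nᵉ :≤ a :- b :- # 1 ⊢ b :+ (nᵉ :+ # 1) :≤ a) a b (ℤP.≮⇒≥ y)) (ne ∘ sym)

      values : ∀ k a b → At k i₀ i₁ j₀ j₁ a b → Value k a b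
      values k a b p with + 0 ℤ.≤? a + b + ε - + 1 | a + b + ε - + 1 ℤ.<? + m
      ... | yes x₀ | yes x₁ = valuesʸ k a b x₀ x₁ p
      ... | no x | _ = either (λ w → ⊥-elim (liaG 6 (λ i₀ i₁ j₀ j₁ a b → hullᵉ i₀ i₁ j₀ j₁ a b :∧ a :+ b :+ εᵉ :- # 1 :< # 0 :∧ leftNᵉ i₀ i₁ j₀ j₁ ⊢ ⊥ᶠ)
                          i₀ i₁ j₀ j₁ a b (hull k i₀ i₁ j₀ j₁ a b s₁ s₂ p , ℤP.≰⇒> x , w))) go le
        where
        go : Holds (leftSᵉ (K i₀) (K i₁) (K j₀) (K j₁)) ρ₀ → Value k a b
        go w with a ℤ.≟ - ε - b
        ... | yes e = value-axis k a b (axis-left k i₀ i₁ j₀ j₁ a b w p e) (trans (cong F e) (left b))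
        ... | no ne =
          let (x₀ , x₁) = either
                (λ r → liaG 6 (λ i₀ i₁ j₀ j₁ a b → hullᵉ i₀ i₁ j₀ j₁ a b :∧ a :< neg εᵉ :- b :∧ leftSᵉ i₀ i₁ j₀ j₁ :∧ rightNᵉ i₀ i₁ j₀ j₁ ⊢
                    # 0 :≤ neg εᵉ :- b :+ (neg εᵉ :- a) :+ εᵉ :- # 1 :∧ neg εᵉ :- b :+ (neg εᵉ :- a) :+ εᵉ :- # 1 :< mᵉ)
                  i₀ i₁ j₀ j₁ a b (hull k i₀ i₁ j₀ j₁ a b s₁ s₂ p , lt , w , r))
                (λ r → liaG 6 (λ i₀ i₁ j₀ j₁ a b → leftSᵉ i₀ i₁ j₀ j₁ :∧ rightSᵉ i₀ i₁ j₀ j₁ ⊢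
                    # 0 :≤ neg εᵉ :- b :+ (neg εᵉ :- a) :+ εᵉ :- # 1 :∧ neg εᵉ :- b :+ (neg εᵉ :- a) :+ εᵉ :- # 1 :< mᵉ) i₀ i₁ j₀ j₁ a b (w , r)) ri
          in value-v k a b (- ε - b) (- ε - a) (left b) (left a) (valuesʸ (swapᵛ k) (- ε - b) (- ε - a) x₀ x₁ (mirror-left k i₀ i₁ j₀ j₁ a b w p))
          where
          lt : a < - ε - b
          lt = ℤP.≤∧≢⇒< (liaG 2 (λ a b → a :+ b :+ εᵉ :- # 1 :< # 0 ⊢ a :≤ neg εᵉ :- b) a b (ℤP.≰⇒> x)) ne
      values k a b p | yes _ | no x =
          either (λ w → ⊥-elim (liaG 6 (λ i₀ i₁ j₀ j₁ a b → hullᵉ i₀ i₁ j₀ j₁ a b :∧ mᵉ :≤ a :+ b :+ εᵉ :- # 1 :∧ rightNᵉ i₀ i₁ j₀ j₁ ⊢ ⊥ᶠ)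
                          i₀ i₁ j₀ j₁ a b (hull k i₀ i₁ j₀ j₁ a b s₁ s₂ p , ℤP.≮⇒≥ x , w))) go ri
        where
        go : Holds (rightSᵉ (K i₀) (K i₁) (K j₀) (K j₁)) ρ₀ → Value k a b
        go w with a ℤ.≟ + m + + 1 - ε - b
        ... | yes e = value-axis k a b (axis-right k i₀ i₁ j₀ j₁ a b w p e) (trans (cong F e) (right b))
        ... | no ne =
          let (x₀ , x₁) = either
                (λ l → liaG 6 (λ i₀ i₁ j₀ j₁ a b → hullᵉ i₀ i₁ j₀ j₁ a b :∧ mᵉ :+ # 1 :- εᵉ :- b :< a :∧ rightSᵉ i₀ i₁ j₀ j₁ :∧ leftNᵉ i₀ i₁ j₀ j₁ ⊢
                    # 0 :≤ mᵉ :+ # 1 :- εᵉ :- b :+ (mᵉ :+ # 1 :- εᵉ :- a) :+ εᵉ :- # 1 :∧ mᵉ :+ # 1 :- εᵉ :- b :+ (mᵉ :+ # 1 :- εᵉ :- a) :+ εᵉ :- # 1 :< mᵉ)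
                  i₀ i₁ j₀ j₁ a b (hull k i₀ i₁ j₀ j₁ a b s₁ s₂ p , lt , w , l))
                (λ l → liaG 6 (λ i₀ i₁ j₀ j₁ a b → rightSᵉ i₀ i₁ j₀ j₁ :∧ leftSᵉ i₀ i₁ j₀ j₁ ⊢
                    # 0 :≤ mᵉ :+ # 1 :- εᵉ :- b :+ (mᵉ :+ # 1 :- εᵉ :- a) :+ εᵉ :- # 1 :∧ mᵉ :+ # 1 :- εᵉ :- b :+ (mᵉ :+ # 1 :- εᵉ :- a) :+ εᵉ :- # 1 :< mᵉ) i₀ i₁ j₀ j₁ a b (w , l)) le
          in value-v k a b (+ m + + 1 - ε - b) (+ m + + 1 - ε - a) (right b) (right a)
               (valuesʸ (swapᵛ k) (+ m + + 1 - ε - b) (+ m + + 1 - ε - a) x₀ x₁ (mirror-right k i₀ i₁ j₀ j₁ a b w p))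
          where
          lt : + m + + 1 - ε - b < a
          lt = ℤP.≤∧≢⇒< (liaG 2 (λ a b → mᵉ :≤ a :+ b :+ εᵉ :- # 1 ⊢ mᵉ :+ # 1 :- εᵉ :- b :≤ a) a b (ℤP.≮⇒≥ x)) (ne ∘ sym)

      -- F is constant on [i₀ , i₁] ∪ [j₀ , j₁] because it is equal at the two coordinates
      -- of each point of the block.
      block-piece : FPiece F (blk i₀ i₁ j₀ j₁)
      block-piece = F j₀ ,
        record { nonempty = s₁
               ; constant = λ k h h′ → values inside k j₀ ((h , h′) , ℤP.≤-refl , s₂)
               ; before = values iLo (i₀ - + 1) j₀ (refl , ℤP.≤-refl , s₂)
               ; after = values iHi (i₁ + + 1) j₀ (refl , ℤP.≤-refl , s₂) } ,
        record { nonempty = s₂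
               ; constant = λ k h h′ → trans (sym (values inside i₀ k ((ℤP.≤-refl , s₁) , h , h′))) i₀≡j₀
               ; before = trans (flip-not (values jLo i₀ (j₀ - + 1) (refl , ℤP.≤-refl , s₁))) (cong not i₀≡j₀)
               ; after = trans (flip-not (values jHi i₀ (j₁ + + 1) (refl , ℤP.≤-refl , s₁))) (cong not i₀≡j₀) }
        where
        i₀≡j₀ : F i₀ ≡ F j₀
        i₀≡j₀ = values inside i₀ j₀ ((ℤP.≤-refl , s₁) , ℤP.≤-refl , s₂)

  module FromTilingProfile (Ps : List Piece)
    (walls : ∀ {P} → P ∈ Ps → Walled P)
    (covers : ∀ q → Bits q → InR q → ∃ λ P → P ∈ Ps × P ∋ q)
    (disjoint : ∀ q → Bits q → InR q → ∀ {P P′} → P ∈ Ps → P′ ∈ Ps → P ∋ q → P′ ∋ q → P ≡ P′) where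
    open FromTiling Ps walls covers disjoint

    F : ℤ → Bool
    F = profile vector

    F-values : ∀ i j → onR i j → F i xor F j ≡ val i j
    F-values i j h = sym (profile-values vector vector-ker i j h)

    xor-true : ∀ a b → a xor b ≡ true → a ≡ not b
    xor-true true false _ = refl
    xor-true false true _ = refl

    base : ∀ {i₀ i₁ j₀ j₁} → blk i₀ i₁ j₀ j₁ ∈ Ps → ∀ k a b → onR a b → At k i₀ i₁ j₀ j₁ a b → Value F k a b
    base P∈ inside a b r p = xor-false (F a) (F b) (trans (F-values a b r) (inside-zero _ _ _ _ a b P∈ p))
    base P∈ iLo a b r p = xor-true (F a) (F b) (trans (F-values a b r) (side-one iLo _ _ _ _ a b P∈ (λ ()) p r))
    base P∈ iHi a b r p = xor-true (F a) (F b) (trans (F-values a b r) (side-one iHi _ _ _ _ a b P∈ (λ ()) p r))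
    base P∈ jLo a b r p = xor-true (F a) (F b) (trans (F-values a b r) (side-one jLo _ _ _ _ a b P∈ (λ ()) p r))
    base P∈ jHi a b r p = xor-true (F a) (F b) (trans (F-values a b r) (side-one jHi _ _ _ _ a b P∈ (λ ()) p r))

    pieces : ∀ {P} → P ∈ Ps → FPiece F P
    pieces {dia a b} P∈ =
      trans eN (sym eW) , trans (flip-not eS) (sym (flip-not eW)) , flip-not eW
      where
      eW : F a ≡ not (F b)
      eW = xor-true (F a) (F b) (trans (F-values a b (liaG 2 (λ a b → walledDiaᵉ a b ⊢ onRᵉ a b) a b (walls P∈))) (dia-W a b P∈))
      eN : F (a + + 1) ≡ not (F b)
      eN = xor-true (F (a + + 1)) (F b) (trans (F-values (a + + 1) b (liaG 2 (λ a b → walledDiaᵉ a b ⊢ onRᵉ (a :+ # 1) b) a b (walls P∈))) (dia-N a b P∈))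
      eS : F a ≡ not (F (b + + 1))
      eS = xor-true (F a) (F (b + + 1)) (trans (F-values a (b + + 1) (liaG 2 (λ a b → walledDiaᵉ a b ⊢ onRᵉ a (b :+ # 1)) a b (walls P∈))) (dia-S a b P∈))
    pieces {blk i₀ i₁ j₀ j₁} P∈ = Unfold.block-piece F (profile-reflective vector vector-ker) i₀ i₁ j₀ j₁ (walls P∈) (base P∈)

    piece-nonconstant : ∀ {P} → FPiece F P → ∃ λ x → ∃ λ y → F x ≡ not (F y)
    piece-nonconstant {dia a b} (_ , _ , e) = b , a , e
    piece-nonconstant {blk i₀ i₁ j₀ j₁} (β , rI , _) =
      i₀ - + 1 , i₀ , trans (Run.before rI) (cong not (sym (Run.constant rI i₀ ℤP.≤-refl (Run.nonempty rI))))

    private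
      search : (∃ λ x → ∃ λ y → onFin vector x y ≡ true) ⊎ (∀ x y → onFin vector x y ≡ false)
      search with FinP.any? (λ x → FinP.any? (λ y → onFin vector x y 𝔹.≟ true))
      ... | yes (x , y , e) = inj₁ (x , y , e)
      ... | no h = inj₂ λ x y → 𝔹.¬-not λ e → h (x , y , e)

      F-zero : (∀ x y → onFin vector x y ≡ false) → ∀ i → F i ≡ false
      F-zero h i = onℤ-false (FoldX.fold (i + ε) - + 1) (FoldY.fold i - + 1)
        where
        onℤ-false : ∀ x y → onℤ vector x y ≡ false
        onℤ-false -[1+ _ ] y = refl
        onℤ-false (+ x) -[1+ _ ] = refl
        onℤ-false (+ x) (+ y) with x ℕ.<? m | y ℕ.<? n
        ... | yes p | yes q = h (Fin.fromℕ< p) (Fin.fromℕ< q)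
        ... | yes _ | no _ = refl
        ... | no _ | _ = refl

      point : ∀ x y → onFin vector x y ≡ true → NonZeroV vector
      point x y e = lem (colourFin x y ≟ᶜ c)
        where
        lem : Dec (colourFin x y ≡ c) → NonZeroV vector
        lem (yes h) = ((x , y) , h) , trans (sym (onFin-value vector x y h)) e
        lem (no h) = case trans (sym e) (onFin-zero vector x y h) of λ ()

    -- A vanishing vector would have a vanishing profile, but a single piece already forces the
    -- profile to take both values.
    vector-nonzero : ∀ {P} → P ∈ Ps → NonZeroV vector
    vector-nonzero P∈ with search
    ... | inj₁ (x , y , e) = point x y e
    ... | inj₂ z with piece-nonconstant (pieces P∈)
    ...   | x , y , e = case trans (sym (F-zero z x)) (trans e (cong not (F-zero z y))) of λ ()

  -- Recovering the points of a block from its part in R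

  module _ (i₀ i₁ j₀ j₁ : ℤ) (wB : Walled (blk i₀ i₁ j₀ j₁)) (P : Piece) (wP : Walled P)
    (to : ∀ q → Bits q → InR q → blk i₀ i₁ j₀ j₁ ∋ q → P ∋ q)
    (from : ∀ q → Bits q → InR q → P ∋ q → blk i₀ i₁ j₀ j₁ ∋ q)
    (i j : ℤ) (on : onR i j) (inB : Contains (blk i₀ i₁ j₀ j₁) i j) where

    private
      B : Piece
      B = blk i₀ i₁ j₀ j₁

      -1≢ : ∀ k → k - + 1 ≢ k
      -1≢ k e = lia 1 (λ k → k :- # 1 :≡ k ⊢ ⊥ᶠ) k e

    -- The faces (i - 1 , j - 1) and (i , j) have only the point (i , j) in common. Since I and J
    -- are intervals, a block that meets both faces contains this point, and no diamond covers quads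
    -- of both.
    opposite-faces : ∀ {hx hy hx′ hy′} → P ∋ quad (i - + 1) (j - + 1) hx hy → P ∋ quad i j hx′ hy′ → Contains P i j
    opposite-faces = go P
      where
      go : ∀ P {hx hy hx′ hy′} → P ∋ quad (i - + 1) (j - + 1) hx hy → P ∋ quad i j hx′ hy′ → Contains P i j
      go (dia a b) (e , _) (e′ , _) = -1≢ i (trans e (sym e′))
      go (blk a₀ a₁ b₀ b₁) (h₁ , _ , h₂ , _) (_ , h₃ , _ , h₄ , _) =
        lia 6 (λ a₀ a₁ b₀ b₁ i j → a₀ :- # 1 :≤ i :- # 1 :∧ b₀ :- # 1 :≤ j :- # 1 :∧ i :≤ a₁ :∧ j :≤ b₁ ⊢ containsᵉ a₀ a₁ b₀ b₁ i j)
          a₀ a₁ b₀ b₁ i j (h₁ , h₂ , h₃ , h₄)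

    opposite-faces′ : ∀ {hx hy hx′ hy′} → P ∋ quad (i - + 1) j hx hy → P ∋ quad i (j - + 1) hx′ hy′ → Contains P i j
    opposite-faces′ = go P
      where
      go : ∀ P {hx hy hx′ hy′} → P ∋ quad (i - + 1) j hx hy → P ∋ quad i (j - + 1) hx′ hy′ → Contains P i j
      go (dia a b) (e , _) (e′ , _) = -1≢ i (trans e (sym e′))
      go (blk a₀ a₁ b₀ b₁) (h₁ , _ , _ , h₂ , _) (_ , h₃ , h₄ , _) =
        lia 6 (λ a₀ a₁ b₀ b₁ i j → a₀ :- # 1 :≤ i :- # 1 :∧ j :≤ b₁ :∧ i :≤ a₁ :∧ b₀ :- # 1 :≤ j :- # 1 ⊢ containsᵉ a₀ a₁ b₀ b₁ i j)
          a₀ a₁ b₀ b₁ i j (h₁ , h₂ , h₃ , h₄)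

    -- The point has a face on its left and one on its right with quads in R. The upper quads are
    -- used, unless the point is on the top side of R.
    between-x : + 1 ≤ i + j + ε - + 1 → i + j + ε - + 1 ≤ + m - + 2 → Contains P i j
    between-x h h′ with i - j - + 1 ℤ.≤? + n - + 2
    ... | yes y =
      let (r₁ , r₂) = liaG 2 (λ i j → onRᵉ i j :∧ # 1 :≤ i :+ j :+ εᵉ :- # 1 :∧ i :+ j :+ εᵉ :- # 1 :≤ mᵉ :- # 2 :∧ i :- j :- # 1 :≤ nᵉ :- # 2 ⊢
            inRᵉ (i :- # 1) (j :- # 1) (# 1) (# 1) :∧ inRᵉ i j (# 0) (# 1)) i j (on , h , h′ , y)
      in opposite-faces (to (quad (i - + 1) (j - + 1) (+ 1) (+ 1)) (0≤1 , 1≤1 , 0≤1 , 1≤1) r₁ (around-E B i j (+ 1) 0≤1 1≤1 inB))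
                        (to (quad i j (+ 0) (+ 1)) (0≤0 , 0≤1 , 0≤1 , 1≤1) r₂ (around-W B i j (+ 1) 0≤1 1≤1 inB))
    ... | no y =
      let (r₁ , r₂) = liaG 2 (λ i j → onRᵉ i j :∧ # 1 :≤ i :+ j :+ εᵉ :- # 1 :∧ i :+ j :+ εᵉ :- # 1 :≤ mᵉ :- # 2 :∧ nᵉ :- # 2 :< i :- j :- # 1 ⊢
            inRᵉ (i :- # 1) (j :- # 1) (# 1) (# 0) :∧ inRᵉ i j (# 0) (# 0)) i j (on , h , h′ , ℤP.≰⇒> y)
      in opposite-faces (to (quad (i - + 1) (j - + 1) (+ 1) (+ 0)) (0≤1 , 1≤1 , 0≤0 , 0≤1) r₁ (around-E B i j (+ 0) 0≤0 0≤1 inB))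
                        (to (quad i j (+ 0) (+ 0)) (0≤0 , 0≤1 , 0≤0 , 0≤1) r₂ (around-W B i j (+ 0) 0≤0 0≤1 inB))

    between-y : + 1 ≤ i - j - + 1 → i - j - + 1 ≤ + n - + 2 → Contains P i j
    between-y h h′ with i + j + ε - + 1 ℤ.≤? + m - + 2
    ... | yes x =
      let (r₁ , r₂) = liaG 2 (λ i j → onRᵉ i j :∧ # 1 :≤ i :- j :- # 1 :∧ i :- j :- # 1 :≤ nᵉ :- # 2 :∧ i :+ j :+ εᵉ :- # 1 :≤ mᵉ :- # 2 ⊢
            inRᵉ (i :- # 1) j (# 1) (# 1) :∧ inRᵉ i (j :- # 1) (# 1) (# 0)) i j (on , h , h′ , x)
      in opposite-faces′ (to (quad (i - + 1) j (+ 1) (+ 1)) (0≤1 , 1≤1 , 0≤1 , 1≤1) r₁ (around-N B i j (+ 1) 0≤1 1≤1 inB))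
                         (to (quad i (j - + 1) (+ 1) (+ 0)) (0≤1 , 1≤1 , 0≤0 , 0≤1) r₂ (around-S B i j (+ 1) 0≤1 1≤1 inB))
    ... | no x =
      let (r₁ , r₂) = liaG 2 (λ i j → onRᵉ i j :∧ # 1 :≤ i :- j :- # 1 :∧ i :- j :- # 1 :≤ nᵉ :- # 2 :∧ mᵉ :- # 2 :< i :+ j :+ εᵉ :- # 1 ⊢
            inRᵉ (i :- # 1) j (# 0) (# 1) :∧ inRᵉ i (j :- # 1) (# 0) (# 0)) i j (on , h , h′ , ℤP.≰⇒> x)
      in opposite-faces′ (to (quad (i - + 1) j (+ 0) (+ 1)) (0≤0 , 0≤1 , 0≤1 , 1≤1) r₁ (around-N B i j (+ 0) 0≤0 0≤1 inB))
                         (to (quad i (j - + 1) (+ 0) (+ 0)) (0≤0 , 0≤1 , 0≤0 , 0≤1) r₂ (around-S B i j (+ 0) 0≤0 0≤1 inB))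

    private
      wallsOf : ∀ {i₀ i₁ j₀ j₁} → Walled (blk i₀ i₁ j₀ j₁) → (i₀ ≤ i₁ × j₀ ≤ j₁) × Bottom i₀ i₁ j₀ j₁ × Top i₀ i₁ j₀ j₁ × Left i₀ i₁ j₀ j₁ × Right i₀ i₁ j₀ j₁
      wallsOf (s₁ , s₂ , b , t , l , r) = (s₁ , s₂) , b , t , l , r

    -- At a corner of R the point is not determined by the cells around it: there a
    -- triangle has to be told apart from a square or hexagon filling the corner.
    corner-SW : i + j + ε - + 1 ≡ + 0 → i - j - + 1 ≡ + 0 → Contains P i j
    corner-SW ex ey with wallsOf wB
    ... | _ , bottom , top , left , right with left | bottom | right | top
    ...   | inj₁ w | _ | _ | _ = ⊥-elim (liaG 6 (λ i₀ i₁ j₀ j₁ i j → (i :+ j :+ εᵉ :- # 1 :≡ # 0 :∧ i :- j :- # 1 :≡ # 0) :∧ containsᵉ i₀ i₁ j₀ j₁ i j :∧ leftNᵉ i₀ i₁ j₀ j₁ ⊢ ⊥ᶠ) i₀ i₁ j₀ j₁ i j ((ex , ey) , inB , w))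
    ...   | inj₂ _ | inj₁ w | _ | _ = ⊥-elim (liaG 6 (λ i₀ i₁ j₀ j₁ i j → (i :+ j :+ εᵉ :- # 1 :≡ # 0 :∧ i :- j :- # 1 :≡ # 0) :∧ containsᵉ i₀ i₁ j₀ j₁ i j :∧ bottomNᵉ i₀ i₁ j₀ j₁ ⊢ ⊥ᶠ) i₀ i₁ j₀ j₁ i j ((ex , ey) , inB , w))
    ...   | inj₂ w | inj₂ _ | inj₂ w′ | _ = ⊥-elim (liaG 4 (λ i₀ i₁ j₀ j₁ → leftSᵉ i₀ i₁ j₀ j₁ :∧ rightSᵉ i₀ i₁ j₀ j₁ ⊢ ⊥ᶠ) i₀ i₁ j₀ j₁ (w , w′))
    ...   | inj₂ _ | inj₂ w | inj₁ _ | inj₂ w′ = ⊥-elim (liaG 4 (λ i₀ i₁ j₀ j₁ → bottomSᵉ i₀ i₁ j₀ j₁ :∧ topSᵉ i₀ i₁ j₀ j₁ ⊢ ⊥ᶠ) i₀ i₁ j₀ j₁ (w , w′))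
    ...   | inj₂ sh | inj₂ sv | inj₁ nh | inj₁ nv = go P refl
              (to (quad (i) (j) (+ 0) (+ 1)) (0≤0 , 0≤1 , 0≤1 , 1≤1) (proj₁ rs) (around-W B i j (+ 1) 0≤1 1≤1 inB))
              (to (quad (i) (j - + 1) (+ 1) (+ 0)) (0≤1 , 1≤1 , 0≤0 , 0≤1) (proj₂ rs) (around-S B i j (+ 1) 0≤1 1≤1 inB))
      where
      rs = liaG 2 (λ i j → i :+ j :+ εᵉ :- # 1 :≡ # 0 :∧ i :- j :- # 1 :≡ # 0 ⊢ inRᵉ (i) (j) (# 0) (# 1) :∧ inRᵉ (i) (j :- # 1) (# 1) (# 0)) i j (ex , ey)
      go : ∀ P′ → P ≡ P′ → P′ ∋ quad (i) (j) (+ 0) (+ 1) → P′ ∋ quad (i) (j - + 1) (+ 1) (+ 0) → Contains P′ i j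
      go (dia a b) e (e₁ , e₂) (e₃ , e₄) = lia 4 (λ a b i j → (i :≡ a :∧ j :≡ b) :∧ (i :≡ a :∧ j :- # 1 :≡ b) ⊢ ⊥ᶠ) a b i j ((e₁ , e₂) , e₃ , e₄)
      go (blk a₀ a₁ b₀ b₁) refl h₁ h₂ with a₀ ℤ.≤? i
      ... | yes p = lia 6 (λ a₀ a₁ b₀ b₁ i j → blkᵉ a₀ a₁ b₀ b₁ (i) (j) (# 0) (# 1) :∧ blkᵉ a₀ a₁ b₀ b₁ (i) (j :- # 1) (# 1) (# 0) :∧ a₀ :≤ i ⊢ containsᵉ a₀ a₁ b₀ b₁ i j) a₀ a₁ b₀ b₁ i j (h₁ , h₂ , p)
      ... | no p with wallsOf wP
      ...   | sz , bottom′ , top′ , left′ , right′ with left′ | bottom′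
      ...     | inj₂ w | _ = ⊥-elim (liaG 6 (λ a₀ a₁ b₀ b₁ i j → (i :+ j :+ εᵉ :- # 1 :≡ # 0 :∧ i :- j :- # 1 :≡ # 0) :∧ (blkᵉ a₀ a₁ b₀ b₁ (i) (j) (# 0) (# 1) :∧ blkᵉ a₀ a₁ b₀ b₁ (i) (j :- # 1) (# 1) (# 0)) :∧ i :< a₀ :∧ leftSᵉ a₀ a₁ b₀ b₁ ⊢ ⊥ᶠ) a₀ a₁ b₀ b₁ i j ((ex , ey) , (h₁ , h₂) , ℤP.≰⇒> p , w))
      ...     | inj₁ _ | inj₂ w = ⊥-elim (liaG 6 (λ a₀ a₁ b₀ b₁ i j → (i :+ j :+ εᵉ :- # 1 :≡ # 0 :∧ i :- j :- # 1 :≡ # 0) :∧ (blkᵉ a₀ a₁ b₀ b₁ (i) (j) (# 0) (# 1) :∧ blkᵉ a₀ a₁ b₀ b₁ (i) (j :- # 1) (# 1) (# 0)) :∧ i :< a₀ :∧ bottomSᵉ a₀ a₁ b₀ b₁ ⊢ ⊥ᶠ) a₀ a₁ b₀ b₁ i j ((ex , ey) , (h₁ , h₂) , ℤP.≰⇒> p , w))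
      -- Now `B` is a triangle, and `P` is a square or hexagon running from the corner along the
      -- diagonal. If `P` ends before the hypotenuse, the quad just behind its end belongs to `B`
      -- alone; otherwise the quad just behind the hypotenuse belongs to `P` alone.
      ...     | inj₁ w | inj₁ w′ with a₁ ℤ.≤? i₁
      ...       | yes cp = ⊥-elim (lia 6 (λ a₀ a₁ b₀ b₁ i j → (a₀ :≡ i :+ # 1 :∧ b₀ :≡ j :∧ b₁ :≡ j) :∧ blkᵉ a₀ a₁ b₀ b₁ (a₁) (j) (# 1) (# 0) ⊢ ⊥ᶠ) a₀ a₁ b₀ b₁ i j (facts , to (quad (a₁) (j) (+ 1) (+ 0)) (0≤1 , 1≤1 , 0≤0 , 0≤1) r k))
        where
        facts = liaG 6 (λ a₀ a₁ b₀ b₁ i j → (i :+ j :+ εᵉ :- # 1 :≡ # 0 :∧ i :- j :- # 1 :≡ # 0) :∧ (blkᵉ a₀ a₁ b₀ b₁ (i) (j) (# 0) (# 1) :∧ blkᵉ a₀ a₁ b₀ b₁ (i) (j :- # 1) (# 1) (# 0)) :∧ i :< a₀ :∧ leftNᵉ a₀ a₁ b₀ b₁ :∧ bottomNᵉ a₀ a₁ b₀ b₁ ⊢ a₀ :≡ i :+ # 1 :∧ b₀ :≡ j :∧ b₁ :≡ j) a₀ a₁ b₀ b₁ i j ((ex , ey) , (h₁ , h₂) , ℤP.≰⇒> p , w , w′)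
        rk = liaG 10 (λ i₀ i₁ j₀ j₁ a₀ a₁ b₀ b₁ i j → ((i :+ j :+ εᵉ :- # 1 :≡ # 0 :∧ i :- j :- # 1 :≡ # 0) :∧ containsᵉ i₀ i₁ j₀ j₁ i j) :∧ (leftSᵉ i₀ i₁ j₀ j₁ :∧ bottomSᵉ i₀ i₁ j₀ j₁ :∧ rightNᵉ i₀ i₁ j₀ j₁ :∧ topNᵉ i₀ i₁ j₀ j₁) :∧ (a₀ :≡ i :+ # 1 :∧ b₀ :≡ j :∧ b₁ :≡ j) :∧ (a₀ :≤ a₁ :∧ b₀ :≤ b₁) :∧ a₁ :≤ i₁ ⊢ inRᵉ (a₁) (j) (# 1) (# 0) :∧ blkᵉ i₀ i₁ j₀ j₁ (a₁) (j) (# 1) (# 0)) i₀ i₁ j₀ j₁ a₀ a₁ b₀ b₁ i j (((ex , ey) , inB) , (sh , sv , nh , nv) , facts , sz , cp)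
        r = proj₁ rk
        k = proj₂ rk
      ...       | no cp = ⊥-elim (lia 6 (λ i₀ i₁ j₀ j₁ i j → blkᵉ i₀ i₁ j₀ j₁ (i₁ :+ # 1) (j) (# 0) (# 0) ⊢ ⊥ᶠ) i₀ i₁ j₀ j₁ i j (from (quad (i₁ + + 1) (j) (+ 0) (+ 0)) (0≤0 , 0≤1 , 0≤0 , 0≤1) r k))
        where
        facts = liaG 6 (λ a₀ a₁ b₀ b₁ i j → (i :+ j :+ εᵉ :- # 1 :≡ # 0 :∧ i :- j :- # 1 :≡ # 0) :∧ (blkᵉ a₀ a₁ b₀ b₁ (i) (j) (# 0) (# 1) :∧ blkᵉ a₀ a₁ b₀ b₁ (i) (j :- # 1) (# 1) (# 0)) :∧ i :< a₀ :∧ leftNᵉ a₀ a₁ b₀ b₁ :∧ bottomNᵉ a₀ a₁ b₀ b₁ ⊢ a₀ :≡ i :+ # 1 :∧ b₀ :≡ j :∧ b₁ :≡ j) a₀ a₁ b₀ b₁ i j ((ex , ey) , (h₁ , h₂) , ℤP.≰⇒> p , w , w′)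
        rk = liaG 10 (λ i₀ i₁ j₀ j₁ a₀ a₁ b₀ b₁ i j → ((i :+ j :+ εᵉ :- # 1 :≡ # 0 :∧ i :- j :- # 1 :≡ # 0) :∧ containsᵉ i₀ i₁ j₀ j₁ i j) :∧ (leftSᵉ i₀ i₁ j₀ j₁ :∧ bottomSᵉ i₀ i₁ j₀ j₁ :∧ rightNᵉ i₀ i₁ j₀ j₁ :∧ topNᵉ i₀ i₁ j₀ j₁) :∧ (a₀ :≡ i :+ # 1 :∧ b₀ :≡ j :∧ b₁ :≡ j) :∧ (a₀ :≤ a₁ :∧ b₀ :≤ b₁) :∧ i₁ :< a₁ ⊢ inRᵉ (i₁ :+ # 1) (j) (# 0) (# 0) :∧ blkᵉ a₀ a₁ b₀ b₁ (i₁ :+ # 1) (j) (# 0) (# 0)) i₀ i₁ j₀ j₁ a₀ a₁ b₀ b₁ i j (((ex , ey) , inB) , (sh , sv , nh , nv) , facts , sz , ℤP.≰⇒> cp)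
        r = proj₁ rk
        k = proj₂ rk
    corner-SE : i + j + ε - + 1 ≡ + m - + 1 → i - j - + 1 ≡ + 0 → Contains P i j
    corner-SE ex ey with wallsOf wB
    ... | _ , bottom , top , left , right with right | bottom | left | top
    ...   | inj₁ w | _ | _ | _ = ⊥-elim (liaG 6 (λ i₀ i₁ j₀ j₁ i j → (i :+ j :+ εᵉ :- # 1 :≡ mᵉ :- # 1 :∧ i :- j :- # 1 :≡ # 0) :∧ containsᵉ i₀ i₁ j₀ j₁ i j :∧ rightNᵉ i₀ i₁ j₀ j₁ ⊢ ⊥ᶠ) i₀ i₁ j₀ j₁ i j ((ex , ey) , inB , w))
    ...   | inj₂ _ | inj₁ w | _ | _ = ⊥-elim (liaG 6 (λ i₀ i₁ j₀ j₁ i j → (i :+ j :+ εᵉ :- # 1 :≡ mᵉ :- # 1 :∧ i :- j :- # 1 :≡ # 0) :∧ containsᵉ i₀ i₁ j₀ j₁ i j :∧ bottomNᵉ i₀ i₁ j₀ j₁ ⊢ ⊥ᶠ) i₀ i₁ j₀ j₁ i j ((ex , ey) , inB , w))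
    ...   | inj₂ w | inj₂ _ | inj₂ w′ | _ = ⊥-elim (liaG 4 (λ i₀ i₁ j₀ j₁ → rightSᵉ i₀ i₁ j₀ j₁ :∧ leftSᵉ i₀ i₁ j₀ j₁ ⊢ ⊥ᶠ) i₀ i₁ j₀ j₁ (w , w′))
    ...   | inj₂ _ | inj₂ w | inj₁ _ | inj₂ w′ = ⊥-elim (liaG 4 (λ i₀ i₁ j₀ j₁ → bottomSᵉ i₀ i₁ j₀ j₁ :∧ topSᵉ i₀ i₁ j₀ j₁ ⊢ ⊥ᶠ) i₀ i₁ j₀ j₁ (w , w′))
    ...   | inj₂ sh | inj₂ sv | inj₁ nh | inj₁ nv = go P refl
              (to (quad (i - + 1) (j - + 1) (+ 1) (+ 1)) (0≤1 , 1≤1 , 0≤1 , 1≤1) (proj₁ rs) (around-E B i j (+ 1) 0≤1 1≤1 inB))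
              (to (quad (i) (j - + 1) (+ 0) (+ 0)) (0≤0 , 0≤1 , 0≤0 , 0≤1) (proj₂ rs) (around-S B i j (+ 0) 0≤0 0≤1 inB))
      where
      rs = liaG 2 (λ i j → i :+ j :+ εᵉ :- # 1 :≡ mᵉ :- # 1 :∧ i :- j :- # 1 :≡ # 0 ⊢ inRᵉ (i :- # 1) (j :- # 1) (# 1) (# 1) :∧ inRᵉ (i) (j :- # 1) (# 0) (# 0)) i j (ex , ey)
      go : ∀ P′ → P ≡ P′ → P′ ∋ quad (i - + 1) (j - + 1) (+ 1) (+ 1) → P′ ∋ quad (i) (j - + 1) (+ 0) (+ 0) → Contains P′ i j
      go (dia a b) e (e₁ , e₂) (e₃ , e₄) = lia 4 (λ a b i j → (i :- # 1 :≡ a :∧ j :- # 1 :≡ b) :∧ (i :≡ a :∧ j :- # 1 :≡ b) ⊢ ⊥ᶠ) a b i j ((e₁ , e₂) , e₃ , e₄)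
      go (blk a₀ a₁ b₀ b₁) refl h₁ h₂ with j ℤ.≤? b₁
      ... | yes p = lia 6 (λ a₀ a₁ b₀ b₁ i j → blkᵉ a₀ a₁ b₀ b₁ (i :- # 1) (j :- # 1) (# 1) (# 1) :∧ blkᵉ a₀ a₁ b₀ b₁ (i) (j :- # 1) (# 0) (# 0) :∧ j :≤ b₁ ⊢ containsᵉ a₀ a₁ b₀ b₁ i j) a₀ a₁ b₀ b₁ i j (h₁ , h₂ , p)
      ... | no p with wallsOf wP
      ...   | sz , bottom′ , top′ , left′ , right′ with right′ | bottom′
      ...     | inj₂ w | _ = ⊥-elim (liaG 6 (λ a₀ a₁ b₀ b₁ i j → (i :+ j :+ εᵉ :- # 1 :≡ mᵉ :- # 1 :∧ i :- j :- # 1 :≡ # 0) :∧ (blkᵉ a₀ a₁ b₀ b₁ (i :- # 1) (j :- # 1) (# 1) (# 1) :∧ blkᵉ a₀ a₁ b₀ b₁ (i) (j :- # 1) (# 0) (# 0)) :∧ b₁ :< j :∧ rightSᵉ a₀ a₁ b₀ b₁ ⊢ ⊥ᶠ) a₀ a₁ b₀ b₁ i j ((ex , ey) , (h₁ , h₂) , ℤP.≰⇒> p , w))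
      ...     | inj₁ _ | inj₂ w = ⊥-elim (liaG 6 (λ a₀ a₁ b₀ b₁ i j → (i :+ j :+ εᵉ :- # 1 :≡ mᵉ :- # 1 :∧ i :- j :- # 1 :≡ # 0) :∧ (blkᵉ a₀ a₁ b₀ b₁ (i :- # 1) (j :- # 1) (# 1) (# 1) :∧ blkᵉ a₀ a₁ b₀ b₁ (i) (j :- # 1) (# 0) (# 0)) :∧ b₁ :< j :∧ bottomSᵉ a₀ a₁ b₀ b₁ ⊢ ⊥ᶠ) a₀ a₁ b₀ b₁ i j ((ex , ey) , (h₁ , h₂) , ℤP.≰⇒> p , w))
      ...     | inj₁ w | inj₁ w′ with j₀ ℤ.≤? b₀
      ...       | yes cp = ⊥-elim (lia 6 (λ a₀ a₁ b₀ b₁ i j → (b₁ :≡ j :- # 1 :∧ a₀ :≡ i :∧ a₁ :≡ i) :∧ blkᵉ a₀ a₁ b₀ b₁ (i :- # 1) (b₀ :- # 1) (# 0) (# 0) ⊢ ⊥ᶠ) a₀ a₁ b₀ b₁ i j (facts , to (quad (i - + 1) (b₀ - + 1) (+ 0) (+ 0)) (0≤0 , 0≤1 , 0≤0 , 0≤1) r k))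
        where
        facts = liaG 6 (λ a₀ a₁ b₀ b₁ i j → (i :+ j :+ εᵉ :- # 1 :≡ mᵉ :- # 1 :∧ i :- j :- # 1 :≡ # 0) :∧ (blkᵉ a₀ a₁ b₀ b₁ (i :- # 1) (j :- # 1) (# 1) (# 1) :∧ blkᵉ a₀ a₁ b₀ b₁ (i) (j :- # 1) (# 0) (# 0)) :∧ b₁ :< j :∧ rightNᵉ a₀ a₁ b₀ b₁ :∧ bottomNᵉ a₀ a₁ b₀ b₁ ⊢ b₁ :≡ j :- # 1 :∧ a₀ :≡ i :∧ a₁ :≡ i) a₀ a₁ b₀ b₁ i j ((ex , ey) , (h₁ , h₂) , ℤP.≰⇒> p , w , w′)
        rk = liaG 10 (λ i₀ i₁ j₀ j₁ a₀ a₁ b₀ b₁ i j → ((i :+ j :+ εᵉ :- # 1 :≡ mᵉ :- # 1 :∧ i :- j :- # 1 :≡ # 0) :∧ containsᵉ i₀ i₁ j₀ j₁ i j) :∧ (rightSᵉ i₀ i₁ j₀ j₁ :∧ bottomSᵉ i₀ i₁ j₀ j₁ :∧ leftNᵉ i₀ i₁ j₀ j₁ :∧ topNᵉ i₀ i₁ j₀ j₁) :∧ (b₁ :≡ j :- # 1 :∧ a₀ :≡ i :∧ a₁ :≡ i) :∧ (a₀ :≤ a₁ :∧ b₀ :≤ b₁) :∧ j₀ :≤ b₀ ⊢ inRᵉ (i :- # 1) (b₀ :- # 1) (# 0) (# 0) :∧ blkᵉ i₀ i₁ j₀ j₁ (i :- # 1) (b₀ :- # 1) (# 0) (# 0)) i₀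 i₁ j₀ j₁ a₀ a₁ b₀ b₁ i j (((ex , ey) , inB) , (sh , sv , nh , nv) , facts , sz , cp)
        r = proj₁ rk
        k = proj₂ rk
      ...       | no cp = ⊥-elim (lia 6 (λ i₀ i₁ j₀ j₁ i j → blkᵉ i₀ i₁ j₀ j₁ (i :- # 1) (j₀ :- # 2) (# 1) (# 0) ⊢ ⊥ᶠ) i₀ i₁ j₀ j₁ i j (from (quad (i - + 1) (j₀ - + 2) (+ 1) (+ 0)) (0≤1 , 1≤1 , 0≤0 , 0≤1) r k))
        where
        facts = liaG 6 (λ a₀ a₁ b₀ b₁ i j → (i :+ j :+ εᵉ :- # 1 :≡ mᵉ :- # 1 :∧ i :- j :- # 1 :≡ # 0) :∧ (blkᵉ a₀ a₁ b₀ b₁ (i :- # 1) (j :- # 1) (# 1) (# 1) :∧ blkᵉ a₀ a₁ b₀ b₁ (i) (j :- # 1) (# 0) (# 0)) :∧ b₁ :< j :∧ rightNᵉ a₀ a₁ b₀ b₁ :∧ bottomNᵉ a₀ a₁ b₀ b₁ ⊢ b₁ :≡ j :- # 1 :∧ a₀ :≡ i :∧ a₁ :≡ i) a₀ a₁ b₀ b₁ i j ((ex , ey) , (h₁ , h₂) , ℤP.≰⇒> p , w , w′)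
        rk = liaG 10 (λ i₀ i₁ j₀ j₁ a₀ a₁ b₀ b₁ i j → ((i :+ j :+ εᵉ :- # 1 :≡ mᵉ :- # 1 :∧ i :- j :- # 1 :≡ # 0) :∧ containsᵉ i₀ i₁ j₀ j₁ i j) :∧ (rightSᵉ i₀ i₁ j₀ j₁ :∧ bottomSᵉ i₀ i₁ j₀ j₁ :∧ leftNᵉ i₀ i₁ j₀ j₁ :∧ topNᵉ i₀ i₁ j₀ j₁) :∧ (b₁ :≡ j :- # 1 :∧ a₀ :≡ i :∧ a₁ :≡ i) :∧ (a₀ :≤ a₁ :∧ b₀ :≤ b₁) :∧ b₀ :< j₀ ⊢ inRᵉ (i :- # 1) (j₀ :- # 2) (# 1) (# 0) :∧ blkᵉ a₀ a₁ b₀ b₁ (i :- # 1) (j₀ :- # 2) (# 1) (# 0)) i₀ i₁ j₀ j₁ a₀ a₁ b₀ b₁ i j (((ex , ey) , inB) , (sh , sv , nh , nv) , facts , sz , ℤP.≰⇒> cp)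
        r = proj₁ rk
        k = proj₂ rk
    corner-NW : i + j + ε - + 1 ≡ + 0 → i - j - + 1 ≡ + n - + 1 → Contains P i j
    corner-NW ex ey with wallsOf wB
    ... | _ , bottom , top , left , right with left | top | right | bottom
    ...   | inj₁ w | _ | _ | _ = ⊥-elim (liaG 6 (λ i₀ i₁ j₀ j₁ i j → (i :+ j :+ εᵉ :- # 1 :≡ # 0 :∧ i :- j :- # 1 :≡ nᵉ :- # 1) :∧ containsᵉ i₀ i₁ j₀ j₁ i j :∧ leftNᵉ i₀ i₁ j₀ j₁ ⊢ ⊥ᶠ) i₀ i₁ j₀ j₁ i j ((ex , ey) , inB , w))
    ...   | inj₂ _ | inj₁ w | _ | _ = ⊥-elim (liaG 6 (λ i₀ i₁ j₀ j₁ i j → (i :+ j :+ εᵉ :- # 1 :≡ # 0 :∧ i :- j :- # 1 :≡ nᵉ :- # 1) :∧ containsᵉ i₀ i₁ j₀ j₁ i j :∧ topNᵉ i₀ i₁ j₀ j₁ ⊢ ⊥ᶠ) i₀ i₁ j₀ j₁ i j ((ex , ey) , inB , w))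
    ...   | inj₂ w | inj₂ _ | inj₂ w′ | _ = ⊥-elim (liaG 4 (λ i₀ i₁ j₀ j₁ → leftSᵉ i₀ i₁ j₀ j₁ :∧ rightSᵉ i₀ i₁ j₀ j₁ ⊢ ⊥ᶠ) i₀ i₁ j₀ j₁ (w , w′))
    ...   | inj₂ _ | inj₂ w | inj₁ _ | inj₂ w′ = ⊥-elim (liaG 4 (λ i₀ i₁ j₀ j₁ → topSᵉ i₀ i₁ j₀ j₁ :∧ bottomSᵉ i₀ i₁ j₀ j₁ ⊢ ⊥ᶠ) i₀ i₁ j₀ j₁ (w , w′))
    ...   | inj₂ sh | inj₂ sv | inj₁ nh | inj₁ nv = go P refl
              (to (quad (i) (j) (+ 0) (+ 0)) (0≤0 , 0≤1 , 0≤0 , 0≤1) (proj₁ rs) (around-W B i j (+ 0) 0≤0 0≤1 inB))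
              (to (quad (i - + 1) (j) (+ 1) (+ 1)) (0≤1 , 1≤1 , 0≤1 , 1≤1) (proj₂ rs) (around-N B i j (+ 1) 0≤1 1≤1 inB))
      where
      rs = liaG 2 (λ i j → i :+ j :+ εᵉ :- # 1 :≡ # 0 :∧ i :- j :- # 1 :≡ nᵉ :- # 1 ⊢ inRᵉ (i) (j) (# 0) (# 0) :∧ inRᵉ (i :- # 1) (j) (# 1) (# 1)) i j (ex , ey)
      go : ∀ P′ → P ≡ P′ → P′ ∋ quad (i) (j) (+ 0) (+ 0) → P′ ∋ quad (i - + 1) (j) (+ 1) (+ 1) → Contains P′ i j
      go (dia a b) e (e₁ , e₂) (e₃ , e₄) = lia 4 (λ a b i j → (i :≡ a :∧ j :≡ b) :∧ (i :- # 1 :≡ a :∧ j :≡ b) ⊢ ⊥ᶠ) a b i j ((e₁ , e₂) , e₃ , e₄)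
      go (blk a₀ a₁ b₀ b₁) refl h₁ h₂ with b₀ ℤ.≤? j
      ... | yes p = lia 6 (λ a₀ a₁ b₀ b₁ i j → blkᵉ a₀ a₁ b₀ b₁ (i) (j) (# 0) (# 0) :∧ blkᵉ a₀ a₁ b₀ b₁ (i :- # 1) (j) (# 1) (# 1) :∧ b₀ :≤ j ⊢ containsᵉ a₀ a₁ b₀ b₁ i j) a₀ a₁ b₀ b₁ i j (h₁ , h₂ , p)
      ... | no p with wallsOf wP
      ...   | sz , bottom′ , top′ , left′ , right′ with left′ | top′
      ...     | inj₂ w | _ = ⊥-elim (liaG 6 (λ a₀ a₁ b₀ b₁ i j → (i :+ j :+ εᵉ :- # 1 :≡ # 0 :∧ i :- j :- # 1 :≡ nᵉ :- # 1) :∧ (blkᵉ a₀ a₁ b₀ b₁ (i) (j) (# 0) (# 0) :∧ blkᵉ a₀ a₁ b₀ b₁ (i :- # 1) (j) (# 1) (# 1)) :∧ j :< b₀ :∧ leftSᵉ a₀ a₁ b₀ b₁ ⊢ ⊥ᶠ) a₀ a₁ b₀ b₁ i j ((ex , ey) , (h₁ , h₂) , ℤP.≰⇒> p , w))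
      ...     | inj₁ _ | inj₂ w = ⊥-elim (liaG 6 (λ a₀ a₁ b₀ b₁ i j → (i :+ j :+ εᵉ :- # 1 :≡ # 0 :∧ i :- j :- # 1 :≡ nᵉ :- # 1) :∧ (blkᵉ a₀ a₁ b₀ b₁ (i) (j) (# 0) (# 0) :∧ blkᵉ a₀ a₁ b₀ b₁ (i :- # 1) (j) (# 1) (# 1)) :∧ j :< b₀ :∧ topSᵉ a₀ a₁ b₀ b₁ ⊢ ⊥ᶠ) a₀ a₁ b₀ b₁ i j ((ex , ey) , (h₁ , h₂) , ℤP.≰⇒> p , w))
      ...     | inj₁ w | inj₁ w′ with b₁ ℤ.≤? j₁
      ...       | yes cp = ⊥-elim (lia 6 (λ a₀ a₁ b₀ b₁ i j → (b₀ :≡ j :+ # 1 :∧ a₀ :≡ i :∧ a₁ :≡ i) :∧ blkᵉ a₀ a₁ b₀ b₁ (i) (b₁) (# 1) (# 1) ⊢ ⊥ᶠ) a₀ a₁ b₀ b₁ i j (facts , to (quad (i) (b₁) (+ 1) (+ 1)) (0≤1 , 1≤1 , 0≤1 , 1≤1) r k))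
        where
        facts = liaG 6 (λ a₀ a₁ b₀ b₁ i j → (i :+ j :+ εᵉ :- # 1 :≡ # 0 :∧ i :- j :- # 1 :≡ nᵉ :- # 1) :∧ (blkᵉ a₀ a₁ b₀ b₁ (i) (j) (# 0) (# 0) :∧ blkᵉ a₀ a₁ b₀ b₁ (i :- # 1) (j) (# 1) (# 1)) :∧ j :< b₀ :∧ leftNᵉ a₀ a₁ b₀ b₁ :∧ topNᵉ a₀ a₁ b₀ b₁ ⊢ b₀ :≡ j :+ # 1 :∧ a₀ :≡ i :∧ a₁ :≡ i) a₀ a₁ b₀ b₁ i j ((ex , ey) , (h₁ , h₂) , ℤP.≰⇒> p , w , w′)
        rk = liaG 10 (λ i₀ i₁ j₀ j₁ a₀ a₁ b₀ b₁ i j → ((i :+ j :+ εᵉ :- # 1 :≡ # 0 :∧ i :- j :- # 1 :≡ nᵉ :- # 1) :∧ containsᵉ i₀ i₁ j₀ j₁ i j) :∧ (leftSᵉ i₀ i₁ j₀ j₁ :∧ topSᵉ i₀ i₁ j₀ j₁ :∧ rightNᵉ i₀ i₁ j₀ j₁ :∧ bottomNᵉ i₀ i₁ j₀ j₁) :∧ (b₀ :≡ j :+ # 1 :∧ a₀ :≡ i :∧ a₁ :≡ i) :∧ (a₀ :≤ a₁ :∧ b₀ :≤ b₁) :∧ b₁ :≤ j₁ ⊢ inRᵉ (i) (b₁) (# 1) (# 1) :∧ blkᵉ i₀ i₁ j₀ j₁ (i) (b₁) (# 1) (# 1)) i₀ i₁ j₀ j₁ a₀ a₁ b₀ b₁ i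 j (((ex , ey) , inB) , (sh , sv , nh , nv) , facts , sz , cp)
        r = proj₁ rk
        k = proj₂ rk
      ...       | no cp = ⊥-elim (lia 6 (λ i₀ i₁ j₀ j₁ i j → blkᵉ i₀ i₁ j₀ j₁ (i) (j₁ :+ # 1) (# 0) (# 1) ⊢ ⊥ᶠ) i₀ i₁ j₀ j₁ i j (from (quad (i) (j₁ + + 1) (+ 0) (+ 1)) (0≤0 , 0≤1 , 0≤1 , 1≤1) r k))
        where
        facts = liaG 6 (λ a₀ a₁ b₀ b₁ i j → (i :+ j :+ εᵉ :- # 1 :≡ # 0 :∧ i :- j :- # 1 :≡ nᵉ :- # 1) :∧ (blkᵉ a₀ a₁ b₀ b₁ (i) (j) (# 0) (# 0) :∧ blkᵉ a₀ a₁ b₀ b₁ (i :- # 1) (j) (# 1) (# 1)) :∧ j :< b₀ :∧ leftNᵉ a₀ a₁ b₀ b₁ :∧ topNᵉ a₀ a₁ b₀ b₁ ⊢ b₀ :≡ j :+ # 1 :∧ a₀ :≡ i :∧ a₁ :≡ i) a₀ a₁ b₀ b₁ i j ((ex , ey) , (h₁ , h₂) , ℤP.≰⇒> p , w , w′)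
        rk = liaG 10 (λ i₀ i₁ j₀ j₁ a₀ a₁ b₀ b₁ i j → ((i :+ j :+ εᵉ :- # 1 :≡ # 0 :∧ i :- j :- # 1 :≡ nᵉ :- # 1) :∧ containsᵉ i₀ i₁ j₀ j₁ i j) :∧ (leftSᵉ i₀ i₁ j₀ j₁ :∧ topSᵉ i₀ i₁ j₀ j₁ :∧ rightNᵉ i₀ i₁ j₀ j₁ :∧ bottomNᵉ i₀ i₁ j₀ j₁) :∧ (b₀ :≡ j :+ # 1 :∧ a₀ :≡ i :∧ a₁ :≡ i) :∧ (a₀ :≤ a₁ :∧ b₀ :≤ b₁) :∧ j₁ :< b₁ ⊢ inRᵉ (i) (j₁ :+ # 1) (# 0) (# 1) :∧ blkᵉ a₀ a₁ b₀ b₁ (i) (j₁ :+ # 1) (# 0) (# 1)) i₀ i₁ j₀ j₁ a₀ a₁ b₀ b₁ i j (((ex , ey) , inB) , (sh , sv , nh , nv) , facts , sz , ℤP.≰⇒> cp)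
        r = proj₁ rk
        k = proj₂ rk
    corner-NE : i + j + ε - + 1 ≡ + m - + 1 → i - j - + 1 ≡ + n - + 1 → Contains P i j
    corner-NE ex ey with wallsOf wB
    ... | _ , bottom , top , left , right with right | top | left | bottom
    ...   | inj₁ w | _ | _ | _ = ⊥-elim (liaG 6 (λ i₀ i₁ j₀ j₁ i j → (i :+ j :+ εᵉ :- # 1 :≡ mᵉ :- # 1 :∧ i :- j :- # 1 :≡ nᵉ :- # 1) :∧ containsᵉ i₀ i₁ j₀ j₁ i j :∧ rightNᵉ i₀ i₁ j₀ j₁ ⊢ ⊥ᶠ) i₀ i₁ j₀ j₁ i j ((ex , ey) , inB , w))
    ...   | inj₂ _ | inj₁ w | _ | _ = ⊥-elim (liaG 6 (λ i₀ i₁ j₀ j₁ i j → (i :+ j :+ εᵉ :- # 1 :≡ mᵉ :- # 1 :∧ i :- j :- # 1 :≡ nᵉ :- # 1) :∧ containsᵉ i₀ i₁ j₀ j₁ i j :∧ topNᵉ i₀ i₁ j₀ j₁ ⊢ ⊥ᶠ) i₀ i₁ j₀ j₁ i j ((ex , ey) , inB , w))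
    ...   | inj₂ w | inj₂ _ | inj₂ w′ | _ = ⊥-elim (liaG 4 (λ i₀ i₁ j₀ j₁ → rightSᵉ i₀ i₁ j₀ j₁ :∧ leftSᵉ i₀ i₁ j₀ j₁ ⊢ ⊥ᶠ) i₀ i₁ j₀ j₁ (w , w′))
    ...   | inj₂ _ | inj₂ w | inj₁ _ | inj₂ w′ = ⊥-elim (liaG 4 (λ i₀ i₁ j₀ j₁ → topSᵉ i₀ i₁ j₀ j₁ :∧ bottomSᵉ i₀ i₁ j₀ j₁ ⊢ ⊥ᶠ) i₀ i₁ j₀ j₁ (w , w′))
    ...   | inj₂ sh | inj₂ sv | inj₁ nh | inj₁ nv = go P refl
              (to (quad (i - + 1) (j - + 1) (+ 1) (+ 0)) (0≤1 , 1≤1 , 0≤0 , 0≤1) (proj₁ rs) (around-E B i j (+ 0) 0≤0 0≤1 inB))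
              (to (quad (i - + 1) (j) (+ 0) (+ 1)) (0≤0 , 0≤1 , 0≤1 , 1≤1) (proj₂ rs) (around-N B i j (+ 0) 0≤0 0≤1 inB))
      where
      rs = liaG 2 (λ i j → i :+ j :+ εᵉ :- # 1 :≡ mᵉ :- # 1 :∧ i :- j :- # 1 :≡ nᵉ :- # 1 ⊢ inRᵉ (i :- # 1) (j :- # 1) (# 1) (# 0) :∧ inRᵉ (i :- # 1) (j) (# 0) (# 1)) i j (ex , ey)
      go : ∀ P′ → P ≡ P′ → P′ ∋ quad (i - + 1) (j - + 1) (+ 1) (+ 0) → P′ ∋ quad (i - + 1) (j) (+ 0) (+ 1) → Contains P′ i j
      go (dia a b) e (e₁ , e₂) (e₃ , e₄) = lia 4 (λ a b i j → (i :- # 1 :≡ a :∧ j :- # 1 :≡ b) :∧ (i :- # 1 :≡ a :∧ j :≡ b) ⊢ ⊥ᶠ) a b i j ((e₁ , e₂) , e₃ , e₄)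
      go (blk a₀ a₁ b₀ b₁) refl h₁ h₂ with i ℤ.≤? a₁
      ... | yes p = lia 6 (λ a₀ a₁ b₀ b₁ i j → blkᵉ a₀ a₁ b₀ b₁ (i :- # 1) (j :- # 1) (# 1) (# 0) :∧ blkᵉ a₀ a₁ b₀ b₁ (i :- # 1) (j) (# 0) (# 1) :∧ i :≤ a₁ ⊢ containsᵉ a₀ a₁ b₀ b₁ i j) a₀ a₁ b₀ b₁ i j (h₁ , h₂ , p)
      ... | no p with wallsOf wP
      ...   | sz , bottom′ , top′ , left′ , right′ with right′ | top′
      ...     | inj₂ w | _ = ⊥-elim (liaG 6 (λ a₀ a₁ b₀ b₁ i j → (i :+ j :+ εᵉ :- # 1 :≡ mᵉ :- # 1 :∧ i :- j :- # 1 :≡ nᵉ :- # 1) :∧ (blkᵉ a₀ a₁ b₀ b₁ (i :- # 1) (j :- # 1) (# 1) (# 0) :∧ blkᵉ a₀ a₁ b₀ b₁ (i :- # 1) (j) (# 0) (# 1)) :∧ a₁ :< i :∧ rightSᵉ a₀ a₁ b₀ b₁ ⊢ ⊥ᶠ) a₀ a₁ b₀ b₁ i j ((ex , ey) , (h₁ , h₂) , ℤP.≰⇒> p , w))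
      ...     | inj₁ _ | inj₂ w = ⊥-elim (liaG 6 (λ a₀ a₁ b₀ b₁ i j → (i :+ j :+ εᵉ :- # 1 :≡ mᵉ :- # 1 :∧ i :- j :- # 1 :≡ nᵉ :- # 1) :∧ (blkᵉ a₀ a₁ b₀ b₁ (i :- # 1) (j :- # 1) (# 1) (# 0) :∧ blkᵉ a₀ a₁ b₀ b₁ (i :- # 1) (j) (# 0) (# 1)) :∧ a₁ :< i :∧ topSᵉ a₀ a₁ b₀ b₁ ⊢ ⊥ᶠ) a₀ a₁ b₀ b₁ i j ((ex , ey) , (h₁ , h₂) , ℤP.≰⇒> p , w))
      ...     | inj₁ w | inj₁ w′ with i₀ ℤ.≤? a₀
      ...       | yes cp = ⊥-elim (lia 6 (λ a₀ a₁ b₀ b₁ i j → (a₁ :≡ i :- # 1 :∧ b₀ :≡ j :∧ b₁ :≡ j) :∧ blkᵉ a₀ a₁ b₀ b₁ (a₀ :- # 1) (j :- # 1) (# 0) (# 1) ⊢ ⊥ᶠ) a₀ a₁ b₀ b₁ i j (facts , to (quad (a₀ - + 1) (j - + 1) (+ 0) (+ 1)) (0≤0 , 0≤1 , 0≤1 , 1≤1) r k))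
        where
        facts = liaG 6 (λ a₀ a₁ b₀ b₁ i j → (i :+ j :+ εᵉ :- # 1 :≡ mᵉ :- # 1 :∧ i :- j :- # 1 :≡ nᵉ :- # 1) :∧ (blkᵉ a₀ a₁ b₀ b₁ (i :- # 1) (j :- # 1) (# 1) (# 0) :∧ blkᵉ a₀ a₁ b₀ b₁ (i :- # 1) (j) (# 0) (# 1)) :∧ a₁ :< i :∧ rightNᵉ a₀ a₁ b₀ b₁ :∧ topNᵉ a₀ a₁ b₀ b₁ ⊢ a₁ :≡ i :- # 1 :∧ b₀ :≡ j :∧ b₁ :≡ j) a₀ a₁ b₀ b₁ i j ((ex , ey) , (h₁ , h₂) , ℤP.≰⇒> p , w , w′)
        rk = liaG 10 (λ i₀ i₁ j₀ j₁ a₀ a₁ b₀ b₁ i j → ((i :+ j :+ εᵉ :- # 1 :≡ mᵉ :- # 1 :∧ i :- j :- # 1 :≡ nᵉ :- # 1) :∧ containsᵉ i₀ i₁ j₀ j₁ i j) :∧ (rightSᵉ i₀ i₁ j₀ j₁ :∧ topSᵉ i₀ i₁ j₀ j₁ :∧ leftNᵉ i₀ i₁ j₀ j₁ :∧ bottomNᵉ i₀ i₁ j₀ j₁) :∧ (a₁ :≡ i :- # 1 :∧ b₀ :≡ j :∧ b₁ :≡ j) :∧ (a₀ :≤ a₁ :∧ b₀ :≤ b₁) :∧ i₀ :≤ a₀ ⊢ inRᵉ (a₀ :- # 1) (j :- # 1) (# 0) (# 1) :∧ blkᵉ i₀ i₁ j₀ j₁ (a₀ :- # 1) (j :- # 1)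 (# 0) (# 1)) i₀ i₁ j₀ j₁ a₀ a₁ b₀ b₁ i j (((ex , ey) , inB) , (sh , sv , nh , nv) , facts , sz , cp)
        r = proj₁ rk
        k = proj₂ rk
      ...       | no cp = ⊥-elim (lia 6 (λ i₀ i₁ j₀ j₁ i j → blkᵉ i₀ i₁ j₀ j₁ (i₀ :- # 2) (j :- # 1) (# 1) (# 1) ⊢ ⊥ᶠ) i₀ i₁ j₀ j₁ i j (from (quad (i₀ - + 2) (j - + 1) (+ 1) (+ 1)) (0≤1 , 1≤1 , 0≤1 , 1≤1) r k))
        where
        facts = liaG 6 (λ a₀ a₁ b₀ b₁ i j → (i :+ j :+ εᵉ :- # 1 :≡ mᵉ :- # 1 :∧ i :- j :- # 1 :≡ nᵉ :- # 1) :∧ (blkᵉ a₀ a₁ b₀ b₁ (i :- # 1) (j :- # 1) (# 1) (# 0) :∧ blkᵉ a₀ a₁ b₀ b₁ (i :- # 1) (j) (# 0) (# 1)) :∧ a₁ :< i :∧ rightNᵉ a₀ a₁ b₀ b₁ :∧ topNᵉ a₀ a₁ b₀ b₁ ⊢ a₁ :≡ i :- # 1 :∧ b₀ :≡ j :∧ b₁ :≡ j) a₀ a₁ b₀ b₁ i j ((ex , ey) , (h₁ , h₂) , ℤP.≰⇒> p , w , w′)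
        rk = liaG 10 (λ i₀ i₁ j₀ j₁ a₀ a₁ b₀ b₁ i j → ((i :+ j :+ εᵉ :- # 1 :≡ mᵉ :- # 1 :∧ i :- j :- # 1 :≡ nᵉ :- # 1) :∧ containsᵉ i₀ i₁ j₀ j₁ i j) :∧ (rightSᵉ i₀ i₁ j₀ j₁ :∧ topSᵉ i₀ i₁ j₀ j₁ :∧ leftNᵉ i₀ i₁ j₀ j₁ :∧ bottomNᵉ i₀ i₁ j₀ j₁) :∧ (a₁ :≡ i :- # 1 :∧ b₀ :≡ j :∧ b₁ :≡ j) :∧ (a₀ :≤ a₁ :∧ b₀ :≤ b₁) :∧ a₀ :< i₀ ⊢ inRᵉ (i₀ :- # 2) (j :- # 1) (# 1) (# 1) :∧ blkᵉ a₀ a₁ b₀ b₁ (i₀ :- # 2) (j :- # 1) (# 1) (# 1)) i₀ i₁ j₀ j₁ a₀ a₁ b₀ b₁ i j (((ex , ey) , inB) , (sh , sv , nh , nv) , facts , sz , ℤP.≰⇒> cp)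
        r = proj₁ rk
        k = proj₂ rk

    same-region : Contains P i j
    same-region with + 1 ℤ.≤? i + j + ε - + 1 | i + j + ε - + 1 ℤ.≤? + m - + 2 | + 1 ℤ.≤? i - j - + 1 | i - j - + 1 ℤ.≤? + n - + 2
    ... | yes x | yes x′ | _ | _ = between-x x x′
    ... | _ | _ | yes y | yes y′ = between-y y y′
    ... | no x | _ | no y | _ =
      let (ex , ey) = liaG 2 (λ i j → onRᵉ i j :∧ i :+ j :+ εᵉ :- # 1 :< # 1 :∧ i :- j :- # 1 :< # 1 ⊢ i :+ j :+ εᵉ :- # 1 :≡ # 0 :∧ i :- j :- # 1 :≡ # 0) i j (on , ℤP.≰⇒> x , ℤP.≰⇒> y) in corner-SW ex ey
    ... | yes _ | no x | no y | _ =
      let (ex , ey) = liaG 2 (λ i j → onRᵉ i j :∧ mᵉ :- # 2 :< i :+ j :+ εᵉ :- # 1 :∧ i :- j :- # 1 :< # 1 ⊢ i :+ j :+ εᵉ :- # 1 :≡ mᵉ :- # 1 :∧ i :- j :- # 1 :≡ # 0) i j (on , ℤP.≰⇒> x , ℤP.≰⇒> y) in corner-SE ex ey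
    ... | no x | _ | yes _ | no y =
      let (ex , ey) = liaG 2 (λ i j → onRᵉ i j :∧ i :+ j :+ εᵉ :- # 1 :< # 1 :∧ nᵉ :- # 2 :< i :- j :- # 1 ⊢ i :+ j :+ εᵉ :- # 1 :≡ # 0 :∧ i :- j :- # 1 :≡ nᵉ :- # 1) i j (on , ℤP.≰⇒> x , ℤP.≰⇒> y) in corner-NW ex ey
    ... | yes _ | no x | yes _ | no y =
      let (ex , ey) = liaG 2 (λ i j → onRᵉ i j :∧ mᵉ :- # 2 :< i :+ j :+ εᵉ :- # 1 :∧ nᵉ :- # 2 :< i :- j :- # 1 ⊢ i :+ j :+ εᵉ :- # 1 :≡ mᵉ :- # 1 :∧ i :- j :- # 1 :≡ nᵉ :- # 1) i j (on , ℤP.≰⇒> x , ℤP.≰⇒> y) in corner-NE ex ey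

  -- The bijection

  _≟ᴾ_ : (P P′ : Piece) → Dec (P ≡ P′)
  dia a b ≟ᴾ dia a′ b′ with a ℤ.≟ a′ | b ℤ.≟ b′
  ... | yes refl | yes refl = yes refl
  ... | no ne | _ = no λ { refl → ne refl }
  ... | yes _ | no ne = no λ { refl → ne refl }
  dia _ _ ≟ᴾ blk _ _ _ _ = no λ ()
  blk _ _ _ _ ≟ᴾ dia _ _ = no λ ()
  blk i₀ i₁ j₀ j₁ ≟ᴾ blk i₀′ i₁′ j₀′ j₁′ with i₀ ℤ.≟ i₀′ | i₁ ℤ.≟ i₁′ | j₀ ℤ.≟ j₀′ | j₁ ℤ.≟ j₁′
  ... | yes refl | yes refl | yes refl | yes refl = yes refl
  ... | no ne | _ | _ | _ = no λ { refl → ne refl }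
  ... | yes _ | no ne | _ | _ = no λ { refl → ne refl }
  ... | yes _ | yes _ | no ne | _ = no λ { refl → ne refl }
  ... | yes _ | yes _ | yes _ | no ne = no λ { refl → ne refl }

  run-cong : ∀ {F G : ℤ → Bool} {β a b} → (∀ k → F k ≡ G k) → Run F β a b → Run G β a b
  run-cong e r = record
    { nonempty = Run.nonempty r
    ; constant = λ k h h′ → trans (sym (e k)) (Run.constant r k h h′)
    ; before = trans (sym (e _)) (Run.before r)
    ; after = trans (sym (e _)) (Run.after r) }

  fpiece-cong : ∀ {F G : ℤ → Bool} → (∀ k → F k ≡ G k) → ∀ P → FPiece F P → FPiece G P
  fpiece-cong e (dia a b) (h₁ , h₂ , h₃) =
    trans (sym (e _)) (trans h₁ (e _)) , trans (sym (e _)) (trans h₂ (e _)) , trans (sym (e _)) (trans h₃ (cong not (e _)))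
  fpiece-cong e (blk _ _ _ _) (β , rI , rJ) = β , run-cong e rI , run-cong e rJ

  bool-⇔ : ∀ {a b : Bool} → (a ≡ true → b ≡ true) → (b ≡ true → a ≡ true) → a ≡ b
  bool-⇔ {false} {false} f g = refl
  bool-⇔ {false} {true} f g = g refl
  bool-⇔ {true} {false} f g = sym (f refl)
  bool-⇔ {true} {true} f g = refl

  rep-same : ∀ t t′ P → Rep t P → Rep t′ P → SameTile t t′
  rep-same t t′ P r r′ d =
    let (q , h) = quadOf d
        (f , g) = r d q h
        (f′ , g′) = r′ d q h
    in bool-⇔ (g′ ∘ f) (g ∘ f′)

  rep-quad : ∀ t P → Rep t P → ∀ d q → IsQuad d q → inTile t d ≡ true → P ∋ q
  rep-quad t P r d q h e = proj₁ (proj₁ (r d q h) e)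

  -- What makes a list of tiles the tiling of `F`. Two lists with this property have the same tiles:
  -- the `cell` of a tile is covered by some tile of the other list, and `piece-unique` identifies
  -- their pieces. This yields both that `Φ` respects pointwise equality and that it is surjective.
  record Shows (F : ℤ → Bool) (ts : List Tile) : Set where
    field
      piece : ∀ {t} → t ∈ ts → ∃ λ P → FPiece F P × Rep t P
      cell  : ∀ {t} → t ∈ ts → ∃ λ d → inR m n d ≡ true × inTile t d ≡ true
      tileAt : ∀ d → inR m n d ≡ true → ∃ λ t → t ∈ ts × inTile t d ≡ true

  shows-cong : ∀ {F G ts} → (∀ k → F k ≡ G k) → Shows F ts → Shows G ts
  shows-cong e s = record
    { piece = λ t∈ → let (P , f , r) = Shows.piece s t∈ in P , fpiece-cong e P f , r
    ; cell = Shows.cell s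
    ; tileAt = Shows.tileAt s }

  shows-matching : ∀ {F ts ts′} → Shows F ts → Shows F ts′ → ∀ {t} → t ∈ ts → ∃ λ t′ → t′ ∈ ts′ × SameTile t t′
  shows-matching s s′ {t} t∈ =
    let (P , f , r) = Shows.piece s t∈
        (d , dR , e) = Shows.cell s t∈
        (t′ , t′∈ , e′) = Shows.tileAt s′ d dR
        (P′ , f′ , r′) = Shows.piece s′ t′∈
        (q , h) = quadOf d
        P≡P′ = piece-unique P P′ q f f′ (rep-quad t P r d q h e) (rep-quad t′ P′ r′ d q h e′)
    in t′ , t′∈ , rep-same t t′ P r (subst (Rep t′) (sym P≡P′) r′)

  shows-same : ∀ {F ts ts′} → Shows F ts → Shows F ts′ → SameTiling ts ts′
  shows-same s s′ = shows-matching s s′ , λ t′∈ →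
    let (t , t∈ , e) = shows-matching s′ s t′∈ in t , t∈ , λ d → sym (e d)

  count-none : ∀ d ts → (∀ {t} → t ∈ ts → inTile t d ≡ false) → count d ts ≡ 0
  count-none d [] h = refl
  count-none d (t ∷ ts) h rewrite h (here refl) = count-none d ts (h ∘ there)

  count-some : ∀ d {t} ts → t ∈ ts → inTile t d ≡ true → 1 ℕ.≤ count d ts
  count-some d (t ∷ ts) (here refl) e rewrite e = ℕ.s≤s ℕ.z≤n
  count-some d (t ∷ ts) (there t∈) e = ℕP.≤-trans (count-some d ts t∈ e) (ℕP.m≤n+m _ _)

  count-find : ∀ d ts → 1 ℕ.≤ count d ts → ∃ λ t → t ∈ ts × inTile t d ≡ true
  count-find d (t ∷ ts) h with inTile t d in e
  ... | true = t , here refl , e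
  ... | false = let (t′ , t′∈ , e′) = count-find d ts h in t′ , there t′∈ , e′

  -- The tiling that belongs to a function F

  module Construct (F : ℤ → Bool) (reflective : Reflective F) (nonconstant : NonConstant F) where

    -- A tile with all the evidence gathered at the cell where it was found. Every entry proves its
    -- own properties, so they survive the removal of duplicates.
    record Entry : Set where
      field
        piece  : Piece
        fpiece : FPiece F piece
        tile   : Tile
        rep    : Rep tile piece
        colour : HasColour c tile
        dashed : All (SegInBoundary m n) (dashedSides tile)
        cell   : Cell
        cellR  : inR m n cell ≡ true
        cellIn : inTile tile cell ≡ true

    entry : ∀ d → inR m n d ≡ true → Entry
    entry d e =
      let (q , h) = quadOf d
          bs = quad-bits d q h
          r = proj₁ (inR-InR d q h) e
          (P , f , p) = cover reflective nonconstant q bs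
          (t , rep , col , dash) = realize P (walled reflective P q f bs p r)
      in record { piece = P ; fpiece = f ; tile = t ; rep = rep ; colour = col ; dashed = dash
                ; cell = d ; cellR = e ; cellIn = proj₂ (rep d q h) (p , r) }

    entriesAt : Cell → List Entry
    entriesAt d with inR m n d 𝔹.≟ true
    ... | yes e = entry d e ∷ []
    ... | no _ = []

    -- There are m n squares here but only (m - 1)(n - 1) in R; `entriesAt` discards the others.
    cells : List Cell
    cells = map (λ { (x , y , q) → + toℕ x , + toℕ y , q }) (cartesianProduct (allFin m) (cartesianProduct (allFin n) (allFin 4)))

    entries : List Entry
    entries = concatMap entriesAt cells

    cells-complete : ∀ d → inR m n d ≡ true → d ∈ cells
    cells-complete (x , y , q) e =
      let (e₁ , e′) = ∧-true e ; (e₂ , e″) = ∧-true e′ ; (e₃ , e₄) = ∧-true e″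
          (a , b , ex , ey) = fins (range x y (proj₁ (≤ᵇ-true _ _) e₁)
            (lia 2 (λ x m → x :+ # 2 :≤ m ⊢ x :< m) x (+ m) (proj₁ (≤ᵇ-true _ _) e₂)) (proj₁ (≤ᵇ-true _ _) e₃)
            (lia 2 (λ x m → x :+ # 2 :≤ m ⊢ x :< m) y (+ n) (proj₁ (≤ᵇ-true _ _) e₄)))
      in subst₂ (λ x y → (x , y , q) ∈ cells) (sym ex) (sym ey)
           (∈-map⁺ _ (∈-cartesianProduct⁺ (∈-allFin a) (∈-cartesianProduct⁺ (∈-allFin b) (∈-allFin q))))

    entriesAt-complete : ∀ d → inR m n d ≡ true → ∃ λ e → e ∈ entriesAt d × Entry.cell e ≡ d
    entriesAt-complete d h with inR m n d 𝔹.≟ true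
    ... | yes e = entry d e , here refl , refl
    ... | no ne = ⊥-elim (ne h)

    entries-complete : ∀ d → inR m n d ≡ true → ∃ λ e → e ∈ entries × Entry.cell e ≡ d
    entries-complete d h =
      let (e , e∈ , eq) = entriesAt-complete d h
      in e , ∈-concat⁺′ e∈ (∈-map⁺ entriesAt (cells-complete d h)) , eq

    SamePiece : Entry → Entry → Set
    SamePiece e e′ = Entry.piece e ≡ Entry.piece e′

    -- A piece turns up once for every cell of R that it covers. Pieces are compared instead of
    -- tiles because their equality is decidable through their indices, and equal pieces have tiles
    -- with the same cells.
    dedup : List Entry → List Entry
    dedup [] = []
    dedup (e ∷ es) with Any.any? (λ e′ → Entry.piece e ≟ᴾ Entry.piece e′) (dedup es)
    ... | yes _ = dedup es
    ... | no _ = e ∷ dedup es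

    dedup-distinct : ∀ es → AllPairs (λ e e′ → ¬ SamePiece e e′) (dedup es)
    dedup-distinct [] = []
    dedup-distinct (e ∷ es) with Any.any? (λ e′ → Entry.piece e ≟ᴾ Entry.piece e′) (dedup es)
    ... | yes _ = dedup-distinct es
    ... | no ne = All.tabulate (λ e′∈ eq → ne (lose e′∈ eq)) ∷ dedup-distinct es

    dedup-complete : ∀ {e} es → e ∈ es → Any (SamePiece e) (dedup es)
    dedup-complete (e ∷ es) (here refl) with Any.any? (λ e′ → Entry.piece e ≟ᴾ Entry.piece e′) (dedup es)
    ... | yes p = p
    ... | no _ = here refl
    dedup-complete (e ∷ es) (there e∈) with Any.any? (λ e′ → Entry.piece e ≟ᴾ Entry.piece e′) (dedup es)
    ... | yes _ = dedup-complete es e∈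
    ... | no _ = there (dedup-complete es e∈)

    final : List Entry
    final = dedup entries

    tiles : List Tile
    tiles = map Entry.tile final

    entry-in-R : ∀ e d → inTile (Entry.tile e) d ≡ true → inR m n d ≡ true
    entry-in-R e d h =
      let (q , hq) = quadOf d in proj₂ (inR-InR d q hq) (proj₂ (proj₁ (Entry.rep e d q hq) h))

    covering : ∀ d → inR m n d ≡ true → ∃ λ e → e ∈ final × inTile (Entry.tile e) d ≡ true
    covering d h =
      let (e , e∈ , eq) = entries-complete d h
          (e′ , e′∈ , same) = find (dedup-complete entries e∈)
          (q , hq) = quadOf d
          inT = subst (λ d → inTile (Entry.tile e) d ≡ true) eq (Entry.cellIn e)
      in e′ , e′∈ , proj₂ (Entry.rep e′ d q hq) (subst (λ P → P ∋ q × InR q) same (proj₁ (Entry.rep e d q hq) inT))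

    shared : ∀ e e′ d → inTile (Entry.tile e) d ≡ true → inTile (Entry.tile e′) d ≡ true → SamePiece e e′
    shared e e′ d h h′ =
      let (q , hq) = quadOf d
      in piece-unique (Entry.piece e) (Entry.piece e′) q (Entry.fpiece e) (Entry.fpiece e′)
           (rep-quad (Entry.tile e) (Entry.piece e) (Entry.rep e) d q hq h) (rep-quad (Entry.tile e′) (Entry.piece e′) (Entry.rep e′) d q hq h′)

    -- By `shared`, two entries covering the same cell have the same piece, which distinctness
    -- excludes.
    count-one : ∀ d es → AllPairs (λ e e′ → ¬ SamePiece e e′) es → ∀ {e} → e ∈ es → inTile (Entry.tile e) d ≡ true →
      count d (map Entry.tile es) ≡ 1
    count-one d (e ∷ es) (ne ∷ _) (here refl) h rewrite h = cong suc (count-none d (map Entry.tile es) λ t∈ → none (∈-map⁻ Entry.tile t∈))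
      where
      none : ∀ {t} → (∃ λ e′ → e′ ∈ es × t ≡ Entry.tile e′) → inTile t d ≡ false
      none (e′ , e′∈ , refl) = 𝔹.¬-not λ h′ → All.lookup ne e′∈ (shared e e′ d h h′)
    count-one d (e₀ ∷ es) (ne ∷ nes) {e} (there e∈) h with inTile (Entry.tile e₀) d in h₀
    ... | true = ⊥-elim (All.lookup ne e∈ (shared e₀ e d h₀ h))
    ... | false = count-one d es nes e∈ h

    counts : ∀ d → count d tiles ≡ (if inR m n d then 1 else 0)
    counts d with inR m n d in h
    ... | true = let (e , e∈ , hT) = covering d h in count-one d final (dedup-distinct entries) e∈ hT
    ... | false = count-none d tiles λ t∈ → none (∈-map⁻ Entry.tile t∈)
      where
      none : ∀ {t} → (∃ λ e → e ∈ final × t ≡ Entry.tile e) → inTile t d ≡ false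
      none (e , e∈ , refl) = 𝔹.¬-not λ h′ → case trans (sym h) (entry-in-R e d h′) of λ ()

    all-tiles : {Q : Tile → Set} → (∀ e → Q (Entry.tile e)) → ∀ es → All Q (map Entry.tile es)
    all-tiles f [] = []
    all-tiles f (e ∷ es) = f e ∷ all-tiles f es

    tiles-tiling : IsColTiling c m n tiles
    tiles-tiling = (counts , all-tiles Entry.dashed final) , all-tiles Entry.colour final

    tiles-show : Shows F tiles
    tiles-show = record
      { piece = λ t∈ → let (e , _ , eq) = ∈-map⁻ Entry.tile t∈ in
          Entry.piece e , Entry.fpiece e , subst (λ t → Rep t (Entry.piece e)) (sym eq) (Entry.rep e)
      ; cell = λ t∈ → let (e , _ , eq) = ∈-map⁻ Entry.tile t∈ in
          Entry.cell e , Entry.cellR e , subst (λ t → inTile t (Entry.cell e) ≡ true) (sym eq) (Entry.cellIn e)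
      ; tileAt = λ d h → let (e , e∈ , hT) = covering d h in Entry.tile e , ∈-map⁺ Entry.tile e∈ , hT }

  Φ : (v : Vector) → InKer c m n v → NonZeroV v → List Tile
  Φ v k z = Construct.tiles (profile v) (profile-reflective v k) (profile-nonconstant v k z)

  Φ-shows : ∀ v k z → Shows (profile v) (Φ v k z)
  Φ-shows v k z = Construct.tiles-show (profile v) (profile-reflective v k) (profile-nonconstant v k z)

  point-quad : ∀ P i j → Contains P i j → onR i j → ∃ λ q → Bits q × InR q × P ∋ q
  point-quad P i j h on with i + j + ε - + 1 ℤ.≤? + m - + 2 | i - j - + 1 ℤ.≤? + n - + 2
  ... | yes x | yes y = quad i j (+ 0) (+ 1) , (0≤0 , 0≤1 , 0≤1 , 1≤1) ,
    liaG 2 (λ i j → onRᵉ i j :∧ i :+ j :+ εᵉ :- # 1 :≤ mᵉ :- # 2 :∧ i :- j :- # 1 :≤ nᵉ :- # 2 ⊢ inRᵉ i j (# 0) (# 1)) i j (on , x , y) ,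
    around-W P i j (+ 1) 0≤1 1≤1 h
  ... | yes x | no y = quad i j (+ 0) (+ 0) , (0≤0 , 0≤1 , 0≤0 , 0≤1) ,
    liaG 2 (λ i j → onRᵉ i j :∧ i :+ j :+ εᵉ :- # 1 :≤ mᵉ :- # 2 :∧ nᵉ :- # 2 :< i :- j :- # 1 ⊢ inRᵉ i j (# 0) (# 0)) i j (on , x , ℤP.≰⇒> y) ,
    around-W P i j (+ 0) 0≤0 0≤1 h
  ... | no x | yes y = quad (i - + 1) (j - + 1) (+ 1) (+ 1) , (0≤1 , 1≤1 , 0≤1 , 1≤1) ,
    liaG 2 (λ i j → onRᵉ i j :∧ mᵉ :- # 2 :< i :+ j :+ εᵉ :- # 1 :∧ i :- j :- # 1 :≤ nᵉ :- # 2 ⊢ inRᵉ (i :- # 1) (j :- # 1) (# 1) (# 1)) i j (on , ℤP.≰⇒> x , y) ,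
    around-E P i j (+ 1) 0≤1 1≤1 h
  ... | no x | no y = quad (i - + 1) (j - + 1) (+ 1) (+ 0) , (0≤1 , 1≤1 , 0≤0 , 0≤1) ,
    liaG 2 (λ i j → onRᵉ i j :∧ mᵉ :- # 2 :< i :+ j :+ εᵉ :- # 1 :∧ nᵉ :- # 2 :< i :- j :- # 1 ⊢ inRᵉ (i :- # 1) (j :- # 1) (# 1) (# 0)) i j (on , ℤP.≰⇒> x , ℤP.≰⇒> y) ,
    around-E P i j (+ 0) 0≤0 0≤1 h

  contains-equal : ∀ {F : ℤ → Bool} P i j → FPiece F P → Contains P i j → F i ≡ F j
  contains-equal (blk i₀ i₁ j₀ j₁) i j (β , rI , rJ) ((h₁ , h₂) , h₃ , h₄) =
    trans (Run.constant rI i h₁ h₂) (sym (Run.constant rJ j h₃ h₄))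

  -- The zero belongs to a block `B` of v, and the tile of `B` occurs in the other tiling as the
  -- tile of some piece P′ of w. Both pieces have the same quads in R, so `same-region` puts the
  -- point into P′, and w vanishes there.
  zero-preserved : ∀ v k z w k′ z′ → SameTiling (Φ v k z) (Φ w k′ z′) → ∀ p → v p ≡ false → w p ≡ false
  zero-preserved v k z w k′ z′ same p vp =
    trans (vector-values w k′ p i j xy on) (trans (cong (_xor profile w j) (contains-equal P′ i j f′ result)) (𝔹.xor-same (profile w j)))
    where
    i j : ℤ
    i = proj₁ (coords p)
    j = proj₁ (proj₂ (coords p))
    xy = proj₁ (proj₂ (proj₂ (coords p)))
    on : onR i j
    on = proj₂ (proj₂ (proj₂ (coords p)))
    Rv = profile-reflective v k
    own : Owned Rv (profile-nonconstant v k z) i j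
    own = owner Rv (profile-nonconstant v k z) i j (xor-false (profile v i) (profile v j) (trans (sym (vector-values v k p i j xy on)) vp))
    i₀ i₁ j₀ j₁ : ℤ
    i₀ = proj₁ own
    i₁ = proj₁ (proj₂ own)
    j₀ = proj₁ (proj₂ (proj₂ own))
    j₁ = proj₁ (proj₂ (proj₂ (proj₂ own)))
    B : Piece
    B = blk i₀ i₁ j₀ j₁
    inB : Contains B i j
    inB = let (h₁ , h₂ , h₃ , h₄) = proj₁ (proj₂ (proj₂ (proj₂ (proj₂ own)))) in (h₁ , h₂) , h₃ , h₄
    fB : FPiece (profile v) B
    fB = profile v i , proj₂ (proj₂ (proj₂ (proj₂ (proj₂ own))))
    q = proj₁ (point-quad B i j inB on)
    bs : Bits q
    bs = proj₁ (proj₂ (point-quad B i j inB on))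
    qR : InR q
    qR = proj₁ (proj₂ (proj₂ (point-quad B i j inB on)))
    qB : B ∋ q
    qB = proj₂ (proj₂ (proj₂ (point-quad B i j inB on)))
    wB : Walled B
    wB = walled Rv B q fB bs qB qR
    d = proj₁ (cellOf q bs)
    hq : IsQuad d q
    hq = proj₂ (cellOf q bs)
    found = Shows.tileAt (Φ-shows v k z) d (proj₂ (inR-InR d q hq) qR)
    t = proj₁ found
    t∈ = proj₁ (proj₂ found)
    tp = Shows.piece (Φ-shows v k z) t∈
    tB : Rep t B
    tB = subst (Rep t) (piece-unique (proj₁ tp) B q (proj₁ (proj₂ tp)) fB
           (rep-quad t (proj₁ tp) (proj₂ (proj₂ tp)) d q hq (proj₂ (proj₂ found))) qB) (proj₂ (proj₂ tp))
    t′ = proj₁ (proj₁ same t∈)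
    tt′ : SameTile t t′
    tt′ = proj₂ (proj₂ (proj₁ same t∈))
    tp′ = Shows.piece (Φ-shows w k′ z′) (proj₁ (proj₂ (proj₁ same t∈)))
    P′ : Piece
    P′ = proj₁ tp′
    f′ : FPiece (profile w) P′
    f′ = proj₁ (proj₂ tp′)
    r′ : Rep t′ P′
    r′ = proj₂ (proj₂ tp′)
    to : ∀ q → Bits q → InR q → B ∋ q → P′ ∋ q
    to q bs r h = let (d , hq) = cellOf q bs in
      rep-quad t′ P′ r′ d q hq (trans (sym (tt′ d)) (proj₂ (tB d q hq) (h , r)))
    from : ∀ q → Bits q → InR q → P′ ∋ q → B ∋ q
    from q bs r h = let (d , hq) = cellOf q bs in
      rep-quad t B tB d q hq (trans (tt′ d) (proj₂ (r′ d q hq) (h , r)))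
    result : Contains P′ i j
    result = same-region i₀ i₁ j₀ j₁ wB P′ (walled (profile-reflective w k′) P′ q f′ bs (to q bs qR qB) qR) to from i j on inB

  same-sym : ∀ {ts ts′} → SameTiling ts ts′ → SameTiling ts′ ts
  same-sym (f , g) =
    (λ t∈ → let (t′ , t′∈ , e) = g t∈ in t′ , t′∈ , λ d → sym (e d)) ,
    (λ t∈ → let (t′ , t′∈ , e) = f t∈ in t′ , t′∈ , λ d → sym (e d))

  Φ-injective : ∀ v k z w k′ z′ → SameTiling (Φ v k z) (Φ w k′ z′) → v ≈ᵥ w
  Φ-injective v k z w k′ z′ same p =
    same-zeros (v p) (w p) (zero-preserved v k z w k′ z′ same p) (zero-preserved w k′ z′ v k z (same-sym same) p)
    where
    same-zeros : ∀ a b → (a ≡ false → b ≡ false) → (b ≡ false → a ≡ false) → a ≡ b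
    same-zeros false b f g = sym (f refl)
    same-zeros true false f g = g refl
    same-zeros true true f g = refl

  -- For a block with at most one axis an extreme quad of the octagon, away from the axis, will do.
  -- With two axes the quad at the corner of R is used; its indices depend on the colour of that
  -- corner and are therefore taken from `quadOf`.
  walled-quad : ∀ P → Walled P → ∃ λ q → Bits q × InR q × P ∋ q
  walled-quad (dia a b) w = quad a b (+ 0) (+ 0) , (0≤0 , 0≤1 , 0≤0 , 0≤1) ,
    liaG 2 (λ a b → walledDiaᵉ a b ⊢ inRᵉ a b (# 0) (# 0)) a b w , refl , refl
  walled-quad (blk i₀ i₁ j₀ j₁) (s₁ , s₂ , inj₁ b , inj₁ t , inj₁ l , inj₁ r) = quad (i₀ - + 1) (j₀ - + 1) (+ 1) (+ 0) , (0≤1 , 1≤1 , 0≤0 , 0≤1) ,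
    liaG 4 (λ i₀ i₁ j₀ j₁ → (i₀ :≤ i₁ :∧ j₀ :≤ j₁) :∧ bottomNᵉ i₀ i₁ j₀ j₁ :∧ topNᵉ i₀ i₁ j₀ j₁ :∧ leftNᵉ i₀ i₁ j₀ j₁ :∧ rightNᵉ i₀ i₁ j₀ j₁ ⊢ inRᵉ (i₀ :- # 1) (j₀ :- # 1) (# 1) (# 0) :∧ blkᵉ i₀ i₁ j₀ j₁ (i₀ :- # 1) (j₀ :- # 1) (# 1) (# 0)) i₀ i₁ j₀ j₁ ((s₁ , s₂) , b , t , l , r)
  walled-quad (blk i₀ i₁ j₀ j₁) (s₁ , s₂ , inj₂ b , inj₁ t , inj₁ l , inj₁ r) = quad (i₁) (j₀ - + 1) (+ 0) (+ 0) , (0≤0 , 0≤1 , 0≤0 , 0≤1) ,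
    liaG 4 (λ i₀ i₁ j₀ j₁ → (i₀ :≤ i₁ :∧ j₀ :≤ j₁) :∧ bottomSᵉ i₀ i₁ j₀ j₁ :∧ topNᵉ i₀ i₁ j₀ j₁ :∧ leftNᵉ i₀ i₁ j₀ j₁ :∧ rightNᵉ i₀ i₁ j₀ j₁ ⊢ inRᵉ (i₁) (j₀ :- # 1) (# 0) (# 0) :∧ blkᵉ i₀ i₁ j₀ j₁ (i₁) (j₀ :- # 1) (# 0) (# 0)) i₀ i₁ j₀ j₁ ((s₁ , s₂) , b , t , l , r)
  walled-quad (blk i₀ i₁ j₀ j₁) (s₁ , s₂ , inj₁ b , inj₁ t , inj₁ l , inj₂ r) = quad (i₀ - + 1) (j₀ - + 1) (+ 1) (+ 0) , (0≤1 , 1≤1 , 0≤0 , 0≤1) ,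
    liaG 4 (λ i₀ i₁ j₀ j₁ → (i₀ :≤ i₁ :∧ j₀ :≤ j₁) :∧ bottomNᵉ i₀ i₁ j₀ j₁ :∧ topNᵉ i₀ i₁ j₀ j₁ :∧ leftNᵉ i₀ i₁ j₀ j₁ :∧ rightSᵉ i₀ i₁ j₀ j₁ ⊢ inRᵉ (i₀ :- # 1) (j₀ :- # 1) (# 1) (# 0) :∧ blkᵉ i₀ i₁ j₀ j₁ (i₀ :- # 1) (j₀ :- # 1) (# 1) (# 0)) i₀ i₁ j₀ j₁ ((s₁ , s₂) , b , t , l , r)
  walled-quad (blk i₀ i₁ j₀ j₁) (s₁ , s₂ , inj₁ b , inj₂ t , inj₁ l , inj₁ r) = quad (i₀ - + 1) (j₁) (+ 0) (+ 1) , (0≤0 , 0≤1 , 0≤1 , 1≤1) ,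
    liaG 4 (λ i₀ i₁ j₀ j₁ → (i₀ :≤ i₁ :∧ j₀ :≤ j₁) :∧ bottomNᵉ i₀ i₁ j₀ j₁ :∧ topSᵉ i₀ i₁ j₀ j₁ :∧ leftNᵉ i₀ i₁ j₀ j₁ :∧ rightNᵉ i₀ i₁ j₀ j₁ ⊢ inRᵉ (i₀ :- # 1) (j₁) (# 0) (# 1) :∧ blkᵉ i₀ i₁ j₀ j₁ (i₀ :- # 1) (j₁) (# 0) (# 1)) i₀ i₁ j₀ j₁ ((s₁ , s₂) , b , t , l , r)
  walled-quad (blk i₀ i₁ j₀ j₁) (s₁ , s₂ , inj₁ b , inj₁ t , inj₂ l , inj₁ r) = quad (i₁) (j₁) (+ 0) (+ 0) , (0≤0 , 0≤1 , 0≤0 , 0≤1) ,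
    liaG 4 (λ i₀ i₁ j₀ j₁ → (i₀ :≤ i₁ :∧ j₀ :≤ j₁) :∧ bottomNᵉ i₀ i₁ j₀ j₁ :∧ topNᵉ i₀ i₁ j₀ j₁ :∧ leftSᵉ i₀ i₁ j₀ j₁ :∧ rightNᵉ i₀ i₁ j₀ j₁ ⊢ inRᵉ (i₁) (j₁) (# 0) (# 0) :∧ blkᵉ i₀ i₁ j₀ j₁ (i₁) (j₁) (# 0) (# 0)) i₀ i₁ j₀ j₁ ((s₁ , s₂) , b , t , l , r)
  walled-quad (blk i₀ i₁ j₀ j₁) (s₁ , s₂ , inj₂ b , inj₁ t , inj₂ l , inj₁ r) =
    let (quad i j hx hy , hq) = quadOf (+ 0 , + 0 , 0F) in
    quad i j hx hy , quad-bits (+ 0 , + 0 , 0F) (quad i j hx hy) hq ,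
    liaG 8 (λ i₀ i₁ j₀ j₁ i j hx hy → quadᵉ (# 0) (# 0) (# 0 :+ (# 0) :+ # 0) (# 0 :- (# 0) :- # 0) i j hx hy :∧ bottomSᵉ i₀ i₁ j₀ j₁ :∧ topNᵉ i₀ i₁ j₀ j₁ :∧ leftSᵉ i₀ i₁ j₀ j₁ :∧ rightNᵉ i₀ i₁ j₀ j₁ ⊢ inRᵉ i j hx hy :∧ blkᵉ i₀ i₁ j₀ j₁ i j hx hy)
      i₀ i₁ j₀ j₁ i j hx hy (hq , b , t , l , r)
  walled-quad (blk i₀ i₁ j₀ j₁) (s₁ , s₂ , inj₂ b , inj₁ t , inj₁ l , inj₂ r) =
    let (quad i j hx hy , hq) = quadOf (+ m - + 2 , + 0 , 1F) in
    quad i j hx hy , quad-bits (+ m - + 2 , + 0 , 1F) (quad i j hx hy) hq ,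
    liaG 8 (λ i₀ i₁ j₀ j₁ i j hx hy → quadᵉ (mᵉ :- # 2) (# 0) (mᵉ :- # 2 :+ (# 0) :+ # 1) (mᵉ :- # 2 :- (# 0) :- # 0) i j hx hy :∧ bottomSᵉ i₀ i₁ j₀ j₁ :∧ topNᵉ i₀ i₁ j₀ j₁ :∧ leftNᵉ i₀ i₁ j₀ j₁ :∧ rightSᵉ i₀ i₁ j₀ j₁ ⊢ inRᵉ i j hx hy :∧ blkᵉ i₀ i₁ j₀ j₁ i j hx hy)
      i₀ i₁ j₀ j₁ i j hx hy (hq , b , t , l , r)
  walled-quad (blk i₀ i₁ j₀ j₁) (s₁ , s₂ , inj₁ b , inj₂ t , inj₁ l , inj₂ r) =
    let (quad i j hx hy , hq) = quadOf (+ m - + 2 , + n - + 2 , 2F) in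
    quad i j hx hy , quad-bits (+ m - + 2 , + n - + 2 , 2F) (quad i j hx hy) hq ,
    liaG 8 (λ i₀ i₁ j₀ j₁ i j hx hy → quadᵉ (mᵉ :- # 2) (nᵉ :- # 2) (mᵉ :- # 2 :+ (nᵉ :- # 2) :+ # 1) (mᵉ :- # 2 :- (nᵉ :- # 2) :- # 1) i j hx hy :∧ bottomNᵉ i₀ i₁ j₀ j₁ :∧ topSᵉ i₀ i₁ j₀ j₁ :∧ leftNᵉ i₀ i₁ j₀ j₁ :∧ rightSᵉ i₀ i₁ j₀ j₁ ⊢ inRᵉ i j hx hy :∧ blkᵉ i₀ i₁ j₀ j₁ i j hx hy)
      i₀ i₁ j₀ j₁ i j hx hy (hq , b , t , l , r)
  walled-quad (blk i₀ i₁ j₀ j₁) (s₁ , s₂ , inj₁ b , inj₂ t , inj₂ l , inj₁ r) =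
    let (quad i j hx hy , hq) = quadOf (+ 0 , + n - + 2 , 3F) in
    quad i j hx hy , quad-bits (+ 0 , + n - + 2 , 3F) (quad i j hx hy) hq ,
    liaG 8 (λ i₀ i₁ j₀ j₁ i j hx hy → quadᵉ (# 0) (nᵉ :- # 2) (# 0 :+ (nᵉ :- # 2) :+ # 0) (# 0 :- (nᵉ :- # 2) :- # 1) i j hx hy :∧ bottomNᵉ i₀ i₁ j₀ j₁ :∧ topSᵉ i₀ i₁ j₀ j₁ :∧ leftSᵉ i₀ i₁ j₀ j₁ :∧ rightNᵉ i₀ i₁ j₀ j₁ ⊢ inRᵉ i j hx hy :∧ blkᵉ i₀ i₁ j₀ j₁ i j hx hy)
      i₀ i₁ j₀ j₁ i j hx hy (hq , b , t , l , r)
  walled-quad (blk i₀ i₁ j₀ j₁) (s₁ , s₂ , inj₂ b , inj₂ t , _) =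
    ⊥-elim (liaG 4 (λ i₀ i₁ j₀ j₁ → bottomSᵉ i₀ i₁ j₀ j₁ :∧ topSᵉ i₀ i₁ j₀ j₁ ⊢ ⊥ᶠ) i₀ i₁ j₀ j₁ (b , t))
  walled-quad (blk i₀ i₁ j₀ j₁) (s₁ , s₂ , _ , _ , inj₂ l , inj₂ r) =
    ⊥-elim (liaG 4 (λ i₀ i₁ j₀ j₁ → leftSᵉ i₀ i₁ j₀ j₁ :∧ rightSᵉ i₀ i₁ j₀ j₁ ⊢ ⊥ᶠ) i₀ i₁ j₀ j₁ (l , r))

  -- Every tiling comes from a kernel vector

  module Surject (ts : List Tile) (tiling : IsColTiling c m n ts) where

    counting : ∀ d → count d ts ≡ (if inR m n d then 1 else 0)
    counting = proj₁ (proj₁ tiling)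

    tile-inside : ∀ {t} → t ∈ ts → Inside t
    tile-inside t∈ d e with inR m n d in h
    ... | true = refl
    ... | false = case subst (1 ℕ.≤_) (trans (counting d) (cong (λ b → if b then 1 else 0) h)) (count-some d ts t∈ e) of λ ()

    classified : All Classified ts
    classified = All.tabulate λ {t} t∈ →
      classify t (All.lookup (proj₂ tiling) t∈) (All.lookup (proj₂ (proj₁ tiling)) t∈) (tile-inside t∈)

    piecesOf : ∀ {ts} → All Classified ts → List Piece
    piecesOf [] = []
    piecesOf ((P , _) ∷ cs) = P ∷ piecesOf cs

    piecesOf-walled : ∀ {ts P} (cs : All Classified ts) → P ∈ piecesOf cs → Walled P
    piecesOf-walled ((_ , _ , w) ∷ cs) (here refl) = w
    piecesOf-walled (_ ∷ cs) (there P∈) = piecesOf-walled cs P∈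

    piecesOf-tile : ∀ {ts t} (cs : All Classified ts) → t ∈ ts → ∃ λ P → P ∈ piecesOf cs × Rep t P
    piecesOf-tile ((P , r , _) ∷ cs) (here refl) = P , here refl , r
    piecesOf-tile (_ ∷ cs) (there t∈) = let (P , P∈ , r) = piecesOf-tile cs t∈ in P , there P∈ , r

    piecesOf-count : ∀ {ts P} (cs : All Classified ts) → P ∈ piecesOf cs → ∀ d q → IsQuad d q → InR q → P ∋ q → 1 ℕ.≤ count d ts
    piecesOf-count {t ∷ ts} ((_ , r , _) ∷ cs) (here refl) d q hq qR h rewrite proj₂ (r d q hq) (h , qR) = ℕ.s≤s ℕ.z≤n
    piecesOf-count {t ∷ ts} (_ ∷ cs) (there P∈) d q hq qR h = ℕP.≤-trans (piecesOf-count cs P∈ d q hq qR h) (ℕP.m≤n+m _ _)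

    -- Pieces at different positions of the list that cover a common cell would raise its count to
    -- two.
    piecesOf-disjoint : ∀ {ts P P′} (cs : All Classified ts) → P ∈ piecesOf cs → P′ ∈ piecesOf cs →
      ∀ d q → IsQuad d q → InR q → P ∋ q → P′ ∋ q → count d ts ℕ.≤ 1 → P ≡ P′
    piecesOf-disjoint (_ ∷ cs) (here refl) (here refl) d q hq qR h h′ le = refl
    piecesOf-disjoint {t ∷ ts} ((_ , r , _) ∷ cs) (here refl) (there P∈) d q hq qR h h′ le
      rewrite proj₂ (r d q hq) (h , qR) = ⊥-elim (ℕP.<⇒≱ (ℕ.s≤s (piecesOf-count cs P∈ d q hq qR h′)) le)
    piecesOf-disjoint {t ∷ ts} ((_ , r , _) ∷ cs) (there P∈) (here refl) d q hq qR h h′ le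
      rewrite proj₂ (r d q hq) (h′ , qR) = ⊥-elim (ℕP.<⇒≱ (ℕ.s≤s (piecesOf-count cs P∈ d q hq qR h)) le)
    piecesOf-disjoint {t ∷ ts} (_ ∷ cs) (there P∈) (there P′∈) d q hq qR h h′ le =
      piecesOf-disjoint cs P∈ P′∈ d q hq qR h h′ (ℕP.≤-trans (ℕP.m≤n+m _ _) le)

    Ps : List Piece
    Ps = piecesOf classified

    tile-at : ∀ d → inR m n d ≡ true → ∃ λ t → t ∈ ts × inTile t d ≡ true
    tile-at d h = count-find d ts (subst (1 ℕ.≤_) (sym (trans (counting d) (cong (λ b → if b then 1 else 0) h))) ℕP.≤-refl)

    covers : ∀ q → Bits q → InR q → ∃ λ P → P ∈ Ps × P ∋ q
    covers q bs r =
      let (d , hq) = cellOf q bs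
          (t , t∈ , e) = tile-at d (proj₂ (inR-InR d q hq) r)
          (P , P∈ , rep) = piecesOf-tile classified t∈
      in P , P∈ , rep-quad t P rep d q hq e

    disjoint : ∀ q → Bits q → InR q → ∀ {P P′} → P ∈ Ps → P′ ∈ Ps → P ∋ q → P′ ∋ q → P ≡ P′
    disjoint q bs r P∈ P′∈ h h′ =
      let (d , hq) = cellOf q bs in
      piecesOf-disjoint classified P∈ P′∈ d q hq r h h′
        (ℕP.≤-reflexive (trans (counting d) (cong (λ b → if b then 1 else 0) (proj₂ (inR-InR d q hq) r))))

    open FromTiling Ps (piecesOf-walled classified) covers disjoint using (vector; vector-ker)
    open FromTilingProfile Ps (piecesOf-walled classified) covers disjoint using (pieces; vector-nonzero)

    corner-cell : Cell
    corner-cell = + 0 , + 0 , 0F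

    corner-inR : inR m n corner-cell ≡ true
    corner-inR = true-∧ (proj₂ (≤ᵇ-true (+ 2) (+ m)) (ℤ.+≤+ 2≤m)) (proj₂ (≤ᵇ-true (+ 2) (+ n)) (ℤ.+≤+ 2≤n))

    -- As m and n are at least 2, R has a cell and hence the tiling a tile; its piece makes the
    -- vector nonzero.
    nonzero : NonZeroV vector
    nonzero =
      let (t , t∈ , _) = tile-at corner-cell corner-inR
          (P , P∈ , _) = piecesOf-tile classified t∈
      in vector-nonzero P∈

    tile-cell : ∀ {t} → t ∈ ts → ∃ λ d → inR m n d ≡ true × inTile t d ≡ true
    tile-cell {t} t∈ =
      let (P , r , w) = All.lookup classified t∈
          (q , bs , qR , h) = walled-quad P w
          (d , hq) = cellOf q bs
      in d , proj₂ (inR-InR d q hq) qR , proj₂ (r d q hq) (h , qR)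

    ts-show : Shows (profile vector) ts
    ts-show = record
      { piece = λ t∈ → let (P , P∈ , r) = piecesOf-tile classified t∈ in P , pieces P∈ , r
      ; cell = tile-cell
      ; tileAt = tile-at }

    surjective : ∃ λ v → Σ (InKer c m n v) λ k → Σ (NonZeroV v) λ z → SameTiling (Φ v k z) ts
    surjective = vector , vector-ker , nonzero , shows-same (Φ-shows vector vector-ker nonzero) ts-show

  bijection : KerTilingBijection c m n
  bijection = Φ ,
    (λ v k z → Construct.tiles-tiling (profile v) (profile-reflective v k) (profile-nonconstant v k z)) ,
    (λ v k z w k′ z′ e → shows-same (Φ-shows v k z) (shows-cong (λ i → sym (profile-cong e i)) (Φ-shows w k′ z′))) ,
    Φ-injective ,
    λ ts tiling → Surject.surjective ts tiling

theorem2 : (m n : ℕ) → 2 ℕ.≤ m → 2 ℕ.≤ n →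
    KerTilingBijection black m n × KerTilingBijection white m n
theorem2 m n 2≤m 2≤n = Board.bijection black m n 2≤m 2≤n , Board.bijection white m n 2≤m 2≤n
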